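{- Let $U_j(x)$ denote the $j$-th Chebyshev polynomial of the second kind, let $i=\sqrt{ -1}$, and let $\xi_{h,d}:=\cos\left(\frac{h\pi}{2d+1}\right)$ for all integers $h$ and $d$. Then for all integers $m,n\geq 1$, the following four numbers are equal: (1) the number of symmetric recurrents on the sandpile grid graph $\mathrm{S}\Gamma_{2m\times 2n}$; (2) the number of domino tilings of a $2m\times 2n$ checkerboard; (3) $(-1)^{mn}\prod_{h=1}^m U_{2n}(i\,\xi_{h,m})$; (4) $\prod_{h=1}^{m}\prod_{k=1}^{n}\left(4\,\xi_{h,m}^2+4\,\xi_{k,n}^2\right)$.
   Context: Chebyshev polynomials of the second kind: $U_0(x)=1$, $U_1(x)=2x$, $U_j(x)=2x\,U_{j-1}(x)-U_{j-2}(x)$ for $j\ge 2$. Grid graph: for integers $p,q\ge1$, $\Gamma_{p\times q}$ is the undirected graph with vertex set $[p]\times[q]$ and edges $\{(a,b),(a',b')\}$ with $|a-a'|+|b-b'|=1$. The sandpile grid graph $\mathrm{S}\Gamma_{p\times q}$ is obtained from $\Gamma_{p\times q}$ by adding a new vertex $s$ (the sink) and, for each grid vertex $v$, an edge between $v$ and $s$ of weight $4-\deg_{\Gamma_{p\times q}}(v)$ (no edge if this is $0$), so that every non-sink vertex has total degree $4$. Recurrents: a configuration on $\mathrm{S}\Gamma_{p\times q}$ is a function $c\colon[p]\times[q]\to\mathbb{N}=\{0,1,2,\dots\}$. A vertex $v$ is unstable in $c$ if $c_v\ge4$; firing an unstable $v$ subtracts $4$ from $c_v$ and adds $1$ to $c_w$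 for each neighbor $w$ of $v$ in $\Gamma_{p\times q}$. Repeatedly firing unstable vertices always leads, after finitely many steps, to a stable configuration (one with no unstable vertices) $c^\circ$ that depends only on $c$. A configuration $c$ is recurrent if it is stable and for every configuration $a$ there is a configuration $b$ with $(a+b)^\circ=c$. A symmetric recurrent on $\mathrm{S}\Gamma_{p\times q}$ is a recurrent configuration $c$ such that $c_{(a,b)}=c_{(a,q-b+1)}=c_{(p-a+1,b)}$ for all $(a,b)\in[p]\times[q]$. Tilings: a $p\times q$ checkerboard is a $p\times q$ rectangular array of squares; a domino is a $1\times2$ or $2\times1$ array of squares; a domino tiling covers every square with non-overlapping dominos. Domino tilings of the $p\times q$ checkerboard are identified with perfect matchings of $\Gamma_{p\times q}$. -}

module Defs where

open import Algebra.Bundles.Raw using (RawRing)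
import Algebra.Definitions.RawSemiring as RawSemiringDefs
open import Data.Bool using (Bool; true; false)
open import Data.Fin using (Fin; toℕ; opposite)
import Data.Fin.Properties as Fin
import Data.Integer as ℤ
import Data.Integer.Properties as ℤ
open import Data.Integer using (+_)
open import Data.List using (List; length)
open import Data.List.Relation.Unary.Unique.Setoid using (Unique)
import Data.List.Membership.Setoid as Membership
open import Data.Nat as ℕ using (ℕ; zero; suc; s≤s; z≤n; _!)
import Data.Nat.Properties as ℕ
open import Data.Product using (∃-syntax; ∃!; _×_; _,_; proj₁; proj₂)
open import Data.Product.Properties using (≡-dec)
import Data.Rational as Rat
open import Data.Rational using (ℚ; 0ℚ; 1ℚ; ½; mkℚ)
import Data.Rational.Properties as ℚₚ
import Data.Rational.Unnormalised as ℚᵘ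
import Data.Rational.Unnormalised.Properties as ℚᵘ
open import Data.Rational.Literals using (fromℤ)
open import Data.Rational.Solver using (module +-*-Solver)
open import Data.Sum using (_⊎_; inj₁; inj₂)
open import Function.Bundles using (_⇔_)
open import Level using (0ℓ)
open import Relation.Binary.Bundles using (Setoid)
open import Relation.Binary.PropositionalEquality
open import Relation.Nullary using (Dec; yes; no; does; ¬_)
open import Relation.Nullary.Decidable using (toWitness)

open RawSemiringDefs ℚₚ.+-*-rawSemiring using () renaming (_^_ to _^ℚ_)

module _ where
  open Rat hiding (ℚ; 0ℚ; 1ℚ; ½; mkℚ; _/_)
  open +-*-Solver

  fromℕℚ : ℕ → ℚ
  fromℕℚ n = fromℤ (+ n)

  ⅓ ⅔ : ℚ
  ⅓ = + 1 Rat./ 3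
  ⅔ = + 2 Rat./ 3

  ring1 : ∀ ε → ½ * ε + ½ * ε ≡ ε
  ring1 = solve 1 (λ ε → con ½ :* ε :+ con ½ :* ε := ε) refl

  ring2 : ∀ p q → - (p - q) ≡ q - p
  ring2 = solve 2 (λ p q → :- (p :- q) := q :- p) refl

  ring3 : ∀ t → ⅓ * fromℕℚ 2 + ⅔ * t ≡ (1ℚ + t) * ⅔
  ring3 = solve 1 (λ t → con ⅓ :* con (fromℕℚ 2) :+ con ⅔ :* t := (con 1ℚ :+ t) :* con ⅔) refl

  ring4 : ∀ t → ⅓ * t + ⅔ * t ≡ t
  ring4 = solve 1 (λ t → con ⅓ :* t :+ con ⅔ :* t := t) refl

  ring5 : ∀ a b → a + (b - a) ≡ b
  ring5 = solve 2 (λ a b → a :+ (b :- a) := b) refl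

  ring6 : ∀ a b → - (a - b) ≡ (- a) - (- b)
  ring6 = solve 2 (λ a b → :- (a :- b) := (:- a) :- (:- b)) refl

  ring7 : ∀ a b c d → (a - b) + (c - d) ≡ (a + c) - (b + d)
  ring7 = solve 4 (λ a b c d → (a :- b) :+ (c :- d) := (a :+ c) :- (b :+ d)) refl

  ring8 : ∀ a b c d → a * (c - d) + d * (a - b) ≡ a * c - b * d
  ring8 = solve 4 (λ a b c d → a :* (c :- d) :+ d :* (a :- b) := a :* c :- b :* d) refl

  ring9 : ∀ s x p r f → (- 1ℚ) * s * (x * (x * p)) * (r * f) ≡ - (s * p * f * (x * x) * r)
  ring9 = solve 5 (λ s x p r f → con (- 1ℚ) :* s :* (x :* (x :* p)) :* (r :* f) := :- (s :* p :* f :* (x :* x) :* r)) refl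

  ring10 : ∀ g d β r → (g * d * (β * β) + g * ((β + β) * d)) * r ≡ g * ((β * β + (β + β)) * r) * d
  ring10 = solve 4 (λ g d β r → (g :* d :* (β :* β) :+ g :* ((β :+ β) :* d)) :* r := g :* ((β :* β :+ (β :+ β)) :* r) :* d) refl

  ring11 : ∀ S T x y r → - (((S - T) * (x * x) + T * ((x + y) * (x - y))) * r) ≡ (- (S * (x * x) * r)) - (- (T * (y * y) * r))
  ring11 = solve 5 (λ S T x y r → :- (((S :- T) :* (x :* x) :+ T :* ((x :+ y) :* (x :- y))) :* r) := (:- (S :* (x :* x) :* r)) :- (:- (T :* (y :* y) :* r))) refl

  ring12 : ∀ a b c → (a - b) + c ≡ (a + c) - b
  ring12 = solve 3 (λ a b c → (a :- b) :+ c := (a :+ c) :- b) refl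

  ring13 : ∀ t → 1ℚ + (1ℚ + fromℕℚ 2 * t) ≡ fromℕℚ 2 * (1ℚ + t)
  ring13 = solve 1 (λ t → con 1ℚ :+ (con 1ℚ :+ con (fromℕℚ 2) :* t) := con (fromℕℚ 2) :* (con 1ℚ :+ t)) refl

  ring14 : ∀ a r → ½ * (fromℕℚ 2 * a * r) ≡ a * r
  ring14 = solve 2 (λ a r → con ½ :* (con (fromℕℚ 2) :* a :* r) := a :* r) refl

  ring15 : ∀ G g → G + g + (g * ½ + g * ½) ≡ G + (g + g)
  ring15 = solve 2 (λ G g → G :+ g :+ (g :* con ½ :+ g :* con ½) := G :+ (g :+ g)) refl

  ring16 : ∀ G g → G + g - G ≡ g
  ring16 = solve 2 (λ G g → G :+ g :- G := g) refl

  ring17 : ∀ g → g * ½ + g * ½ ≡ ½ * (g + g)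
  ring17 = solve 1 (λ g → g :* con ½ :+ g :* con ½ := con ½ :* (g :+ g)) refl

  ring18 : ∀ a b c → (a - b) + (b - c) ≡ a - c
  ring18 = solve 3 (λ a b c → (a :- b) :+ (b :- c) := a :- c) refl

  ring19 : ∀ a b → b - (⅔ * a + ⅓ * b) ≡ ⅔ * (b - a)
  ring19 = solve 2 (λ a b → b :- (con ⅔ :* a :+ con ⅓ :* b) := con ⅔ :* (b :- a)) refl

  ring20 : ∀ a b → ⅓ * a + ⅔ * b - a ≡ ⅔ * (b - a)
  ring20 = solve 2 (λ a b → con ⅓ :* a :+ con ⅔ :* b :- a := con ⅔ :* (b :- a)) refl

  ring21 : ∀ a b → a + ⅓ * (b - a) ≡ ⅔ * a + ⅓ * b
  ring21 = solve 2 (λ a b → a :+ con ⅓ :* (b :- a) := con ⅔ :* a :+ con ⅓ :* b) refl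

  ring22 : ∀ a b → ⅓ * a + ⅔ * b + ⅓ * (b - a) ≡ b
  ring22 = solve 2 (λ a b → con ⅓ :* a :+ con ⅔ :* b :+ con ⅓ :* (b :- a) := b) refl

  fromℕℚ-suc : ∀ n → fromℕℚ (suc n) ≡ 1ℚ + fromℕℚ n
  fromℕℚ-suc n = ℚₚ.toℚᵘ-injective (ℚᵘ.≃-sym (ℚᵘ.≃-trans (ℚₚ.toℚᵘ-homo-+ 1ℚ (fromℕℚ n))
    (ℚᵘ.*≡* (trans (ℤ.*-identityʳ _) (trans (cong (ℤ._+_ (+ 1)) (ℤ.*-identityʳ (+ n))) (sym (ℤ.*-identityʳ _)))))))

  fromℕℚ-mono : ∀ {m n} → m ℕ.≤ n → fromℕℚ m ≤ fromℕℚ n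
  fromℕℚ-mono m≤n = *≤* (ℤ.*-monoʳ-≤-nonNeg (+ 1) (ℤ.+≤+ m≤n))

  0≤fromℕℚ : ∀ n → 0ℚ ≤ fromℕℚ n
  0≤fromℕℚ n = fromℕℚ-mono z≤n

  ≤-by : ∀ {p q} → p ≤ q → ∀ {p′ q′} → p ≡ p′ → q ≡ q′ → p′ ≤ q′
  ≤-by p≤q refl refl = p≤q

  abstract
    *-mono-≤ : ∀ {p q r s} → 0ℚ ≤ p → p ≤ q → 0ℚ ≤ r → r ≤ s → p * r ≤ q * s
    *-mono-≤ {p} {q} {r} {s} 0≤p p≤q 0≤r r≤s = ℚₚ.≤-trans
      (ℚₚ.*-monoˡ-≤-nonNeg p {{Rat.nonNegative 0≤p}} r≤s)
      (ℚₚ.*-monoʳ-≤-nonNeg s {{Rat.nonNegative (ℚₚ.≤-trans 0≤r r≤s)}} p≤q)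

    *-nonneg : ∀ {p q} → 0ℚ ≤ p → 0ℚ ≤ q → 0ℚ ≤ p * q
    *-nonneg 0≤p 0≤q = *-mono-≤ ℚₚ.≤-refl 0≤p ℚₚ.≤-refl 0≤q

    +-nonneg : ∀ {p q} → 0ℚ ≤ p → 0ℚ ≤ q → 0ℚ ≤ p + q
    +-nonneg 0≤p 0≤q = ℚₚ.+-mono-≤ 0≤p 0≤q

    *-pos : ∀ {p q} → 0ℚ < p → 0ℚ < q → 0ℚ < p * q
    *-pos {p} {q} 0<p 0<q =
      ℚₚ.positive⁻¹ (p * q) {{ℚₚ.pos*pos⇒pos p {{Rat.positive 0<p}} q {{Rat.positive 0<q}}}}

    ≤⇒0≤- : ∀ {p q} → p ≤ q → 0ℚ ≤ q - p
    ≤⇒0≤- {p} {q} p≤q = ≤-by (ℚₚ.+-monoˡ-≤ (- p) p≤q) (ℚₚ.+-inverseʳ p) refl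

  0≤½ : 0ℚ ≤ ½
  0≤½ = ℚₚ.nonNegative⁻¹ ½

  abstract
    0<½ : 0ℚ < ½
    0<½ = ℚₚ.positive⁻¹ ½

  ½+½ : ∀ ε → ½ * ε + ½ * ε ≡ ε
  ½+½ = ring1

  abstract
    p<1+p : ∀ p → p < 1ℚ + p
    p<1+p p = subst (_< 1ℚ + p) (ℚₚ.+-identityˡ p) (ℚₚ.+-monoˡ-< p (ℚₚ.positive⁻¹ 1ℚ))

  abstract
    shrink : ∀ C ε → 0ℚ ≤ C → 0ℚ < ε → ∃[ δ ] 0ℚ < δ × C * δ < ε
    shrink C ε 0≤C 0<ε = δ , 0<δ , subst (C * δ <_) eq (ℚₚ.*-monoˡ-<-pos δ {{Rat.positive 0<δ}} (p<1+p C))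
      where
      D : ℚ
      D = 1ℚ + C
      instance
        D>0 : Rat.Positive D
        D>0 = Rat.positive (ℚₚ.≤-<-trans 0≤C (p<1+p C))
        D≢0 : Rat.NonZero D
        D≢0 = ℚₚ.pos⇒nonZero D
      δ : ℚ
      δ = 1/ D * ε
      0<δ : 0ℚ < δ
      0<δ = *-pos (ℚₚ.positive⁻¹ (1/ D) {{ℚₚ.1/pos⇒pos D}}) 0<ε
      eq : D * δ ≡ ε
      eq = trans (sym (ℚₚ.*-assoc D (1/ D) ε)) (trans (cong (_* ε) (ℚₚ.*-inverseʳ D)) (ℚₚ.*-identityˡ ε))

    <fromℕℚ : ∀ p → ∃[ n ] p < fromℕℚ n
    <fromℕℚ (mkℚ (+ m) d c) = suc m , *<* (subst₂ ℤ._<_ (sym (ℤ.*-identityʳ (+ m))) (ℤ.pos-* (suc m) (suc d))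
      (ℤ.+<+ (ℕ.<-≤-trans (ℕ.n<1+n m) (ℕ.m≤m*n (suc m) (suc d)))))
    <fromℕℚ (mkℚ ℤ.-[1+ m ] d c) = 0 , *<* (subst (ℤ._<_ (ℤ.-[1+ m ] ℤ.* + 1)) (sym (ℤ.*-zeroˡ (+ suc d)))
      (subst (ℤ._< + 0) (sym (ℤ.*-identityʳ ℤ.-[1+ m ])) ℤ.-<+))

    archimedean : ∀ K ε → 0ℚ < ε → ∃[ n ] K < fromℕℚ n * ε
    archimedean K ε 0<ε = n , subst (_< fromℕℚ n * ε) eq (ℚₚ.*-monoˡ-<-pos ε {{ε>0}} (proj₂ bound))
      where
      ε>0 : Rat.Positive ε
      ε>0 = Rat.positive 0<ε
      instance
        ε≢0 : Rat.NonZero ε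
        ε≢0 = ℚₚ.pos⇒nonZero ε {{ε>0}}
      bound : ∃[ n ] K * 1/ ε < fromℕℚ n
      bound = <fromℕℚ (K * 1/ ε)
      n : ℕ
      n = proj₁ bound
      eq : K * 1/ ε * ε ≡ K
      eq = trans (ℚₚ.*-assoc K (1/ ε) ε) (trans (cong (K *_) (ℚₚ.*-inverseˡ ε)) (ℚₚ.*-identityʳ K))

  ∣p-q∣≡∣q-p∣ : ∀ p q → ∣ p - q ∣ ≡ ∣ q - p ∣
  ∣p-q∣≡∣q-p∣ p q = trans (sym (ℚₚ.∣-p∣≡∣p∣ (p - q)))
    (cong ∣_∣ (ring2 p q))

  IsNull : (ℕ → ℚ) → Set
  IsNull x = ∀ ε → 0ℚ < ε → ∃[ N ] (∀ n → N ℕ.≤ n → ∣ x n ∣ < ε)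

  IsCauchy : (ℕ → ℚ) → Set
  IsCauchy x = ∀ ε → 0ℚ < ε → ∃[ N ] (∀ m n → N ℕ.≤ m → N ℕ.≤ n → ∣ x m - x n ∣ < ε)

  cauchy-ordered : ∀ {x} →
    (∀ ε → 0ℚ < ε → ∃[ N ] (∀ m n → N ℕ.≤ n → n ℕ.≤ m → ∣ x m - x n ∣ < ε)) → IsCauchy x
  cauchy-ordered {x} h ε 0<ε with h ε 0<ε
  ... | N , close = N , both
    where
    both : ∀ m n → N ℕ.≤ m → N ℕ.≤ n → ∣ x m - x n ∣ < ε
    both m n N≤m N≤n with ℕ.≤-total n m
    ... | inj₁ n≤m = close m n N≤n n≤m
    ... | inj₂ m≤n = subst (_< ε) (∣p-q∣≡∣q-p∣ (x n) (x m)) (close n m N≤m m≤n)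

  -- a sequence shrinking by the factor 2/3 at each step is null, since (n + 2) * w n
  -- is nonincreasing
  abstract
    geometric-null : ∀ {w} → (∀ n → 0ℚ ≤ w n) → (∀ n → w (suc n) ≤ ⅔ * w n) → IsNull w
    geometric-null {w} 0≤w dec ε 0<ε with archimedean (fromℕℚ 2 * w 0) ε 0<ε
    ... | N , big = N , small
      where
      step : ∀ n → fromℕℚ (3 ℕ.+ n) * w (suc n) ≤ fromℕℚ (2 ℕ.+ n) * w n
      step n = ℚₚ.≤-trans (ℚₚ.*-monoˡ-≤-nonNeg (fromℕℚ (3 ℕ.+ n)) {{Rat.nonNegative (0≤fromℕℚ (3 ℕ.+ n))}} (dec n))
        (≤-by (ℚₚ.*-monoʳ-≤-nonNeg (w n) {{Rat.nonNegative (0≤w n)}} lem) eq refl)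
        where
        t : ℚ
        t = fromℕℚ (2 ℕ.+ n)
        2≤t : fromℕℚ 2 ≤ t
        2≤t = fromℕℚ-mono (s≤s (s≤s z≤n))
        lem : (1ℚ + t) * ⅔ ≤ t
        lem = ≤-by (ℚₚ.+-monoˡ-≤ (⅔ * t) (ℚₚ.*-monoˡ-≤-nonNeg ⅓ 2≤t))
          (ring3 t)
          (ring4 t)
        eq : (1ℚ + t) * ⅔ * w n ≡ fromℕℚ (3 ℕ.+ n) * (⅔ * w n)
        eq = trans (ℚₚ.*-assoc (1ℚ + t) ⅔ (w n)) (cong (_* (⅔ * w n)) (sym (fromℕℚ-suc (2 ℕ.+ n))))
      bound : ∀ n → fromℕℚ (2 ℕ.+ n) * w n ≤ fromℕℚ 2 * w 0
      bound zero = ℚₚ.≤-refl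
      bound (suc n) = ℚₚ.≤-trans (step n) (bound n)
      small : ∀ n → N ℕ.≤ n → ∣ w n ∣ < ε
      small n N≤n = subst (_< ε) (sym (ℚₚ.0≤p⇒∣p∣≡p (0≤w n)))
        (ℚₚ.*-cancelˡ-<-nonNeg (fromℕℚ (2 ℕ.+ n)) {{Rat.nonNegative (0≤fromℕℚ (2 ℕ.+ n))}}
          (ℚₚ.≤-<-trans (bound n) (ℚₚ.<-≤-trans big
            (ℚₚ.*-monoʳ-≤-nonNeg ε {{Rat.nonNegative (ℚₚ.<⇒≤ 0<ε)}}
              (fromℕℚ-mono (ℕ.≤-trans N≤n (ℕ.m≤n+m n 2)))))))

    finite-bound : ∀ (x : ℕ → ℚ) N → ∃[ B ] 0ℚ ≤ B × (∀ n → n ℕ.≤ N → ∣ x n ∣ ≤ B)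
    finite-bound x zero = ∣ x 0 ∣ , ℚₚ.0≤∣p∣ (x 0) , λ { zero _ → ℚₚ.≤-refl }
    finite-bound x (suc N) with finite-bound x N
    ... | B , 0≤B , below = B + ∣ x (suc N) ∣ , +-nonneg 0≤B (ℚₚ.0≤∣p∣ _) , λ n n≤ → go n (ℕ.m≤n⇒m<n∨m≡n n≤)
      where
      go : ∀ n → (n ℕ.< suc N) ⊎ (n ≡ suc N) → ∣ x n ∣ ≤ B + ∣ x (suc N) ∣
      go n (inj₁ (s≤s n≤N)) = ≤-by (ℚₚ.+-mono-≤ (below n n≤N) (ℚₚ.0≤∣p∣ (x (suc N)))) (ℚₚ.+-identityʳ _) refl
      go n (inj₂ refl) = ≤-by (ℚₚ.+-monoˡ-≤ ∣ x (suc N) ∣ 0≤B) (ℚₚ.+-identityˡ _) refl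

    cauchy-bound : ∀ {x} → IsCauchy x → ∃[ B ] 0ℚ ≤ B × (∀ n → ∣ x n ∣ ≤ B)
    cauchy-bound {x} h with h 1ℚ (ℚₚ.positive⁻¹ 1ℚ)
    ... | N , close with finite-bound x N
    ... | B , 0≤B , below = B + 1ℚ , +-nonneg 0≤B (ℚₚ.nonNegative⁻¹ 1ℚ) , λ n → go n (ℕ.≤-total n N)
      where
      go : ∀ n → (n ℕ.≤ N) ⊎ (N ℕ.≤ n) → ∣ x n ∣ ≤ B + 1ℚ
      go n (inj₁ n≤N) = ≤-by (ℚₚ.+-mono-≤ (below n n≤N) (ℚₚ.nonNegative⁻¹ 1ℚ)) (ℚₚ.+-identityʳ _) refl
      go n (inj₂ N≤n) = subst (λ t → ∣ t ∣ ≤ B + 1ℚ)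
        (ring5 (x N) (x n))
        (ℚₚ.≤-trans (ℚₚ.∣p+q∣≤∣p∣+∣q∣ (x N) (x n - x N))
          (ℚₚ.+-mono-≤ (below N ℕ.≤-refl) (ℚₚ.<⇒≤ (close n N N≤n ℕ.≤-refl))))

  cauchy-const : ∀ p → IsCauchy (λ _ → p)
  cauchy-const p ε 0<ε = 0 , λ _ _ _ _ → subst (λ t → ∣ t ∣ < ε) (sym (ℚₚ.+-inverseʳ p)) 0<ε

  cauchy-neg : ∀ {x} → IsCauchy x → IsCauchy (λ n → - x n)
  cauchy-neg {x} hx ε 0<ε with hx ε 0<ε
  ... | N , close = N , λ m n N≤m N≤n → subst (_< ε)
    (trans (sym (ℚₚ.∣-p∣≡∣p∣ (x m - x n)))
      (cong ∣_∣ (ring6 (x m) (x n))))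
    (close m n N≤m N≤n)

  cauchy-+ : ∀ {x y} → IsCauchy x → IsCauchy y → IsCauchy (λ n → x n + y n)
  cauchy-+ {x} {y} hx hy ε 0<ε with hx (½ * ε) (*-pos 0<½ 0<ε) | hy (½ * ε) (*-pos 0<½ 0<ε)
  ... | N₁ , c₁ | N₂ , c₂ = N₁ ℕ.⊔ N₂ , λ m n N≤m N≤n →
    subst₂ (λ s t → ∣ s ∣ < t)
      (ring7 (x m) (x n) (y m) (y n))
      (½+½ ε)
      (ℚₚ.≤-<-trans (ℚₚ.∣p+q∣≤∣p∣+∣q∣ (x m - x n) (y m - y n))
        (ℚₚ.+-mono-< (c₁ m n (ℕ.m⊔n≤o⇒m≤o N₁ N₂ N≤m) (ℕ.m⊔n≤o⇒m≤o N₁ N₂ N≤n))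
                    (c₂ m n (ℕ.m⊔n≤o⇒n≤o N₁ N₂ N≤m) (ℕ.m⊔n≤o⇒n≤o N₁ N₂ N≤n))))

  cauchy-* : ∀ {x y} → IsCauchy x → IsCauchy y → IsCauchy (λ n → x n * y n)
  cauchy-* {x} {y} hx hy ε 0<ε with cauchy-bound hx | cauchy-bound hy
  ... | B , 0≤B , xB | C , 0≤C , yC
    with shrink B (½ * ε) 0≤B (*-pos 0<½ 0<ε) | shrink C (½ * ε) 0≤C (*-pos 0<½ 0<ε)
  ... | δ₁ , 0<δ₁ , Bδ₁ | δ₂ , 0<δ₂ , Cδ₂ with hy δ₁ 0<δ₁ | hx δ₂ 0<δ₂
  ... | N₁ , c₁ | N₂ , c₂ = N₁ ℕ.⊔ N₂ , λ m n N≤m N≤n →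
    subst₂ (λ s t → ∣ s ∣ < t)
      (ring8 (x m) (x n) (y m) (y n))
      (½+½ ε)
      (ℚₚ.≤-<-trans (ℚₚ.∣p+q∣≤∣p∣+∣q∣ (x m * (y m - y n)) (y n * (x m - x n)))
        (ℚₚ.+-mono-<
          (prod (x m) (y m - y n) (xB m) (c₁ m n (ℕ.m⊔n≤o⇒m≤o N₁ N₂ N≤m) (ℕ.m⊔n≤o⇒m≤o N₁ N₂ N≤n)) Bδ₁)
          (prod (y n) (x m - x n) (yC n) (c₂ m n (ℕ.m⊔n≤o⇒n≤o N₁ N₂ N≤m) (ℕ.m⊔n≤o⇒n≤o N₁ N₂ N≤n)) Cδ₂)))
    where
    prod : ∀ p q {D δ η} → ∣ p ∣ ≤ D → ∣ q ∣ < δ → D * δ < η → ∣ p * q ∣ < η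
    prod p q pD qδ Dδ = ℚₚ.≤-<-trans
      (≤-by (*-mono-≤ (ℚₚ.0≤∣p∣ p) pD (ℚₚ.0≤∣p∣ q) (ℚₚ.<⇒≤ qδ)) (sym (ℚₚ.∣p*q∣≡∣p∣*∣q∣ p q)) refl) Dδ

  recip : ∀ n .{{_ : ℕ.NonZero n}} → ℚ
  recip n = + 1 Rat./ n

  cosTerm : ℕ → ℚ → ℚ
  cosTerm k x = (- 1ℚ) ^ℚ k * x ^ℚ (2 ℕ.* k) * recip ((2 ℕ.* k) !) {{ (2 ℕ.* k) ℕ.!≢0 }}

  cosSum : ℕ → ℚ → ℚ
  cosSum zero    x = 0ℚ
  cosSum (suc n) x = cosSum n x + cosTerm n x

  recip-toℚᵘ : ∀ n → toℚᵘ (recip (suc n)) ℚᵘ.≃ ℚᵘ.mkℚᵘ (+ 1) n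
  recip-toℚᵘ n = ℚₚ.toℚᵘ-fromℚᵘ (ℚᵘ.mkℚᵘ (+ 1) n)

  recip-* : ∀ m n .{{_ : ℕ.NonZero m}} .{{_ : ℕ.NonZero n}} .{{_ : ℕ.NonZero (m ℕ.* n)}} →
            recip (m ℕ.* n) ≡ recip m * recip n
  recip-* (suc m) (suc n) = ℚₚ.toℚᵘ-injective (ℚᵘ.≃-trans (recip-toℚᵘ _)
    (ℚᵘ.≃-sym (ℚᵘ.≃-trans (ℚₚ.toℚᵘ-homo-* (recip (suc m)) (recip (suc n)))
      (ℚᵘ.*-cong (recip-toℚᵘ m) (recip-toℚᵘ n)))))

  fromℕℚ*recip : ∀ n → fromℕℚ (suc n) * recip (suc n) ≡ 1ℚ
  fromℕℚ*recip n = ℚₚ.toℚᵘ-injective (ℚᵘ.≃-trans (ℚₚ.toℚᵘ-homo-* (fromℕℚ (suc n)) (recip (suc n)))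
    (ℚᵘ.≃-trans (ℚᵘ.*-congˡ {toℚᵘ (fromℕℚ (suc n))} (recip-toℚᵘ n))
      (ℚᵘ.*≡* (trans (ℤ.*-identityʳ _) (trans (ℤ.*-identityʳ (+ suc n))
        (sym (trans (ℤ.*-identityˡ _) (cong +_ (ℕ.*-identityˡ (suc n))))))))))

  0≤recip : ∀ n .{{_ : ℕ.NonZero n}} → 0ℚ ≤ recip n
  0≤recip n = ℚₚ.nonNegative⁻¹ (recip n) {{ℚₚ.normalize-nonNeg 1 n}}

  recip≤1 : ∀ n → recip (suc n) ≤ 1ℚ
  recip≤1 n = ≤-by (ℚₚ.*-monoʳ-≤-nonNeg (recip (suc n)) {{Rat.nonNegative (0≤recip (suc n))}}
    (fromℕℚ-mono {1} {suc n} (s≤s z≤n))) (ℚₚ.*-identityˡ _) (fromℕℚ*recip n)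

  !-recip : ∀ n → recip (suc n !) {{suc n ℕ.!≢0}} ≡ recip (suc n) * recip (n !) {{n ℕ.!≢0}}
  !-recip n = recip-* (suc n) (n !) {{_}} {{n ℕ.!≢0}} {{suc n ℕ.!≢0}}

  ratio : ℕ → ℚ
  ratio k = recip (2 ℕ.+ 2 ℕ.* k) * recip (1 ℕ.+ 2 ℕ.* k)

  0≤ratio : ∀ k → 0ℚ ≤ ratio k
  0≤ratio k = *-nonneg (0≤recip (2 ℕ.+ 2 ℕ.* k)) (0≤recip (1 ℕ.+ 2 ℕ.* k))

  invFact : ℕ → ℚ
  invFact n = recip (n !) {{n ℕ.!≢0}}

  invFact-suc : ∀ k → invFact (2 ℕ.* suc k) ≡ ratio k * invFact (2 ℕ.* k)
  invFact-suc k = trans (cong invFact (ℕ.*-suc 2 k)) (trans (!-recip (suc (2 ℕ.* k)))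
    (trans (cong (recip (2 ℕ.+ 2 ℕ.* k) *_) (!-recip (2 ℕ.* k)))
      (sym (ℚₚ.*-assoc (recip (2 ℕ.+ 2 ℕ.* k)) (recip (1 ℕ.+ 2 ℕ.* k)) (invFact (2 ℕ.* k))))))

  cosTerm-suc : ∀ k x → cosTerm (suc k) x ≡ - (cosTerm k x * (x * x) * ratio k)
  cosTerm-suc k x = trans
    (cong₂ (λ a b → - 1ℚ * (- 1ℚ) ^ℚ k * a * b) (cong (x ^ℚ_) (ℕ.*-suc 2 k)) (invFact-suc k))
    (ring9 ((- 1ℚ) ^ℚ k) x (x ^ℚ (2 ℕ.* k)) (ratio k) (invFact (2 ℕ.* k)))

  -- On [-β, β] the k-th term and its Lipschitz constant are at most gₖ := αᵏ/(2k)!,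
  -- where α = β² + 2β

  module CosBound (β : ℚ) (0≤β : 0ℚ ≤ β) where

    α : ℚ
    α = β * β + (β + β)

    0≤α : 0ℚ ≤ α
    0≤α = +-nonneg (*-nonneg 0≤β 0≤β) (+-nonneg 0≤β 0≤β)

    g : ℕ → ℚ
    g zero    = 1ℚ
    g (suc k) = g k * (α * ratio k)

    0≤g : ∀ k → 0ℚ ≤ g k
    0≤g zero    = ℚₚ.nonNegative⁻¹ 1ℚ
    0≤g (suc k) = *-nonneg (0≤g k) (*-nonneg 0≤α (0≤ratio k))

    G : ℕ → ℚ
    G zero    = 0ℚ
    G (suc n) = G n + g n

    ∣x*x∣≤ : ∀ x → ∣ x ∣ ≤ β → ∣ x * x ∣ ≤ β * β
    ∣x*x∣≤ x xβ = ≤-by (*-mono-≤ (ℚₚ.0≤∣p∣ x) xβ (ℚₚ.0≤∣p∣ x) xβ) (sym (ℚₚ.∣p*q∣≡∣p∣*∣q∣ x x)) refl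

    ∣-p*r∣ : ∀ p k → ∣ - (p * ratio k) ∣ ≡ ∣ p ∣ * ratio k
    ∣-p*r∣ p k = trans (ℚₚ.∣-p∣≡∣p∣ (p * ratio k)) (trans (ℚₚ.∣p*q∣≡∣p∣*∣q∣ p (ratio k))
      (cong (∣ p ∣ *_) (ℚₚ.0≤p⇒∣p∣≡p (0≤ratio k))))

    term-bound : ∀ x → ∣ x ∣ ≤ β → ∀ k → ∣ cosTerm k x ∣ ≤ g k
    term-bound x xβ zero    = ℚₚ.≤-refl
    term-bound x xβ (suc k) = ≤-by
      (ℚₚ.*-monoʳ-≤-nonNeg (ratio k) {{Rat.nonNegative (0≤ratio k)}}
        (*-mono-≤ (ℚₚ.0≤∣p∣ T) (term-bound x xβ k) (ℚₚ.0≤∣p∣ (x * x))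
          (ℚₚ.≤-trans (∣x*x∣≤ x xβ) (≤-by (ℚₚ.+-monoʳ-≤ (β * β) (+-nonneg 0≤β 0≤β)) (ℚₚ.+-identityʳ _) refl))))
      (trans (cong (_* ratio k) (sym (ℚₚ.∣p*q∣≡∣p∣*∣q∣ T (x * x))))
        (trans (sym (∣-p*r∣ (T * (x * x)) k)) (cong ∣_∣ (sym (cosTerm-suc k x)))))
      (ℚₚ.*-assoc (g k) α (ratio k))
      where T = cosTerm k x

    term-lipschitz : ∀ x y → ∣ x ∣ ≤ β → ∣ y ∣ ≤ β → ∀ k →
                     ∣ cosTerm k x - cosTerm k y ∣ ≤ g k * ∣ x - y ∣
    term-lipschitz x y xβ yβ zero = ≤-by (*-nonneg (0≤g 0) (ℚₚ.0≤∣p∣ (x - y))) refl refl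
    term-lipschitz x y xβ yβ (suc k) = ≤-by
      (ℚₚ.*-monoʳ-≤-nonNeg (ratio k) {{Rat.nonNegative (0≤ratio k)}} main)
      (trans (sym (∣-p*r∣ (D * (x * x) + T * ((x + y) * d)) k)) (cong ∣_∣ eq₁))
      (ring10 (g k) ∣ d ∣ β (ratio k))
      where
      T = cosTerm k y
      D = cosTerm k x - T
      d = x - y
      eq₁ : - ((D * (x * x) + T * ((x + y) * d)) * ratio k) ≡ cosTerm (suc k) x - cosTerm (suc k) y
      eq₁ = trans
        (ring11 (cosTerm k x) T x y (ratio k))
        (sym (cong₂ _-_ (cosTerm-suc k x) (cosTerm-suc k y)))
      main : ∣ D * (x * x) + T * ((x + y) * d) ∣ ≤ g k * ∣ d ∣ * (β * β) + g k * ((β + β) * ∣ d ∣)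
      main = ℚₚ.≤-trans (ℚₚ.∣p+q∣≤∣p∣+∣q∣ (D * (x * x)) (T * ((x + y) * d))) (ℚₚ.+-mono-≤
        (≤-by (*-mono-≤ (ℚₚ.0≤∣p∣ D) (term-lipschitz x y xβ yβ k) (ℚₚ.0≤∣p∣ (x * x)) (∣x*x∣≤ x xβ))
          (sym (ℚₚ.∣p*q∣≡∣p∣*∣q∣ D (x * x))) refl)
        (≤-by (*-mono-≤ (ℚₚ.0≤∣p∣ T) (term-bound y yβ k) (*-nonneg (ℚₚ.0≤∣p∣ (x + y)) (ℚₚ.0≤∣p∣ d))
                (ℚₚ.*-monoʳ-≤-nonNeg ∣ d ∣ {{ℚₚ.∣-∣-nonNeg d}}
                  (ℚₚ.≤-trans (ℚₚ.∣p+q∣≤∣p∣+∣q∣ x y) (ℚₚ.+-mono-≤ xβ yβ))))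
          (sym (trans (ℚₚ.∣p*q∣≡∣p∣*∣q∣ T ((x + y) * d)) (cong (∣ T ∣ *_) (ℚₚ.∣p*q∣≡∣p∣*∣q∣ (x + y) d)))) refl))

    sum-lipschitz : ∀ x y → ∣ x ∣ ≤ β → ∣ y ∣ ≤ β → ∀ n →
                    ∣ cosSum n x - cosSum n y ∣ ≤ G n * ∣ x - y ∣
    sum-lipschitz x y xβ yβ zero = ≤-by ℚₚ.≤-refl refl (sym (ℚₚ.*-zeroˡ ∣ x - y ∣))
    sum-lipschitz x y xβ yβ (suc n) = ≤-by
      (ℚₚ.≤-trans (ℚₚ.∣p+q∣≤∣p∣+∣q∣ (cosSum n x - cosSum n y) (cosTerm n x - cosTerm n y))
        (ℚₚ.+-mono-≤ (sum-lipschitz x y xβ yβ n) (term-lipschitz x y xβ yβ n)))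
      (cong ∣_∣ (ring7 (cosSum n x) (cosSum n y) (cosTerm n x) (cosTerm n y)))
      (sym (ℚₚ.*-distribʳ-+ ∣ x - y ∣ (G n) (g n)))

    sum-tail : ∀ x → ∣ x ∣ ≤ β → ∀ n j → ∣ cosSum (j ℕ.+ n) x - cosSum n x ∣ ≤ G (j ℕ.+ n) - G n
    sum-tail x xβ n zero = ≤-by ℚₚ.≤-refl (sym (cong ∣_∣ (ℚₚ.+-inverseʳ (cosSum n x)))) (sym (ℚₚ.+-inverseʳ (G n)))
    sum-tail x xβ n (suc j) = ≤-by
      (ℚₚ.≤-trans (ℚₚ.∣p+q∣≤∣p∣+∣q∣ (cosSum (j ℕ.+ n) x - cosSum n x) (cosTerm (j ℕ.+ n) x))
        (ℚₚ.+-mono-≤ (sum-tail x xβ n j) (term-bound x xβ (j ℕ.+ n))))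
      (cong ∣_∣ (swap (cosSum (j ℕ.+ n) x) (cosSum n x) (cosTerm (j ℕ.+ n) x)))
      (swap (G (j ℕ.+ n)) (G n) (g (j ℕ.+ n)))
      where
      swap : ∀ a b c → (a - b) + c ≡ (a + c) - b
      swap = ring12

    -- from index A on, the gₖ at least halve at each step

    A : ℕ
    A = proj₁ (<fromℕℚ α)

    g-halves : ∀ k → A ℕ.≤ k → g (suc k) ≤ g k * ½
    g-halves k A≤k = ℚₚ.*-monoˡ-≤-nonNeg (g k) {{Rat.nonNegative (0≤g k)}} (≤-by
      (*-mono-≤ (*-nonneg 0≤α (0≤recip (2 ℕ.+ 2 ℕ.* k))) half (0≤recip (1 ℕ.+ 2 ℕ.* k)) (recip≤1 (2 ℕ.* k)))
      (ℚₚ.*-assoc α (recip (2 ℕ.+ 2 ℕ.* k)) (recip (1 ℕ.+ 2 ℕ.* k)))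
      (ℚₚ.*-identityʳ ½))
      where
      r = recip (2 ℕ.+ 2 ℕ.* k)
      double : fromℕℚ 2 * fromℕℚ k ≤ fromℕℚ (2 ℕ.+ 2 ℕ.* k)
      double = ≤-by (fromℕℚ-mono (ℕ.m≤n+m (2 ℕ.* k) 2)) (fromℕℚ-2* k) refl
        where
        fromℕℚ-2* : ∀ k → fromℕℚ (2 ℕ.* k) ≡ fromℕℚ 2 * fromℕℚ k
        fromℕℚ-2* zero = refl
        fromℕℚ-2* (suc k) = trans (cong fromℕℚ (ℕ.*-suc 2 k)) (trans (fromℕℚ-suc (suc (2 ℕ.* k)))
          (trans (cong (_+_ 1ℚ) (trans (fromℕℚ-suc (2 ℕ.* k)) (cong (_+_ 1ℚ) (fromℕℚ-2* k))))
            (trans (ring13 (fromℕℚ k))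
              (cong (fromℕℚ 2 *_) (sym (fromℕℚ-suc k))))))
      half : α * r ≤ ½
      half = ≤-by
        (ℚₚ.*-monoˡ-≤-nonNeg ½ (ℚₚ.*-monoʳ-≤-nonNeg r {{Rat.nonNegative (0≤recip (2 ℕ.+ 2 ℕ.* k))}}
          (ℚₚ.≤-trans (ℚₚ.*-monoˡ-≤-nonNeg (fromℕℚ 2)
            (ℚₚ.≤-trans (ℚₚ.<⇒≤ (proj₂ (<fromℕℚ α))) (fromℕℚ-mono A≤k))) double)))
        (ring14 α r)
        (trans (cong (½ *_) (fromℕℚ*recip (suc (2 ℕ.* k)))) (ℚₚ.*-identityʳ ½))

    G-decreasing : ∀ k → A ℕ.≤ k → G (suc k) + (g (suc k) + g (suc k)) ≤ G k + (g k + g k)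
    G-decreasing k A≤k = ≤-by (ℚₚ.+-monoʳ-≤ (G k + g k) (ℚₚ.+-mono-≤ (g-halves k A≤k) (g-halves k A≤k)))
      refl (ring15 (G k) (g k))

    G-tail : ∀ n j → A ℕ.≤ n → G (j ℕ.+ n) - G n ≤ g n + g n
    G-tail n j A≤n = ≤-by
      (ℚₚ.+-monoˡ-≤ (- G n) (ℚₚ.≤-trans (≤-by (ℚₚ.+-monoʳ-≤ (G (j ℕ.+ n)) (+-nonneg (0≤g (j ℕ.+ n)) (0≤g (j ℕ.+ n))))
        (ℚₚ.+-identityʳ (G (j ℕ.+ n))) refl) (go j)))
      refl (ring16 (G n) (g n + g n))
      where
      go : ∀ j → G (j ℕ.+ n) + (g (j ℕ.+ n) + g (j ℕ.+ n)) ≤ G n + (g n + g n)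
      go zero    = ℚₚ.≤-refl
      go (suc j) = ℚₚ.≤-trans (G-decreasing (j ℕ.+ n) (ℕ.≤-trans A≤n (ℕ.m≤n+m n j))) (go j)

    g-null : IsNull (λ j → g (j ℕ.+ A) + g (j ℕ.+ A))
    g-null = geometric-null (λ j → +-nonneg (0≤g (j ℕ.+ A)) (0≤g (j ℕ.+ A))) λ j →
      ℚₚ.≤-trans
        (≤-by (ℚₚ.+-mono-≤ (g-halves (j ℕ.+ A) (ℕ.m≤n+m A j)) (g-halves (j ℕ.+ A) (ℕ.m≤n+m A j)))
          refl (ring17 (g (j ℕ.+ A))))
        (ℚₚ.*-monoʳ-≤-nonNeg (g (j ℕ.+ A) + g (j ℕ.+ A))
          {{Rat.nonNegative (+-nonneg (0≤g (j ℕ.+ A)) (0≤g (j ℕ.+ A)))}} (toWitness {a? = ½ ℚₚ.≤? ⅔} _))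

    G-step : ∀ n → G n ≤ G (suc n)
    G-step n = ≤-by (ℚₚ.+-monoʳ-≤ (G n) (0≤g n)) (ℚₚ.+-identityʳ _) refl

    G-mono : ∀ n j → G n ≤ G (j ℕ.+ n)
    G-mono n zero    = ℚₚ.≤-refl
    G-mono n (suc j) = ℚₚ.≤-trans (G-mono n j) (G-step (j ℕ.+ n))

    C : ℚ
    C = G A + (g A + g A)

    G≤C : ∀ n → G n ≤ C
    G≤C n = ℚₚ.≤-trans (subst (λ k → G n ≤ G k) (ℕ.+-comm A n) (G-mono n A)) (≤-by
      (ℚₚ.+-monoʳ-≤ (G A) (G-tail A n ℕ.≤-refl))
      (ring5 (G A) (G (n ℕ.+ A))) refl)

    0≤C : 0ℚ ≤ C
    0≤C = G≤C 0

  cauchy-cos : ∀ {x} → IsCauchy x → IsCauchy (λ n → cosSum n (x n))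
  cauchy-cos {x} hx with cauchy-bound hx
  ... | β , 0≤β , xβ = cauchy-ordered {λ n → cosSum n (x n)} λ ε 0<ε →
      combine ε (shrink C (½ * ε) 0≤C (*-pos 0<½ 0<ε)) (g-null (½ * ε) (*-pos 0<½ 0<ε))
    where
    open CosBound β 0≤β

    estimate : ∀ m n → A ℕ.≤ n → n ℕ.≤ m →
               ∣ cosSum m (x m) - cosSum n (x n) ∣ ≤ C * ∣ x m - x n ∣ + (g n + g n)
    estimate m n A≤n n≤m = ≤-by
      (ℚₚ.≤-trans (ℚₚ.∣p+q∣≤∣p∣+∣q∣ (cosSum m (x m) - cosSum m (x n)) (cosSum m (x n) - cosSum n (x n)))
        (ℚₚ.+-mono-≤
          (ℚₚ.≤-trans (sum-lipschitz (x m) (x n) (xβ m) (xβ n) m)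
            (ℚₚ.*-monoʳ-≤-nonNeg ∣ x m - x n ∣ {{ℚₚ.∣-∣-nonNeg (x m - x n)}} (G≤C m)))
          (subst (λ k → ∣ cosSum k (x n) - cosSum n (x n) ∣ ≤ g n + g n) (ℕ.m∸n+n≡m n≤m)
            (ℚₚ.≤-trans (sum-tail (x n) (xβ n) n (m ℕ.∸ n)) (G-tail n (m ℕ.∸ n) A≤n)))))
      (cong ∣_∣ (ring18 (cosSum m (x m)) (cosSum m (x n)) (cosSum n (x n))))
      refl

    combine : ∀ ε → ∃[ δ ] 0ℚ < δ × C * δ < ½ * ε →
              ∃[ N ] (∀ j → N ℕ.≤ j → ∣ g (j ℕ.+ A) + g (j ℕ.+ A) ∣ < ½ * ε) →
              ∃[ N ] (∀ m n → N ℕ.≤ n → n ℕ.≤ m → ∣ cosSum m (x m) - cosSum n (x n) ∣ < ε)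
    combine ε (δ , 0<δ , Cδ) (N₂ , small) = N₁ ℕ.⊔ (N₂ ℕ.+ A) , λ m n N≤n n≤m →
      close m n n≤m (ℕ.m⊔n≤o⇒m≤o N₁ (N₂ ℕ.+ A) N≤n) (ℕ.m⊔n≤o⇒n≤o N₁ (N₂ ℕ.+ A) N≤n)
      where
      N₁ : ℕ
      N₁ = proj₁ (hx δ 0<δ)
      g-small : ∀ n → N₂ ℕ.+ A ℕ.≤ n → g n + g n < ½ * ε
      g-small n N≤n = subst (λ k → g k + g k < ½ * ε) (ℕ.m∸n+n≡m (ℕ.m+n≤o⇒n≤o N₂ N≤n))
        (subst (_< ½ * ε) (ℚₚ.0≤p⇒∣p∣≡p (+-nonneg (0≤g (n ℕ.∸ A ℕ.+ A)) (0≤g (n ℕ.∸ A ℕ.+ A))))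
          (small (n ℕ.∸ A) (ℕ.m+n≤o⇒m≤o∸n N₂ N≤n)))
      close : ∀ m n → n ℕ.≤ m → N₁ ℕ.≤ n → N₂ ℕ.+ A ℕ.≤ n → ∣ cosSum m (x m) - cosSum n (x n) ∣ < ε
      close m n n≤m N₁≤n N₂A≤n = ℚₚ.≤-<-trans (estimate m n (ℕ.m+n≤o⇒n≤o N₂ N₂A≤n) n≤m)
        (subst (C * ∣ x m - x n ∣ + (g n + g n) <_) (ring1 ε)
          (ℚₚ.+-mono-<
            (ℚₚ.≤-<-trans (ℚₚ.*-monoˡ-≤-nonNeg C {{Rat.nonNegative 0≤C}}
              (ℚₚ.<⇒≤ (proj₂ (hx δ 0<δ) m n (ℕ.≤-trans N₁≤n n≤m) N₁≤n))) Cδ)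
            (g-small n N₂A≤n)))

  -- Trisection for π/2, the zero of cos in [0, 2].  The sign of the cosine series,
  -- truncated after 3 + n terms, at the midpoint of the bracket decides which outer
  -- third is discarded.  A truncated sum can have the wrong sign only where |cos| is
  -- below the truncation error, hence only if the midpoint is within a sixth of the
  -- width of the bracket from the zero, and then the zero lies in the retained part.

  trisect : Bool → ℚ × ℚ → ℚ × ℚ
  trisect true  (a , b) = ⅔ * a + ⅓ * b , b
  trisect false (a , b) = a , ⅓ * a + ⅔ * b

  midpointPositive : ℕ → ℚ × ℚ → Bool
  midpointPositive n (a , b) = does (0ℚ ℚₚ.<? cosSum (3 ℕ.+ n) (½ * (a + b)))

  bracket : ℕ → ℚ × ℚ
  bracket zero    = 0ℚ , fromℕℚ 2
  bracket (suc n) = trisect (midpointPositive n (bracket n)) (bracket n)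

  lower upper width : ℕ → ℚ
  lower n = proj₁ (bracket n)
  upper n = proj₂ (bracket n)
  width n = upper n - lower n

  trisect-width : ∀ s a b → proj₂ (trisect s (a , b)) - proj₁ (trisect s (a , b)) ≡ ⅔ * (b - a)
  trisect-width true  = ring19
  trisect-width false = ring20

  0≤width : ∀ n → 0ℚ ≤ width n
  0≤width zero    = ℚₚ.nonNegative⁻¹ (fromℕℚ 2)
  0≤width (suc n) = ≤-by (*-nonneg (ℚₚ.nonNegative⁻¹ ⅔) (0≤width n))
    refl (sym (trisect-width (midpointPositive n (bracket n)) (lower n) (upper n)))

  trisect-nested : ∀ s {a b} → 0ℚ ≤ b - a → a ≤ proj₁ (trisect s (a , b)) × proj₂ (trisect s (a , b)) ≤ b
  trisect-nested true {a} {b} h = ≤-by (ℚₚ.+-monoʳ-≤ a (*-nonneg (ℚₚ.nonNegative⁻¹ ⅓) h)) (ℚₚ.+-identityʳ a)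
    (ring21 a b) , ℚₚ.≤-refl
  trisect-nested false {a} {b} h = ℚₚ.≤-refl ,
    ≤-by (ℚₚ.+-monoʳ-≤ (⅓ * a + ⅔ * b) (*-nonneg (ℚₚ.nonNegative⁻¹ ⅓) h)) (ℚₚ.+-identityʳ _)
      (ring22 a b)

  nested : ∀ n j → lower n ≤ lower (j ℕ.+ n) × upper (j ℕ.+ n) ≤ upper n
  nested n zero = ℚₚ.≤-refl , ℚₚ.≤-refl
  nested n (suc j) = ℚₚ.≤-trans (proj₁ (nested n j)) (proj₁ inner) , ℚₚ.≤-trans (proj₂ inner) (proj₂ (nested n j))
    where
    inner : lower (j ℕ.+ n) ≤ lower (suc j ℕ.+ n) × upper (suc j ℕ.+ n) ≤ upper (j ℕ.+ n)
    inner = trisect-nested (midpointPositive (j ℕ.+ n) (bracket (j ℕ.+ n))) (0≤width (j ℕ.+ n))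

  lower-close : ∀ n j → ∣ lower (j ℕ.+ n) - lower n ∣ ≤ width n
  lower-close n j = ≤-by (ℚₚ.+-monoˡ-≤ (- lower n) (ℚₚ.≤-trans low≤up (proj₂ (nested n j))))
    (sym (ℚₚ.0≤p⇒∣p∣≡p (≤⇒0≤- (proj₁ (nested n j))))) refl
    where
    low≤up : lower (j ℕ.+ n) ≤ upper (j ℕ.+ n)
    low≤up = ≤-by (ℚₚ.+-monoʳ-≤ (lower (j ℕ.+ n)) (0≤width (j ℕ.+ n))) (ℚₚ.+-identityʳ (lower (j ℕ.+ n)))
      (ring5 (lower (j ℕ.+ n)) (upper (j ℕ.+ n)))

  cauchy-lower : IsCauchy lower
  cauchy-lower = cauchy-ordered {lower} go
    where
    width-null : IsNull width
    width-null = geometric-null 0≤width (λ n → ℚₚ.≤-reflexive (trisect-width (midpointPositive n (bracket n)) (lower n) (upper n)))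
    go : ∀ ε → 0ℚ < ε → ∃[ N ] (∀ m n → N ℕ.≤ n → n ℕ.≤ m → ∣ lower m - lower n ∣ < ε)
    go ε 0<ε = proj₁ (width-null ε 0<ε) , λ m n N≤n n≤m → ℚₚ.≤-<-trans
      (subst (λ k → ∣ lower k - lower n ∣ ≤ width n) (ℕ.m∸n+n≡m n≤m) (lower-close n (m ℕ.∸ n)))
      (subst (_< ε) (ℚₚ.0≤p⇒∣p∣≡p (0≤width n)) (proj₂ (width-null ε 0<ε) n N≤n))

record ℝ : Set where
  constructor mkℝ
  field
    seq    : ℕ → ℚ
    cauchy : IsCauchy seq

open ℝ

infix  4 _≃ℝ_ _≃ℂ_
infixl 6 _+ℝ_ _+ℂ_
infixl 7 _*ℝ_ _*ℂ_
infix  8 -ℝ_ -ℂ_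

_≃ℝ_ : ℝ → ℝ → Set
x ≃ℝ y = IsNull (λ n → seq x n Rat.- seq y n)

_+ℝ_ _*ℝ_ : ℝ → ℝ → ℝ
x +ℝ y = mkℝ (λ n → seq x n Rat.+ seq y n) (cauchy-+ {seq x} {seq y} (cauchy x) (cauchy y))
x *ℝ y = mkℝ (λ n → seq x n Rat.* seq y n) (cauchy-* {seq x} {seq y} (cauchy x) (cauchy y))

-ℝ_ : ℝ → ℝ
-ℝ x = mkℝ (λ n → Rat.- seq x n) (cauchy-neg {seq x} (cauchy x))

ℚ→ℝ : ℚ → ℝ
ℚ→ℝ p = mkℝ (λ _ → p) (cauchy-const p)

ℕ→ℝ : ℕ → ℝ
ℕ→ℝ n = ℚ→ℝ (fromℕℚ n)

ℝ-rawRing : RawRing 0ℓ 0ℓ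
ℝ-rawRing = record
  { Carrier = ℝ
  ; _≈_ = _≃ℝ_
  ; _+_ = _+ℝ_
  ; _*_ = _*ℝ_
  ; -_  = -ℝ_
  ; 0#  = ℕ→ℝ 0
  ; 1#  = ℕ→ℝ 1
  }

-- On bounded sets the partial sums share a Lipschitz constant and converge uniformly,
-- so the diagonal sequence converges to the sum of the cosine series at x.
cos : ℝ → ℝ
cos x = mkℝ (λ n → cosSum n (seq x n)) (cauchy-cos {seq x} (cauchy x))

-- cos has exactly one zero in [0, 2], namely π/2.
π : ℝ
π = ℕ→ℝ 2 *ℝ mkℝ lower cauchy-lower

ξ : ℕ → ℕ → ℝ
ξ h d = cos (ℚ→ℝ (+ h Rat./ suc (2 ℕ.* d)) *ℝ π)

record ℂ : Set where
  constructor _+i_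
  field
    re im : ℝ

open ℂ

_≃ℂ_ : ℂ → ℂ → Set
z ≃ℂ w = re z ≃ℝ re w × im z ≃ℝ im w

_+ℂ_ _*ℂ_ : ℂ → ℂ → ℂ
z +ℂ w = (re z +ℝ re w) +i (im z +ℝ im w)
z *ℂ w = (re z *ℝ re w +ℝ -ℝ (im z *ℝ im w)) +i (re z *ℝ im w +ℝ im z *ℝ re w)

-ℂ_ : ℂ → ℂ
-ℂ z = (-ℝ re z) +i (-ℝ im z)

ℝ→ℂ : ℝ → ℂ
ℝ→ℂ x = x +i ℕ→ℝ 0

ℕ→ℂ : ℕ → ℂ
ℕ→ℂ n = ℝ→ℂ (ℕ→ℝ n)

𝕚 : ℂ
𝕚 = ℕ→ℝ 0 +i ℕ→ℝ 1

ℂ-rawRing : RawRing 0ℓ 0ℓ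
ℂ-rawRing = record
  { Carrier = ℂ
  ; _≈_ = _≃ℂ_
  ; _+_ = _+ℂ_
  ; _*_ = _*ℂ_
  ; -_  = -ℂ_
  ; 0#  = ℕ→ℂ 0
  ; 1#  = ℕ→ℂ 1
  }

open RawSemiringDefs (RawRing.rawSemiring ℝ-rawRing) using () renaming (_^_ to _^ℝ_) public
open RawSemiringDefs (RawRing.rawSemiring ℂ-rawRing) using () renaming (_^_ to _^ℂ_) public

module _ (R : RawRing 0ℓ 0ℓ) where
  open RawRing R

  -- f 1 * f 2 * … * f n
  productFrom1 : ℕ → (ℕ → Carrier) → Carrier
  productFrom1 zero    f = 1#
  productFrom1 (suc n) f = productFrom1 n f * f (suc n)

  chebyshevU : ℕ → Carrier → Carrier
  chebyshevU 0             x = 1#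
  chebyshevU 1             x = (1# + 1#) * x
  chebyshevU (suc (suc j)) x = (1# + 1#) * x * chebyshevU (suc j) x + - chebyshevU j x

∏ℝ : ℕ → (ℕ → ℝ) → ℝ
∏ℝ = productFrom1 ℝ-rawRing

∏ℂ : ℕ → (ℕ → ℂ) → ℂ
∏ℂ = productFrom1 ℂ-rawRing

U : ℕ → ℂ → ℂ
U = chebyshevU ℂ-rawRing

-- Unique and _∈_ are relative to the equality of S, so N is the number of
-- equivalence classes satisfying P.
Counts : (S : Setoid 0ℓ 0ℓ) → (Setoid.Carrier S → Set) → ℕ → Set
Counts S P N = ∃[ xs ] Unique S xs × length xs ≡ N × (∀ x → x ∈ xs ⇔ P x)
  where open Membership S using (_∈_)

Vertex : ℕ → ℕ → Set
Vertex p q = Fin p × Fin q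

Adjacent : ∀ {p q} → Vertex p q → Vertex p q → Set
Adjacent (a , b) (a′ , b′) = ℕ.∣ toℕ a - toℕ a′ ∣ ℕ.+ ℕ.∣ toℕ b - toℕ b′ ∣ ≡ 1

adjacent? : ∀ {p q} (v w : Vertex p q) → Dec (Adjacent v w)
adjacent? (a , b) (a′ , b′) = ℕ.∣ toℕ a - toℕ a′ ∣ ℕ.+ ℕ.∣ toℕ b - toℕ b′ ∣ ℕ.≟ 1

_≟ᵥ_ : ∀ {p q} (v w : Vertex p q) → Dec (v ≡ w)
_≟ᵥ_ = ≡-dec Fin._≟_ Fin._≟_

ConfigSetoid : ℕ → ℕ → Setoid 0ℓ 0ℓ
ConfigSetoid p q = Vertex p q →-setoid ℕ

Config : ℕ → ℕ → Set
Config p q = Vertex p q → ℕ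

module _ {p q : ℕ} where

  _⊕_ : Config p q → Config p q → Config p q
  (a ⊕ b) v = a v ℕ.+ b v

  -- The edges to the sink make up every degree to 4; grains sent to the sink are lost.
  Unstable : Config p q → Vertex p q → Set
  Unstable c v = 4 ℕ.≤ c v

  Stable : Config p q → Set
  Stable c = ∀ v → ¬ Unstable c v

  fire : Vertex p q → Config p q → Config p q
  fire v c w with w ≟ᵥ v | adjacent? v w
  ... | yes _ | _     = c w ℕ.∸ 4
  ... | no _  | yes _ = c w ℕ.+ 1
  ... | no _  | no _  = c w

  data _⟶*_ (c d : Config p q) : Set where
    done : c ≗ d → c ⟶* d
    step : ∀ v → Unstable c v → fire v c ⟶* d → c ⟶* d

  -- c° = d.  Such a d exists for every c and is unique up to ≗.
  _StabilizesTo_ : Config p q → Config p q → Set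
  c StabilizesTo d = c ⟶* d × Stable d

  Recurrent : Config p q → Set
  Recurrent c = Stable c × (∀ a → ∃[ b ] (a ⊕ b) StabilizesTo c)

  Symmetric : Config p q → Set
  Symmetric c = ∀ a b → c (a , b) ≡ c (a , opposite b) × c (a , b) ≡ c (opposite a , b)

  SymmetricRecurrent : Config p q → Set
  SymmetricRecurrent c = Recurrent c × Symmetric c

-- A domino is placed by giving its upper left square.
data Domino (p q : ℕ) : Set where
  horizontal : Fin p → Fin (q ℕ.∸ 1) → Domino p q
  vertical   : Fin (p ℕ.∸ 1) → Fin q → Domino p q

Covers : ∀ {p q} → Domino p q → Vertex p q → Set
Covers (horizontal a b) (x , y) = toℕ x ≡ toℕ a × (toℕ y ≡ toℕ b ⊎ toℕ y ≡ suc (toℕ b))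
Covers (vertical a b)   (x , y) = (toℕ x ≡ toℕ a ⊎ toℕ x ≡ suc (toℕ a)) × toℕ y ≡ toℕ b

-- Sets of dominoes, given by characteristic functions.
DominoSetSetoid : ℕ → ℕ → Setoid 0ℓ 0ℓ
DominoSetSetoid p q = Domino p q →-setoid Bool

IsTiling : ∀ {p q} → (Domino p q → Bool) → Set
IsTiling T = ∀ s → ∃! _≡_ (λ d → T d ≡ true × Covers d s)

module Submission where

-- All four numbers equal det Δ, where Δ is the reduced Laplacian of the quotient of the
-- 2m × 2n grid by its two reflections.
--
-- By Dhar's burning criterion, c ↦ 3 - c identifies the symmetric recurrents with the parking
-- functions of the quotient, whose number obeys the deletion–contraction recursion of det Δ.
-- The number of tilings is the Pfaffian of Kasteleyn's signed adjacency matrix K.  On one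
-- colour class K² splits into two blocks that are copies of -Δ, so the square of the Pfaffian
-- is (det Δ)².
--
-- For the products, write Δ = T m ⊗ 1 + 1 ⊗ T n.  With U₂ⱼ(x) = Pⱼ(x²), the vector
-- ((-1)ʲ Pⱼ(ξ²))ⱼ is an eigenvector of T m with eigenvalue 4 ξ² for each zero ξ of U₂ₘ, and the
-- squares of the ξ h m are distinct.  The zeros come from the addition formula of the cosine, which is
-- read off the Cauchy product of the series.

-- Up to the two products everything is integer arithmetic. Determinants and Pfaffians are top
-- coefficients in one exterior algebra, so multiplicativity, reordering and the bipartite Pfaffian
-- follow from a few rules for the wedge, and no sum over permutations is formed. The signs left
-- open in the comparison of the squares are harmless: absolute values are taken, and both roots are
-- natural numbers. Equality of reals is undecidable, so a nonzero real cannot simply be divided by.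
-- Regular elements, those that can be cancelled, take the place of nonzero ones. Their regularity
-- comes from explicit bounds on the sequences: for 1 - cos at angles up to π/2, for cos at angles
-- up to π/4, and for the norms of the eigenvectors, whose first entry is 1. The sine enters only
-- through 1 - cos², so identities for sines appear in squared form. Since π is given by a
-- trisection steered by truncated sums, cos (π/2) = 0 has to be extracted from sign decisions that
-- may be wrong near the zero.

open import Algebra.Bundles using (CommutativeRing)
open import Algebra.Bundles.Raw using (RawRing)
open import Data.Nat using (ℕ; NonZero)
import Data.Rational as Rat
open import Level using (0ℓ)
open import Relation.Binary.PropositionalEquality using (_≡_)
open import Relation.Nullary using (Dec)

-- Ring solver with integer coefficients over an arbitrary commutative ring.

module IntegerCoefficients (R : CommutativeRing 0ℓ 0ℓ) where
  open import Algebra.Solver.Ring.AlmostCommutativeRing using (fromCommutativeRing; _-Raw-AlmostCommutative⟶_)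
  import Algebra.Solver.Ring
  open import Algebra.Properties.Ring (CommutativeRing.ring R)
  open import Data.Integer as ℤ using (ℤ; +_; -[1+_])
  import Data.Integer.Properties as ℤ
  open import Data.Maybe using (Maybe; just; nothing)
  open import Data.Nat as ℕ using (ℕ; zero; suc)
  open import Relation.Binary.PropositionalEquality as ≡ using (_≡_)
  open import Relation.Nullary using (yes; no)
  open CommutativeRing R
  open import Relation.Binary.Reasoning.Setoid setoid

  -- With a clause of its own for 1, the coefficient 1 is `1#` itself and 2 is `1# + 1#`, which is
  -- how these constants occur in the goals given to the solver.
  fromNat : ℕ → Carrier
  fromNat 0             = 0#
  fromNat 1             = 1#
  fromNat (suc (suc n)) = 1# + fromNat (suc n)

  fromInt : ℤ → Carrier
  fromInt (+ n)    = fromNat n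
  fromInt -[1+ n ] = - fromNat (suc n)

  fromNat-suc : ∀ n → fromNat (suc n) ≈ 1# + fromNat n
  fromNat-suc zero    = sym (+-identityʳ 1#)
  fromNat-suc (suc n) = refl

  fromNat-+ : ∀ m n → fromNat (m ℕ.+ n) ≈ fromNat m + fromNat n
  fromNat-+ zero    n = sym (+-identityˡ _)
  fromNat-+ (suc m) n = begin
    fromNat (suc (m ℕ.+ n))        ≈⟨ fromNat-suc (m ℕ.+ n) ⟩
    1# + fromNat (m ℕ.+ n)         ≈⟨ +-congˡ (fromNat-+ m n) ⟩
    1# + (fromNat m + fromNat n)   ≈⟨ +-assoc _ _ _ ⟨
    1# + fromNat m + fromNat n     ≈⟨ +-congʳ (fromNat-suc m) ⟨
    fromNat (suc m) + fromNat n    ∎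

  fromNat-* : ∀ m n → fromNat (m ℕ.* n) ≈ fromNat m * fromNat n
  fromNat-* zero    n = sym (zeroˡ _)
  fromNat-* (suc m) n = begin
    fromNat (n ℕ.+ m ℕ.* n)              ≈⟨ fromNat-+ n (m ℕ.* n) ⟩
    fromNat n + fromNat (m ℕ.* n)        ≈⟨ +-cong (sym (*-identityˡ _)) (fromNat-* m n) ⟩
    1# * fromNat n + fromNat m * fromNat n ≈⟨ distribʳ _ _ _ ⟨
    (1# + fromNat m) * fromNat n         ≈⟨ *-congʳ (fromNat-suc m) ⟨
    fromNat (suc m) * fromNat n          ∎

  -0≈0 : - 0# ≈ 0#
  -0≈0 = -0#≈0#

  cancel : ∀ a b c → (c + a) + - (c + b) ≈ a + - b
  cancel a b c = begin
    (c + a) + - (c + b)     ≈⟨ +-congˡ (-‿+-comm c b) ⟨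
    (c + a) + (- c + - b)   ≈⟨ +-congʳ (+-comm c a) ⟩
    (a + c) + (- c + - b)   ≈⟨ +-assoc _ _ _ ⟩
    a + (c + (- c + - b))   ≈⟨ +-congˡ (+-assoc _ _ _) ⟨
    a + (c + - c + - b)     ≈⟨ +-congˡ (+-congʳ (-‿inverseʳ c)) ⟩
    a + (0# + - b)          ≈⟨ +-congˡ (+-identityˡ _) ⟩
    a + - b                 ∎

  fromInt-⊖ : ∀ m n → fromInt (m ℤ.⊖ n) ≈ fromNat m + - fromNat n
  fromInt-⊖ m       zero    = sym (trans (+-congˡ -0≈0) (+-identityʳ _))
  fromInt-⊖ zero    (suc n) = sym (+-identityˡ _)
  fromInt-⊖ (suc m) (suc n) = begin
    fromInt (suc m ℤ.⊖ suc n)              ≡⟨ ≡.cong fromInt (ℤ.[1+m]⊖[1+n]≡m⊖n m n) ⟩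
    fromInt (m ℤ.⊖ n)                      ≈⟨ fromInt-⊖ m n ⟩
    fromNat m + - fromNat n                ≈⟨ cancel _ _ 1# ⟨
    (1# + fromNat m) + - (1# + fromNat n)  ≈⟨ +-cong (fromNat-suc m) (-‿cong (fromNat-suc n)) ⟨
    fromNat (suc m) + - fromNat (suc n)    ∎

  fromInt-neg : ∀ i → fromInt (ℤ.- i) ≈ - fromInt i
  fromInt-neg (+ zero)   = sym -0≈0
  fromInt-neg (+ suc n)  = refl
  fromInt-neg -[1+ n ]   = sym (-‿involutive _)

  fromInt-+ : ∀ i j → fromInt (i ℤ.+ j) ≈ fromInt i + fromInt j
  fromInt-+ (+ m)    (+ n)    = fromNat-+ m n
  fromInt-+ (+ m)    -[1+ n ] = fromInt-⊖ m (suc n)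
  fromInt-+ -[1+ m ] (+ n)    = trans (fromInt-⊖ n (suc m)) (+-comm _ _)
  fromInt-+ -[1+ m ] -[1+ n ] = begin
    - fromNat (suc (suc (m ℕ.+ n)))             ≡⟨ ≡.cong (λ k → - fromNat k) (≡.sym (ℕ.+-suc (suc m) n)) ⟩
    - fromNat (suc m ℕ.+ suc n)                 ≈⟨ -‿cong (fromNat-+ (suc m) (suc n)) ⟩
    - (fromNat (suc m) + fromNat (suc n))       ≈⟨ -‿+-comm _ _ ⟨
    - fromNat (suc m) + - fromNat (suc n)       ∎
    where import Data.Nat.Properties as ℕ

  fromInt-*-pos : ∀ m j → fromInt (+ m ℤ.* j) ≈ fromNat m * fromInt j
  fromInt-*-pos m (+ n)    = trans (reflexive (≡.cong fromInt (≡.sym (ℤ.pos-* m n)))) (fromNat-* m n)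
  fromInt-*-pos m -[1+ n ] = begin
    fromInt (+ m ℤ.* -[1+ n ])          ≡⟨ ≡.cong fromInt (≡.sym (ℤ.neg-distribʳ-* (+ m) (+ suc n))) ⟩
    fromInt (ℤ.- (+ m ℤ.* + suc n))     ≈⟨ fromInt-neg (+ m ℤ.* + suc n) ⟩
    - fromInt (+ m ℤ.* + suc n)         ≈⟨ -‿cong (fromInt-*-pos m (+ suc n)) ⟩
    - (fromNat m * fromNat (suc n))     ≈⟨ -‿distribʳ-* _ _ ⟩
    fromNat m * - fromNat (suc n)       ∎

  fromInt-* : ∀ i j → fromInt (i ℤ.* j) ≈ fromInt i * fromInt j
  fromInt-* (+ m)    j = fromInt-*-pos m j
  fromInt-* -[1+ m ] j = begin
    fromInt (-[1+ m ] ℤ.* j)        ≡⟨ ≡.cong fromInt (≡.sym (ℤ.neg-distribˡ-* (+ suc m) j)) ⟩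
    fromInt (ℤ.- (+ suc m ℤ.* j))   ≈⟨ fromInt-neg (+ suc m ℤ.* j) ⟩
    - fromInt (+ suc m ℤ.* j)       ≈⟨ -‿cong (fromInt-*-pos (suc m) j) ⟩
    - (fromNat (suc m) * fromInt j) ≈⟨ -‿distribˡ-* _ _ ⟩
    - fromNat (suc m) * fromInt j   ∎

  private
    morphism : ℤ.+-*-rawRing -Raw-AlmostCommutative⟶ fromCommutativeRing R
    morphism = record
      { ⟦_⟧ = fromInt ; +-homo = fromInt-+ ; *-homo = fromInt-*
      ; -‿homo = fromInt-neg ; 0-homo = refl ; 1-homo = refl }

    fromInt≟ : ∀ i j → Maybe (fromInt i ≈ fromInt j)
    fromInt≟ i j with i ℤ.≟ j
    ... | yes ≡.refl = just refl
    ... | no _       = nothing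

  module Solver = Algebra.Solver.Ring ℤ.+-*-rawRing (fromCommutativeRing R) morphism fromInt≟

-- Finite sums and products over lists.

module ListSums (R : CommutativeRing 0ℓ 0ℓ) where
  open import Data.Integer using (+_)
  open import Data.List using (List; []; _∷_; _++_; map; cartesianProduct)
  open import Data.List.Membership.Propositional using (_∈_)
  open import Data.List.Relation.Unary.Any using (here; there)
  open import Data.Product using (_,_)
  open import Relation.Binary.PropositionalEquality as ≡ using (_≡_; _≢_)
  open CommutativeRing R
  open import Relation.Binary.Reasoning.Setoid setoid
  open IntegerCoefficients R using (module Solver; -0≈0)
  open Solver

  private variable I J : Set

  ∑ : List I → (I → Carrier) → Carrier
  ∑ []       f = 0#
  ∑ (i ∷ is) f = f i + ∑ is f

  ∏ : List I → (I → Carrier) → Carrier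
  ∏ []       f = 1#
  ∏ (i ∷ is) f = f i * ∏ is f

  ∑-cong : ∀ (is : List I) {f g} → (∀ {i} → i ∈ is → f i ≈ g i) → ∑ is f ≈ ∑ is g
  ∑-cong []       h = refl
  ∑-cong (i ∷ is) h = +-cong (h (here ≡.refl)) (∑-cong is (λ m → h (there m)))

  ∏-cong : ∀ (is : List I) {f g} → (∀ {i} → i ∈ is → f i ≈ g i) → ∏ is f ≈ ∏ is g
  ∏-cong []       h = refl
  ∏-cong (i ∷ is) h = *-cong (h (here ≡.refl)) (∏-cong is (λ m → h (there m)))

  ∑-zero : ∀ (is : List I) {f} → (∀ {i} → i ∈ is → f i ≈ 0#) → ∑ is f ≈ 0#
  ∑-zero []       h = refl
  ∑-zero (i ∷ is) h = trans (+-cong (h (here ≡.refl)) (∑-zero is (λ m → h (there m)))) (+-identityˡ 0#)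

  ∑-+ : ∀ (is : List I) f g → ∑ is (λ i → f i + g i) ≈ ∑ is f + ∑ is g
  ∑-+ []       f g = sym (+-identityˡ 0#)
  ∑-+ (i ∷ is) f g = trans (+-congˡ (∑-+ is f g))
    (solve 4 (λ a b c d → a :+ b :+ (c :+ d) := a :+ c :+ (b :+ d)) refl (f i) (g i) (∑ is f) (∑ is g))

  ∑-* : ∀ (is : List I) c f → ∑ is (λ i → c * f i) ≈ c * ∑ is f
  ∑-* []       c f = sym (zeroʳ c)
  ∑-* (i ∷ is) c f = trans (+-congˡ (∑-* is c f)) (sym (distribˡ c _ _))

  ∑-*ʳ : ∀ (is : List I) c f → ∑ is (λ i → f i * c) ≈ ∑ is f * c
  ∑-*ʳ is c f = trans (∑-cong is (λ _ → *-comm _ _)) (trans (∑-* is c f) (*-comm _ _))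

  ∑-neg : ∀ (is : List I) f → ∑ is (λ i → - f i) ≈ - ∑ is f
  ∑-neg []       f = sym -0≈0
  ∑-neg (i ∷ is) f = trans (+-congˡ (∑-neg is f)) (solve 2 (λ a b → :- a :+ :- b := :- (a :+ b)) refl (f i) (∑ is f))

  ∑-++ : ∀ (is js : List I) f → ∑ (is ++ js) f ≈ ∑ is f + ∑ js f
  ∑-++ []       js f = sym (+-identityˡ _)
  ∑-++ (i ∷ is) js f = trans (+-congˡ (∑-++ is js f)) (sym (+-assoc _ _ _))

  ∑-map : ∀ (g : I → J) is f → ∑ (map g is) f ≈ ∑ is (λ i → f (g i))
  ∑-map g []       f = refl
  ∑-map g (i ∷ is) f = +-congˡ (∑-map g is f)

  ∏-++ : ∀ (is js : List I) f → ∏ (is ++ js) f ≈ ∏ is f * ∏ js f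
  ∏-++ []       js f = sym (*-identityˡ _)
  ∏-++ (i ∷ is) js f = trans (*-congˡ (∏-++ is js f)) (sym (*-assoc _ _ _))

  ∏-map : ∀ (g : I → J) is f → ∏ (map g is) f ≈ ∏ is (λ i → f (g i))
  ∏-map g []       f = refl
  ∏-map g (i ∷ is) f = *-congˡ (∏-map g is f)

  ∑-swap : ∀ (is : List I) (js : List J) (f : I → J → Carrier) → ∑ is (λ i → ∑ js (f i)) ≈ ∑ js (λ j → ∑ is (λ i → f i j))
  ∑-swap []       js f = sym (∑-zero js (λ _ → refl))
  ∑-swap (i ∷ is) js f = trans (+-congˡ (∑-swap is js f)) (sym (∑-+ js _ _))

  ∑-× : ∀ (is : List I) (js : List J) f → ∑ (cartesianProduct is js) f ≈ ∑ is (λ i → ∑ js (λ j → f (i , j)))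
  ∑-× []       js f = refl
  ∑-× (i ∷ is) js f = trans (∑-++ (map (i ,_) js) _ f) (+-cong (∑-map (i ,_) js f) (∑-× is js f))

  ∏-× : ∀ (is : List I) (js : List J) f → ∏ (cartesianProduct is js) f ≈ ∏ is (λ i → ∏ js (λ j → f (i , j)))
  ∏-× []       js f = refl
  ∏-× (i ∷ is) js f = trans (∏-++ (map (i ,_) js) _ f) (*-cong (∏-map (i ,_) js f) (∏-× is js f))

-- Exterior algebra and determinants.

module Exterior (R : CommutativeRing 0ℓ 0ℓ) where
  open import Data.Bool using (Bool; true; false; not; _xor_)
  open import Data.Empty using (⊥-elim)
  open import Data.Integer using (+_)
  open import Data.List using (List; []; _∷_; _++_; map; foldr; length)
  open import Data.List.Membership.Propositional using (_∈_)
  open import Data.List.Relation.Binary.Permutation.Propositional as Perm using (_↭_; prep; swap)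
  open import Data.List.Relation.Unary.Any using (here; there)
  open import Data.Nat as ℕ using (ℕ; zero; suc; _≤_; z≤n; s≤s)
  import Data.Nat.Properties as ℕ
  open import Data.Vec using (Vec; []; _∷_; replicate)
  open import Relation.Binary.PropositionalEquality as ≡ using (_≡_; _≢_)
  open CommutativeRing R
  open import Relation.Binary.Reasoning.Setoid setoid
  open IntegerCoefficients R using (module Solver; -0≈0)
  open Solver
  open ListSums R
  open import Algebra.Properties.Ring ring using (-‿involutive; -‿distribˡ-*; -‿distribʳ-*)

  private variable
    I J : Set
    is js : List I

  -- The exterior algebra on the free module with ordered basis (eᵢ) for i in the list,
  -- as coefficient functions on the subsets of the basis.
  Λ : List I → Set
  Λ is = Vec Bool (length is) → Carrier

  -- With z = z₀ + eᵢ ∧ z₁ and v = vᵢ eᵢ + v′, the product is v′ ∧ z₀ + eᵢ ∧ (vᵢ z₀ - v′ ∧ z₁); the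
  -- minus sign comes from moving eᵢ to the front.
  wedge : ∀ (is : List I) → (I → Carrier) → Λ is → Λ is
  wedge []       v z L           = 0#
  wedge (i ∷ is) v z (false ∷ L) = wedge is v (λ K → z (false ∷ K)) L
  wedge (i ∷ is) v z (true ∷ L)  = v i * z (false ∷ L) - wedge is v (λ K → z (true ∷ K)) L

  one : ∀ (is : List I) → Λ is
  one []       L           = 1#
  one (i ∷ is) (false ∷ L) = one is L
  one (i ∷ is) (true ∷ L)  = 0#

  top : ∀ (is : List I) → Λ is → Carrier
  top is z = z (replicate (length is) true)

  wedges : ∀ (is : List I) → List (I → Carrier) → Λ is → Λ is
  wedges is rows z = foldr (wedge is) z rows

  volume : List (I → Carrier) → List I → Carrier
  volume rows is = top is (wedges is rows (one is))

  -- Multiplying the rows in the exterior algebra replaces the sum over permutations; multilinearity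
  -- and the alternating property become properties of `wedge` alone.
  det : (is : List I) → (I → I → Carrier) → Carrier
  det is A = volume (map A is) is

  wedge-cong : ∀ (is : List I) {v w z z′} → (∀ {i} → i ∈ is → v i ≈ w i) → (∀ L → z L ≈ z′ L) →
               ∀ L → wedge is v z L ≈ wedge is w z′ L
  wedge-cong []       h k L           = refl
  wedge-cong (i ∷ is) h k (false ∷ L) = wedge-cong is (λ m → h (there m)) (λ K → k _) L
  wedge-cong (i ∷ is) h k (true ∷ L)  = +-cong (*-cong (h (here ≡.refl)) (k _))
    (-‿cong (wedge-cong is (λ m → h (there m)) (λ K → k _) L))

  wedge-congʳ : ∀ (is : List I) {v z z′} → (∀ L → z L ≈ z′ L) → ∀ L → wedge is v z L ≈ wedge is v z′ L
  wedge-congʳ is = wedge-cong is (λ _ → refl)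

  wedge-linearʳ : ∀ (is : List I) v a b x y L →
    wedge is v (λ K → a * x K + b * y K) L ≈ a * wedge is v x L + b * wedge is v y L
  wedge-linearʳ []       v a b x y L = solve 2 (λ a b → con (+ 0) := a :* con (+ 0) :+ b :* con (+ 0)) refl a b
  wedge-linearʳ (i ∷ is) v a b x y (false ∷ L) = wedge-linearʳ is v a b _ _ L
  wedge-linearʳ (i ∷ is) v a b x y (true ∷ L) = trans (+-congˡ (-‿cong (wedge-linearʳ is v a b _ _ L)))
    (solve 7 (λ v a b x y p q → v :* (a :* x :+ b :* y) :- (a :* p :+ b :* q) := a :* (v :* x :- p) :+ b :* (v :* y :- q))
      refl (v i) a b (x (false ∷ L)) (y (false ∷ L)) (wedge is v (λ K → x (true ∷ K)) L) (wedge is v (λ K → y (true ∷ K)) L))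

  wedge-linearˡ : ∀ (is : List I) v w a b z L →
    wedge is (λ i → a * v i + b * w i) z L ≈ a * wedge is v z L + b * wedge is w z L
  wedge-linearˡ []       v w a b z L = solve 2 (λ a b → con (+ 0) := a :* con (+ 0) :+ b :* con (+ 0)) refl a b
  wedge-linearˡ (i ∷ is) v w a b z (false ∷ L) = wedge-linearˡ is v w a b _ L
  wedge-linearˡ (i ∷ is) v w a b z (true ∷ L) = trans (+-congˡ (-‿cong (wedge-linearˡ is v w a b _ L)))
    (solve 7 (λ v a b x y p q → (a :* v :+ b :* x) :* y :- (a :* p :+ b :* q) := a :* (v :* y :- p) :+ b :* (x :* y :- q))
      refl (v i) a b (w i) (z (false ∷ L)) (wedge is v (λ K → z (true ∷ K)) L) (wedge is w (λ K → z (true ∷ K)) L))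

  wedge-sub : ∀ (is : List I) v c x y L →
    wedge is v (λ K → c * x K - y K) L ≈ c * wedge is v x L - wedge is v y L
  wedge-sub is v c x y L = begin
    wedge is v (λ K → c * x K - y K) L            ≈⟨ wedge-congʳ is (λ K → lem c (x K) (y K)) L ⟩
    wedge is v (λ K → c * x K + - 1# * y K) L     ≈⟨ wedge-linearʳ is v c (- 1#) x y L ⟩
    c * wedge is v x L + - 1# * wedge is v y L    ≈⟨ lem c _ _ ⟨
    c * wedge is v x L - wedge is v y L           ∎
    where
    lem : ∀ a b c → a * b - c ≈ a * b + - 1# * c
    lem = solve 3 (λ a b c → a :* b :- c := a :* b :+ :- con (+ 1) :* c) refl

  wedge-+ʳ : ∀ (is : List I) v x y L → wedge is v (λ K → x K + y K) L ≈ wedge is v x L + wedge is v y L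
  wedge-+ʳ is v x y L = trans (wedge-congʳ is (λ K → lem (x K) (y K)) L)
    (trans (wedge-linearʳ is v 1# 1# x y L) (sym (lem _ _)))
    where
    lem : ∀ a b → a + b ≈ 1# * a + 1# * b
    lem = solve 2 (λ a b → a :+ b := con (+ 1) :* a :+ con (+ 1) :* b) refl

  wedge-*ʳ : ∀ (is : List I) v c x L → wedge is v (λ K → c * x K) L ≈ c * wedge is v x L
  wedge-*ʳ is v c x L = trans (wedge-congʳ is (λ K → lem (c * x K) (x K)) L)
    (trans (wedge-linearʳ is v c 0# x x L) (sym (lem _ _)))
    where
    lem : ∀ a b → a ≈ a + 0# * b
    lem = solve 2 (λ a b → a := a :+ con (+ 0) :* b) refl

  wedge-+ˡ : ∀ (is : List I) v w z L → wedge is (λ i → v i + w i) z L ≈ wedge is v z L + wedge is w z L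
  wedge-+ˡ is v w z L = trans (wedge-cong is (λ _ → lem _ _) (λ _ → refl) L)
    (trans (wedge-linearˡ is v w 1# 1# z L) (sym (lem _ _)))
    where
    lem : ∀ a b → a + b ≈ 1# * a + 1# * b
    lem = solve 2 (λ a b → a :+ b := con (+ 1) :* a :+ con (+ 1) :* b) refl

  wedge-*ˡ : ∀ (is : List I) v c z L → wedge is (λ i → c * v i) z L ≈ c * wedge is v z L
  wedge-*ˡ is v c z L = trans (wedge-cong is (λ _ → lem _ _) (λ _ → refl) L)
    (trans (wedge-linearˡ is v v c 0# z L) (sym (lem _ _)))
    where
    lem : ∀ a b → a ≈ a + 0# * b
    lem = solve 2 (λ a b → a := a :+ con (+ 0) :* b) refl

  wedge-neg : ∀ (is : List I) v x L → wedge is v (λ K → - x K) L ≈ - wedge is v x L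
  wedge-neg is v x L = trans (wedge-congʳ is (λ K → lem (x K)) L) (trans (wedge-*ʳ is v (- 1#) x L) (sym (lem _)))
    where
    lem : ∀ a → - a ≈ (- 1#) * a
    lem = solve 1 (λ a → :- a := (:- con (+ 1)) :* a) refl

  wedge-zeroʳ : ∀ (is : List I) v {z} → (∀ L → z L ≈ 0#) → ∀ L → wedge is v z L ≈ 0#
  wedge-zeroʳ []       v h L           = refl
  wedge-zeroʳ (i ∷ is) v h (false ∷ L) = wedge-zeroʳ is v (λ K → h _) L
  wedge-zeroʳ (i ∷ is) v h (true ∷ L)  = trans (+-cong (*-congˡ (h _)) (-‿cong (wedge-zeroʳ is v (λ K → h _) L)))
    (solve 1 (λ a → a :* con (+ 0) :- con (+ 0) := con (+ 0)) refl (v i))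

  wedge-zeroˡ : ∀ (is : List I) {v} z → (∀ {i} → i ∈ is → v i ≈ 0#) → ∀ L → wedge is v z L ≈ 0#
  wedge-zeroˡ []       z h L           = refl
  wedge-zeroˡ (i ∷ is) z h (false ∷ L) = wedge-zeroˡ is _ (λ m → h (there m)) L
  wedge-zeroˡ (i ∷ is) z h (true ∷ L)  = trans (+-cong (*-congʳ (h (here ≡.refl))) (-‿cong (wedge-zeroˡ is _ (λ m → h (there m)) L)))
    (solve 1 (λ a → con (+ 0) :* a :- con (+ 0) := con (+ 0)) refl (z (false ∷ L)))

  wedge-anticomm : ∀ (is : List I) u v z L → wedge is u (wedge is v z) L ≈ - wedge is v (wedge is u z) L
  wedge-anticomm []       u v z L           = sym -0≈0
  wedge-anticomm (i ∷ is) u v z (false ∷ L) = wedge-anticomm is u v _ L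
  wedge-anticomm (i ∷ is) u v z (true ∷ L)  = begin
    u i * wedge is v x L - wedge is u (λ K → v i * x K - wedge is v y K) L
      ≈⟨ +-congˡ (-‿cong (trans (wedge-sub is u (v i) x (wedge is v y) L) (+-congˡ (-‿cong (wedge-anticomm is u v y L))))) ⟩
    u i * wedge is v x L - (v i * wedge is u x L - - wedge is v (wedge is u y) L)
      ≈⟨ solve 3 (λ p q r → p :- (q :- :- r) := :- (q :- (p :- r))) refl (u i * wedge is v x L) (v i * wedge is u x L) (wedge is v (wedge is u y) L) ⟩
    - (v i * wedge is u x L - (u i * wedge is v x L - wedge is v (wedge is u y) L))
      ≈⟨ -‿cong (+-congˡ (-‿cong (wedge-sub is v (u i) x (wedge is u y) L))) ⟨
    - (v i * wedge is u x L - wedge is v (λ K → u i * x K - wedge is u y K) L) ∎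
    where
    x = λ K → z (false ∷ K)
    y = λ K → z (true ∷ K)

  -- Anticommutativity only shows that twice this product vanishes, and 2 may be a zero divisor in
  -- R; hence a separate induction.
  wedge-square : ∀ (is : List I) v z L → wedge is v (wedge is v z) L ≈ 0#
  wedge-square []       v z L           = refl
  wedge-square (i ∷ is) v z (false ∷ L) = wedge-square is v _ L
  wedge-square (i ∷ is) v z (true ∷ L)  = begin
    v i * wedge is v x L - wedge is v (λ K → v i * x K - wedge is v y K) L
      ≈⟨ +-congˡ (-‿cong (trans (wedge-sub is v (v i) x (wedge is v y) L) (+-congˡ (-‿cong (wedge-square is v y L))))) ⟩
    v i * wedge is v x L - (v i * wedge is v x L - 0#)
      ≈⟨ solve 1 (λ p → p :- (p :- con (+ 0)) := con (+ 0)) refl (v i * wedge is v x L) ⟩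
    0# ∎
    where
    x = λ K → z (false ∷ K)
    y = λ K → z (true ∷ K)

  wedges-cong : ∀ (is : List I) (f g : J → I → Carrier) rs {z z′} → (∀ {r} → r ∈ rs → ∀ {i} → i ∈ is → f r i ≈ g r i) →
                (∀ L → z L ≈ z′ L) → ∀ L → wedges is (map f rs) z L ≈ wedges is (map g rs) z′ L
  wedges-cong is f g []       h k = k
  wedges-cong is f g (r ∷ rs) h k = wedge-cong is (h (here ≡.refl)) (wedges-cong is f g rs (λ m → h (there m)) k)

  wedges-congʳ : ∀ (is : List I) rows {z z′} → (∀ L → z L ≈ z′ L) → ∀ L → wedges is rows z L ≈ wedges is rows z′ L
  wedges-congʳ is []       k = k
  wedges-congʳ is (r ∷ rs) k = wedge-congʳ is (wedges-congʳ is rs k)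

  wedges-zero : ∀ (is : List I) rows {z} → (∀ L → z L ≈ 0#) → ∀ L → wedges is rows z L ≈ 0#
  wedges-zero is []       h = h
  wedges-zero is (r ∷ rs) h = wedge-zeroʳ is r (wedges-zero is rs h)

  volume-cong : ∀ (is : List I) (f g : J → I → Carrier) rs → (∀ {r} → r ∈ rs → ∀ {i} → i ∈ is → f r i ≈ g r i) →
                volume (map f rs) is ≈ volume (map g rs) is
  volume-cong is f g rs h = wedges-cong is f g rs h (λ _ → refl) _

  volume-head-cong : ∀ (is : List I) {r s} rows → (∀ {i} → i ∈ is → r i ≈ s i) → volume (r ∷ rows) is ≈ volume (s ∷ rows) is
  volume-head-cong is rows h = wedge-cong is {z = wedges is rows (one is)} h (λ _ → refl) (replicate (length is) true)

  volume-tail-cong : ∀ (is : List I) r (f g : J → I → Carrier) rs → (∀ {r} → r ∈ rs → ∀ {i} → i ∈ is → f r i ≈ g r i) →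
    volume (r ∷ map f rs) is ≈ volume (r ∷ map g rs) is
  volume-tail-cong is r f g rs h = wedge-congʳ is {r} (wedges-cong is f g rs h (λ _ → refl)) (replicate (length is) true)

  volume-head-+ : ∀ (is : List I) r s rows → volume ((λ i → r i + s i) ∷ rows) is ≈ volume (r ∷ rows) is + volume (s ∷ rows) is
  volume-head-+ is r s rows = wedge-+ˡ is r s (wedges is rows (one is)) (replicate (length is) true)

  det-cong : ∀ (is : List I) {A B} → (∀ {i j} → i ∈ is → j ∈ is → A i j ≈ B i j) → det is A ≈ det is B
  det-cong is h = volume-cong is _ _ is (λ r m → h r m)

  weight : ∀ {n} → Vec Bool n → ℕ
  weight []          = 0
  weight (true ∷ L)  = suc (weight L)
  weight (false ∷ L) = weight L

  weight≤ : ∀ {n} (L : Vec Bool n) → weight L ≤ n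
  weight≤ []          = z≤n
  weight≤ (true ∷ L)  = s≤s (weight≤ L)
  weight≤ (false ∷ L) = ℕ.m≤n⇒m≤1+n (weight≤ L)

  -- The grading by degree. It makes a product of as many rows as there are basis vectors a multiple
  -- of the top form.
  Homogeneous : ∀ (is : List I) → ℕ → Λ is → Set
  Homogeneous is k z = ∀ L → weight L ≢ k → z L ≈ 0#

  one-homogeneous : ∀ (is : List I) → Homogeneous is 0 (one is)
  one-homogeneous []       []          h = ⊥-elim (h ≡.refl)
  one-homogeneous (i ∷ is) (false ∷ L) h = one-homogeneous is L h
  one-homogeneous (i ∷ is) (true ∷ L)  h = refl

  wedge-homogeneous : ∀ (is : List I) v k z → Homogeneous is k z → Homogeneous is (suc k) (wedge is v z)
  wedge-homogeneous []       v k z h L           _ = refl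
  wedge-homogeneous (i ∷ is) v k z h (false ∷ L) n = wedge-homogeneous is v k _ (λ K → h (false ∷ K)) L n
  wedge-homogeneous (i ∷ is) v k z h (true ∷ L)  n = trans (+-cong (*-congˡ (h (false ∷ L) (λ e → n (≡.cong suc e)))) (-‿cong (tail k h n)))
    (solve 1 (λ a → a :* con (+ 0) :- con (+ 0) := con (+ 0)) refl (v i))
    where
    tail : ∀ k → Homogeneous (i ∷ is) k z → suc (weight L) ≢ suc k → wedge is v (λ K → z (true ∷ K)) L ≈ 0#
    tail zero    h n = wedge-zeroʳ is v (λ K → h (true ∷ K) (λ ())) L
    tail (suc k) h n = wedge-homogeneous is v k _ (λ K m → h (true ∷ K) (λ e → m (ℕ.suc-injective e))) L (λ e → n (≡.cong suc e))

  wedges-homogeneous : ∀ (is : List I) rows → Homogeneous is (length rows) (wedges is rows (one is))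
  wedges-homogeneous is []       = one-homogeneous is
  wedges-homogeneous is (r ∷ rs) = wedge-homogeneous is r _ _ (wedges-homogeneous is rs)

  -- The algebra homomorphism induced by the linear map eᵢ ↦ ∑ⱼ aᵢⱼ eⱼ.
  Φ : ∀ (is : List I) (js : List J) → (I → J → Carrier) → Λ is → Λ js
  Φ []       js a z L = z [] * one js L
  Φ (i ∷ is) js a z L = Φ is js a (λ K → z (false ∷ K)) L + wedge js (a i) (Φ is js a (λ K → z (true ∷ K))) L

  Φ-cong : ∀ (is : List I) (js : List J) a {z z′} → (∀ L → z L ≈ z′ L) → ∀ L → Φ is js a z L ≈ Φ is js a z′ L
  Φ-cong []       js a h L = *-congʳ (h [])
  Φ-cong (i ∷ is) js a h L = +-cong (Φ-cong is js a (λ K → h _) L) (wedge-congʳ js (Φ-cong is js a (λ K → h _)) L)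

  Φ-zero : ∀ (is : List I) (js : List J) a {z} → (∀ L → z L ≈ 0#) → ∀ L → Φ is js a z L ≈ 0#
  Φ-zero []       js a h L = trans (*-congʳ (h [])) (zeroˡ _)
  Φ-zero (i ∷ is) js a h L = trans (+-cong (Φ-zero is js a (λ K → h _) L) (wedge-zeroʳ js _ (Φ-zero is js a (λ K → h _)) L)) (+-identityˡ 0#)

  Φ-sub : ∀ (is : List I) (js : List J) a c x y L →
    Φ is js a (λ K → c * x K - y K) L ≈ c * Φ is js a x L - Φ is js a y L
  Φ-sub []       js a c x y L = solve 4 (λ c x y o → (c :* x :- y) :* o := c :* (x :* o) :- y :* o) refl c (x []) (y []) (one js L)
  Φ-sub (i ∷ is) js a c x y L = trans
    (+-cong (Φ-sub is js a c _ _ L) (trans (wedge-congʳ js (Φ-sub is js a c _ _) L) (wedge-sub js (a i) c _ _ L)))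
    (solve 5 (λ c p q r s → c :* p :- q :+ (c :* r :- s) := c :* (p :+ r) :- (q :+ s)) refl c _ _ _ _)

  Φ-one : ∀ (is : List I) (js : List J) a L → Φ is js a (one is) L ≈ one js L
  Φ-one []       js a L = *-identityˡ _
  Φ-one (i ∷ is) js a L = trans (+-cong (Φ-one is js a L) (wedge-zeroʳ js _ (Φ-zero is js a (λ _ → refl)) L)) (+-identityʳ _)

  pushforward : List I → (I → J → Carrier) → (I → Carrier) → (J → Carrier)
  pushforward is a v j = ∑ is (λ i → v i * a i j)

  -- Write z = x + eᵢ ∧ y and split the pushforward of v as vᵢ aᵢ + w. The terms in y match because
  -- aᵢ ∧ aᵢ = 0 and w anticommutes with aᵢ.
  Φ-wedge : ∀ (is : List I) (js : List J) a v z L →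
    Φ is js a (wedge is v z) L ≈ wedge js (pushforward is a v) (Φ is js a z) L
  Φ-wedge []       js a v z L = trans (zeroˡ _) (sym (wedge-zeroˡ js _ (λ _ → refl) L))
  Φ-wedge (i ∷ is) js a v z L = begin
    Φ is js a (wedge is v x) L + wedge js (a i) (Φ is js a (λ K → v i * x K - wedge is v y K)) L
      ≈⟨ +-cong (Φ-wedge is js a v x L) (trans (wedge-congʳ js (λ K → trans (Φ-sub is js a (v i) x (wedge is v y) K)
            (+-congˡ (-‿cong (Φ-wedge is js a v y K)))) L)
            (trans (wedge-sub js (a i) (v i) X (wedge js w Y) L) (+-congˡ (-‿cong (wedge-anticomm js (a i) w Y L))))) ⟩
    wedge js w X L + (v i * wedge js (a i) X L - - wedge js w (wedge js (a i) Y) L)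
      ≈⟨ solve 4 (λ p q r t → p :+ (q :- :- r) := (q :+ p) :+ (t :* con (+ 0) :+ r)) refl (wedge js w X L) (v i * wedge js (a i) X L) (wedge js w (wedge js (a i) Y) L) (v i) ⟩
    (v i * wedge js (a i) X L + wedge js w X L) + (v i * 0# + wedge js w (wedge js (a i) Y) L)
      ≈⟨ +-cong (split X L) (trans (split (wedge js (a i) Y) L) (+-congʳ (*-congˡ (wedge-square js (a i) Y L)))) ⟨
    wedge js W X L + wedge js W (wedge js (a i) Y) L
      ≈⟨ wedge-+ʳ js W X (wedge js (a i) Y) L ⟨
    wedge js W (λ K → X K + wedge js (a i) Y K) L ∎
    where
    x = λ K → z (false ∷ K)
    y = λ K → z (true ∷ K)
    X = Φ is js a x
    Y = Φ is js a y
    w = pushforward is a v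
    W = pushforward (i ∷ is) a v
    split : ∀ z L → wedge js W z L ≈ v i * wedge js (a i) z L + wedge js w z L
    split z L = trans (wedge-+ˡ js (λ j → v i * a i j) w z L) (+-congʳ (wedge-*ˡ js (a i) (v i) z L))

  Φ-wedges : ∀ (is : List I) (js : List J) a rows L →
    Φ is js a (wedges is rows (one is)) L ≈ wedges js (map (pushforward is a) rows) (one js) L
  Φ-wedges is js a []       L = Φ-one is js a L
  Φ-wedges is js a (r ∷ rs) L = trans (Φ-wedge is js a r _ L) (wedge-congʳ js (Φ-wedges is js a rs) L)

  -- A form of top degree is a multiple of the product of all basis vectors, and that product is
  -- mapped to the product of the rows of a.
  Φ-top : ∀ (is : List I) (js : List J) a z → Homogeneous is (length is) z →
    ∀ L → Φ is js a z L ≈ top is z * wedges js (map a is) (one js) L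
  Φ-top []       js a z h L = refl
  Φ-top (i ∷ is) js a z h L = begin
    Φ is js a (λ K → z (false ∷ K)) L + wedge js (a i) (Φ is js a (λ K → z (true ∷ K))) L
      ≈⟨ +-cong (Φ-zero is js a (λ K → h (false ∷ K) (λ e → ℕ.1+n≰n (≡.subst (ℕ._≤ length is) e (weight≤ K)))) L)
                (wedge-congʳ js (Φ-top is js a _ (λ K n → h (true ∷ K) (λ e → n (ℕ.suc-injective e)))) L) ⟩
    0# + wedge js (a i) (λ K → top (i ∷ is) z * wedges js (map a is) (one js) K) L
      ≈⟨ trans (+-identityˡ _) (wedge-*ʳ js (a i) _ _ L) ⟩
    top (i ∷ is) z * wedges js (map a (i ∷ is)) (one js) L ∎

  -- Multiplicativity of the determinant: the image under `Φ` of the product of the rows is the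
  -- product of their images, and by top degree it is also a multiple of the product of the rows of
  -- a.
  volume-pushforward : ∀ (is : List I) (js : List J) a rows → length rows ≡ length is →
    volume (map (pushforward is a) rows) js ≈ volume rows is * volume (map a is) js
  volume-pushforward is js a rows e = trans (sym (Φ-wedges is js a rows _))
    (Φ-top is js a _ (≡.subst (λ k → Homogeneous is k (wedges is rows (one is))) e (wedges-homogeneous is rows)) _)

  wedges-false : ∀ (i : I) is rows z L →
    wedges (i ∷ is) rows z (false ∷ L) ≈ wedges is rows (λ K → z (false ∷ K)) L
  wedges-false i is []       z L = refl
  wedges-false i is (r ∷ rs) z L = wedge-congʳ is (wedges-false i is rs z) L

  -- Laplace expansion along a row concentrated in the first column. In deletion-contraction this is
  -- the contracted term.
  volume-unit : ∀ (i : I) is r rows → (∀ {j} → j ∈ is → r j ≈ 0#) →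
    volume (r ∷ rows) (i ∷ is) ≈ r i * volume rows is
  volume-unit i is r rows h = begin
    r i * wedges (i ∷ is) rows (one (i ∷ is)) (false ∷ _) - wedge is r _ _
      ≈⟨ +-cong (*-congˡ (wedges-false i is rows (one (i ∷ is)) _)) (-‿cong (wedge-zeroˡ is _ h _)) ⟩
    r i * volume rows is - 0#
      ≈⟨ solve 1 (λ a → a :- con (+ 0) := a) refl _ ⟩
    r i * volume rows is ∎

  wedges-scale : ∀ (is : List I) (c : J → Carrier) f rs z L →
    wedges is (map (λ r i → c r * f r i) rs) z L ≈ ∏ rs c * wedges is (map f rs) z L
  wedges-scale is c f []       z L = sym (*-identityˡ _)
  wedges-scale is c f (r ∷ rs) z L = begin
    wedge is (λ i → c r * f r i) (wedges is (map (λ r i → c r * f r i) rs) z) L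
      ≈⟨ wedge-*ˡ is (f r) (c r) _ L ⟩
    c r * wedge is (f r) (wedges is (map (λ r i → c r * f r i) rs) z) L
      ≈⟨ *-congˡ (trans (wedge-congʳ is (wedges-scale is c f rs z) L) (wedge-*ʳ is (f r) _ _ L)) ⟩
    c r * (∏ rs c * wedge is (f r) (wedges is (map f rs) z) L)
      ≈⟨ *-assoc _ _ _ ⟨
    c r * ∏ rs c * wedge is (f r) (wedges is (map f rs) z) L ∎

  volume-scale : ∀ (is : List I) (c : J → Carrier) f rs →
    volume (map (λ r i → c r * f r i) rs) is ≈ ∏ rs c * volume (map f rs) is
  volume-scale is c f rs = wedges-scale is c f rs (one is) _

  -- interior product with the functional taking the value 1 on each basis vector
  contract : ∀ (is : List I) → Λ is → Λ is
  contract []       z L           = 0#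
  contract (i ∷ is) z (false ∷ L) = z (true ∷ L) + contract is (λ K → z (false ∷ K)) L
  contract (i ∷ is) z (true ∷ L)  = - contract is (λ K → z (true ∷ K)) L

  contract-cong : ∀ (is : List I) {z z′} → (∀ L → z L ≈ z′ L) → ∀ L → contract is z L ≈ contract is z′ L
  contract-cong []       h L           = refl
  contract-cong (i ∷ is) h (false ∷ L) = +-cong (h _) (contract-cong is (λ K → h _) L)
  contract-cong (i ∷ is) h (true ∷ L)  = -‿cong (contract-cong is (λ K → h _) L)

  contract-sub : ∀ (is : List I) c x y L → contract is (λ K → c * x K - y K) L ≈ c * contract is x L - contract is y L
  contract-sub []       c x y L = solve 1 (λ c → con (+ 0) := c :* con (+ 0) :- con (+ 0)) refl c
  contract-sub (i ∷ is) c x y (false ∷ L) = trans (+-congˡ (contract-sub is c _ _ L))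
    (solve 5 (λ c p q r s → c :* p :- q :+ (c :* r :- s) := c :* (p :+ r) :- (q :+ s)) refl c _ _ _ _)
  contract-sub (i ∷ is) c x y (true ∷ L) = trans (-‿cong (contract-sub is c _ _ L))
    (solve 3 (λ c p q → :- (c :* p :- q) := c :* (:- p) :- :- q) refl c _ _)

  contract-zero : ∀ (is : List I) L → contract is (λ _ → 0#) L ≈ 0#
  contract-zero []       L           = refl
  contract-zero (i ∷ is) (false ∷ L) = trans (+-identityˡ _) (contract-zero is L)
  contract-zero (i ∷ is) (true ∷ L)  = trans (-‿cong (contract-zero is L)) -0≈0

  contract-one : ∀ (is : List I) L → contract is (one is) L ≈ 0#
  contract-one []       L           = refl
  contract-one (i ∷ is) (false ∷ L) = trans (+-identityˡ _) (contract-one is L)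
  contract-one (i ∷ is) (true ∷ L)  = trans (-‿cong (contract-zero is L)) -0≈0

  -- The interior product is an antiderivation: its functional takes the value ∑ v on the vector v,
  -- and passing over v costs a sign.
  contract-wedge : ∀ (is : List I) v z L →
    contract is (wedge is v z) L ≈ ∑ is v * z L - wedge is v (contract is z) L
  contract-wedge [] v z L = solve 1 (λ a → con (+ 0) := con (+ 0) :* a :- con (+ 0)) refl (z L)
  contract-wedge (i ∷ is) v z (false ∷ L) = begin
    (v i * x L - wedge is v y L) + contract is (wedge is v x) L
      ≈⟨ +-congˡ (contract-wedge is v x L) ⟩
    (v i * x L - wedge is v y L) + (∑ is v * x L - wedge is v (contract is x) L)
      ≈⟨ solve 5 (λ a b c d e → (a :* b :- c) :+ (d :* b :- e) := (a :+ d) :* b :- (c :+ e)) refl (v i) (x L) _ _ _ ⟩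
    (v i + ∑ is v) * x L - (wedge is v y L + wedge is v (contract is x) L)
      ≈⟨ +-congˡ (-‿cong (wedge-+ʳ is v y (contract is x) L)) ⟨
    (v i + ∑ is v) * x L - wedge is v (λ K → y K + contract is x K) L ∎
    where
    x = λ K → z (false ∷ K)
    y = λ K → z (true ∷ K)
  contract-wedge (i ∷ is) v z (true ∷ L) = begin
    - contract is (λ K → v i * x K - wedge is v y K) L
      ≈⟨ -‿cong (trans (contract-sub is (v i) x (wedge is v y) L) (+-congˡ (-‿cong (contract-wedge is v y L)))) ⟩
    - (v i * contract is x L - (∑ is v * y L - wedge is v (contract is y) L))
      ≈⟨ solve 5 (λ a b c d e → :- (a :* b :- (c :* d :- e)) := (a :+ c) :* d :- (a :* (d :+ b) :- (:- e))) refl (v i) _ _ (y L) _ ⟩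
    (v i + ∑ is v) * y L - (v i * (y L + contract is x L) - - wedge is v (contract is y) L)
      ≈⟨ +-congˡ (-‿cong (+-congˡ (-‿cong (wedge-neg is v (contract is y) L)))) ⟨
    (v i + ∑ is v) * y L - (v i * (y L + contract is x L) - wedge is v (λ K → - contract is y K) L) ∎
    where
    x = λ K → z (false ∷ K)
    y = λ K → z (true ∷ K)

  -- When all row sums vanish, contraction annihilates the product of the rows. But contracting the
  -- top form recovers its coefficient, which must therefore be zero.
  volume-zero : ∀ (i : I) is rows → length rows ≡ suc (length is) → (∀ {r} → r ∈ rows → ∑ (i ∷ is) r ≈ 0#) →
    volume rows (i ∷ is) ≈ 0#
  volume-zero i is rows e h = begin
    z (true ∷ full)
      ≈⟨ trans (+-congˡ (trans (contract-cong is (λ K → z-false K) full) (contract-zero is full))) (+-identityʳ _) ⟨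
    contract (i ∷ is) z (false ∷ full)
      ≈⟨ contract-wedges rows h (false ∷ full) ⟩
    0# ∎
    where
    full = replicate (length is) true
    z = wedges (i ∷ is) rows (one (i ∷ is))
    -- The degree of z exceeds the length of `is` by one, so no subset avoiding i can carry a
    -- coefficient.
    z-false : ∀ K → z (false ∷ K) ≈ 0#
    z-false K = wedges-homogeneous (i ∷ is) rows (false ∷ K)
      (λ q → ℕ.1+n≰n (≡.subst (ℕ._≤ length is) (≡.trans q e) (weight≤ K)))
    contract-wedges : ∀ rs → (∀ {r} → r ∈ rs → ∑ (i ∷ is) r ≈ 0#) →
      ∀ L → contract (i ∷ is) (wedges (i ∷ is) rs (one (i ∷ is))) L ≈ 0#
    contract-wedges []       h L = contract-one (i ∷ is) L
    contract-wedges (r ∷ rs) h L = begin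
      contract (i ∷ is) (wedge (i ∷ is) r w) L
        ≈⟨ contract-wedge (i ∷ is) r w L ⟩
      ∑ (i ∷ is) r * w L - wedge (i ∷ is) r (contract (i ∷ is) w) L
        ≈⟨ +-cong (*-congʳ (h (here ≡.refl))) (-‿cong (wedge-zeroʳ (i ∷ is) r (contract-wedges rs (λ m → h (there m))) L)) ⟩
      0# * w L - 0#
        ≈⟨ solve 1 (λ a → con (+ 0) :* a :- con (+ 0) := con (+ 0)) refl (w L) ⟩
      0# ∎
      where w = wedges (i ∷ is) rs (one (i ∷ is))

  -- Signs are Booleans with `xor` as product, so that a sign can be named and combined without
  -- being computed.
  signed : Bool → Carrier → Carrier
  signed false x = x
  signed true  x = - x

  signed-cong : ∀ b {x y} → x ≈ y → signed b x ≈ signed b y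
  signed-cong false h = h
  signed-cong true  h = -‿cong h

  signed-xor : ∀ b c x → signed b (signed c x) ≈ signed (b xor c) x
  signed-xor false c     x = refl
  signed-xor true  false x = refl
  signed-xor true  true  x = -‿involutive x

  signed-* : ∀ b c x y → signed b x * signed c y ≈ signed (b xor c) (x * y)
  signed-* false false x y = refl
  signed-* false true  x y = sym (-‿distribʳ-* x y)
  signed-* true  false x y = sym (-‿distribˡ-* x y)
  signed-* true  true  x y = solve 2 (λ x y → :- x :* :- y := x :* y) refl x y

  odd : is ↭ js → Bool
  odd Perm.refl       = false
  odd (prep i p)      = odd p
  odd (swap i j p)    = not (odd p)
  odd (Perm.trans p q) = odd p xor odd q

  -- Exchanging two neighbouring basis vectors changes the sign of exactly those coefficients that
  -- contain both.
  reorder : {is js : List I} → is ↭ js → Λ is → Λ js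
  reorder Perm.refl        z L                  = z L
  reorder (prep i p)       z (b ∷ L)            = reorder p (λ K → z (b ∷ K)) L
  reorder (swap i j p)     z (true ∷ true ∷ L)  = - reorder p (λ K → z (true ∷ true ∷ K)) L
  reorder (swap i j p)     z (true ∷ false ∷ L) = reorder p (λ K → z (false ∷ true ∷ K)) L
  reorder (swap i j p)     z (false ∷ b ∷ L)    = reorder p (λ K → z (b ∷ false ∷ K)) L
  reorder (Perm.trans p q) z L                  = reorder q (reorder p z) L

  reorder-cong : ∀ {is js : List I} (p : is ↭ js) {z z′} → (∀ L → z L ≈ z′ L) → ∀ L → reorder p z L ≈ reorder p z′ L
  reorder-cong Perm.refl        h L                  = h L
  reorder-cong (prep i p)       h (b ∷ L)            = reorder-cong p (λ K → h _) L
  reorder-cong (swap i j p)     h (true ∷ true ∷ L)  = -‿cong (reorder-cong p (λ K → h _) L)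
  reorder-cong (swap i j p)     h (true ∷ false ∷ L) = reorder-cong p (λ K → h _) L
  reorder-cong (swap i j p)     h (false ∷ b ∷ L)    = reorder-cong p (λ K → h _) L
  reorder-cong (Perm.trans p q) h L                  = reorder-cong q (reorder-cong p h) L

  reorder-sub : ∀ {is js : List I} (p : is ↭ js) c x y L →
    reorder p (λ K → c * x K - y K) L ≈ c * reorder p x L - reorder p y L
  reorder-sub Perm.refl        c x y L                  = refl
  reorder-sub (prep i p)       c x y (b ∷ L)            = reorder-sub p c _ _ L
  reorder-sub (swap i j p)     c x y (true ∷ true ∷ L)  = trans (-‿cong (reorder-sub p c _ _ L))
    (solve 3 (λ c x y → :- (c :* x :- y) := c :* (:- x) :- :- y) refl c _ _)
  reorder-sub (swap i j p)     c x y (true ∷ false ∷ L) = reorder-sub p c _ _ L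
  reorder-sub (swap i j p)     c x y (false ∷ b ∷ L)    = reorder-sub p c _ _ L
  reorder-sub (Perm.trans p q) c x y L                  =
    trans (reorder-cong q (reorder-sub p c x y) L) (reorder-sub q c _ _ L)

  reorder-zero : ∀ {is js : List I} (p : is ↭ js) {z} → (∀ L → z L ≈ 0#) → ∀ L → reorder p z L ≈ 0#
  reorder-zero Perm.refl        h L                  = h L
  reorder-zero (prep i p)       h (b ∷ L)            = reorder-zero p (λ K → h _) L
  reorder-zero (swap i j p)     h (true ∷ true ∷ L)  = trans (-‿cong (reorder-zero p (λ K → h _) L)) -0≈0
  reorder-zero (swap i j p)     h (true ∷ false ∷ L) = reorder-zero p (λ K → h _) L
  reorder-zero (swap i j p)     h (false ∷ b ∷ L)    = reorder-zero p (λ K → h _) L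
  reorder-zero (Perm.trans p q) h L                  = reorder-zero q (reorder-zero p h) L

  reorder-one : ∀ {is js : List I} (p : is ↭ js) L → reorder p (one is) L ≈ one js L
  reorder-one Perm.refl        L                  = refl
  reorder-one (prep i p)       (true ∷ L)         = reorder-zero p (λ _ → refl) L
  reorder-one (prep i p)       (false ∷ L)        = reorder-one p L
  reorder-one (swap i j p)     (true ∷ true ∷ L)  = trans (-‿cong (reorder-zero p (λ _ → refl) L)) -0≈0
  reorder-one (swap i j p)     (true ∷ false ∷ L) = reorder-zero p (λ _ → refl) L
  reorder-one (swap i j p)     (false ∷ true ∷ L) = reorder-zero p (λ _ → refl) L
  reorder-one (swap i j p)     (false ∷ false ∷ L) = reorder-one p L
  reorder-one (Perm.trans p q) L                  = trans (reorder-cong q (reorder-one p) L) (reorder-one q L)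

  reorder-wedge : ∀ {is js : List I} (p : is ↭ js) v z L → reorder p (wedge is v z) L ≈ wedge js v (reorder p z) L
  reorder-wedge Perm.refl        v z L = refl
  reorder-wedge (prep i p)       v z (false ∷ L) = reorder-wedge p v _ L
  reorder-wedge (prep i p)       v z (true ∷ L)  = trans (reorder-sub p (v i) _ _ L) (+-congˡ (-‿cong (reorder-wedge p v _ L)))
  reorder-wedge (swap {js} {ks} i j p) v z (true ∷ true ∷ L) = begin
    - reorder p (λ K → v i * z (false ∷ true ∷ K) - (v j * z (true ∷ false ∷ K) - wedge js v (λ K → z (true ∷ true ∷ K)) K)) L
      ≈⟨ -‿cong (trans (reorder-sub p (v i) _ _ L) (+-congˡ (-‿cong (reorder-sub p (v j) _ _ L)))) ⟩
    - (v i * reorder p (λ K → z (false ∷ true ∷ K)) L - (v j * reorder p (λ K → z (true ∷ false ∷ K)) L - reorder p (wedge js v (λ K → z (true ∷ true ∷ K))) L))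
      ≈⟨ -‿cong (+-congˡ (-‿cong (+-congˡ (-‿cong (reorder-wedge p v _ L))))) ⟩
    - (v i * reorder p (λ K → z (false ∷ true ∷ K)) L - (v j * reorder p (λ K → z (true ∷ false ∷ K)) L - wedge ks v (reorder p (λ K → z (true ∷ true ∷ K))) L))
      ≈⟨ solve 3 (λ a b c → :- (a :- (b :- c)) := b :- (a :- :- c)) refl _ _ _ ⟩
    v j * reorder p (λ K → z (true ∷ false ∷ K)) L - (v i * reorder p (λ K → z (false ∷ true ∷ K)) L - - wedge ks v (reorder p (λ K → z (true ∷ true ∷ K))) L)
      ≈⟨ +-congˡ (-‿cong (+-congˡ (-‿cong (wedge-neg ks v _ L)))) ⟨
    v j * reorder p (λ K → z (true ∷ false ∷ K)) L - (v i * reorder p (λ K → z (false ∷ true ∷ K)) L - wedge ks v (λ K → - reorder p (λ K → z (true ∷ true ∷ K)) K) L) ∎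
  reorder-wedge (swap i j p)     v z (true ∷ false ∷ L) = trans (reorder-sub p (v j) _ _ L) (+-congˡ (-‿cong (reorder-wedge p v _ L)))
  reorder-wedge (swap i j p)     v z (false ∷ true ∷ L) = trans (reorder-sub p (v i) _ _ L) (+-congˡ (-‿cong (reorder-wedge p v _ L)))
  reorder-wedge (swap i j p)     v z (false ∷ false ∷ L) = reorder-wedge p v _ L
  reorder-wedge (Perm.trans p q) v z L = trans (reorder-cong q (reorder-wedge p v z) L) (reorder-wedge q v _ L)

  reorder-top : ∀ {is js : List I} (p : is ↭ js) z → top js (reorder p z) ≈ signed (odd p) (top is z)
  reorder-top Perm.refl        z = refl
  reorder-top (prep i p)       z = reorder-top p _
  reorder-top (swap i j p)     z = trans (-‿cong (reorder-top p _)) (sym (signed-not (odd p) _))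
    where
    signed-not : ∀ b x → signed (not b) x ≈ - signed b x
    signed-not false x = refl
    signed-not true  x = sym (-‿involutive x)
  reorder-top (Perm.trans p q) z = trans (reorder-top q _) (trans (signed-cong (odd q) (reorder-top p z)) (trans (signed-xor (odd q) (odd p) _) (xor-comm (odd q) (odd p) _)))
    where
    xor-comm : ∀ b c x → signed (b xor c) x ≈ signed (c xor b) x
    xor-comm false false x = refl
    xor-comm false true  x = refl
    xor-comm true  false x = refl
    xor-comm true  true  x = refl

  reorder-wedges : ∀ {is js : List I} (p : is ↭ js) rows L →
    reorder p (wedges is rows (one is)) L ≈ wedges js rows (one js) L
  reorder-wedges p []       L = reorder-one p L
  reorder-wedges {js = js} p (r ∷ rs) L = trans (reorder-wedge p r _ L) (wedge-congʳ js (reorder-wedges p rs) L)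

  wedges-↭ : ∀ (ks : List J) (f : I → J → Carrier) {is js} (p : is ↭ js) z L →
    wedges ks (map f is) z L ≈ signed (odd p) (wedges ks (map f js) z L)
  wedges-↭ ks f Perm.refl        z L = refl
  wedges-↭ ks f (prep i p)       z L = trans (wedge-congʳ ks (wedges-↭ ks f p z) L) (wedge-signed (odd p))
    where
    wedge-signed : ∀ b {v w} → wedge ks v (λ K → signed b (w K)) L ≈ signed b (wedge ks v w L)
    wedge-signed false = refl
    wedge-signed true  = wedge-neg ks _ _ L
  wedges-↭ ks f (swap i j p)     z L = trans (wedge-anticomm ks (f i) (f j) _ L)
    (trans (-‿cong (wedge-congʳ ks (wedge-congʳ ks (wedges-↭ ks f p z)) L)) (twice (odd p)))
    where
    twice : ∀ b {u v w} → - wedge ks u (wedge ks v (λ K → signed b (w K))) L ≈ signed (not b) (wedge ks u (wedge ks v w) L)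
    twice false = refl
    twice true  = trans (-‿cong (trans (wedge-congʳ ks (wedge-neg ks _ _) L) (wedge-neg ks _ _ L))) (-‿involutive _)
  wedges-↭ ks f (Perm.trans p q) z L = trans (wedges-↭ ks f p z L)
    (trans (signed-cong (odd p) (wedges-↭ ks f q z L)) (signed-xor (odd p) (odd q) _))

  -- Reordering the columns and reordering the rows each produce the sign `odd p`, and the two signs
  -- cancel.
  det-↭ : ∀ {is js : List I} → is ↭ js → ∀ A → det is A ≈ det js A
  det-↭ {is = is} {js} p A = begin
    det is A                                             ≈⟨ double (odd p) _ ⟨
    signed (odd p) (signed (odd p) (det is A))           ≈⟨ signed-cong (odd p) (reorder-top p _) ⟨
    signed (odd p) (top js (reorder p (wedges is (map A is) (one is)))) ≈⟨ signed-cong (odd p) (reorder-wedges p (map A is) _) ⟩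
    signed (odd p) (top js (wedges js (map A is) (one js))) ≈⟨ signed-cong (odd p) (wedges-↭ js A p (one js) _) ⟩
    signed (odd p) (signed (odd p) (det js A))           ≈⟨ double (odd p) _ ⟩
    det js A                                             ∎
    where
    double : ∀ b x → signed b (signed b x) ≈ x
    double false x = refl
    double true  x = -‿involutive x

  -- The product x ∧ y of forms in disjoint sets of variables, with the variables of x in front.
  tensor : ∀ (is js : List I) → Λ is → Λ js → Λ (is ++ js)
  tensor []       js x y L       = x [] * y L
  tensor (i ∷ is) js x y (b ∷ L) = tensor is js (λ K → x (b ∷ K)) y L

  tensor-cong : ∀ (is js : List I) {x x′ y y′} → (∀ L → x L ≈ x′ L) → (∀ L → y L ≈ y′ L) → ∀ L → tensor is js x y L ≈ tensor is js x′ y′ L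
  tensor-cong []       js h k L       = *-cong (h []) (k L)
  tensor-cong (i ∷ is) js h k (b ∷ L) = tensor-cong is js (λ K → h _) k L

  tensor-sub : ∀ (is js : List I) c x y z L → tensor is js (λ K → c * x K - y K) z L ≈ c * tensor is js x z L - tensor is js y z L
  tensor-sub []       js c x y z L       = solve 4 (λ c x y z → (c :* x :- y) :* z := c :* (x :* z) :- y :* z) refl c (x []) (y []) (z L)
  tensor-sub (i ∷ is) js c x y z (b ∷ L) = tensor-sub is js c _ _ z L

  tensor-zero : ∀ (is js : List I) {x} y → (∀ L → x L ≈ 0#) → ∀ L → tensor is js x y L ≈ 0#
  tensor-zero []       js y h L       = trans (*-congʳ (h [])) (zeroˡ _)
  tensor-zero (i ∷ is) js y h (b ∷ L) = tensor-zero is js y (λ K → h _) L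

  tensor-one : ∀ (is js : List I) L → tensor is js (one is) (one js) L ≈ one (is ++ js) L
  tensor-one []       js L           = *-identityˡ _
  tensor-one (i ∷ is) js (false ∷ L) = tensor-one is js L
  tensor-one (i ∷ is) js (true ∷ L)  = tensor-zero is js _ (λ _ → refl) L

  tensor-top : ∀ (is js : List I) x y → top (is ++ js) (tensor is js x y) ≈ top is x * top js y
  tensor-top []       js x y = refl
  tensor-top (i ∷ is) js x y = tensor-top is js _ y

  wedge-tensorˡ : ∀ (is js : List I) v x y → (∀ {j} → j ∈ js → v j ≈ 0#) →
    ∀ L → wedge (is ++ js) v (tensor is js x y) L ≈ tensor is js (wedge is v x) y L
  wedge-tensorˡ []       js v x y h L           = trans (wedge-zeroˡ js _ h L) (sym (zeroˡ _))
  wedge-tensorˡ (i ∷ is) js v x y h (false ∷ L) = wedge-tensorˡ is js v _ y h L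
  wedge-tensorˡ (i ∷ is) js v x y h (true ∷ L)  =
    trans (+-congˡ (-‿cong (wedge-tensorˡ is js v _ y h L))) (sym (tensor-sub is js (v i) _ _ y L))

  -- A vector in the back variables has to pass the left factor; for the left factor `one` this
  -- costs no sign.
  wedge-tensorʳ : ∀ (is js : List I) v y → (∀ {i} → i ∈ is → v i ≈ 0#) →
    ∀ L → wedge (is ++ js) v (tensor is js (one is) y) L ≈ tensor is js (one is) (wedge js v y) L
  wedge-tensorʳ []       js v y h L           = wedge-*ʳ js v _ y L
  wedge-tensorʳ (i ∷ is) js v y h (false ∷ L) = wedge-tensorʳ is js v y (λ m → h (there m)) L
  wedge-tensorʳ (i ∷ is) js v y h (true ∷ L)  = begin
    v i * tensor is js (one is) y L - wedge (is ++ js) v (tensor is js (λ _ → 0#) y) L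
      ≈⟨ +-cong (*-congʳ (h (here ≡.refl))) (-‿cong (wedge-zeroʳ (is ++ js) v (tensor-zero is js y (λ _ → refl)) L)) ⟩
    0# * tensor is js (one is) y L - 0#
      ≈⟨ solve 1 (λ a → con (+ 0) :* a :- con (+ 0) := con (+ 0)) refl _ ⟩
    0#
      ≈⟨ tensor-zero is js _ (λ _ → refl) L ⟨
    tensor is js (λ _ → 0#) (wedge js v y) L ∎

  -- The rows of js are multiplied first, while the left factor is still `one`; the rows of is then
  -- act on the left factor alone.
  det-block : ∀ (is js : List I) A → (∀ {i j} → i ∈ is → j ∈ js → A i j ≈ 0#) → (∀ {i j} → i ∈ is → j ∈ js → A j i ≈ 0#) →
    det (is ++ js) A ≈ det is A * det js A
  det-block is js A h k = begin
    top (is ++ js) (wedges (is ++ js) (map A (is ++ js)) (one (is ++ js)))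
      ≡⟨ ≡.cong (λ rs → top (is ++ js) (wedges (is ++ js) rs (one (is ++ js)))) (map-++ A is js) ⟩
    top (is ++ js) (wedges (is ++ js) (map A is ++ map A js) (one (is ++ js)))
      ≡⟨ ≡.cong (top (is ++ js)) (foldr-++ (wedge (is ++ js)) (one (is ++ js)) (map A is) (map A js)) ⟩
    top (is ++ js) (wedges (is ++ js) (map A is) (wedges (is ++ js) (map A js) (one (is ++ js))))
      ≈⟨ wedges-congʳ (is ++ js) (map A is) (right js (λ m → m)) _ ⟩
    top (is ++ js) (wedges (is ++ js) (map A is) (tensor is js (one is) (wedges js (map A js) (one js))))
      ≈⟨ left is (λ m → m) _ ⟩
    top (is ++ js) (tensor is js (wedges is (map A is) (one is)) (wedges js (map A js) (one js)))
      ≈⟨ tensor-top is js _ _ ⟩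
    det is A * det js A ∎
    where
    open import Data.List.Properties using (map-++; foldr-++)
    right : ∀ ks → (∀ {j} → j ∈ ks → j ∈ js) → ∀ L →
      wedges (is ++ js) (map A ks) (one (is ++ js)) L ≈ tensor is js (one is) (wedges js (map A ks) (one js)) L
    right []       s L = sym (tensor-one is js L)
    right (r ∷ rs) s L = trans (wedge-congʳ (is ++ js) (right rs (λ m → s (there m))) L)
      (wedge-tensorʳ is js (A r) _ (λ m → k m (s (here ≡.refl))) L)
    left : ∀ ks → (∀ {i} → i ∈ ks → i ∈ is) → ∀ {y} L →
      wedges (is ++ js) (map A ks) (tensor is js (one is) y) L ≈ tensor is js (wedges is (map A ks) (one is)) y L
    left []       s L = refl
    left (r ∷ rs) s L = trans (wedge-congʳ (is ++ js) (left rs (λ m → s (there m))) L)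
      (wedge-tensorˡ is js (A r) _ _ (λ m → h (s (here ≡.refl)) m) L)

  relabel : ∀ (g : I → J) is → Vec Bool (length is) → Vec Bool (length (map g is))
  relabel g []       L       = []
  relabel g (i ∷ is) (b ∷ L) = b ∷ relabel g is L

  relabel-wedge : ∀ (g : I → J) is v z L →
    wedge (map g is) v z (relabel g is L) ≈ wedge is (λ i → v (g i)) (λ K → z (relabel g is K)) L
  relabel-wedge g []       v z L           = refl
  relabel-wedge g (i ∷ is) v z (false ∷ L) = relabel-wedge g is v _ L
  relabel-wedge g (i ∷ is) v z (true ∷ L)  = +-congˡ (-‿cong (relabel-wedge g is v _ L))

  relabel-one : ∀ (g : I → J) is L → one (map g is) (relabel g is L) ≈ one is L
  relabel-one g []       L           = refl
  relabel-one g (i ∷ is) (false ∷ L) = relabel-one g is L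
  relabel-one g (i ∷ is) (true ∷ L)  = refl

  relabel-full : ∀ (g : I → J) is → relabel g is (replicate (length is) true) ≡ replicate (length (map g is)) true
  relabel-full g []       = ≡.refl
  relabel-full g (i ∷ is) = ≡.cong (true ∷_) (relabel-full g is)

  det-map : ∀ (g : I → J) is A → det (map g is) A ≈ det is (λ i j → A (g i) (g j))
  det-map g is A = trans (reflexive (≡.cong (wedges (map g is) (map A (map g is)) (one (map g is))) (≡.sym (relabel-full g is))))
    (go is _)
    where
    go : ∀ ks L → wedges (map g is) (map A (map g ks)) (one (map g is)) (relabel g is L) ≈ wedges is (map (λ i j → A (g i) (g j)) ks) (one is) L
    go []       L = relabel-one g is L
    go (k ∷ ks) L = trans (relabel-wedge g is (A (g k)) _ L) (wedge-congʳ is (go ks) L)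

-- Cauchy products, the binomial theorem and the remainder of a truncated product.

module Convolution (R : CommutativeRing 0ℓ 0ℓ) where
  open import Data.Integer using (+_)
  open import Data.Nat as ℕ using (ℕ; zero; suc)
  open import Function using (_∘_)
  open CommutativeRing R hiding (zero)
  open import Relation.Binary.Reasoning.Setoid setoid
  open IntegerCoefficients R using (module Solver; fromNat; fromNat-suc)
  open Solver

  conv : (ℕ → Carrier) → (ℕ → Carrier) → ℕ → Carrier
  conv f g zero    = f 0 * g 0
  conv f g (suc k) = f 0 * g (suc k) + conv (f ∘ suc) g k

  partialSum : (ℕ → Carrier) → ℕ → Carrier
  partialSum f zero    = 0#
  partialSum f (suc n) = partialSum f n + f n

  conv-cong : ∀ {f f′ g g′} → (∀ i → f i ≈ f′ i) → (∀ i → g i ≈ g′ i) → ∀ k → conv f g k ≈ conv f′ g′ k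
  conv-cong h e zero    = *-cong (h 0) (e 0)
  conv-cong h e (suc k) = +-cong (*-cong (h 0) (e (suc k))) (conv-cong (h ∘ suc) e k)

  conv-+ˡ : ∀ f f′ g k → conv (λ i → f i + f′ i) g k ≈ conv f g k + conv f′ g k
  conv-+ˡ f f′ g zero    = distribʳ _ _ _
  conv-+ˡ f f′ g (suc k) = trans (+-congˡ (conv-+ˡ (f ∘ suc) (f′ ∘ suc) g k))
    (solve 5 (λ a b c d e → (a :+ b) :* c :+ (d :+ e) := a :* c :+ d :+ (b :* c :+ e)) refl (f 0) (f′ 0) (g (suc k)) _ _)

  conv-+ʳ : ∀ f g g′ k → conv f (λ i → g i + g′ i) k ≈ conv f g k + conv f g′ k
  conv-+ʳ f g g′ zero    = distribˡ _ _ _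
  conv-+ʳ f g g′ (suc k) = trans (+-congˡ (conv-+ʳ (f ∘ suc) g g′ k))
    (solve 5 (λ a b c d e → a :* (b :+ c) :+ (d :+ e) := a :* b :+ d :+ (a :* c :+ e)) refl (f 0) (g (suc k)) (g′ (suc k)) _ _)

  conv-*ˡ : ∀ c f g k → conv (λ i → c * f i) g k ≈ c * conv f g k
  conv-*ˡ c f g zero    = *-assoc _ _ _
  conv-*ˡ c f g (suc k) = trans (+-congˡ (conv-*ˡ c (f ∘ suc) g k))
    (solve 4 (λ c a b d → c :* a :* b :+ c :* d := c :* (a :* b :+ d)) refl c (f 0) (g (suc k)) _)

  conv-*ʳ : ∀ c f g k → conv f (λ i → c * g i) k ≈ c * conv f g k
  conv-*ʳ c f g zero    = solve 3 (λ a c b → a :* (c :* b) := c :* (a :* b)) refl (f 0) c (g 0)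
  conv-*ʳ c f g (suc k) = trans (+-congˡ (conv-*ʳ c (f ∘ suc) g k))
    (solve 4 (λ c a b d → a :* (c :* b) :+ c :* d := c :* (a :* b :+ d)) refl c (f 0) (g (suc k)) _)

  conv-shiftʳ : ∀ f g k → g 0 ≈ 0# → conv f g (suc k) ≈ conv f (g ∘ suc) k
  conv-shiftʳ f g zero    h = trans (+-congˡ (trans (*-congˡ h) (zeroʳ _))) (+-identityʳ _)
  conv-shiftʳ f g (suc k) h = +-congˡ (conv-shiftʳ (f ∘ suc) g k h)

  -- The Euler operator t d/dt on the coefficients of a power series; `leibniz` is its product rule.
  θ : (ℕ → Carrier) → ℕ → Carrier
  θ f i = fromNat i * f i

  leibniz : ∀ f g k → fromNat k * conv f g k ≈ conv (θ f) g k + conv f (θ g) k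
  leibniz f g zero = solve 2 (λ a b → con (+ 0) :* (a :* b) := con (+ 0) :* a :* b :+ a :* (con (+ 0) :* b)) refl (f 0) (g 0)
  leibniz f g (suc k) = begin
    fromNat (suc k) * (f 0 * g (suc k) + C)
      ≈⟨ *-congʳ (fromNat-suc k) ⟩
    (1# + fromNat k) * (f 0 * g (suc k) + C)
      ≈⟨ solve 4 (λ n a b c → (con (+ 1) :+ n) :* (a :* b :+ c) := con (+ 0) :* a :* b :+ (n :* c :+ c) :+ a :* ((con (+ 1) :+ n) :* b)) refl (fromNat k) (f 0) (g (suc k)) C ⟩
    0# * f 0 * g (suc k) + (fromNat k * C + C) + f 0 * ((1# + fromNat k) * g (suc k))
      ≈⟨ +-cong (+-congˡ (+-congʳ (leibniz (f ∘ suc) g k))) (*-congˡ (*-congʳ (sym (fromNat-suc k)))) ⟩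
    0# * f 0 * g (suc k) + ((conv (θ (f ∘ suc)) g k + conv (f ∘ suc) (θ g) k) + C) + f 0 * θ g (suc k)
      ≈⟨ solve 5 (λ z p q c r → z :+ ((p :+ q) :+ c) :+ r := z :+ (c :+ p) :+ (r :+ q)) refl (0# * f 0 * g (suc k)) (conv (θ (f ∘ suc)) g k) (conv (f ∘ suc) (θ g) k) C (f 0 * θ g (suc k)) ⟩
    0# * f 0 * g (suc k) + (C + conv (θ (f ∘ suc)) g k) + (f 0 * θ g (suc k) + conv (f ∘ suc) (θ g) k)
      ≈⟨ +-congʳ (+-congˡ (trans (sym (conv-+ˡ (f ∘ suc) (θ (f ∘ suc)) g k)) (conv-cong (λ i → shifted i) (λ _ → refl) k))) ⟩
    conv (θ f) g (suc k) + conv f (θ g) (suc k) ∎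
    where
    C = conv (f ∘ suc) g k
    shifted : ∀ i → f (suc i) + θ (f ∘ suc) i ≈ θ f (suc i)
    shifted i = trans (solve 2 (λ a n → a :+ n :* a := (con (+ 1) :+ n) :* a) refl (f (suc i)) (fromNat i)) (*-congʳ (sym (fromNat-suc i)))

  -- The differential equation f′ = x f in terms of coefficients, solved by the multiples of xᵏ/k!.
  DividedPowers : Carrier → (ℕ → Carrier) → Set
  DividedPowers x f = ∀ k → fromNat (suc k) * f (suc k) ≈ x * f k

  -- (a + b)ᵏ/k! = ∑ aⁱ/i! bʲ/j!, where both sides satisfy the recursion of divided powers
  binomial : (∀ k {x y} → fromNat (suc k) * x ≈ fromNat (suc k) * y → x ≈ y) →
    ∀ {a b f g h} → DividedPowers a f → DividedPowers b g → DividedPowers (a + b) h →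
    f 0 * g 0 ≈ h 0 → ∀ k → conv f g k ≈ h k
  binomial cancel {a} {b} {f} {g} {h} F G H e zero    = e
  binomial cancel {a} {b} {f} {g} {h} F G H e (suc k) = cancel k (begin
    fromNat (suc k) * conv f g (suc k)
      ≈⟨ leibniz f g (suc k) ⟩
    (fromNat 0 * f 0 * g (suc k) + conv (θ f ∘ suc) g k) + conv f (θ g) (suc k)
      ≈⟨ +-cong (+-cong (solve 2 (λ a b → con (+ 0) :* a :* b := con (+ 0)) refl (f 0) (g (suc k))) (conv-cong F (λ _ → refl) k))
                (trans (conv-shiftʳ f (θ g) k (zeroˡ _)) (conv-cong (λ _ → refl) G k)) ⟩
    (0# + conv (λ i → a * f i) g k) + conv f (λ i → b * g i) k
      ≈⟨ +-cong (trans (+-identityˡ _) (conv-*ˡ a f g k)) (conv-*ʳ b f g k) ⟩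
    a * conv f g k + b * conv f g k
      ≈⟨ distribʳ _ _ _ ⟨
    (a + b) * conv f g k
      ≈⟨ *-congˡ (binomial cancel F G H e k) ⟩
    (a + b) * h k
      ≈⟨ H k ⟨
    fromNat (suc k) * h (suc k) ∎)

  double : ℕ → ℕ
  double zero    = zero
  double (suc k) = suc (suc (double k))

  -- At an even index, a factor with even terms only meets only the even terms of the other factor.
  conv-even : ∀ f g → (∀ k → g (suc (double k)) ≈ 0#) → ∀ k → conv f g (double k) ≈ conv (f ∘ double) (g ∘ double) k
  conv-even f g h zero    = refl
  conv-even f g h (suc k) = +-congˡ (begin
    f 1 * g (suc (double k)) + conv (f ∘ suc ∘ suc) g (double k) ≈⟨ +-congʳ (trans (*-congˡ (h k)) (zeroʳ _)) ⟩
    0# + conv (f ∘ suc ∘ suc) g (double k)                       ≈⟨ +-identityˡ _ ⟩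
    conv (f ∘ suc ∘ suc) g (double k)                            ≈⟨ conv-even (f ∘ suc ∘ suc) g h k ⟩
    conv (f ∘ double ∘ suc) (g ∘ double) k                       ∎)

  conv-twist : ∀ (s f g : ℕ → Carrier) → (∀ i j → s (i ℕ.+ j) ≈ s i * s j) → ∀ k →
    conv (λ i → s i * f i) (λ j → s j * g j) k ≈ s k * conv f g k
  conv-twist s f g h k = go f s (λ j → h 0 j) h k
    where
    -- The recursion shifts the first factor together with its multiplier, so s is replaced there by
    -- a sequence t that satisfies the same functional equation relative to s.
    go : ∀ f (t : ℕ → Carrier) → (∀ j → t j ≈ t 0 * s j) → (∀ i j → t (i ℕ.+ j) ≈ t i * s j) → ∀ k →
      conv (λ i → t i * f i) (λ j → s j * g j) k ≈ t k * conv f g k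
    go f t e h zero = trans (solve 4 (λ t f s g → t :* f :* (s :* g) := t :* s :* (f :* g)) refl (t 0) (f 0) (s 0) (g 0)) (*-congʳ (sym (e 0)))
    go f t e h (suc k) = begin
      t 0 * f 0 * (s (suc k) * g (suc k)) + conv (λ i → t (suc i) * f (suc i)) (λ j → s j * g j) k
        ≈⟨ +-cong (solve 4 (λ t f s g → t :* f :* (s :* g) := t :* s :* (f :* g)) refl (t 0) (f 0) (s (suc k)) (g (suc k)))
                  (go (f ∘ suc) (t ∘ suc) (λ j → h 1 j) (λ i j → h (suc i) j) k) ⟩
      t 0 * s (suc k) * (f 0 * g (suc k)) + t (suc k) * conv (f ∘ suc) g k
        ≈⟨ +-congʳ (*-congʳ (e (suc k))) ⟨
      t (suc k) * (f 0 * g (suc k)) + t (suc k) * conv (f ∘ suc) g k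
        ≈⟨ distribˡ _ _ _ ⟨
      t (suc k) * conv f g (suc k) ∎

  partialSum-cong : ∀ {f g} → (∀ i → f i ≈ g i) → ∀ n → partialSum f n ≈ partialSum g n
  partialSum-cong h zero    = refl
  partialSum-cong h (suc n) = +-cong (partialSum-cong h n) (h n)

  partialSum-+ : ∀ f g n → partialSum (λ i → f i + g i) n ≈ partialSum f n + partialSum g n
  partialSum-+ f g zero    = sym (+-identityˡ _)
  partialSum-+ f g (suc n) = trans (+-congʳ (partialSum-+ f g n))
    (solve 4 (λ a b c d → a :+ b :+ (c :+ d) := a :+ c :+ (b :+ d)) refl _ _ _ _)

  partialSum-* : ∀ c f n → partialSum (λ i → c * f i) n ≈ c * partialSum f n
  partialSum-* c f zero    = sym (zeroʳ _)
  partialSum-* c f (suc n) = trans (+-congʳ (partialSum-* c f n)) (sym (distribˡ _ _ _))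

  partialSum-head : ∀ f n → partialSum f (suc n) ≈ f 0 + partialSum (f ∘ suc) n
  partialSum-head f zero    = +-comm _ _
  partialSum-head f (suc n) = trans (+-congʳ (partialSum-head f n)) (+-assoc _ _ _)

  -- The sum of f i * g j over the triangle i, j < n ≤ i + j: the terms of the product of two
  -- partial sums that a truncated Cauchy product misses.
  cauchyRemainder : (ℕ → Carrier) → (ℕ → Carrier) → ℕ → Carrier
  cauchyRemainder f g n = partialSum f n * partialSum g n - partialSum (conv f g) n

  -- The index i = 0 contributes nothing to the triangle. After shifting f, the column j = n is
  -- complete and the rest is a smaller triangle.
  cauchyRemainder-suc : ∀ f g n →
    cauchyRemainder f g (suc n) ≈ partialSum (f ∘ suc) n * g n + cauchyRemainder (f ∘ suc) g n
  cauchyRemainder-suc f g n = begin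
    partialSum f (suc n) * (partialSum g n + g n) - partialSum (conv f g) (suc n)
      ≈⟨ +-cong (*-congʳ (partialSum-head f n)) (-‿cong (conv-sum n)) ⟩
    (f 0 + partialSum (f ∘ suc) n) * (partialSum g n + g n) - (f 0 * (partialSum g n + g n) + partialSum (conv (f ∘ suc) g) n)
      ≈⟨ solve 5 (λ a F G g S → (a :+ F) :* (G :+ g) :- (a :* (G :+ g) :+ S) := F :* g :+ (F :* G :- S)) refl (f 0) _ _ _ _ ⟩
    partialSum (f ∘ suc) n * g n + cauchyRemainder (f ∘ suc) g n ∎
    where
    conv-sum : ∀ n → partialSum (conv f g) (suc n) ≈ f 0 * (partialSum g n + g n) + partialSum (conv (f ∘ suc) g) n
    conv-sum zero    = solve 2 (λ a b → con (+ 0) :+ a :* b := a :* (con (+ 0) :+ b) :+ con (+ 0)) refl (f 0) (g 0)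
    conv-sum (suc n) = trans (+-congʳ (conv-sum n))
      (solve 5 (λ a x y p q → a :* x :+ p :+ (a :* y :+ q) := a :* (x :+ y) :+ (p :+ q)) refl (f 0) (partialSum g n + g n) (g (suc n)) _ _)

-- Pfaffians, in particular of bipartite matrices.

module Pfaffian (R : CommutativeRing 0ℓ 0ℓ) where
  open import Data.Bool using (true; false; not; _xor_)
  open import Data.Integer using (+_)
  open import Data.List using (List; []; _∷_; [_]; _++_; map; length)
  open import Data.List.Properties using (++-identityʳ; ++-assoc; length-map; map-∘)
  open import Data.List.Membership.Propositional using (_∈_)
  open import Data.List.Membership.Propositional.Properties using (∈-++⁻; ∈-map⁻)
  open import Data.List.Relation.Binary.Permutation.Propositional as Perm using (_↭_; prep; swap)
  open import Data.List.Relation.Binary.Permutation.Propositional.Properties using (++-comm)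
  open import Data.List.Relation.Unary.Any using (here; there)
  open import Data.Product using (_,_; ∃-syntax)
  open import Data.Sum using (inj₁; inj₂)
  open import Data.Vec using ([]; _∷_)
  open import Relation.Binary.PropositionalEquality as ≡ using (_≡_)
  open CommutativeRing R
  open import Relation.Binary.Reasoning.Setoid setoid
  open IntegerCoefficients R using (module Solver)
  open Solver
  open ListSums R
  open Exterior R

  module _ {I : Set} (A : I → I → Carrier) where

    -- the generating function exp (∑ Aᵢⱼ eᵢ ∧ eⱼ) of the Pfaffians of all principal submatrices
    pf : (is : List I) → Λ is
    pf []       L           = 1#
    pf (i ∷ is) (false ∷ L) = pf is L
    pf (i ∷ is) (true ∷ L)  = wedge is (A i) (pf is) L

    pfaffian : List I → Carrier
    pfaffian is = top is (pf is)

    module _ (skew : ∀ i j → A i j ≈ - A j i) where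

      -- For skew A the form ∑ Aᵢⱼ eᵢ ∧ eⱼ does not depend on the order of the basis, hence neither
      -- does its exponential.
      reorder-pf : ∀ {is js} (p : is ↭ js) L → reorder p (pf is) L ≈ pf js L
      reorder-pf Perm.refl        L           = refl
      reorder-pf (prep i p)       (false ∷ L) = reorder-pf p L
      reorder-pf (prep {_} {js} i p) (true ∷ L) = trans (reorder-wedge p (A i) _ L) (wedge-congʳ js (reorder-pf p) L)
      reorder-pf (swap i j p)     (false ∷ false ∷ L) = reorder-pf p L
      reorder-pf (swap {_} {js} i j p) (false ∷ true ∷ L)  = trans (reorder-wedge p (A i) _ L) (wedge-congʳ js (reorder-pf p) L)
      reorder-pf (swap {_} {js} i j p) (true ∷ false ∷ L)  = trans (reorder-wedge p (A j) _ L) (wedge-congʳ js (reorder-pf p) L)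
      reorder-pf (swap {is} {js} i j p) (true ∷ true ∷ L)   = begin
        - reorder p (λ K → A i j * pf is K - wedge is (A i) (wedge is (A j) (pf is)) K) L
          ≈⟨ -‿cong (trans (reorder-sub p (A i j) (pf is) _ L) (+-cong (*-cong (skew i j) (reorder-pf p L))
               (-‿cong (trans (reorder-wedge p (A i) _ L) (wedge-congʳ js (λ K → trans (reorder-wedge p (A j) (pf is) K) (wedge-congʳ js (reorder-pf p) K)) L))))) ⟩
        - (- A j i * pf js L - wedge js (A i) (wedge js (A j) (pf js)) L)
          ≈⟨ -‿cong (+-congˡ (-‿cong (wedge-anticomm js (A i) (A j) (pf js) L))) ⟩
        - (- A j i * pf js L - - wedge js (A j) (wedge js (A i) (pf js)) L)
          ≈⟨ solve 3 (λ a b c → :- (:- a :* b :- :- c) := a :* b :- c) refl (A j i) (pf js L) _ ⟩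
        A j i * pf js L - wedge js (A j) (wedge js (A i) (pf js)) L ∎
      reorder-pf (Perm.trans p q) L = trans (reorder-cong q (reorder-pf p) L) (reorder-pf q L)

      pfaffian-↭ : ∀ {is js} (p : is ↭ js) → pfaffian js ≈ signed (odd p) (pfaffian is)
      pfaffian-↭ {is} {js} p = trans (sym (reorder-pf p _)) (reorder-top p (pf is))

    -- Vectors without an eᵢ component move past eᵢ at the cost of a sign each. The total sign stays
    -- existential, as only absolute values are compared in the end.
    wedges-true : ∀ (i : I) (is : List I) (vs : List (I → Carrier)) (z : Λ (i ∷ is)) → (∀ {v} → v ∈ vs → v i ≈ 0#) → ∃[ s ] (∀ L →
      wedges (i ∷ is) vs z (true ∷ L) ≈ signed s (wedges is vs (λ K → z (true ∷ K)) L))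
    wedges-true i is []       z h = false , λ L → refl
    wedges-true i is (v ∷ vs) z h with wedges-true i is vs z (λ m → h (there m))
    ... | s , e = not s , λ L → trans
      (+-cong (*-congʳ (h (here ≡.refl))) (-‿cong (trans (wedge-congʳ is e L) (wedge-signed s _ L))))
      (trans (solve 2 (λ a b → con (+ 0) :* a :- b := :- b) refl _ _) (signed-not s))
      where
      wedge-signed : ∀ s z L → wedge is v (λ K → signed s (z K)) L ≈ signed s (wedge is v z L)
      wedge-signed false z L = refl
      wedge-signed true  z L = wedge-neg is v z L
      signed-not : ∀ s {x} → - signed s x ≈ signed (not s) x
      signed-not false = refl
      signed-not true  = solve 1 (λ x → :- :- x := x) refl _

    pf-independent : ∀ (ws : List I) → (∀ {v w} → v ∈ ws → w ∈ ws → A v w ≈ 0#) → ∀ L → pf ws L ≈ one ws L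
    pf-independent []       h []          = refl
    pf-independent (w ∷ ws) h (false ∷ L) = pf-independent ws (λ p q → h (there p) (there q)) L
    pf-independent (w ∷ ws) h (true ∷ L)  = wedge-zeroˡ ws _ (λ m → h (here ≡.refl) (there m)) L

    -- A perfect matching pairs every black vertex with a white one. Extracting the black vertices
    -- one after the other turns each into a row, and what remains is the exponential of 0 on the
    -- white vertices.
    pfaffian-bipartite : ∀ (bs ws : List I) → (∀ {v w} → v ∈ ws → w ∈ ws → A v w ≈ 0#) → (∀ {v w} → v ∈ bs → w ∈ bs → A v w ≈ 0#) →
      ∃[ s ] pfaffian (bs ++ ws) ≈ signed s (volume (map A bs) ws)
    pfaffian-bipartite bs ws hw hb = go bs [] (λ m → m) (λ ())
      where
      -- The vertices of us have become rows already, those of ks are still basis vectors. The next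
      -- row is appended at the end of us because it is multiplied before them.
      go : ∀ (ks us : List I) → (∀ {k} → k ∈ ks → k ∈ bs) → (∀ {u} → u ∈ us → u ∈ bs) →
        ∃[ s ] top (ks ++ ws) (wedges (ks ++ ws) (map A us) (pf (ks ++ ws))) ≈ signed s (volume (map A (us ++ ks)) ws)
      go []       us hk hu = false , trans (wedges-congʳ ws (map A us) (pf-independent ws hw) _)
        (reflexive (≡.cong (λ vs → volume (map A vs) ws) (≡.sym (++-identityʳ us))))
      go (k ∷ ks) us hk hu with wedges-true k (ks ++ ws) (map A us) (pf (k ∷ ks ++ ws)) zero-at-k
                              | go ks (us ++ [ k ]) (λ m → hk (there m)) (λ m → snoc m)
        where
        zero-at-k : ∀ {v : I → Carrier} → v ∈ map A us → v k ≈ 0#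
        zero-at-k m with ∈-map⁻ A m
        ... | u , u∈ , ≡.refl = hb (hu u∈) (hk (here ≡.refl))
        snoc : ∀ {u : I} → u ∈ us ++ [ k ] → u ∈ bs
        snoc m with ∈-++⁻ us m
        ... | inj₁ u∈ = hu u∈
        ... | inj₂ (here ≡.refl) = hk (here ≡.refl)
      ... | s , e | t , f = (s xor t) , (begin
        wedges (k ∷ ks ++ ws) (map A us) (pf (k ∷ ks ++ ws)) _
          ≈⟨ e _ ⟩
        signed s (wedges (ks ++ ws) (map A us) (wedge (ks ++ ws) (A k) (pf (ks ++ ws))) _)
          ≈⟨ signed-cong s (reflexive (≡.cong (λ z → top (ks ++ ws) z) (≡.sym (≡.trans (≡.cong (λ vs → wedges (ks ++ ws) vs (pf (ks ++ ws))) (map-++ A us [ k ])) (foldr-++ (wedge (ks ++ ws)) (pf (ks ++ ws)) (map A us) [ A k ]))))) ⟩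
        signed s (wedges (ks ++ ws) (map A (us ++ [ k ])) (pf (ks ++ ws)) _)
          ≈⟨ signed-cong s f ⟩
        signed s (signed t (volume (map A ((us ++ [ k ]) ++ ks)) ws))
          ≈⟨ signed-xor s t _ ⟩
        signed (s xor t) (volume (map A ((us ++ [ k ]) ++ ks)) ws)
          ≡⟨ ≡.cong (λ vs → signed (s xor t) (volume (map A vs) ws)) (++-assoc us [ k ] ks) ⟩
        signed (s xor t) (volume (map A (us ++ k ∷ ks)) ws) ∎)
        where open import Data.List.Properties using (map-++; foldr-++)

    -- Putting once the black and once the white vertices in front gives the volumes of the two
    -- off-diagonal blocks of A; their product is the determinant of A² on the black vertices.
    pfaffian² : (∀ i j → A i j ≈ - A j i) → ∀ {is : List I} bs ws → is ↭ bs ++ ws → length bs ≡ length ws →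
      (∀ {v w} → v ∈ ws → w ∈ ws → A v w ≈ 0#) → (∀ {v w} → v ∈ bs → w ∈ bs → A v w ≈ 0#) →
      ∃[ s ] pfaffian is * pfaffian is ≈ signed s (det bs (λ b b′ → ∑ ws (λ w → A b w * A w b′)))
    pfaffian² skew {is} bs ws p len hw hb with pfaffian-bipartite bs ws hw hb | pfaffian-bipartite ws bs hb hw
    ... | s , e | t , f = ((odd p xor s) xor (odd q xor t)) , (begin
      pfaffian is * pfaffian is
        ≈⟨ *-cong (flip p e) (flip q f) ⟩
      signed (odd p xor s) (volume (map A bs) ws) * signed (odd q xor t) (volume (map A ws) bs)
        ≈⟨ signed-* (odd p xor s) (odd q xor t) _ _ ⟩
      signed u (volume (map A bs) ws * volume (map A ws) bs)
        ≈⟨ signed-cong u (volume-pushforward ws bs A (map A bs) (≡.trans (length-map A bs) len)) ⟨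
      signed u (volume (map (pushforward ws A) (map A bs)) bs)
        ≡⟨ ≡.cong (λ vs → signed u (volume vs bs)) (≡.sym (map-∘ bs)) ⟩
      signed u (det bs (λ b b′ → ∑ ws (λ w → A b w * A w b′))) ∎)
      where
      q = Perm.↭-trans p (++-comm bs ws)
      u = (odd p xor s) xor (odd q xor t)
      flip : ∀ {js c v} (p : is ↭ js) → pfaffian js ≈ signed c v → pfaffian is ≈ signed (odd p xor c) v
      flip {js} {c} {v} p e = begin
        pfaffian is                                   ≈⟨ twice (odd p) ⟨
        signed (odd p) (signed (odd p) (pfaffian is)) ≈⟨ signed-cong (odd p) (pfaffian-↭ skew p) ⟨
        signed (odd p) (pfaffian js)                  ≈⟨ signed-cong (odd p) e ⟩
        signed (odd p) (signed c v)                   ≈⟨ signed-xor (odd p) c v ⟩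
        signed (odd p xor c) v                        ∎
        where
        twice : ∀ b {x} → signed b (signed b x) ≈ x
        twice false = refl
        twice true  = solve 1 (λ x → :- :- x := x) refl _

open import Defs

-- Counting up to the equality of a setoid.

module Counting where
  open import Data.Empty using (⊥-elim)
  open import Data.List using ([]; _∷_; _++_; map)
  open import Data.List.Properties using (length-++; length-map)
  import Data.List.Membership.Setoid as Membership
  import Data.List.Membership.Setoid.Properties as Mem
  open import Data.List.Relation.Unary.All as All using (All; []; _∷_)
  import Data.List.Relation.Unary.All.Properties as All
  open import Data.List.Relation.Unary.AllPairs using ([]; _∷_)
  open import Data.List.Relation.Unary.Any using (here; there)
  open import Data.List.Relation.Unary.Unique.Setoid using (Unique)
  import Data.List.Relation.Unary.Unique.Setoid.Properties as Unique
  open import Data.Nat using (_+_)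
  open import Data.Product using (_×_; _,_; ∃-syntax)
  open import Data.Sum as Sum using (_⊎_; [_,_]′)
  open import Function using (_∘_)
  open import Function.Bundles using (_⇔_; mk⇔; Equivalence)
  open import Relation.Binary.Bundles using (Setoid)
  open import Relation.Binary.PropositionalEquality using (refl; trans; cong₂)
  open import Relation.Nullary using (¬_)
  open Setoid using (Carrier)
  open Equivalence using (to; from)

  module _ {S : Setoid 0ℓ 0ℓ} where
    open Setoid S using (_≈_)

    counts-∅ : ∀ {P} → (∀ x → ¬ P x) → Counts S P 0
    counts-∅ h = [] , [] , refl , λ x → mk⇔ (λ ()) (λ p → ⊥-elim (h x p))

    counts-singleton : ∀ {P} y → (∀ x → x ≈ y ⇔ P x) → Counts S P 1
    counts-singleton y h = y ∷ [] , ([] ∷ []) , refl ,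
      λ x → mk⇔ (λ { (here e) → to (h x) e ; (there ()) }) (λ p → here (from (h x) p))

    counts-⊎ : ∀ {P Q T M N} → (∀ x y → x ≈ y → P x → Q y → Data.Empty.⊥) → (∀ x → (P x ⊎ Q x) ⇔ T x) →
      Counts S P M → Counts S Q N → Counts S T (M + N)
    counts-⊎ dis h (xs , uxs , lxs , cxs) (ys , uys , lys , cys) = xs ++ ys ,
      Unique.++⁺ S uxs uys (λ { (p , q) → dis _ _ (Setoid.refl S) (to (cxs _) p) (to (cys _) q) }) ,
      trans (length-++ xs) (cong₂ _+_ lxs lys) ,
      λ x → mk⇔ (λ m → to (h x) (Sum.map (to (cxs x)) (to (cys x)) (Mem.∈-++⁻ S xs m)))
        (λ t → [ Mem.∈-++⁺ˡ S ∘ from (cxs x) , Mem.∈-++⁺ʳ S xs ∘ from (cys x) ]′ (from (h x) t))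

    counts-⇔ : ∀ {P Q N} → (∀ x → P x ⇔ Q x) → Counts S P N → Counts S Q N
    counts-⇔ h (xs , u , l , c) = xs , u , l , λ x → mk⇔ (to (h x) ∘ to (c x)) (from (c x) ∘ from (h x))

  module _ {S T : Setoid 0ℓ 0ℓ} where
    open Setoid S using () renaming (_≈_ to _≈₁_)
    open Setoid T using () renaming (_≈_ to _≈₂_)

    counts-map : ∀ {P : Carrier S → Set} {Q : Carrier T → Set} {N} (f : Carrier S → Carrier T) →
      (∀ {x y} → x ≈₁ y → f x ≈₂ f y) →
      (∀ {x y} → P x → P y → f x ≈₂ f y → x ≈₁ y) →
      (∀ {x} {y} → P x → y ≈₂ f x → Q y) →
      (∀ y → Q y → ∃[ x ] P x × y ≈₂ f x) →
      Counts S P N → Counts T Q N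
    counts-map {P} {Q} f f-cong f-inj f-to f-from (xs , u , l , c) =
      map f xs , unique xs u (All.tabulateₛ S (λ {x} m → to (c x) m)) , trans (length-map f xs) l , λ y → mk⇔
        (λ m → let x , x∈ , e = Mem.∈-map⁻ S T m in f-to (to (c x) x∈) e)
        (λ q → let x , p , e = f-from y q in Mem.∈-resp-≈ T (Setoid.sym T e) (Mem.∈-map⁺ S T f-cong (from (c x) p)))
      where
      unique : ∀ xs → Unique S xs → All P xs → Unique T (map f xs)
      unique []       []       []       = []
      unique (x ∷ xs) (h ∷ u) (p ∷ ps) =
        All.map⁺ (All.zipWith (λ { (n , q) e → n (f-inj p q e) }) (h , ps)) ∷ unique xs u ps

-- Parking functions and deletion-contraction.

-- The count satisfies the same recursion as the determinant of the reduced Laplacian: for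
-- a vertex v joined to the sink, contracting such an edge takes care of the functions
-- with f v = 0, and deleting it of those with f v > 0.
module ParkingFunctions {I : Set} (_≟_ : (i j : I) → Dec (i ≡ j)) (w : I → I → ℕ) (loopless : ∀ i → w i i ≡ 0) where
  open import Data.Bool using (Bool; true; false; if_then_else_)
  open import Data.Integer as ℤ using (ℤ; +_)
  import Data.Integer.Properties as ℤ
  open import Data.List using (List; []; _∷_; _++_; map; length)
  import Data.List.Properties
  open import Data.List.Membership.Propositional using (_∈_; _∉_; find)
  open import Data.List.Membership.Propositional.Properties using (∈-∃++)
  open import Data.List.Relation.Binary.Permutation.Propositional using (_↭_; ↭-sym; ↭-trans; ↭-reflexive)
  open import Data.List.Relation.Binary.Permutation.Propositional.Properties using (∈-resp-↭; shift; ↭-length) renaming (map⁺ to ↭-map⁺)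
  open import Data.List.Relation.Binary.Permutation.Setoid.Properties (Relation.Binary.PropositionalEquality.setoid I) using (Unique-resp-↭)
  open import Data.List.Relation.Binary.Permutation.Propositional using (↭⇒↭ₛ)
  open import Data.List.Relation.Unary.Any using (here; there; any?)
  open import Data.List.Relation.Unary.All as All using (All; []; _∷_)
  open import Data.List.Relation.Unary.AllPairs using ([]; _∷_)
  open import Data.List.Relation.Unary.Unique.Propositional using (Unique)
  open import Data.Nat using (suc; pred; _+_; _≤_; _<_; z≤n; s≤s; s≤s⁻¹; _<?_; >-nonZero; ≢-nonZero)
  open import Data.Nat.ListAction using (sum)
  open import Data.Nat.ListAction.Properties using (sum-↭)
  open import Data.Nat.Properties hiding (_≟_)
  open import Data.Product using (_×_; _,_; ∃-syntax; proj₁; proj₂)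
  open import Data.Sum using (_⊎_; inj₁; inj₂)
  open import Function using (_∘_; const)
  open import Function.Bundles using (mk⇔; _⇔_)
  open import Relation.Binary.PropositionalEquality
  open import Relation.Nullary using (yes; no; ¬_; does; contradiction)
  open Counting
  open Exterior ℤ.+-*-commutativeRing using (det; det-↭; volume; volume-zero; volume-unit; volume-head-cong; volume-tail-cong; volume-head-+)
  open ListSums ℤ.+-*-commutativeRing using (∑)

  demand : List I → (I → Bool) → I → ℕ
  demand is A u = sum (map (λ j → if A j then w u j else 0) is)

  -- G-parking functions: d u minus the demand is the number of edges by which u leaves A. Whatever
  -- d u exceeds the edges within the list counts as edges to the sink, so deleting such an edge
  -- only lowers d.
  Parking : List I → (I → ℕ) → (I → ℕ) → Set
  Parking is d f = (∀ u → u ∉ is → f u ≡ 0) ×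
    (∀ A v → v ∈ is → A v ≡ true → ∃[ u ] u ∈ is × A u ≡ true × f u + demand is A u < d u)

  laplacian : (I → ℕ) → I → I → ℤ
  laplacian d u j = if does (u ≟ j) then + d u else ℤ.- (+ w u j)

  private
    ℕ^I = I →-setoid ℕ

    laplacian-diag : ∀ d u → laplacian d u u ≡ + d u
    laplacian-diag d u with u ≟ u
    ... | yes _ = refl
    ... | no n  = contradiction refl n

    laplacian-off : ∀ d {u j} → u ≢ j → laplacian d u j ≡ ℤ.- (+ w u j)
    laplacian-off d {u} {j} n with u ≟ j
    ... | yes e = contradiction e n
    ... | no _  = refl

    demand-cong : ∀ is {A B} u → (∀ {j} → j ∈ is → A j ≡ B j) → demand is A u ≡ demand is B u
    demand-cong []       u h = refl
    demand-cong (i ∷ is) u h = cong₂ _+_ (cong (if_then w u i else 0) (h (here refl))) (demand-cong is u (h ∘ there))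

    demand-≤ : ∀ is A u → demand is A u ≤ demand is (const true) u
    demand-≤ []       A u = z≤n
    demand-≤ (i ∷ is) A u = +-mono-≤ (lem (A i)) (demand-≤ is A u)
      where
      lem : ∀ b → (if b then w u i else 0) ≤ w u i
      lem true  = ≤-refl
      lem false = z≤n

    demand-↭ : ∀ {is js} → is ↭ js → ∀ A u → demand is A u ≡ demand js A u
    demand-↭ p A u = sum-↭ (↭-map⁺ _ p)

    parking-↭ : ∀ {is js} → is ↭ js → ∀ {d f} → Parking is d f → Parking js d f
    parking-↭ p (z , h) = (λ u n → z u (n ∘ ∈-resp-↭ p)) , λ A v m e →
      let u , u∈ , Au , lt = h A v (∈-resp-↭ (↭-sym p) m) e
      in u , ∈-resp-↭ p u∈ , Au , subst (λ x → _ + x < _) (demand-↭ p A u) lt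

    parking-cong : ∀ {is d f g} → f ≗ g → Parking is d f → Parking is d g
    parking-cong e (z , h) = (λ u n → trans (sym (e u)) (z u n)) , λ A v m t →
      let u , u∈ , Au , lt = h A v m t in u , u∈ , Au , subst (λ x → x + _ < _) (e u) lt

    -- The right-hand side is the number of edges from u to the sink; when there are none at any
    -- vertex, the determinant vanishes.
    row-sum : ∀ d u is → Unique is → u ∈ is → ∑ is (laplacian d u) ≡ + d u ℤ.- + demand is (const true) u
    row-sum d u (i ∷ is) (n ∷ _) (here refl) = begin
      laplacian d u u ℤ.+ ∑ is (laplacian d u)            ≡⟨ cong₂ ℤ._+_ (laplacian-diag d u) (off is (λ m → All.lookup n m)) ⟩
      + d u ℤ.+ ℤ.- (+ demand is (const true) u)          ≡⟨ cong (λ x → + d u ℤ.- (+ (x + demand is (const true) u))) (sym (loopless u)) ⟩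
      + d u ℤ.- (+ (w u u + demand is (const true) u))    ∎
      where
      open ≡-Reasoning
      off : ∀ js → (∀ {j} → j ∈ js → u ≢ j) → ∑ js (laplacian d u) ≡ ℤ.- (+ demand js (const true) u)
      off []       h = refl
      off (j ∷ js) h = trans (cong₂ ℤ._+_ (laplacian-off d (h (here refl))) (off js (h ∘ there)))
        (sym (ℤ.neg-distrib-+ (+ w u j) (+ demand js (const true) u)))
    row-sum d u (i ∷ is) (n ∷ un) (there m) = begin
      laplacian d u i ℤ.+ ∑ is (laplacian d u)
        ≡⟨ cong₂ ℤ._+_ (laplacian-off d (λ e → All.lookup n m (sym e))) (row-sum d u is un m) ⟩
      ℤ.- (+ w u i) ℤ.+ (+ d u ℤ.- + demand is (const true) u)
        ≡⟨ ring (+ w u i) (+ d u) (+ demand is (const true) u) ⟩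
      + d u ℤ.- (+ (w u i + demand is (const true) u)) ∎
      where
      open ≡-Reasoning
      open import Data.Integer.Solver using (module +-*-Solver)
      open +-*-Solver
      ring : ∀ a b c → ℤ.- a ℤ.+ (b ℤ.- c) ≡ b ℤ.- (a ℤ.+ c)
      ring = solve 3 (λ a b c → :- a :+ (b :- c) := b :- (a :+ c)) refl

    -- Here v has at least one edge to the sink. Contracting it merges v with the sink, so the other
    -- vertices keep their degrees d and their edges to v become edges to the sink; deleting it
    -- replaces d by `d⁻`.
    module Step (v : I) (is : List I) (v∉is : v ∉ is) (d : I → ℕ) (slack : demand (v ∷ is) (const true) v < d v) where

      d⁻ : I → ℕ
      d⁻ u = if does (u ≟ v) then pred (d u) else d u

      bump unbump : (I → ℕ) → (I → ℕ)
      bump f u   = if does (u ≟ v) then suc (f u) else f u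
      unbump f u = if does (u ≟ v) then pred (f u) else f u

      remove : (I → Bool) → I → Bool
      remove A u = if does (u ≟ v) then false else A u

      ∉-tail : ∀ {j} → j ∈ is → j ≢ v
      ∉-tail m refl = v∉is m

      remove-demand : ∀ A u → demand (v ∷ is) (remove A) u ≡ demand is A u
      remove-demand A u = cong₂ _+_ (cong (if_then w u v else 0) at-v) (demand-cong is u away)
        where
        at-v : remove A v ≡ false
        at-v with v ≟ v
        ... | yes _ = refl
        ... | no n  = contradiction refl n
        away : ∀ {j} → j ∈ is → remove A j ≡ A j
        away {j} m with j ≟ v
        ... | yes e = contradiction e (∉-tail m)
        ... | no _  = refl

      0<d : 0 < d v
      0<d = ≤-<-trans z≤n slack

      -- A set containing v has v itself as witness, since f v = 0 and v has an edge to the sink;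
      -- any other set lives on the remaining vertices. Conversely, v is removed from a set before
      -- the hypothesis is applied.
      contracted : ∀ f → Parking is d f ⇔ (f v ≡ 0 × Parking (v ∷ is) d f)
      contracted f = mk⇔ (λ p → proj₁ p v v∉is , to p) (λ { (e , p) → from e p })
        where
        to : Parking is d f → Parking (v ∷ is) d f
        to (z , h) = (λ u n → z u (n ∘ there)) , go
          where
          go : ∀ A x → x ∈ v ∷ is → A x ≡ true → ∃[ u ] u ∈ v ∷ is × A u ≡ true × f u + demand (v ∷ is) A u < d u
          go A x m e with A v in eq
          ... | true  = v , here refl , eq , subst (λ t → t + _ < d v) (sym (z v v∉is))
            (≤-<-trans (subst (λ b → (if b then w v v else 0) + demand is A v ≤ demand (v ∷ is) (const true) v) eq (demand-≤ (v ∷ is) A v)) slack)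
          go A x (here refl) e | false with () ← trans (sym eq) e
          go A x (there m) e | false = let u , u∈ , Au , lt = h A x m e in u , there u∈ , Au , lt
        from : f v ≡ 0 → Parking (v ∷ is) d f → Parking is d f
        from fv (z , h) = supp , go
          where
          supp : ∀ u → u ∉ is → f u ≡ 0
          supp u n with u ≟ v
          ... | yes refl = fv
          ... | no u≢v   = z u (λ { (here e) → u≢v e ; (there m) → n m })
          go : ∀ A x → x ∈ is → A x ≡ true → ∃[ u ] u ∈ is × A u ≡ true × f u + demand is A u < d u
          go A x m e with h (remove A) x (there m) removed
            where
            removed : remove A x ≡ true
            removed with x ≟ v
            ... | yes q = contradiction q (∉-tail m)
            ... | no _  = e
          ... | u , u∈ , Au , lt with u ≟ v
          go A x m e | u , u∈ , () , lt | yes _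
          go A x m e | u , here q , Au , lt | no n = contradiction q n
          go A x m e | u , there u∈ , Au , lt | no _ = u , u∈ , Au , subst (λ t → f u + t < d u) (remove-demand A u) lt

      bump-lt : ∀ f u x → (f u + x < d⁻ u) ⇔ (bump f u + x < d u)
      bump-lt f u x with u ≟ v
      ... | no _     = mk⇔ (λ p → p) (λ p → p)
      ... | yes refl = mk⇔ (λ p → subst (suc (f u) + x <_) (suc-pred (d u) {{>-nonZero 0<d}}) (s≤s p)) (λ p → s≤s⁻¹ (subst (suc (f u) + x <_) (sym (suc-pred (d u) {{>-nonZero 0<d}})) p))

      bump-off : ∀ f u → u ≢ v → bump f u ≡ f u
      bump-off f u n with u ≟ v
      ... | yes e = contradiction e n
      ... | no _  = refl

      bump-at : ∀ f → bump f v ≡ suc (f v)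
      bump-at f with v ≟ v
      ... | yes _ = refl
      ... | no n  = contradiction refl n

      deleted : ∀ f → Parking (v ∷ is) d⁻ f ⇔ Parking (v ∷ is) d (bump f)
      deleted f = mk⇔
        (λ { (z , h) → (λ u n → trans (bump-off f u (n ∘ here)) (z u n)) ,
             λ A x m e → let u , u∈ , Au , lt = h A x m e in u , u∈ , Au , Function.Bundles.Equivalence.to (bump-lt f u _) lt })
        (λ { (z , h) → (λ u n → trans (sym (bump-off f u (n ∘ here))) (z u n)) ,
             λ A x m e → let u , u∈ , Au , lt = h A x m e in u , u∈ , Au , Function.Bundles.Equivalence.from (bump-lt f u _) lt })

      bump-cong : ∀ {f g} → f ≗ g → bump f ≗ bump g
      bump-cong e u with u ≟ v
      ... | yes _ = cong suc (e u)
      ... | no _  = e u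

      bump-injective : ∀ {f g} → bump f ≗ bump g → f ≗ g
      bump-injective e u with u ≟ v | e u
      ... | yes _ | q = suc-injective q
      ... | no _  | q = q

      bump-unbump : ∀ f → f v ≢ 0 → f ≗ bump (unbump f)
      bump-unbump f n u with u ≟ v
      ... | yes refl = sym (suc-pred (f u) {{≢-nonZero n}})
      ... | no _     = refl

      count : ∀ {M N} → Counts ℕ^I (Parking is d) M → Counts ℕ^I (Parking (v ∷ is) d⁻) N → Counts ℕ^I (Parking (v ∷ is) d) (M + N)
      count cM cN = counts-⊎ {S = ℕ^I} {P = λ f → f v ≡ 0 × Parking (v ∷ is) d f} {Q = λ f → f v ≢ 0 × Parking (v ∷ is) d f}
        (λ f g e p q → proj₁ q (trans (sym (e v)) (proj₁ p)))
        (λ f → mk⇔ (λ { (inj₁ p) → proj₂ p ; (inj₂ p) → proj₂ p }) (split f))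
        (counts-⇔ {S = ℕ^I} contracted cM)
        (counts-map {S = ℕ^I} {T = ℕ^I} bump bump-cong (λ _ _ → bump-injective)
          (λ {f} {g} p e → (λ q → 0≢1+n (trans (sym q) (trans (e v) (bump-at f)))) ,
             parking-cong (λ u → sym (e u)) (Function.Bundles.Equivalence.to (deleted f) p))
          (λ f p → unbump f , Function.Bundles.Equivalence.from (deleted (unbump f)) (parking-cong (bump-unbump f (proj₁ p)) (proj₂ p)) , bump-unbump f (proj₁ p))
          cN)
        where
        split : ∀ f → Parking (v ∷ is) d f → (f v ≡ 0 × Parking (v ∷ is) d f) ⊎ (f v ≢ 0 × Parking (v ∷ is) d f)
        split f p with f v Data.Nat.≟ 0
        ... | yes e = inj₁ (e , p)
        ... | no n  = inj₂ (n , p)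

      unit : I → ℤ
      unit u = if does (u ≟ v) then + 1 else + 0

      unit-at : unit v ≡ + 1
      unit-at with v ≟ v
      ... | yes _ = refl
      ... | no n  = contradiction refl n

      unit-off : ∀ {u} → u ≢ v → unit u ≡ + 0
      unit-off {u} n with u ≟ v
      ... | yes e = contradiction e n
      ... | no _  = refl

      row-v : ∀ j → laplacian d v j ≡ unit j ℤ.+ laplacian d⁻ v j
      row-v j with v ≟ j
      ... | no n = sym (trans (cong (ℤ._+ _) (unit-off (n ∘ sym))) (ℤ.+-identityˡ _))
      ... | yes refl = sym (trans (cong₂ (λ a b → a ℤ.+ + b) unit-at d⁻-at) (cong +_ (suc-pred (d v) {{>-nonZero 0<d}})))
        where
        d⁻-at : d⁻ v ≡ pred (d v)
        d⁻-at with v ≟ v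
        ... | yes _ = refl
        ... | no n  = contradiction refl n

      row-other : ∀ {u} → u ≢ v → ∀ j → laplacian d u j ≡ laplacian d⁻ u j
      row-other {u} n j with u ≟ j
      ... | no _     = refl
      ... | yes refl with u ≟ v
      ... | yes e = contradiction e n
      ... | no _  = refl

      -- Lowering d v by one subtracts a unit vector from row v, and the determinant is additive in
      -- that row.
      det-step : det (v ∷ is) (laplacian d) ≡ det is (laplacian d) ℤ.+ det (v ∷ is) (laplacian d⁻)
      det-step = begin
        volume (laplacian d v ∷ map (laplacian d) is) (v ∷ is)
          ≡⟨ volume-head-cong (v ∷ is) (map (laplacian d) is) (λ {j} _ → row-v j) ⟩
        volume ((λ j → unit j ℤ.+ laplacian d⁻ v j) ∷ map (laplacian d) is) (v ∷ is)
          ≡⟨ volume-head-+ (v ∷ is) unit (laplacian d⁻ v) (map (laplacian d) is) ⟩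
        volume (unit ∷ map (laplacian d) is) (v ∷ is) ℤ.+ volume (laplacian d⁻ v ∷ map (laplacian d) is) (v ∷ is)
          ≡⟨ cong₂ ℤ._+_
              (trans (volume-unit v is unit (map (laplacian d) is) (λ m → unit-off (∉-tail m))) (trans (cong (ℤ._* det is (laplacian d)) unit-at) (ℤ.*-identityˡ _)))
              (volume-tail-cong (v ∷ is) (laplacian d⁻ v) (laplacian d) (laplacian d⁻) is (λ m {j} _ → row-other (∉-tail m) j)) ⟩
        det is (laplacian d) ℤ.+ det (v ∷ is) (laplacian d⁻) ∎
        where open ≡-Reasoning

      d⁻-≤ : ∀ u → d⁻ u ≤ d u
      d⁻-≤ u with u ≟ v
      ... | yes _ = pred[n]≤n
      ... | no _  = ≤-refl

      d⁻-total : sum (map d⁻ (v ∷ is)) < sum (map d (v ∷ is))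
      d⁻-total = +-mono-<-≤ at-v (rest is)
        where
        at-v : d⁻ v < d v
        at-v with v ≟ v
        ... | yes _ = ≤-reflexive (suc-pred (d v) {{>-nonZero 0<d}})
        ... | no n  = contradiction refl n
        rest : ∀ js → sum (map d⁻ js) ≤ sum (map d js)
        rest []       = z≤n
        rest (j ∷ js) = +-mono-≤ (d⁻-≤ j) (rest js)

      d⁻-demand : (∀ {u} → u ∈ v ∷ is → demand (v ∷ is) (const true) u ≤ d u) →
        ∀ {u} → u ∈ v ∷ is → demand (v ∷ is) (const true) u ≤ d⁻ u
      d⁻-demand h {u} m with u ≟ v
      ... | yes refl = s≤s⁻¹ (subst (demand (v ∷ is) (const true) v <_) (sym (suc-pred (d v) {{>-nonZero 0<d}})) slack)
      ... | no _     = h m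

  Counted : List I → (I → ℕ) → Set
  Counted is d = ∃[ N ] Counts ℕ^I (Parking is d) N × + N ≡ det is (laplacian d)

  counted : ∀ is d → Unique is → (∀ {u} → u ∈ is → demand is (const true) u ≤ d u) → Counted is d
  counted is d = go _ is d ≤-refl
    where
    -- The measure is the number of vertices plus the total degree: contraction loses a vertex,
    -- deletion a unit of degree.
    go : ∀ k is d → length is + sum (map d is) ≤ k → Unique is → (∀ {u} → u ∈ is → demand is (const true) u ≤ d u) → Counted is d
    go k [] d _ _ _ = 1 , counts-singleton {S = ℕ^I} (const 0) (λ f → mk⇔ (λ e → (λ u _ → e u) , λ A v ()) (λ { (z , _) u → z u (λ ()) })) , refl
    go (suc k) is@(i ∷ is′) d fuel uniq h with any? (λ v → demand is (const true) v <? d v) is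
    -- No vertex has an edge to the sink: the whole vertex set then violates the parking condition,
    -- and all row sums of the Laplacian vanish.
    ... | no n = 0 , counts-∅ {S = ℕ^I} impossible , sym (volume-zero i is′ (map (laplacian d) is) (Data.List.Properties.length-map _ is) zero-rows)
      where
      tight : ∀ {u} → u ∈ is → d u ≤ demand is (const true) u
      tight m = ≮⇒≥ (λ lt → n (Data.List.Membership.Propositional.lose m lt))
      impossible : ∀ f → ¬ Parking is d f
      impossible f (_ , p) = let u , u∈ , _ , lt = p (const true) i (here refl) refl in
        <⇒≱ lt (≤-trans (tight u∈) (m≤n+m _ (f u)))
      zero-rows : ∀ {r} → r ∈ map (laplacian d) is → ∑ is r ≡ + 0
      zero-rows m with Data.List.Membership.Propositional.Properties.∈-map⁻ (laplacian d) m
      ... | u , u∈ , refl = trans (row-sum d u is uniq u∈)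
        (trans (cong (λ x → + d u ℤ.- + x) (≤-antisym (h u∈) (tight u∈))) (ℤ.+-inverseʳ (+ d u)))
    ... | yes any with find any
    ... | v , v∈ , slack with ∈-∃++ v∈
    ... | xs , ys , eq = finish (go k rest d fuel₁ uniq-rest h₁) (go k (v ∷ rest) d⁻ fuel₂ uniq′ (d⁻-demand (λ {u} m → subst (_≤ d u) (demand-↭ p (const true) u) (h (∈-resp-↭ (↭-sym p) m)))))
      where
      rest = xs ++ ys
      p : is ↭ v ∷ rest
      p = ↭-trans (↭-reflexive eq) (shift v xs ys)
      uniq′ : Unique (v ∷ rest)
      uniq′ = Unique-resp-↭ (↭⇒↭ₛ p) uniq
      uniq-rest : Unique rest
      uniq-rest = Data.List.Relation.Unary.AllPairs.tail uniq′
      v∉ : v ∉ rest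
      v∉ m = All.lookup (Data.List.Relation.Unary.AllPairs.head uniq′) m refl
      open Step v rest v∉ d (subst (_< d v) (demand-↭ p (const true) v) slack)
      total : length is + sum (map d is) ≡ length (v ∷ rest) + sum (map d (v ∷ rest))
      total = cong₂ _+_ (↭-length p) (sum-↭ (↭-map⁺ d p))
      fuel′ : length (v ∷ rest) + sum (map d (v ∷ rest)) ≤ suc k
      fuel′ = subst (_≤ suc k) total fuel
      fuel₁ : length rest + sum (map d rest) ≤ k
      fuel₁ = s≤s⁻¹ (≤-trans (+-monoʳ-≤ (suc (length rest)) (m≤n+m _ (d v))) fuel′)
      fuel₂ : length (v ∷ rest) + sum (map d⁻ (v ∷ rest)) ≤ k
      fuel₂ = s≤s⁻¹ (<-≤-trans (+-monoʳ-< (length (v ∷ rest)) d⁻-total) fuel′)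
      h₁ : ∀ {u} → u ∈ rest → demand rest (const true) u ≤ d u
      h₁ {u} m = ≤-trans (m≤n+m _ (w u v)) (subst (_≤ d u) (demand-↭ p (const true) u) (h (∈-resp-↭ (↭-sym p) (there m))))
      finish : Counted rest d → Counted (v ∷ rest) d⁻ → Counted is d
      finish (M , cM , eM) (N , cN , eN) = M + N ,
        counts-⇔ {S = ℕ^I} (λ f → mk⇔ (parking-↭ (↭-sym p)) (parking-↭ p)) (count cM cN) ,
        trans (cong₂ ℤ._+_ eM eN) (trans (sym det-step) (sym (det-↭ p (laplacian d))))

-- The commutative ring of Cauchy reals.

module RealRing where
  open import Data.Nat as ℕ using (ℕ)
  import Data.Nat.Properties as ℕ
  open import Data.Product using (_×_; _,_; ∃-syntax)
  open import Data.Rational as ℚ using (ℚ; 0ℚ; ½; _+_; _*_; -_; _-_; _<_; _≤_; ∣_∣)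
  import Data.Rational.Properties as ℚ
  open import Relation.Binary.PropositionalEquality
  open ℝ

  infix 4 _≈ℝ_

  -- x and y can be inferred from x ≈ℝ y, but not from its unfolding x ≃ℝ y.
  record _≈ℝ_ (x y : ℝ) : Set where
    constructor mk≈
    field ≈⇒≃ : x ≃ℝ y
  open _≈ℝ_ public

  private
    D : ℝ → ℝ → ℕ → ℚ
    D x y n = seq x n - seq y n

  abstract
    null-cong : ∀ {x y : ℕ → ℚ} → x ≗ y → IsNull x → IsNull y
    null-cong e h ε 0<ε = let N , c = h ε 0<ε in N , λ n N≤n → subst (λ t → ∣ t ∣ < ε) (e n) (c n N≤n)

    null-0 : IsNull (λ _ → 0ℚ)
    null-0 ε 0<ε = 0 , λ _ _ → 0<ε

    null-dominated : ∀ {x y : ℕ → ℚ} → (∀ n → ∣ y n ∣ ≤ ∣ x n ∣) → IsNull x → IsNull y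
    null-dominated d h ε 0<ε = let N , c = h ε 0<ε in N , λ n N≤n → ℚ.≤-<-trans (d n) (c n N≤n)

    null-neg : ∀ {x : ℕ → ℚ} → IsNull x → IsNull (λ n → - x n)
    null-neg {x} = null-dominated {x} (λ n → ℚ.≤-reflexive (ℚ.∣-p∣≡∣p∣ (x n)))

    null-+ : ∀ {x y : ℕ → ℚ} → IsNull x → IsNull y → IsNull (λ n → x n + y n)
    null-+ {x} {y} hx hy ε 0<ε with hx (½ * ε) (*-pos 0<½ 0<ε) | hy (½ * ε) (*-pos 0<½ 0<ε)
    ... | M , c | N , d = M ℕ.⊔ N , λ n le → subst (∣ x n + y n ∣ <_) (½+½ ε)
      (ℚ.≤-<-trans (ℚ.∣p+q∣≤∣p∣+∣q∣ (x n) (y n))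
        (ℚ.+-mono-< (c n (ℕ.m⊔n≤o⇒m≤o M N le)) (d n (ℕ.m⊔n≤o⇒n≤o M N le))))

    null-* : ∀ {x y : ℕ → ℚ} B → 0ℚ ≤ B → (∀ n → ∣ x n ∣ ≤ B) → IsNull y → IsNull (λ n → x n * y n)
    null-* {x} {y} B 0≤B xB hy ε 0<ε with shrink B ε 0≤B 0<ε
    ... | δ , 0<δ , Bδ with hy δ 0<δ
    ... | N , c = N , λ n le → ℚ.≤-<-trans
      (≤-by (*-mono-≤ (ℚ.0≤∣p∣ (x n)) (xB n) (ℚ.0≤∣p∣ (y n)) (ℚ.<⇒≤ (c n le))) (sym (ℚ.∣p*q∣≡∣p∣*∣q∣ (x n) (y n))) refl) Bδ

    null-shift : ∀ k {x : ℕ → ℚ} → IsNull (λ n → x (k ℕ.+ n)) → IsNull x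
    null-shift k {x} h ε 0<ε = let N , c = h ε 0<ε in k ℕ.+ N , λ n le →
      subst (λ t → ∣ x t ∣ < ε) (ℕ.m+[n∸m]≡n (ℕ.m+n≤o⇒m≤o k le)) (c (n ℕ.∸ k) (ℕ.m+n≤o⇒m≤o∸n N (subst (ℕ._≤ n) (ℕ.+-comm k N) le)))

    pointwise : ∀ {x y} → (∀ n → seq x n ≡ seq y n) → x ≈ℝ y
    pointwise {x} {y} h = mk≈ (null-cong {λ _ → 0ℚ} (λ n → sym (trans (cong (_- seq y n) (h n)) (ℚ.+-inverseʳ (seq y n)))) null-0)

    ≈-refl : ∀ {x} → x ≈ℝ x
    ≈-refl = pointwise (λ _ → refl)

    ≈-sym : ∀ {x y} → x ≈ℝ y → y ≈ℝ x
    ≈-sym {x} {y} (mk≈ h) = mk≈ (null-cong {λ n → - D x y n} (λ n → ring2 (seq x n) (seq y n)) (null-neg {D x y} h))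

    ≈-trans : ∀ {x y z} → x ≈ℝ y → y ≈ℝ z → x ≈ℝ z
    ≈-trans {x} {y} {z} (mk≈ h) (mk≈ k) = mk≈ (null-cong {λ n → D x y n + D y z n} (λ n → ring18 (seq x n) (seq y n) (seq z n)) (null-+ {D x y} {D y z} h k))

    infixl 6 _⊞_
    infixl 7 _⊠_
    infix  8 ⊟_

    -- Opaque copies of the operations on ℝ: identities between reals are to follow from the ring
    -- laws, not from unfolding the sequences.
    _⊞_ _⊠_ : ℝ → ℝ → ℝ
    _⊞_ = _+ℝ_
    _⊠_ = _*ℝ_

    ⊟_ : ℝ → ℝ
    ⊟_ = -ℝ_

    0ℝ 1ℝ : ℝ
    0ℝ = ℕ→ℝ 0
    1ℝ = ℕ→ℝ 1

    ⊞-def : ∀ x y → x ⊞ y ≡ x +ℝ y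
    ⊞-def x y = refl

    ⊠-def : ∀ x y → x ⊠ y ≡ x *ℝ y
    ⊠-def x y = refl

    ⊟-def : ∀ x → ⊟ x ≡ -ℝ x
    ⊟-def x = refl

    0ℝ-def : 0ℝ ≡ ℕ→ℝ 0
    0ℝ-def = refl

    1ℝ-def : 1ℝ ≡ ℕ→ℝ 1
    1ℝ-def = refl

    +-cong : ∀ {x y u v} → x ≈ℝ y → u ≈ℝ v → x ⊞ u ≈ℝ y ⊞ v
    +-cong {x} {y} {u} {v} (mk≈ h) (mk≈ k) = mk≈ (null-cong {λ n → D x y n + D u v n} (λ n → ring7 (seq x n) (seq y n) (seq u n) (seq v n)) (null-+ {D x y} {D u v} h k))

    neg-cong : ∀ {x y} → x ≈ℝ y → ⊟ x ≈ℝ ⊟ y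
    neg-cong {x} {y} (mk≈ h) = mk≈ (null-cong {λ n → - D x y n} (λ n → ring6 (seq x n) (seq y n)) (null-neg {D x y} h))

    *-cong : ∀ {x y u v} → x ≈ℝ y → u ≈ℝ v → x ⊠ u ≈ℝ y ⊠ v
    *-cong {x} {y} {u} {v} (mk≈ h) (mk≈ k) = mk≈ (bounded (cauchy-bound {seq x} (cauchy x)) (cauchy-bound {seq v} (cauchy v)))
      where
      bounded : ∃[ B ] 0ℚ ≤ B × (∀ n → ∣ seq x n ∣ ≤ B) → ∃[ C ] 0ℚ ≤ C × (∀ n → ∣ seq v n ∣ ≤ C) →
        IsNull (λ n → seq x n * seq u n - seq y n * seq v n)
      bounded (B , 0≤B , xB) (C , 0≤C , vC) = null-cong {λ n → seq x n * D u v n + seq v n * D x y n}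
        (λ n → ring8 (seq x n) (seq y n) (seq u n) (seq v n))
        (null-+ {λ n → seq x n * D u v n} {λ n → seq v n * D x y n} (null-* {seq x} {D u v} B 0≤B xB k) (null-* {seq v} {D x y} C 0≤C vC h))

    +-assoc : ∀ x y z → (x ⊞ y) ⊞ z ≈ℝ x ⊞ (y ⊞ z)
    +-assoc x y z = pointwise (λ n → ℚ.+-assoc (seq x n) (seq y n) (seq z n))

    +-comm : ∀ x y → x ⊞ y ≈ℝ y ⊞ x
    +-comm x y = pointwise (λ n → ℚ.+-comm (seq x n) (seq y n))

    +-identityˡ : ∀ x → 0ℝ ⊞ x ≈ℝ x
    +-identityˡ x = pointwise (λ n → ℚ.+-identityˡ (seq x n))

    +-identityʳ : ∀ x → x ⊞ 0ℝ ≈ℝ x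
    +-identityʳ x = pointwise (λ n → ℚ.+-identityʳ (seq x n))

    +-inverseˡ : ∀ x → (⊟ x) ⊞ x ≈ℝ 0ℝ
    +-inverseˡ x = pointwise (λ n → ℚ.+-inverseˡ (seq x n))

    +-inverseʳ : ∀ x → x ⊞ (⊟ x) ≈ℝ 0ℝ
    +-inverseʳ x = pointwise (λ n → ℚ.+-inverseʳ (seq x n))

    *-assoc : ∀ x y z → (x ⊠ y) ⊠ z ≈ℝ x ⊠ (y ⊠ z)
    *-assoc x y z = pointwise (λ n → ℚ.*-assoc (seq x n) (seq y n) (seq z n))

    *-comm : ∀ x y → x ⊠ y ≈ℝ y ⊠ x
    *-comm x y = pointwise (λ n → ℚ.*-comm (seq x n) (seq y n))

    *-identityˡ : ∀ x → 1ℝ ⊠ x ≈ℝ x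
    *-identityˡ x = pointwise (λ n → ℚ.*-identityˡ (seq x n))

    *-identityʳ : ∀ x → x ⊠ 1ℝ ≈ℝ x
    *-identityʳ x = pointwise (λ n → ℚ.*-identityʳ (seq x n))

    *-distribˡ-+ : ∀ x y z → x ⊠ (y ⊞ z) ≈ℝ x ⊠ y ⊞ x ⊠ z
    *-distribˡ-+ x y z = pointwise (λ n → ℚ.*-distribˡ-+ (seq x n) (seq y n) (seq z n))

    *-distribʳ-+ : ∀ x y z → (y ⊞ z) ⊠ x ≈ℝ y ⊠ x ⊞ z ⊠ x
    *-distribʳ-+ x y z = pointwise (λ n → ℚ.*-distribʳ-+ (seq x n) (seq y n) (seq z n))

  ℝ-commutativeRing : CommutativeRing 0ℓ 0ℓ
  ℝ-commutativeRing = record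
    { Carrier = ℝ ; _≈_ = _≈ℝ_ ; _+_ = _⊞_ ; _*_ = _⊠_ ; -_ = ⊟_ ; 0# = 0ℝ ; 1# = 1ℝ
    ; isCommutativeRing = record
      { isRing = record
        { +-isAbelianGroup = record
          { isGroup = record
            { isMonoid = record
              { isSemigroup = record
                { isMagma = record
                  { isEquivalence = record { refl = ≈-refl ; sym = ≈-sym ; trans = ≈-trans }
                  ; ∙-cong = +-cong }
                ; assoc = +-assoc }
              ; identity = +-identityˡ , +-identityʳ }
            ; inverse = +-inverseˡ , +-inverseʳ
            ; ⁻¹-cong = neg-cong }
          ; comm = +-comm }
        ; *-cong = *-cong
        ; *-assoc = *-assoc
        ; *-identity = *-identityˡ , *-identityʳ
        ; distrib = *-distribˡ-+ , *-distribʳ-+ }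
      ; *-comm = *-comm } }

  -- Takes the place of invertibility: cancellation without constructing an inverse.
  Regular : ℝ → Set
  Regular x = ∀ y → x ⊠ y ≈ℝ 0ℝ → y ≈ℝ 0ℝ

  abstract
    bounded-away⇒regular : ∀ x c N → 0ℚ < c → (∀ n → N ℕ.≤ n → c ≤ ∣ seq x n ∣) → Regular x
    bounded-away⇒regular x c N 0<c h y (mk≈ xy) = mk≈ go
      where
      go : y ≃ℝ ℕ→ℝ 0
      go ε 0<ε with xy (c * ε) (*-pos 0<c 0<ε)
      ... | M , close = M ℕ.⊔ N , λ n le → subst (λ t → ∣ t ∣ < ε) (sym (ℚ.+-identityʳ (seq y n)))
        (ℚ.*-cancelˡ-<-nonNeg c {{ℚ.nonNegative (ℚ.<⇒≤ 0<c)}}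
          (ℚ.≤-<-trans (ℚ.*-monoʳ-≤-nonNeg ∣ seq y n ∣ {{ℚ.nonNegative (ℚ.0≤∣p∣ (seq y n))}} (h n (ℕ.m⊔n≤o⇒n≤o M N le)))
            (subst (_< c * ε) (trans (cong ∣_∣ (ℚ.+-identityʳ (seq x n * seq y n))) (ℚ.∣p*q∣≡∣p∣*∣q∣ (seq x n) (seq y n)))
              (close n (ℕ.m⊔n≤o⇒m≤o M N le)))))

    -- All partial sums share one Lipschitz constant on an interval that contains both sequences.
    cos-cong : ∀ {x y} → x ≈ℝ y → cos x ≈ℝ cos y
    cos-cong {x} {y} (mk≈ h) = mk≈ (bounded (cauchy-bound {seq x} (cauchy x)) (cauchy-bound {seq y} (cauchy y)))
      where
      bounded : ∃[ B ] 0ℚ ≤ B × (∀ n → ∣ seq x n ∣ ≤ B) → ∃[ C ] 0ℚ ≤ C × (∀ n → ∣ seq y n ∣ ≤ C) →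
        IsNull (λ n → cosSum n (seq x n) - cosSum n (seq y n))
      bounded (B , 0≤B , xB) (B′ , 0≤B′ , yB) =
        null-dominated {λ n → C * D x y n} dom (null-* {λ _ → C} {D x y} C 0≤C (λ _ → ℚ.≤-reflexive (ℚ.0≤p⇒∣p∣≡p 0≤C)) h)
        where
        open CosBound (B + B′) (+-nonneg 0≤B 0≤B′)
        dom : ∀ n → ∣ cosSum n (seq x n) - cosSum n (seq y n) ∣ ≤ ∣ C * D x y n ∣
        dom n = ℚ.≤-trans (sum-lipschitz (seq x n) (seq y n)
            (≤-by (ℚ.+-mono-≤ (xB n) 0≤B′) (ℚ.+-identityʳ _) refl)
            (≤-by (ℚ.+-mono-≤ 0≤B (yB n)) (ℚ.+-identityˡ _) refl) n)
          (≤-by (ℚ.*-monoʳ-≤-nonNeg ∣ D x y n ∣ {{ℚ.nonNegative (ℚ.0≤∣p∣ (D x y n))}} (G≤C n)) refl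
            (trans (cong (_* ∣ D x y n ∣) (sym (ℚ.0≤p⇒∣p∣≡p 0≤C))) (sym (ℚ.∣p*q∣≡∣p∣*∣q∣ C (D x y n)))))

-- The addition formula of the cosine.

module CosineAddition where
  import Algebra.Definitions.RawSemiring as RawSemiringDefs
  open import Data.Nat as ℕ using (ℕ; zero; suc)
  import Data.Nat.Properties as ℕ
  open import Data.Product using (_×_; _,_; ∃-syntax)
  open import Data.Rational as ℚ using (ℚ; 0ℚ; 1ℚ; ½; _+_; _*_; -_; _-_; _≤_; ∣_∣)
  import Data.Rational.Properties as ℚ
  open import Data.Rational.Solver using (module +-*-Solver)
  open import Function using (_∘_)
  open import Relation.Binary.PropositionalEquality
  open RawSemiringDefs ℚ.+-*-rawSemiring using () renaming (_^_ to _^ℚ_)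
  open +-*-Solver
  open Convolution ℚ.+-*-commutativeRing
  open IntegerCoefficients ℚ.+-*-commutativeRing using (fromNat; fromNat-suc)
  open RealRing
  open ℝ

  private
    rearrange₁ : ∀ n x p r f → (n * r) * (x * (p * f)) ≡ n * (x * p * (r * f))
    rearrange₁ = solve 5 (λ n x p r f → (n :* r) :* (x :* (p :* f)) := n :* (x :* p :* (r :* f))) refl

    rearrange₂ : ∀ r n x → r * (n * x) ≡ (n * r) * x
    rearrange₂ = solve 3 (λ r n x → r :* (n :* x) := (n :* r) :* x) refl

    neg-neg-* : ∀ x p → (- x) * ((- x) * p) ≡ x * (x * p)
    neg-neg-* = solve 2 (λ x p → (:- x) :* ((:- x) :* p) := x :* (x :* p)) refl

    neg-neg-neg-* : ∀ x p → (- x) * ((- x) * (- p)) ≡ - (x * (x * p))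
    neg-neg-neg-* = solve 2 (λ x p → (:- x) :* ((:- x) :* (:- p)) := :- (x :* (x :* p))) refl

    cancel-odd : ∀ p r → p * r + (- p) * r ≡ 0ℚ
    cancel-odd = solve 2 (λ p r → p :* r :+ (:- p) :* r := con 0ℚ) refl

    twice : ∀ p → p + p ≡ fromℕℚ 2 * p
    twice = solve 1 (λ p → p :+ p := con (fromℕℚ 2) :* p) refl

    assoc₃ : ∀ s p f → s * p * f ≡ s * (p * f)
    assoc₃ = solve 3 (λ s p f → s :* p :* f := s :* (p :* f)) refl

    factor : ∀ s c → s * (fromℕℚ 2 * c) ≡ fromℕℚ 2 * (s * c)
    factor = solve 2 (λ s c → s :* (con (fromℕℚ 2) :* c) := con (fromℕℚ 2) :* (s :* c)) refl

  fromNat≡fromℕℚ : ∀ n → fromNat n ≡ fromℕℚ n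
  fromNat≡fromℕℚ zero    = refl
  fromNat≡fromℕℚ (suc n) = trans (fromNat-suc n) (trans (cong (1ℚ +_) (fromNat≡fromℕℚ n)) (sym (fromℕℚ-suc n)))

  fromNat-cancel : ∀ k {x y} → fromNat (suc k) * x ≡ fromNat (suc k) * y → x ≡ y
  fromNat-cancel k {x} {y} e = trans (sym (inv x)) (trans (cong (recip (suc k) *_) e) (inv y))
    where
    inv : ∀ x → recip (suc k) * (fromNat (suc k) * x) ≡ x
    inv x = trans (rearrange₂ (recip (suc k)) (fromNat (suc k)) x)
      (trans (cong (_* x) (trans (cong (_* recip (suc k)) (fromNat≡fromℕℚ (suc k))) (fromℕℚ*recip k))) (ℚ.*-identityˡ x))

  dividedPower : ℚ → ℕ → ℚ
  dividedPower x k = x ^ℚ k * invFact k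

  dividedPowers : ∀ x → DividedPowers x (dividedPower x)
  dividedPowers x k = begin
    fromNat (suc k) * (x * x ^ℚ k * invFact (suc k))
      ≡⟨ cong₂ (λ n f → n * (x * x ^ℚ k * f)) (fromNat≡fromℕℚ (suc k)) (!-recip k) ⟩
    fromℕℚ (suc k) * (x * x ^ℚ k * (recip (suc k) * invFact k))
      ≡⟨ rearrange₁ (fromℕℚ (suc k)) x (x ^ℚ k) (recip (suc k)) (invFact k) ⟨
    (fromℕℚ (suc k) * recip (suc k)) * (x * (x ^ℚ k * invFact k))
      ≡⟨ cong (_* (x * (x ^ℚ k * invFact k))) (fromℕℚ*recip k) ⟩
    1ℚ * (x * (x ^ℚ k * invFact k))
      ≡⟨ ℚ.*-identityˡ _ ⟩
    x * (x ^ℚ k * invFact k) ∎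
    where open ≡-Reasoning

  dividedPower-+ : ∀ a b k → conv (dividedPower a) (dividedPower b) k ≡ dividedPower (a + b) k
  dividedPower-+ a b = binomial fromNat-cancel {a} {b} {dividedPower a} {dividedPower b} {dividedPower (a + b)} (dividedPowers a) (dividedPowers b) (dividedPowers (a + b)) refl

  even-neg : ∀ x k → (- x) ^ℚ (double k) ≡ x ^ℚ (double k)
  even-neg x zero    = refl
  even-neg x (suc k) = trans (cong (λ p → (- x) * ((- x) * p)) (even-neg x k)) (neg-neg-* x (x ^ℚ double k))

  odd-neg : ∀ x k → (- x) ^ℚ (suc (double k)) ≡ - (x ^ℚ (suc (double k)))
  odd-neg x zero    = one-neg x
    where
    one-neg : ∀ x → (- x) * 1ℚ ≡ - (x * 1ℚ)
    one-neg = solve 1 (λ x → (:- x) :* con 1ℚ := :- (x :* con 1ℚ)) refl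
  odd-neg x (suc k) = trans (cong (λ p → (- x) * ((- x) * p)) (odd-neg x k)) (neg-neg-neg-* x (x ^ℚ suc (double k)))

  -- Replacing b by -b changes the sign of its odd powers, so these drop out of the sum and the even
  -- ones are doubled.
  dividedPower-± : ∀ a b k → dividedPower (a + b) (double k) + dividedPower (a - b) (double k)
    ≡ fromℕℚ 2 * conv (dividedPower a ∘ double) (dividedPower b ∘ double) k
  dividedPower-± a b k = begin
    dividedPower (a + b) (double k) + dividedPower (a - b) (double k)
      ≡⟨ cong₂ _+_ (dividedPower-+ a b (double k)) (dividedPower-+ a (- b) (double k)) ⟨
    conv (dividedPower a) (dividedPower b) (double k) + conv (dividedPower a) (dividedPower (- b)) (double k)
      ≡⟨ conv-+ʳ (dividedPower a) (dividedPower b) (dividedPower (- b)) (double k) ⟨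
    conv (dividedPower a) (λ j → dividedPower b j + dividedPower (- b) j) (double k)
      ≡⟨ conv-even (dividedPower a) (λ j → dividedPower b j + dividedPower (- b) j) odd-part k ⟩
    conv (dividedPower a ∘ double) (λ j → dividedPower b (double j) + dividedPower (- b) (double j)) k
      ≡⟨ conv-cong (λ _ → refl) even-part k ⟩
    conv (dividedPower a ∘ double) (λ j → fromℕℚ 2 * dividedPower b (double j)) k
      ≡⟨ conv-*ʳ (fromℕℚ 2) (dividedPower a ∘ double) (dividedPower b ∘ double) k ⟩
    fromℕℚ 2 * conv (dividedPower a ∘ double) (dividedPower b ∘ double) k ∎
    where
    open ≡-Reasoning
    odd-part : ∀ j → dividedPower b (suc (double j)) + dividedPower (- b) (suc (double j)) ≡ 0ℚ
    odd-part j = trans (cong (λ p → dividedPower b (suc (double j)) + p * invFact (suc (double j))) (odd-neg b j))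
      (cancel-odd (b ^ℚ suc (double j)) (invFact (suc (double j))))
    even-part : ∀ j → dividedPower b (double j) + dividedPower (- b) (double j) ≡ fromℕℚ 2 * dividedPower b (double j)
    even-part j = trans (cong (λ p → dividedPower b (double j) + p * invFact (double j)) (even-neg b j)) (twice (dividedPower b (double j)))

  alternating : ℕ → ℚ
  alternating k = (- 1ℚ) ^ℚ k

  alternating-+ : ∀ i j → alternating (i ℕ.+ j) ≡ alternating i * alternating j
  alternating-+ zero    j = sym (ℚ.*-identityˡ _)
  alternating-+ (suc i) j = trans (cong ((- 1ℚ) *_) (alternating-+ i j)) (sym (ℚ.*-assoc (- 1ℚ) (alternating i) (alternating j)))

  2*≡double : ∀ k → 2 ℕ.* k ≡ double k
  2*≡double zero    = refl
  2*≡double (suc k) = trans (ℕ.*-suc 2 k) (cong (suc ∘ suc) (2*≡double k))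

  cosTerm-dividedPower : ∀ k x → cosTerm k x ≡ alternating k * dividedPower x (double k)
  cosTerm-dividedPower k x = trans (assoc₃ (alternating k) (x ^ℚ (2 ℕ.* k)) (invFact (2 ℕ.* k)))
    (cong (λ j → alternating k * dividedPower x j) (2*≡double k))

  cosTerms : ℚ → ℕ → ℚ
  cosTerms x k = cosTerm k x

  -- The sign (-1)ᵏ is multiplicative in k and so distributes over the two factors of the
  -- convolution.
  cosTerm-± : ∀ a b k → cosTerm k (a + b) + cosTerm k (a - b) ≡ fromℕℚ 2 * conv (cosTerms a) (cosTerms b) k
  cosTerm-± a b k = begin
    cosTerm k (a + b) + cosTerm k (a - b)
      ≡⟨ cong₂ _+_ (cosTerm-dividedPower k (a + b)) (cosTerm-dividedPower k (a - b)) ⟩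
    alternating k * dividedPower (a + b) (double k) + alternating k * dividedPower (a - b) (double k)
      ≡⟨ ℚ.*-distribˡ-+ (alternating k) (dividedPower (a + b) (double k)) (dividedPower (a - b) (double k)) ⟨
    alternating k * (dividedPower (a + b) (double k) + dividedPower (a - b) (double k))
      ≡⟨ cong (alternating k *_) (dividedPower-± a b k) ⟩
    alternating k * (fromℕℚ 2 * conv (dividedPower a ∘ double) (dividedPower b ∘ double) k)
      ≡⟨ factor (alternating k) (conv (dividedPower a ∘ double) (dividedPower b ∘ double) k) ⟩
    fromℕℚ 2 * (alternating k * conv (dividedPower a ∘ double) (dividedPower b ∘ double) k)
      ≡⟨ cong (fromℕℚ 2 *_) (conv-twist alternating (dividedPower a ∘ double) (dividedPower b ∘ double) alternating-+ k) ⟨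
    fromℕℚ 2 * conv (λ i → alternating i * dividedPower a (double i)) (λ i → alternating i * dividedPower b (double i)) k
      ≡⟨ cong (fromℕℚ 2 *_) (conv-cong (λ i → cosTerm-dividedPower i a) (λ i → cosTerm-dividedPower i b) k) ⟨
    fromℕℚ 2 * conv (cosTerms a) (cosTerms b) k ∎
    where open ≡-Reasoning

  cosSum-partialSum : ∀ n x → cosSum n x ≡ partialSum (cosTerms x) n
  cosSum-partialSum zero    x = refl
  cosSum-partialSum (suc n) x = cong (_+ cosTerm n x) (cosSum-partialSum n x)

  -- Term by term the formula is exact; truncation leaves only the triangle by which the product of
  -- the partial sums exceeds the Cauchy product.
  cosSum-± : ∀ a b n → cosSum n (a + b) + cosSum n (a - b) - fromℕℚ 2 * cosSum n a * cosSum n b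
    ≡ - (fromℕℚ 2 * cauchyRemainder (cosTerms a) (cosTerms b) n)
  cosSum-± a b n = begin
    cosSum n (a + b) + cosSum n (a - b) - fromℕℚ 2 * cosSum n a * cosSum n b
      ≡⟨ cong₂ _-_ (trans (cong₂ _+_ (cosSum-partialSum n (a + b)) (cosSum-partialSum n (a - b))) (sym (partialSum-+ (cosTerms (a + b)) (cosTerms (a - b)) n)))
           (cong₂ (λ s t → fromℕℚ 2 * s * t) (cosSum-partialSum n a) (cosSum-partialSum n b)) ⟩
    partialSum (λ k → cosTerm k (a + b) + cosTerm k (a - b)) n - fromℕℚ 2 * A * B
      ≡⟨ cong (_- fromℕℚ 2 * A * B) (trans (partialSum-cong (cosTerm-± a b) n) (partialSum-* (fromℕℚ 2) (conv (cosTerms a) (cosTerms b)) n)) ⟩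
    fromℕℚ 2 * partialSum (conv (cosTerms a) (cosTerms b)) n - fromℕℚ 2 * A * B
      ≡⟨ lem (partialSum (conv (cosTerms a) (cosTerms b)) n) A B ⟩
    - (fromℕℚ 2 * cauchyRemainder (cosTerms a) (cosTerms b) n) ∎
    where
    open ≡-Reasoning
    A = partialSum (cosTerms a) n
    B = partialSum (cosTerms b) n
    lem : ∀ s a b → fromℕℚ 2 * s - fromℕℚ 2 * a * b ≡ - (fromℕℚ 2 * (a * b - s))
    lem = solve 3 (λ s a b → con (fromℕℚ 2) :* s :- con (fromℕℚ 2) :* a :* b := :- (con (fromℕℚ 2) :* (a :* b :- s))) refl

  halfPower : ℕ → ℚ
  halfPower zero    = 1ℚ
  halfPower (suc k) = ½ * halfPower k

  0≤halfPower : ∀ k → 0ℚ ≤ halfPower k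
  0≤halfPower zero    = ℚ.nonNegative⁻¹ 1ℚ
  0≤halfPower (suc k) = *-nonneg 0≤½ (0≤halfPower k)

  partialSum-halfPower : ∀ f K → (∀ i → ∣ f i ∣ ≤ K * halfPower i) → ∀ n →
    ∣ partialSum f n ∣ ≤ fromℕℚ 2 * K * (1ℚ - halfPower n)
  partialSum-halfPower f K h zero = ℚ.≤-reflexive (lem K)
    where
    lem : ∀ K → 0ℚ ≡ fromℕℚ 2 * K * (1ℚ - 1ℚ)
    lem = solve 1 (λ K → con 0ℚ := con (fromℕℚ 2) :* K :* (con 1ℚ :- con 1ℚ)) refl
  partialSum-halfPower f K h (suc n) = ℚ.≤-trans (ℚ.∣p+q∣≤∣p∣+∣q∣ (partialSum f n) (f n))
    (≤-by (ℚ.+-mono-≤ (partialSum-halfPower f K h n) (h n)) refl (lem K (halfPower n)))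
    where
    lem : ∀ K p → fromℕℚ 2 * K * (1ℚ - p) + K * p ≡ fromℕℚ 2 * K * (1ℚ - ½ * p)
    lem = solve 2 (λ K p → con (fromℕℚ 2) :* K :* (con 1ℚ :- p) :+ K :* p := con (fromℕℚ 2) :* K :* (con 1ℚ :- con ½ :* p)) refl

  -- Dropping f 0 halves the constant K, while the complete last column contributes at most K L 2⁻ⁿ;
  -- the step from n to n + 1 thus gives the bound (n + 1) K L 2⁻ⁿ.
  remainder-bound : ∀ f g K L → 0ℚ ≤ K → (∀ i → ∣ f i ∣ ≤ K * halfPower i) → (∀ i → ∣ g i ∣ ≤ L * halfPower i) →
    ∀ n → ∣ cauchyRemainder f g n ∣ ≤ fromℕℚ 2 * K * L * (fromℕℚ n * halfPower n)
  remainder-bound f g K L 0≤K fK gL zero = ℚ.≤-reflexive (lem K L)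
    where
    lem : ∀ K L → 0ℚ ≡ fromℕℚ 2 * K * L * (0ℚ * 1ℚ)
    lem = solve 2 (λ K L → con 0ℚ := con (fromℕℚ 2) :* K :* L :* (con 0ℚ :* con 1ℚ)) refl
  remainder-bound f g K L 0≤K fK gL (suc n) = ≤-by
    (ℚ.≤-trans (ℚ.∣p+q∣≤∣p∣+∣q∣ (F * g n) (cauchyRemainder (f ∘ suc) g n))
      (ℚ.+-mono-≤ (≤-by (*-mono-≤ (ℚ.0≤∣p∣ F) F≤ (ℚ.0≤∣p∣ (g n)) (gL n)) (sym (ℚ.∣p*q∣≡∣p∣*∣q∣ F (g n))) refl)
        (remainder-bound (f ∘ suc) g (K * ½) L (*-nonneg 0≤K 0≤½) fK′ gL n)))
    (cong ∣_∣ (sym (cauchyRemainder-suc f g n)))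
    (trans (lem K L (halfPower n) (fromℕℚ n)) (cong (λ t → fromℕℚ 2 * K * L * (t * (½ * halfPower n))) (sym (fromℕℚ-suc n))))
    where
    F = partialSum (f ∘ suc) n
    fK′ : ∀ i → ∣ f (suc i) ∣ ≤ K * ½ * halfPower i
    fK′ i = ≤-by (fK (suc i)) refl (sym (ℚ.*-assoc K ½ (halfPower i)))
    F≤ : ∣ F ∣ ≤ K
    F≤ = ℚ.≤-trans (partialSum-halfPower (f ∘ suc) (K * ½) fK′ n)
      (≤-by (ℚ.+-monoʳ-≤ K (ℚ.neg-antimono-≤ (*-nonneg 0≤K (0≤halfPower n)))) (lem₁ K (halfPower n)) (lem₂ K))
      where
      lem₁ : ∀ K p → K + - (K * p) ≡ fromℕℚ 2 * (K * ½) * (1ℚ - p)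
      lem₁ = solve 2 (λ K p → K :+ :- (K :* p) := con (fromℕℚ 2) :* (K :* con ½) :* (con 1ℚ :- p)) refl
      lem₂ : ∀ K → K + - 0ℚ ≡ K
      lem₂ = solve 1 (λ K → K :+ :- con 0ℚ := K) refl
    lem : ∀ K L p n → K * (L * p) + fromℕℚ 2 * (K * ½) * L * (n * p) ≡ fromℕℚ 2 * K * L * ((1ℚ + n) * (½ * p))
    lem = solve 4 (λ K L p n → K :* (L :* p) :+ con (fromℕℚ 2) :* (K :* con ½) :* L :* (n :* p)
      := con (fromℕℚ 2) :* K :* L :* ((con 1ℚ :+ n) :* (con ½ :* p))) refl

  n*halfPower-null : IsNull (λ n → fromℕℚ n * halfPower n)
  -- The ratio (n + 1)/(2n) of consecutive terms is at most 2/3 from n = 3 on.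
  n*halfPower-null = null-shift 3 {λ n → fromℕℚ n * halfPower n}
    (geometric-null (λ n → *-nonneg (0≤fromℕℚ (3 ℕ.+ n)) (0≤halfPower (3 ℕ.+ n))) decrease)
    where
    decrease : ∀ n → fromℕℚ (4 ℕ.+ n) * halfPower (4 ℕ.+ n) ≤ ⅔ * (fromℕℚ (3 ℕ.+ n) * halfPower (3 ℕ.+ n))
    decrease n = ≤-by
      (ℚ.*-monoʳ-≤-nonNeg p {{ℚ.nonNegative (0≤halfPower (3 ℕ.+ n))}}
        (ℚ.+-monoˡ-≤ (½ * t) (ℚ.*-monoˡ-≤-nonNeg (⅔ - ½) (fromℕℚ-mono {3} (ℕ.m≤m+n 3 n)))))
      (trans (lem₁ t p) (cong (_* (½ * p)) (sym (fromℕℚ-suc (3 ℕ.+ n)))))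
      (lem₂ t p)
      where
      t = fromℕℚ (3 ℕ.+ n)
      p = halfPower (3 ℕ.+ n)
      lem₁ : ∀ t p → ((⅔ - ½) * fromℕℚ 3 + ½ * t) * p ≡ (1ℚ + t) * (½ * p)
      lem₁ = solve 2 (λ t p → ((con ⅔ :- con ½) :* con (fromℕℚ 3) :+ con ½ :* t) :* p := (con 1ℚ :+ t) :* (con ½ :* p)) refl
      lem₂ : ∀ t p → ((⅔ - ½) * t + ½ * t) * p ≡ ⅔ * (t * p)
      lem₂ = solve 2 (λ t p → ((con ⅔ :- con ½) :* t :+ con ½ :* t) :* p := con ⅔ :* (t :* p)) refl

  -- The terms before index A are absorbed into the constant: prefixing g 0 to a sequence bounded by
  -- K 2⁻ᵏ gives the constant g 0 + 2K.
  eventually-halving : ∀ A (g : ℕ → ℚ) → (∀ k → 0ℚ ≤ g k) → (∀ k → A ℕ.≤ k → g (suc k) ≤ g k * ½) →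
    ∃[ K ] 0ℚ ≤ K × (∀ k → g k ≤ K * halfPower k)
  eventually-halving zero g 0≤g halves = g 0 , 0≤g 0 , bound
    where
    bound : ∀ k → g k ≤ g 0 * halfPower k
    bound zero    = ℚ.≤-reflexive (sym (ℚ.*-identityʳ (g 0)))
    bound (suc k) = ℚ.≤-trans (halves k ℕ.z≤n) (≤-by (ℚ.*-monoʳ-≤-nonNeg ½ (bound k)) refl (lem (g 0) (halfPower k)))
      where
      lem : ∀ a b → a * b * ½ ≡ a * (½ * b)
      lem = solve 2 (λ a b → a :* b :* con ½ := a :* (con ½ :* b)) refl
  eventually-halving (suc A) g 0≤g halves with eventually-halving A (g ∘ suc) (0≤g ∘ suc) (λ k le → halves (suc k) (ℕ.s≤s le))
  ... | K , 0≤K , h = g 0 + fromℕℚ 2 * K , +-nonneg (0≤g 0) 0≤2K , bound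
    where
    0≤2K : 0ℚ ≤ fromℕℚ 2 * K
    0≤2K = *-nonneg (0≤fromℕℚ 2) 0≤K
    bound : ∀ k → g k ≤ (g 0 + fromℕℚ 2 * K) * halfPower k
    bound zero    = ≤-by (ℚ.+-monoʳ-≤ (g 0) 0≤2K) (ℚ.+-identityʳ (g 0)) (sym (ℚ.*-identityʳ (g 0 + fromℕℚ 2 * K)))
    bound (suc k) = ℚ.≤-trans (h k) (≤-by (ℚ.+-monoˡ-≤ (K * halfPower k) (*-nonneg (*-nonneg (0≤g 0) 0≤½) (0≤halfPower k)))
      (ℚ.+-identityˡ (K * halfPower k)) (lem (g 0) K (halfPower k)))
      where
      lem : ∀ a b p → a * ½ * p + b * p ≡ (a + fromℕℚ 2 * b) * (½ * p)
      lem = solve 3 (λ a b p → a :* con ½ :* p :+ b :* p := (a :+ con (fromℕℚ 2) :* b) :* (con ½ :* p)) refl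

  abstract
    -- One geometric sequence dominates the terms of both series, so the defect of the n-th partial
    -- sums is at most a constant times n 2⁻ⁿ.
    cos-± : ∀ x y → cos (x +ℝ y) +ℝ cos (x +ℝ (-ℝ y)) ≈ℝ ℕ→ℝ 2 *ℝ cos x *ℝ cos y
    cos-± x y = mk≈ (bounded (cauchy-bound {seq x} (cauchy x)) (cauchy-bound {seq y} (cauchy y)))
      where
      bounded : ∃[ B ] 0ℚ ≤ B × (∀ n → ∣ seq x n ∣ ≤ B) → ∃[ C ] 0ℚ ≤ C × (∀ n → ∣ seq y n ∣ ≤ C) →
        IsNull (λ n → cosSum n (seq x n + seq y n) + cosSum n (seq x n + - seq y n) - fromℕℚ 2 * cosSum n (seq x n) * cosSum n (seq y n))
      bounded (B , 0≤B , xB) (B′ , 0≤B′ , yB) = decay (eventually-halving A g 0≤g g-halves)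
        where
        open CosBound (B + B′) (+-nonneg 0≤B 0≤B′)
        decay : ∃[ K ] 0ℚ ≤ K × (∀ k → g k ≤ K * halfPower k) →
          IsNull (λ n → cosSum n (seq x n + seq y n) + cosSum n (seq x n + - seq y n) - fromℕℚ 2 * cosSum n (seq x n) * cosSum n (seq y n))
        decay (K , 0≤K , gK) = null-dominated {λ n → M * (fromℕℚ n * halfPower n)} dom
          (null-* {λ _ → M} {λ n → fromℕℚ n * halfPower n} M 0≤M (λ _ → ℚ.≤-reflexive (ℚ.0≤p⇒∣p∣≡p 0≤M)) n*halfPower-null)
          where
          M : ℚ
          M = fromℕℚ 2 * (fromℕℚ 2 * K * K)
          0≤M : 0ℚ ≤ M
          0≤M = *-nonneg (0≤fromℕℚ 2) (*-nonneg (*-nonneg (0≤fromℕℚ 2) 0≤K) 0≤K)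
          dom : ∀ n → ∣ cosSum n (seq x n + seq y n) + cosSum n (seq x n + - seq y n) - fromℕℚ 2 * cosSum n (seq x n) * cosSum n (seq y n) ∣
            ≤ ∣ M * (fromℕℚ n * halfPower n) ∣
          dom n = ≤-by (ℚ.*-monoˡ-≤-nonNeg (fromℕℚ 2)
              (remainder-bound (cosTerms a) (cosTerms b) K K 0≤K
                (λ i → ℚ.≤-trans (term-bound a (≤-by (ℚ.+-mono-≤ (xB n) 0≤B′) (ℚ.+-identityʳ ∣ a ∣) refl) i) (gK i))
                (λ i → ℚ.≤-trans (term-bound b (≤-by (ℚ.+-mono-≤ 0≤B (yB n)) (ℚ.+-identityˡ ∣ b ∣) refl) i) (gK i)) n))
            (sym (trans (cong ∣_∣ (cosSum-± a b n)) (trans (ℚ.∣-p∣≡∣p∣ (fromℕℚ 2 * R)) (ℚ.∣p*q∣≡∣p∣*∣q∣ (fromℕℚ 2) R))))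
            (trans (sym (ℚ.*-assoc (fromℕℚ 2) (fromℕℚ 2 * K * K) (fromℕℚ n * halfPower n)))
              (sym (ℚ.0≤p⇒∣p∣≡p (*-nonneg 0≤M (*-nonneg (0≤fromℕℚ n) (0≤halfPower n))))))
            where
            a b R : ℚ
            a = seq x n
            b = seq y n
            R = cauchyRemainder (cosTerms a) (cosTerms b) n

-- Bounds for the cosine series on [0, 2].

module CosineZero where
  open import Data.Nat as ℕ using (ℕ; zero; suc; z≤n; s≤s)
  import Data.Nat.Properties as ℕ
  open import Data.Product using (_×_; _,_; ∃-syntax; proj₁; proj₂)
  open import Data.Rational as ℚ using (ℚ; 0ℚ; 1ℚ; ½; _+_; _*_; -_; _-_; _≤_)
  import Data.Rational.Properties as ℚ
  open import Data.Rational.Solver using (module +-*-Solver)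
  open import Data.Sum using (_⊎_; inj₁; inj₂; [_,_]′)
  open import Function using (_∘_)
  open import Relation.Binary.PropositionalEquality
  open import Relation.Nullary.Decidable using (toWitness)
  open +-*-Solver
  open RealRing
  open ℝ

  -- In the nested form t 0 - (t 1 - (t 2 - ...)) the bounds of Leibniz follow by plain induction
  -- from the tail.
  alternatingSum : (ℕ → ℚ) → ℕ → ℚ
  alternatingSum t zero    = 0ℚ
  alternatingSum t (suc n) = t 0 - alternatingSum (t ∘ suc) n

  abstract
    0≤q-p⇒p≤q : ∀ {p q} → 0ℚ ≤ q - p → p ≤ q
    0≤q-p⇒p≤q {p} {q} h = ≤-by (ℚ.+-monoʳ-≤ p h) (ℚ.+-identityʳ p) (ring5 p q)

    p-nonneg≤p : ∀ {p q} → 0ℚ ≤ q → p - q ≤ p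
    p-nonneg≤p {p} {q} h = ≤-by (ℚ.+-monoʳ-≤ p (ℚ.neg-antimono-≤ h)) refl (ℚ.+-identityʳ p)

    p-≤p- : ∀ p {q r} → q ≤ r → p - r ≤ p - q
    p-≤p- p h = ℚ.+-monoʳ-≤ p (ℚ.neg-antimono-≤ h)

    alternatingSum-bounds : ∀ t → (∀ k → 0ℚ ≤ t k) → (∀ k → t (suc k) ≤ t k) → ∀ n →
      0ℚ ≤ alternatingSum t n × alternatingSum t n ≤ t 0
    alternatingSum-bounds t 0≤t dec zero    = ℚ.≤-refl , 0≤t 0
    alternatingSum-bounds t 0≤t dec (suc n) with alternatingSum-bounds (t ∘ suc) (0≤t ∘ suc) (dec ∘ suc) n
    ... | lo , hi = ≤⇒0≤- (ℚ.≤-trans hi (dec 0)) , p-nonneg≤p lo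

  -- A lower bound for the slope of -cos on [2/3, 2]: as a function of x² the slope is at least 1/6,
  -- and x² - y² has the factor x + y ≥ 4/3.
  κ : ℚ
  κ = ⅓ * ⅔

  -- the absolute value of the k-th term of the cosine series, as a function of the square
  term : ℕ → ℚ → ℚ
  term zero    s = 1ℚ
  term (suc k) s = term k s * s * ratio k

  private
    step₂ : ∀ c t A → c - (t - A) ≡ c - t + A
    step₂ = solve 3 (λ c t A → c :- (t :- A) := c :- t :+ A) refl

    step₃ : ∀ c t A → c + (t - A) ≡ c + t - A
    step₃ = solve 3 (λ c t A → c :+ (t :- A) := c :+ t :- A) refl

  tail : ℕ → ℚ → ℕ → ℚ
  tail j s k = term (k ℕ.+ j) s

  abstract
    cosTerm-even⇒odd : ∀ k x → cosTerm k x ≡ term k (x * x) → cosTerm (suc k) x ≡ - term (suc k) (x * x)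
    cosTerm-even⇒odd k x e = trans (cosTerm-suc k x) (cong (λ c → - (c * (x * x) * ratio k)) e)

    cosTerm-odd⇒even : ∀ k x → cosTerm k x ≡ - term k (x * x) → cosTerm (suc k) x ≡ term (suc k) (x * x)
    cosTerm-odd⇒even k x e = trans (cosTerm-suc k x) (trans (cong (λ c → - (c * (x * x) * ratio k)) e)
      (lem (term k (x * x)) (x * x) (ratio k)))
      where
      lem : ∀ c y r → - ((- c) * y * r) ≡ c * y * r
      lem = solve 3 (λ c y r → :- ((:- c) :* y :* r) := c :* y :* r) refl

    tail-suc : ∀ j s k → tail j s (suc k) ≡ tail (suc j) s k
    tail-suc j s k = cong (λ i → term i s) (sym (ℕ.+-suc k j))

    alternatingSum-cong : ∀ {t u} → (∀ k → t k ≡ u k) → ∀ n → alternatingSum t n ≡ alternatingSum u n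
    alternatingSum-cong h zero    = refl
    alternatingSum-cong h (suc n) = cong₂ _-_ (h 0) (alternatingSum-cong (h ∘ suc) n)

    -- After its first term, a tail that starts with a positive term starts with a negative one, and
    -- vice versa; hence the mutual induction.
    cosSum-even : ∀ j x → cosTerm j x ≡ term j (x * x) → ∀ n →
      cosSum (n ℕ.+ j) x ≡ cosSum j x + alternatingSum (tail j (x * x)) n
    cosSum-odd : ∀ j x → cosTerm j x ≡ - term j (x * x) → ∀ n →
      cosSum (n ℕ.+ j) x ≡ cosSum j x - alternatingSum (tail j (x * x)) n

    cosSum-even j x e zero    = sym (ℚ.+-identityʳ (cosSum j x))
    cosSum-even j x e (suc n) = begin
      cosSum (suc n ℕ.+ j) x                             ≡⟨ cong (λ k → cosSum k x) (ℕ.+-suc n j) ⟨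
      cosSum (n ℕ.+ suc j) x                             ≡⟨ cosSum-odd (suc j) x (cosTerm-even⇒odd j x e) n ⟩
      cosSum j x + cosTerm j x - alternatingSum (tail (suc j) (x * x)) n
        ≡⟨ cong₂ (λ c A → cosSum j x + c - A) e (alternatingSum-cong (λ k → sym (tail-suc j (x * x) k)) n) ⟩
      cosSum j x + term j (x * x) - alternatingSum (tail j (x * x) ∘ suc) n
        ≡⟨ step₃ (cosSum j x) (term j (x * x)) (alternatingSum (tail j (x * x) ∘ suc) n) ⟨
      cosSum j x + alternatingSum (tail j (x * x)) (suc n) ∎
      where open ≡-Reasoning

    cosSum-odd j x e zero    = sym (ℚ.+-identityʳ (cosSum j x))
    cosSum-odd j x e (suc n) = begin
      cosSum (suc n ℕ.+ j) x                             ≡⟨ cong (λ k → cosSum k x) (ℕ.+-suc n j) ⟨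
      cosSum (n ℕ.+ suc j) x                             ≡⟨ cosSum-even (suc j) x (cosTerm-odd⇒even j x e) n ⟩
      cosSum j x + cosTerm j x + alternatingSum (tail (suc j) (x * x)) n
        ≡⟨ cong₂ (λ c A → cosSum j x + c + A) e (alternatingSum-cong (λ k → sym (tail-suc j (x * x) k)) n) ⟩
      cosSum j x - term j (x * x) + alternatingSum (tail j (x * x) ∘ suc) n
        ≡⟨ step₂ (cosSum j x) (term j (x * x)) (alternatingSum (tail j (x * x) ∘ suc) n) ⟨
      cosSum j x - alternatingSum (tail j (x * x)) (suc n) ∎
      where open ≡-Reasoning

    recip-antitone : ∀ {m n} → suc m ℕ.≤ suc n → recip (suc n) ≤ recip (suc m)
    recip-antitone {m} {n} le = ≤-by
      (ℚ.*-monoˡ-≤-nonNeg (r * r′) {{ℚ.nonNegative (*-nonneg (0≤recip (suc m)) (0≤recip (suc n)))}} (fromℕℚ-mono le))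
      (trans (lem₁ r r′ (fromℕℚ (suc m))) (trans (cong (r′ *_) (fromℕℚ*recip m)) (ℚ.*-identityʳ r′)))
      (trans (lem₂ r r′ (fromℕℚ (suc n))) (trans (cong (r *_) (fromℕℚ*recip n)) (ℚ.*-identityʳ r)))
      where
      r r′ : ℚ
      r = recip (suc m)
      r′ = recip (suc n)
      lem₁ : ∀ r r′ m → r * r′ * m ≡ r′ * (m * r)
      lem₁ = solve 3 (λ r r′ m → r :* r′ :* m := r′ :* (m :* r)) refl
      lem₂ : ∀ r r′ n → r * r′ * n ≡ r * (n * r′)
      lem₂ = solve 3 (λ r r′ n → r :* r′ :* n := r :* (n :* r′)) refl

    ratio≤ : ∀ k → ratio (suc k) ≤ recip 4 * recip 3
    ratio≤ k = *-mono-≤ (0≤recip (2 ℕ.+ 2 ℕ.* suc k)) (recip-antitone (s≤s (s≤s (ℕ.*-monoʳ-≤ 2 (s≤s (z≤n {k}))))))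
      (0≤recip (1 ℕ.+ 2 ℕ.* suc k)) (recip-antitone (s≤s (ℕ.*-monoʳ-≤ 2 (s≤s (z≤n {k})))))

    0≤term : ∀ k {s} → 0ℚ ≤ s → 0ℚ ≤ term k s
    0≤term zero    h = ℚ.nonNegative⁻¹ 1ℚ
    0≤term (suc k) h = *-nonneg (*-nonneg (0≤term k h) h) (0≤ratio k)

    -- The quotient of the two terms is s/((2k + 3)(2k + 4)), at most 4/12.
    term-decreasing : ∀ k {s} → 0ℚ ≤ s → s ≤ fromℕℚ 4 → term (suc (suc k)) s ≤ ⅓ * term (suc k) s
    term-decreasing k {s} 0≤s s≤4 = ≤-by
      (*-mono-≤ (*-nonneg 0≤t 0≤s) (*-mono-≤ 0≤t ℚ.≤-refl 0≤s s≤4) (0≤ratio (suc k)) (ratio≤ k))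
      refl (lem (term (suc k) s))
      where
      0≤t : 0ℚ ≤ term (suc k) s
      0≤t = 0≤term (suc k) 0≤s
      lem : ∀ t → t * fromℕℚ 4 * (recip 4 * recip 3) ≡ ⅓ * t
      lem = solve 1 (λ t → t :* con (fromℕℚ 4) :* (con (recip 4) :* con (recip 3)) := con ⅓ :* t) refl

    ⅓*≤ : ∀ {p} → 0ℚ ≤ p → ⅓ * p ≤ p
    ⅓*≤ {p} h = ≤-by (ℚ.*-monoʳ-≤-nonNeg p {{ℚ.nonNegative h}} (toWitness {a? = ⅓ ℚ.≤? 1ℚ} _)) refl (ℚ.*-identityˡ p)

    tail-bounds : ∀ j {s} → 0ℚ ≤ s → s ≤ fromℕℚ 4 → ∀ n →
      0ℚ ≤ alternatingSum (tail (suc j) s) n × alternatingSum (tail (suc j) s) n ≤ term (suc j) s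
    tail-bounds j {s} 0≤s s≤4 = alternatingSum-bounds (tail (suc j) s) (λ k → 0≤term (k ℕ.+ suc j) 0≤s)
      (λ k → subst (λ i → term (suc i) s ≤ term i s) (sym (ℕ.+-suc k j))
        (ℚ.≤-trans (term-decreasing (k ℕ.+ j) 0≤s s≤4) (⅓*≤ (0≤term (suc (k ℕ.+ j)) 0≤s))))

    cosSum-2 : ∀ x → cosSum 2 x ≡ 1ℚ - ½ * (x * x)
    cosSum-2 x = trans (cong (λ c → 0ℚ + 1ℚ + c) (cosTerm-suc 0 x)) (lem (x * x))
      where
      lem : ∀ s → 0ℚ + 1ℚ + - (1ℚ * s * ratio 0) ≡ 1ℚ - ½ * s
      lem = solve 1 (λ s → con 0ℚ :+ con 1ℚ :+ :- (con 1ℚ :* s :* con (ratio 0)) := con 1ℚ :- con ½ :* s) refl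

    cosTerm-2 : ∀ x → cosTerm 2 x ≡ term 2 (x * x)
    cosTerm-2 x = cosTerm-odd⇒even 1 x (cosTerm-even⇒odd 0 x refl)

    0≤x*x : ∀ x → 0ℚ ≤ x * x
    0≤x*x x with ℚ.≤-total 0ℚ x
    ... | inj₁ h = *-nonneg h h
    ... | inj₂ h = ≤-by (*-nonneg (ℚ.neg-antimono-≤ h) (ℚ.neg-antimono-≤ h)) refl (lem x)
      where
      lem : ∀ x → (- x) * (- x) ≡ x * x
      lem = solve 1 (λ x → (:- x) :* (:- x) := x :* x) refl

    cosSum-≥ : ∀ n x → x * x ≤ fromℕℚ 4 → 1ℚ - ½ * (x * x) ≤ cosSum (n ℕ.+ 2) x
    cosSum-≥ n x h = ≤-by (ℚ.+-monoʳ-≤ (cosSum 2 x) (proj₁ (tail-bounds 1 (0≤x*x x) h n)))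
      (trans (ℚ.+-identityʳ (cosSum 2 x)) (cosSum-2 x)) (sym (cosSum-even 2 x (cosTerm-2 x) n))

    -- Beyond 1 - x²/2 the series adds at most its next term, and this is at most a third of x²/2;
    -- the factor is 1/3 = 1/2 - 1/6.
    cosSum-≤ : ∀ n x → x * x ≤ fromℕℚ 4 → cosSum (n ℕ.+ 2) x ≤ 1ℚ - ⅓ * (x * x)
    cosSum-≤ n x h = ℚ.≤-trans (≤-by (ℚ.+-monoʳ-≤ (cosSum 2 x) (ℚ.≤-trans (proj₂ (tail-bounds 1 (0≤x*x x) h n)) (term-decreasing 0 (0≤x*x x) h)))
        (sym (cosSum-even 2 x (cosTerm-2 x) n)) (cong (_+ ⅓ * term 1 (x * x)) (cosSum-2 x)))
      (ℚ.≤-reflexive (lem (x * x)))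
      where
      lem : ∀ s → 1ℚ - ½ * s + ⅓ * (1ℚ * s * ratio 0) ≡ 1ℚ - ⅓ * s
      lem = solve 1 (λ s → con 1ℚ :- con ½ :* s :+ con ⅓ :* (con 1ℚ :* s :* con (ratio 0)) := con 1ℚ :- con ⅓ :* s) refl

    cosTerm-sign : ∀ j x → cosTerm j x ≡ term j (x * x) ⊎ cosTerm j x ≡ - term j (x * x)
    cosTerm-sign zero    x = inj₁ refl
    cosTerm-sign (suc j) x = [ (λ e → inj₂ (cosTerm-even⇒odd j x e)) , (λ e → inj₁ (cosTerm-odd⇒even j x e)) ]′ (cosTerm-sign j x)

    -- The tail is an alternating sum bounded by its first term; as its sign depends on the parity
    -- of j, the estimate is two-sided.
    cosSum-error : ∀ j x → x * x ≤ fromℕℚ 4 → ∀ n →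
      cosSum (suc j) x - term (suc j) (x * x) ≤ cosSum (n ℕ.+ suc j) x × cosSum (n ℕ.+ suc j) x ≤ cosSum (suc j) x + term (suc j) (x * x)
    cosSum-error j x h n = [ even , odd ]′ (cosTerm-sign (suc j) x)
      where
      c t A : ℚ
      c = cosSum (suc j) x
      t = term (suc j) (x * x)
      A = alternatingSum (tail (suc j) (x * x)) n
      0≤t : 0ℚ ≤ t
      0≤t = 0≤term (suc j) (0≤x*x x)
      0≤A : 0ℚ ≤ A
      0≤A = proj₁ (tail-bounds j (0≤x*x x) h n)
      A≤t : A ≤ t
      A≤t = proj₂ (tail-bounds j (0≤x*x x) h n)
      even : cosTerm (suc j) x ≡ t → c - t ≤ cosSum (n ℕ.+ suc j) x × cosSum (n ℕ.+ suc j) x ≤ c + t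
      even e = subst (λ y → c - t ≤ y × y ≤ c + t) (sym (cosSum-even (suc j) x e n))
        (ℚ.+-monoʳ-≤ c (ℚ.≤-trans (ℚ.neg-antimono-≤ 0≤t) 0≤A) , ℚ.+-monoʳ-≤ c A≤t)
      odd : cosTerm (suc j) x ≡ - t → c - t ≤ cosSum (n ℕ.+ suc j) x × cosSum (n ℕ.+ suc j) x ≤ c + t
      odd e = subst (λ y → c - t ≤ y × y ≤ c + t) (sym (cosSum-odd (suc j) x e n))
        (p-≤p- c A≤t , ℚ.+-monoʳ-≤ c (ℚ.≤-trans (ℚ.neg-antimono-≤ 0≤A) 0≤t))

    term-mono : ∀ k {s t} → 0ℚ ≤ s → s ≤ t → term k s ≤ term k t
    term-mono zero    0≤s s≤t = ℚ.≤-refl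
    term-mono (suc k) 0≤s s≤t = ℚ.*-monoʳ-≤-nonNeg (ratio k) {{ℚ.nonNegative (0≤ratio k)}}
      (*-mono-≤ (0≤term k 0≤s) (term-mono k 0≤s s≤t) 0≤s s≤t)

    -- The quotient of `term (suc k) s` by s is a constant times sᵏ, hence monotone; here the
    -- denominators are cleared.
    term-cross : ∀ k {s t} → 0ℚ ≤ s → s ≤ t → t * term (suc k) s ≤ s * term (suc k) t
    term-cross zero {s} {t} 0≤s s≤t = ℚ.≤-reflexive (lem s t (ratio 0))
      where
      lem : ∀ s t r → t * (1ℚ * s * r) ≡ s * (1ℚ * t * r)
      lem = solve 3 (λ s t r → t :* (con 1ℚ :* s :* r) := s :* (con 1ℚ :* t :* r)) refl
    term-cross (suc k) {s} {t} 0≤s s≤t = ≤-by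
      (ℚ.*-monoʳ-≤-nonNeg (ratio (suc k)) {{ℚ.nonNegative (0≤ratio (suc k))}}
        (*-mono-≤ (*-nonneg 0≤t (0≤term (suc k) 0≤s)) (term-cross k 0≤s s≤t) 0≤s s≤t))
      (lem t (term (suc k) s) s (ratio (suc k))) (lem s (term (suc k) t) t (ratio (suc k)))
      where
      0≤t : 0ℚ ≤ t
      0≤t = ℚ.≤-trans 0≤s s≤t
      lem : ∀ a b c r → a * b * c * r ≡ a * (b * c * r)
      lem = solve 4 (λ a b c r → a :* b :* c :* r := a :* (b :* c :* r)) refl

    term-1 : ∀ s → term 1 s ≡ ½ * s
    term-1 s = lem s
      where
      lem : ∀ s → 1ℚ * s * ratio 0 ≡ ½ * s
      lem = solve 1 (λ s → con 1ℚ :* s :* con (ratio 0) := con ½ :* s) refl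

    ⅔*≤ : ∀ {p} → 0ℚ ≤ p → ⅔ * p ≤ p
    ⅔*≤ {p} h = ≤-by (ℚ.*-monoʳ-≤-nonNeg p {{ℚ.nonNegative h}} (toWitness {a? = ⅔ ℚ.≤? 1ℚ} _)) refl (ℚ.*-identityˡ p)

    -- The termwise differences of the series at s and t form an alternating series of their own. It
    -- decreases by the factor 2/3, so its sum is at least a third of its first term (t - s)/2.
    module Gap {s t : ℚ} (0≤s : 0ℚ ≤ s) (s≤t : s ≤ t) (t≤4 : t ≤ fromℕℚ 4) where

      gap : ℕ → ℚ
      gap k = term (suc k) t - term (suc k) s

      0≤gap : ∀ k → 0ℚ ≤ gap k
      0≤gap k = ≤⇒0≤- (term-mono (suc k) 0≤s s≤t)

      -- Up to the factor `ratio`, the next difference is s + t times the present one minus a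
      -- nonnegative cross term, and (4 + 4)/12 = 2/3.
      gap-decreasing : ∀ k → gap (suc k) ≤ ⅔ * gap k
      gap-decreasing k = ℚ.≤-trans
        (≤-by (ℚ.*-monoʳ-≤-nonNeg r {{ℚ.nonNegative (0≤ratio (suc k))}}
          (p-nonneg≤p {(s + t) * gap k} (≤⇒0≤- (term-cross k 0≤s s≤t)))) (lem₁ a b s t r) refl)
        (≤-by (*-mono-≤ (*-nonneg (+-nonneg 0≤s (ℚ.≤-trans 0≤s s≤t)) (0≤gap k)) (ℚ.*-monoʳ-≤-nonNeg (gap k) {{ℚ.nonNegative (0≤gap k)}} (ℚ.+-mono-≤ (ℚ.≤-trans s≤t t≤4) t≤4))
          (0≤ratio (suc k)) (ratio≤ k)) refl (lem (gap k)))
        where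
        a b r : ℚ
        a = term (suc k) s
        b = term (suc k) t
        r = ratio (suc k)
        lem : ∀ g → (fromℕℚ 4 + fromℕℚ 4) * g * (recip 4 * recip 3) ≡ ⅔ * g
        lem = solve 1 (λ g → (con (fromℕℚ 4) :+ con (fromℕℚ 4)) :* g :* (con (recip 4) :* con (recip 3)) := con ⅔ :* g) refl
        lem₁ : ∀ a b s t r → ((s + t) * (b - a) - (s * b - t * a)) * r ≡ b * t * r - a * s * r
        lem₁ = solve 5 (λ a b s t r → ((s :+ t) :* (b :- a) :- (s :* b :- t :* a)) :* r := b :* t :* r :- a :* s :* r) refl

      alternatingSum-- : ∀ f g n → alternatingSum f n - alternatingSum g n ≡ alternatingSum (λ k → f k - g k) n
      alternatingSum-- f g zero    = refl
      alternatingSum-- f g (suc n) = trans (lem (f 0) _ (g 0) _) (cong (λ x → f 0 - g 0 - x) (alternatingSum-- (f ∘ suc) (g ∘ suc) n))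
        where
        lem : ∀ a b c d → a - b - (c - d) ≡ a - c - (b - d)
        lem = solve 4 (λ a b c d → a :- b :- (c :- d) := a :- c :- (b :- d)) refl

      gap-0 : gap 0 ≡ ½ * (t - s)
      gap-0 = trans (cong₂ _-_ (term-1 t) (term-1 s)) (lem t s)
        where
        lem : ∀ t s → ½ * t - ½ * s ≡ ½ * (t - s)
        lem = solve 2 (λ t s → con ½ :* t :- con ½ :* s := con ½ :* (t :- s)) refl

      gap-tail : ∀ n → alternatingSum (gap ∘ suc) n ≤ ⅔ * gap 0
      gap-tail n = ℚ.≤-trans (proj₂ (alternatingSum-bounds (gap ∘ suc) (0≤gap ∘ suc) (λ k → ℚ.≤-trans (gap-decreasing (suc k)) (⅔*≤ (0≤gap (suc k)))) n))
        (gap-decreasing 0)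

      gap-sum : ∀ n → (⅓ * ½) * (t - s) ≤ alternatingSum gap (suc n)
      gap-sum n = ℚ.≤-trans (ℚ.≤-reflexive (sym (trans (cong (λ g → g - ⅔ * g) gap-0) (lem (t - s))))) (p-≤p- (gap 0) (gap-tail n))
        where
        lem : ∀ d → ½ * d - ⅔ * (½ * d) ≡ ⅓ * ½ * d
        lem = solve 1 (λ d → con ½ :* d :- con ⅔ :* (con ½ :* d) := con ⅓ :* con ½ :* d) refl

      alternatingSum-gap : ∀ n → (⅓ * ½) * (t - s) ≤ alternatingSum (tail 1 t) (suc n) - alternatingSum (tail 1 s) (suc n)
      alternatingSum-gap n = subst ((⅓ * ½) * (t - s) ≤_)
        (sym (trans (alternatingSum-- (tail 1 t) (tail 1 s) (suc n)) (alternatingSum-cong shift (suc n)))) (gap-sum n)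
        where
        shift : ∀ k → tail 1 t k - tail 1 s k ≡ gap k
        shift k = cong (λ i → term i t - term i s) (ℕ.+-comm k 1)

    square-≤ : ∀ {x y} → 0ℚ ≤ x → x ≤ y → x * x ≤ y * y
    square-≤ 0≤x x≤y = *-mono-≤ 0≤x x≤y 0≤x x≤y

    0≤⅔ : 0ℚ ≤ ⅔
    0≤⅔ = ℚ.nonNegative⁻¹ ⅔

    cosSum-gap : ∀ n {u v} → ⅔ ≤ u → u ≤ v → v ≤ fromℕℚ 2 → κ * (v - u) ≤ cosSum (n ℕ.+ 2) u - cosSum (n ℕ.+ 2) v
    cosSum-gap n {u} {v} ⅔≤u u≤v v≤2 = ℚ.≤-trans
      (≤-by (ℚ.*-monoˡ-≤-nonNeg (⅓ * ½) {{ℚ.nonNegative (*-nonneg (ℚ.nonNegative⁻¹ ⅓) 0≤½)}}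
        (ℚ.*-monoʳ-≤-nonNeg (v - u) {{ℚ.nonNegative (≤⇒0≤- u≤v)}} (ℚ.+-mono-≤ ⅔≤u (ℚ.≤-trans ⅔≤u u≤v))))
        (lem₁ (v - u)) (cong ((⅓ * ½) *_) (lem₂ u v)))
      (≤-by (alternatingSum-gap n) refl (sym (trans (cong₂ _-_ (expand u) (expand v)) (lem₃ (cosSum 1 u) (alternatingSum (tail 1 (u * u)) (suc n)) (alternatingSum (tail 1 (v * v)) (suc n))))))
      where
      0≤u : 0ℚ ≤ u
      0≤u = ℚ.≤-trans 0≤⅔ ⅔≤u
      open Gap (0≤x*x u) (square-≤ 0≤u u≤v) (square-≤ (ℚ.≤-trans 0≤u u≤v) v≤2)
      expand : ∀ x → cosSum (n ℕ.+ 2) x ≡ cosSum 1 x - alternatingSum (tail 1 (x * x)) (suc n)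
      expand x = trans (cong (λ k → cosSum k x) (ℕ.+-suc n 1)) (cosSum-odd 1 x (cosTerm-even⇒odd 0 x refl) (suc n))
      lem₁ : ∀ d → (⅓ * ½) * ((⅔ + ⅔) * d) ≡ ⅓ * ⅔ * d
      lem₁ = solve 1 (λ d → (con ⅓ :* con ½) :* ((con ⅔ :+ con ⅔) :* d) := con ⅓ :* con ⅔ :* d) refl
      lem₂ : ∀ u v → (u + v) * (v - u) ≡ v * v - u * u
      lem₂ = solve 2 (λ u v → (u :+ v) :* (v :- u) := v :* v :- u :* u) refl
      lem₃ : ∀ c a b → c - a - (c - b) ≡ b - a
      lem₃ = solve 3 (λ c a b → c :- a :- (c :- b) := b :- a) refl

-- The cosine vanishes at the limit of the trisection.

module HalfPi where
  open import Data.Bool using (true; false)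
  open import Data.Nat as ℕ using (ℕ; zero; suc; z≤n; s≤s)
  import Data.Nat.Properties as ℕ
  open import Data.Product using (_,_; ∃-syntax; proj₁; proj₂)
  open import Data.Rational as ℚ using (ℚ; 0ℚ; 1ℚ; ½; _+_; _*_; -_; _-_; _≤_; ∣_∣)
  import Data.Rational.Properties as ℚ
  open import Data.Rational.Solver using (module +-*-Solver)
  open import Data.Sum using (inj₁; inj₂)
  open import Relation.Binary.PropositionalEquality
  open import Relation.Nullary using (Dec; yes; no; does; ¬_)
  open import Relation.Nullary.Decidable using (toWitness)
  open +-*-Solver
  open RealRing
  open CosineZero
  open ℝ

  -- the width of the bracket dominates the truncation error
  ω : ℚ
  ω = κ * (½ * ⅓)

  -- The state after m + 1 trisections, when 4 + m terms decide the next sign. The signs at the ends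
  -- are required of all longer truncations too, since they have to survive the later steps; `error`
  -- confines a wrong decision to a sixth of the width.
  record Brackets (m : ℕ) (a b : ℚ) : Set where
    field
      ⅔≤a   : ⅔ ≤ a
      a≤b   : a ≤ b
      b≤2   : b ≤ fromℕℚ 2
      left  : ∀ N → 4 ℕ.+ m ℕ.≤ N → 0ℚ ≤ cosSum N a
      right : ∀ N → 4 ℕ.+ m ℕ.≤ N → cosSum N b ≤ 0ℚ
      error : term (4 ℕ.+ m) (fromℕℚ 4) ≤ ω * (b - a)

  abstract
    beyond : ∀ {k N} → k ℕ.≤ N → (P : ℕ → Set) → (∀ n → P (n ℕ.+ k)) → P N
    beyond k≤N P h = subst P (ℕ.m∸n+n≡m k≤N) (h _)

    square-≤4 : ∀ {x} → 0ℚ ≤ x → x ≤ fromℕℚ 2 → x * x ≤ fromℕℚ 4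
    square-≤4 0≤x x≤2 = square-≤ 0≤x x≤2

    -- At the midpoint 1 the three terms 1 - 1/2 + 1/24 have a positive sum, so the first step moves
    -- the left end to 2/3, from where on the slope estimate is available.
    bracket-1 : bracket 1 ≡ (⅔ , fromℕℚ 2)
    bracket-1 = refl

    brackets-1 : Brackets 0 ⅔ (fromℕℚ 2)
    brackets-1 = record
      { ⅔≤a = ℚ.≤-refl
      ; a≤b = toWitness {a? = ⅔ ℚ.≤? fromℕℚ 2} _
      ; b≤2 = ℚ.≤-refl
      ; left = λ N le → beyond {2} (ℕ.≤-trans (s≤s (s≤s z≤n)) le) (λ N → 0ℚ ≤ cosSum N ⅔)
          (λ n → ℚ.≤-trans (toWitness {a? = 0ℚ ℚ.≤? 1ℚ - ½ * (⅔ * ⅔)} _) (cosSum-≥ n ⅔ (toWitness {a? = ⅔ * ⅔ ℚ.≤? fromℕℚ 4} _)))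
      ; right = λ N le → beyond {2} (ℕ.≤-trans (s≤s (s≤s z≤n)) le) (λ N → cosSum N (fromℕℚ 2) ≤ 0ℚ)
          (λ n → ℚ.≤-trans (cosSum-≤ n (fromℕℚ 2) (toWitness {a? = fromℕℚ 2 * fromℕℚ 2 ℚ.≤? fromℕℚ 4} _)) (toWitness {a? = 1ℚ - ⅓ * (fromℕℚ 2 * fromℕℚ 2) ℚ.≤? 0ℚ} _))
      ; error = ≤4
      }
      where
      ≤4 : term 4 (fromℕℚ 4) ≤ ω * (fromℕℚ 2 - ⅔)
      ≤4 = toWitness {a? = term 4 (fromℕℚ 4) ℚ.≤? ω * (fromℕℚ 2 - ⅔)} _

  module Step (m : ℕ) (a b : ℚ) (B : Brackets m a b) where
    open Brackets B

    M : ℚ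
    M = ½ * (a + b)

    abstract
      M-a : ⅔ * a + ⅓ * b + ½ * ⅓ * (b - a) ≡ M
      M-a = lem a b
        where
        lem : ∀ a b → ⅔ * a + ⅓ * b + ½ * ⅓ * (b - a) ≡ ½ * (a + b)
        lem = solve 2 (λ a b → con ⅔ :* a :+ con ⅓ :* b :+ con ½ :* con ⅓ :* (b :- a) := con ½ :* (a :+ b)) refl

      b-M : M + ½ * ⅓ * (b - a) ≡ ⅓ * a + ⅔ * b
      b-M = lem a b
        where
        lem : ∀ a b → ½ * (a + b) + ½ * ⅓ * (b - a) ≡ ⅓ * a + ⅔ * b
        lem = solve 2 (λ a b → con ½ :* (a :+ b) :+ con ½ :* con ⅓ :* (b :- a) := con ⅓ :* a :+ con ⅔ :* b) refl

      0≤w : 0ℚ ≤ b - a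
      0≤w = ≤⇒0≤- a≤b

      0≤w/6 : 0ℚ ≤ ½ * ⅓ * (b - a)
      0≤w/6 = *-nonneg (*-nonneg 0≤½ (ℚ.nonNegative⁻¹ ⅓)) 0≤w

      +-≤ : ∀ {p q r} → 0ℚ ≤ q → p + q ≡ r → p ≤ r
      +-≤ {p} h e = ≤-by (ℚ.+-monoʳ-≤ p h) (ℚ.+-identityʳ p) e

      a≤l : a ≤ ⅔ * a + ⅓ * b
      a≤l = proj₁ (trisect-nested true {a} {b} 0≤w)

      u≤b : ⅓ * a + ⅔ * b ≤ b
      u≤b = proj₂ (trisect-nested false {a} {b} 0≤w)

      l≤M : ⅔ * a + ⅓ * b ≤ M
      l≤M = +-≤ {⅔ * a + ⅓ * b} 0≤w/6 M-a

      M≤u : M ≤ ⅓ * a + ⅔ * b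
      M≤u = +-≤ {M} 0≤w/6 b-M

      0≤M : 0ℚ ≤ M
      0≤M = ℚ.≤-trans 0≤⅔ (ℚ.≤-trans ⅔≤a (ℚ.≤-trans a≤l l≤M))

      M²≤4 : M * M ≤ fromℕℚ 4
      M²≤4 = square-≤4 0≤M (ℚ.≤-trans M≤u (ℚ.≤-trans u≤b b≤2))

      err≤ : term (4 ℕ.+ m) (M * M) ≤ ω * (b - a)
      err≤ = ℚ.≤-trans (term-mono (4 ℕ.+ m) (0≤x*x M) M²≤4) error

      -- The truncation error drops by the factor 1/3 in each step, the width only by 2/3.
      error′ : ∀ {d} → d ≡ ⅔ * (b - a) → term (5 ℕ.+ m) (fromℕℚ 4) ≤ ω * d
      error′ e = ℚ.≤-trans (term-decreasing (3 ℕ.+ m) (0≤fromℕℚ 4) ℚ.≤-refl)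
        (ℚ.≤-trans (ℚ.*-monoˡ-≤-nonNeg ⅓ error)
          (≤-by (ℚ.*-monoʳ-≤-nonNeg (ω * (b - a)) {{ℚ.nonNegative 0≤ωw}} (toWitness {a? = ⅓ ℚ.≤? ⅔} _)) refl
            (trans (lem ⅔ ω (b - a)) (cong (ω *_) (sym e)))))
        where
        0≤ωw : 0ℚ ≤ ω * (b - a)
        0≤ωw = *-nonneg (*-nonneg (*-nonneg (ℚ.nonNegative⁻¹ ⅓) 0≤⅔) (*-nonneg 0≤½ (ℚ.nonNegative⁻¹ ⅓))) 0≤w
        lem : ∀ x y z → x * (y * z) ≡ y * (x * z)
        lem = solve 3 (λ x y z → x :* (y :* z) := y :* (x :* z)) refl

      gap-l : ∀ n → ω * (b - a) ≤ cosSum (n ℕ.+ 2) (⅔ * a + ⅓ * b) - cosSum (n ℕ.+ 2) M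
      gap-l n = ≤-by (cosSum-gap n (ℚ.≤-trans ⅔≤a a≤l) l≤M (ℚ.≤-trans M≤u (ℚ.≤-trans u≤b b≤2)))
        (trans (cong (κ *_) (trans (cong (_- (⅔ * a + ⅓ * b)) (sym M-a)) (ring16 (⅔ * a + ⅓ * b) (½ * ⅓ * (b - a))))) (sym (ℚ.*-assoc κ (½ * ⅓) (b - a)))) refl

      gap-u : ∀ n → ω * (b - a) ≤ cosSum (n ℕ.+ 2) M - cosSum (n ℕ.+ 2) (⅓ * a + ⅔ * b)
      gap-u n = ≤-by (cosSum-gap n (ℚ.≤-trans ⅔≤a (ℚ.≤-trans a≤l l≤M)) M≤u (ℚ.≤-trans u≤b b≤2))
        (trans (cong (κ *_) (trans (cong (_- M) (sym b-M)) (ring16 M (½ * ⅓ * (b - a))))) (sym (ℚ.*-assoc κ (½ * ⅓) (b - a)))) refl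

      -- The longer sums at the midpoint are at least -ω (b - a). The new left end lies a sixth of
      -- the width further left, where the slope κ raises them by ω (b - a), so there they are
      -- nonnegative.
      positive : 0ℚ ≤ cosSum (4 ℕ.+ m) M → Brackets (suc m) (⅔ * a + ⅓ * b) b
      positive 0≤c = record
        { ⅔≤a = ℚ.≤-trans ⅔≤a a≤l ; a≤b = ℚ.≤-trans l≤M (ℚ.≤-trans M≤u u≤b) ; b≤2 = b≤2
        ; left = λ N le → chain N (ω * (b - a)) (cosSum N M) (cosSum N (⅔ * a + ⅓ * b)) (at-M N (ℕ.≤-trans (ℕ.n≤1+n _) le))
            (beyond {2} (ℕ.≤-trans (s≤s (s≤s z≤n)) le) (λ N → ω * (b - a) ≤ cosSum N (⅔ * a + ⅓ * b) - cosSum N M) gap-l)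
        ; right = λ N le → right N (ℕ.≤-trans (ℕ.n≤1+n _) le)
        ; error = error′ (ring19 a b) }
        where
        at-M : ∀ N → 4 ℕ.+ m ℕ.≤ N → - (ω * (b - a)) ≤ cosSum N M
        at-M N le = beyond le (λ N → - (ω * (b - a)) ≤ cosSum N M) (λ n →
          ℚ.≤-trans (≤-by (ℚ.+-mono-≤ 0≤c (ℚ.neg-antimono-≤ err≤)) (ℚ.+-identityˡ (- (ω * (b - a)))) refl)
            (proj₁ (cosSum-error (3 ℕ.+ m) M M²≤4 n)))
        chain : ∀ (N : ℕ) w c d → - w ≤ c → w ≤ d - c → 0ℚ ≤ d
        chain _ w c d p q = ≤-by (ℚ.+-mono-≤ p q) (ℚ.+-inverseˡ w) (ring5 c d)

      negative : cosSum (4 ℕ.+ m) M ≤ 0ℚ → Brackets (suc m) a (⅓ * a + ⅔ * b)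
      negative c≤0 = record
        { ⅔≤a = ⅔≤a ; a≤b = ℚ.≤-trans a≤l (ℚ.≤-trans l≤M M≤u) ; b≤2 = ℚ.≤-trans u≤b b≤2
        ; left = λ N le → left N (ℕ.≤-trans (ℕ.n≤1+n _) le)
        ; right = λ N le → chain (ω * (b - a)) (cosSum N M) (cosSum N (⅓ * a + ⅔ * b)) (at-M N (ℕ.≤-trans (ℕ.n≤1+n _) le))
            (beyond {2} (ℕ.≤-trans (s≤s (s≤s z≤n)) le) (λ N → ω * (b - a) ≤ cosSum N M - cosSum N (⅓ * a + ⅔ * b)) gap-u)
        ; error = error′ (ring20 a b) }
        where
        at-M : ∀ N → 4 ℕ.+ m ℕ.≤ N → cosSum N M ≤ ω * (b - a)
        at-M N le = beyond le (λ N → cosSum N M ≤ ω * (b - a)) (λ n →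
          ℚ.≤-trans (proj₂ (cosSum-error (3 ℕ.+ m) M M²≤4 n)) (≤-by (ℚ.+-mono-≤ c≤0 err≤) refl (ℚ.+-identityˡ (ω * (b - a)))))
        chain : ∀ w c d → c ≤ w → w ≤ c - d → d ≤ 0ℚ
        chain w c d p q = 0≤q-p⇒p≤q (≤-by (≤⇒0≤- (ℚ.≤-trans p q)) refl (lem c d))
          where
          lem : ∀ c d → c - d - c ≡ 0ℚ - d
          lem = solve 2 (λ c d → c :- d :- c := con 0ℚ :- d) refl

      refine : ∀ s → (s ≡ true → 0ℚ ≤ cosSum (4 ℕ.+ m) M) → (s ≡ false → cosSum (4 ℕ.+ m) M ≤ 0ℚ) →
        Brackets (suc m) (proj₁ (trisect s (a , b))) (proj₂ (trisect s (a , b)))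
      refine true  p n = positive (p refl)
      refine false p n = negative (n refl)

  abstract
    does-true : ∀ {P : Set} (d : Dec P) → does d ≡ true → P
    does-true (yes p) e = p

    does-false : ∀ {P : Set} (d : Dec P) → does d ≡ false → ¬ P
    does-false (no n) e = n

    brackets : ∀ m → Brackets m (lower (suc m)) (upper (suc m))
    brackets zero    = subst (λ p → Brackets 0 (proj₁ p) (proj₂ p)) (sym bracket-1) brackets-1
    brackets (suc m) = Step.refine m (lower (suc m)) (upper (suc m)) (brackets m) (midpointPositive (suc m) (bracket (suc m)))
      (λ e → ℚ.<⇒≤ (does-true (0ℚ ℚ.<? cosSum (4 ℕ.+ m) (½ * (lower (suc m) + upper (suc m)))) e))
      (λ e → ℚ.≮⇒≥ (does-false (0ℚ ℚ.<? cosSum (4 ℕ.+ m) (½ * (lower (suc m) + upper (suc m)))) e))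

  halfπ : ℝ
  halfπ = mkℝ lower cauchy-lower

  abstract
    -- The truncated sums at the two ends of a bracket have opposite signs, so by the Lipschitz
    -- bound each is at most a constant times the width.
    cos-halfπ : cos halfπ ≈ℝ ℕ→ℝ 0
    cos-halfπ = mk≈ (null-cong {λ N → cosSum N (lower N)} (λ N → sym (ℚ.+-identityʳ (cosSum N (lower N))))
      (null-shift 4 {λ N → cosSum N (lower N)}
        (null-dominated {λ m → (C + C) * width (suc m)} dom
          (null-* {λ _ → C + C} {λ m → width (suc m)} (C + C) 0≤2C (λ _ → ℚ.≤-reflexive (ℚ.0≤p⇒∣p∣≡p 0≤2C))
            (geometric-null (λ m → 0≤width (suc m))
              (λ m → ℚ.≤-reflexive (trisect-width (midpointPositive (suc m) (bracket (suc m))) (lower (suc m)) (upper (suc m)))))))))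
      where
      open CosBound (fromℕℚ 2) (0≤fromℕℚ 2)
      0≤2C : 0ℚ ≤ C + C
      0≤2C = +-nonneg 0≤C 0≤C

      in-range : ∀ {x} → ⅔ ≤ x → x ≤ fromℕℚ 2 → ∣ x ∣ ≤ fromℕℚ 2
      in-range ⅔≤x x≤2 = ≤-by x≤2 (sym (ℚ.0≤p⇒∣p∣≡p (ℚ.≤-trans 0≤⅔ ⅔≤x))) refl

      lipschitz : ∀ N x y → ∣ x ∣ ≤ fromℕℚ 2 → ∣ y ∣ ≤ fromℕℚ 2 → ∀ {w} → ∣ x - y ∣ ≤ w → ∣ cosSum N x - cosSum N y ∣ ≤ C * w
      lipschitz N x y hx hy {w} h = ℚ.≤-trans (sum-lipschitz x y hx hy N)
        (*-mono-≤ (ℚ.≤-trans (ℚ.0≤∣p∣ (G N)) (ℚ.≤-reflexive (ℚ.0≤p⇒∣p∣≡p (0≤G N)))) (G≤C N) (ℚ.0≤∣p∣ (x - y)) h)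
        where
        0≤G : ∀ n → 0ℚ ≤ G n
        0≤G zero    = ℚ.≤-refl
        0≤G (suc n) = +-nonneg (0≤G n) (0≤g n)

      -- The signs for 4 + m terms are known at bracket 1 + m, whereas the diagonal sequence
      -- evaluates at bracket 4 + m; passing from one to the other costs a second C times the width.
      dom : ∀ m → ∣ cosSum (4 ℕ.+ m) (lower (4 ℕ.+ m)) ∣ ≤ ∣ (C + C) * width (suc m) ∣
      dom m = ≤-by
        (ℚ.≤-trans (ℚ.∣p+q∣≤∣p∣+∣q∣ (c y - c x) (c x)) (ℚ.+-mono-≤ moved small))
        (cong ∣_∣ (lem (c y) (c x)))
        (trans (sym (ℚ.*-distribʳ-+ w C C)) (sym (ℚ.0≤p⇒∣p∣≡p (*-nonneg 0≤2C (0≤width (suc m))))))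
        where
        x y w : ℚ
        x = lower (suc m)
        y = lower (4 ℕ.+ m)
        w = width (suc m)
        c : ℚ → ℚ
        c = cosSum (4 ℕ.+ m)
        open Brackets
        lem : ∀ a b → a - b + b ≡ a
        lem = solve 2 (λ a b → a :- b :+ b := a) refl
        y≤2 : y ≤ fromℕℚ 2
        y≤2 = ℚ.≤-trans (a≤b (brackets (3 ℕ.+ m))) (b≤2 (brackets (3 ℕ.+ m)))
        x≤2 : x ≤ fromℕℚ 2
        x≤2 = ℚ.≤-trans (a≤b (brackets m)) (b≤2 (brackets m))
        moved : ∣ c y - c x ∣ ≤ C * w
        moved = lipschitz (4 ℕ.+ m) y x (in-range (⅔≤a (brackets (3 ℕ.+ m))) y≤2) (in-range (⅔≤a (brackets m)) x≤2)
          (lower-close (suc m) 3)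
        small : ∣ c x ∣ ≤ C * w
        small = ≤-by (ℚ.≤-trans (ℚ.≤-trans (≤-by (ℚ.+-monoʳ-≤ (c x) (ℚ.neg-antimono-≤ (right (brackets m) (4 ℕ.+ m) ℕ.≤-refl))) (ℚ.+-identityʳ (c x)) refl)
            (p≤∣p∣ (c x - c (upper (suc m)))))
          (lipschitz (4 ℕ.+ m) x (upper (suc m)) (in-range (⅔≤a (brackets m)) x≤2)
            (in-range (ℚ.≤-trans (⅔≤a (brackets m)) (a≤b (brackets m))) (b≤2 (brackets m)))
            (ℚ.≤-reflexive (trans (∣p-q∣≡∣q-p∣ x (upper (suc m))) (ℚ.0≤p⇒∣p∣≡p (0≤width (suc m)))))))
          (sym (ℚ.0≤p⇒∣p∣≡p (left (brackets m) (4 ℕ.+ m) ℕ.≤-refl))) refl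
          where
          p≤∣p∣ : ∀ p → p ≤ ∣ p ∣
          p≤∣p∣ p with ℚ.≤-total 0ℚ p
          ... | inj₁ h = ℚ.≤-reflexive (sym (ℚ.0≤p⇒∣p∣≡p h))
          ... | inj₂ h = ℚ.≤-trans h (ℚ.0≤∣p∣ p)

-- Chebyshev polynomials at even indices and at cosines.

module ChebyshevU (R : CommutativeRing 0ℓ 0ℓ) where
  open import Data.Integer using (+_)
  open import Data.Nat as ℕ using (ℕ; zero; suc)
  import Data.Nat.Properties as ℕ
  open import Relation.Binary.PropositionalEquality as ≡ using (_≡_)
  open CommutativeRing R hiding (zero)
  open import Relation.Binary.Reasoning.Setoid setoid
  open IntegerCoefficients R using (module Solver; fromInt)
  open Solver

  two four : Carrier
  two = 1# + 1#
  four = fromInt (+ 4)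

  Regular : Carrier → Set
  Regular x = ∀ y → x * y ≈ 0# → y ≈ 0#

  regular-cong : ∀ {x y} → x ≈ y → Regular x → Regular y
  regular-cong e r z h = r z (trans (*-congʳ e) h)

  regular-* : ∀ {x y} → Regular x → Regular y → Regular (x * y)
  regular-* r s z h = s z (r _ (trans (sym (*-assoc _ _ _)) h))

  regular-*ˡ : ∀ {x y} → Regular (x * y) → Regular x
  regular-*ˡ {x} {y} r z h = r z (trans (trans (*-congʳ (*-comm x y)) (*-assoc y x z)) (trans (*-congˡ h) (zeroʳ y)))

  regular-cancel : ∀ {x y z} → Regular x → x * y ≈ x * z → y ≈ z
  regular-cancel {x} {y} {z} r h = trans (solve 2 (λ y z → y := y :- z :+ z) refl y z)
    (trans (+-congʳ (r (y - z) (trans (solve 3 (λ x y z → x :* (y :- z) := x :* y :- x :* z) refl x y z) (trans (+-congʳ h) (-‿inverseʳ _)))))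
      (+-identityˡ z))

  U# : ℕ → Carrier → Carrier
  U# = chebyshevU rawRing

  -- U₂ₙ as a polynomial in the square of the variable
  P : ℕ → Carrier → Carrier
  P zero          z = 1#
  P (suc zero)    z = four * z - 1#
  P (suc (suc n)) z = (four * z - two) * P (suc n) z - P n z

  U-even : ∀ n y → U# (2 ℕ.* n) y ≈ P n (y * y)
  U-even n y = trans (reflexive (≡.cong (λ k → U# k y) (2*≡ n))) (go n)
    where
    dbl : ℕ → ℕ
    dbl zero    = zero
    dbl (suc n) = suc (suc (dbl n))
    2*≡ : ∀ n → 2 ℕ.* n ≡ dbl n
    2*≡ zero    = ≡.refl
    2*≡ (suc n) = ≡.trans (ℕ.*-suc 2 n) (≡.cong (λ k → suc (suc k)) (2*≡ n))
    four-step : ∀ k → U# (suc (suc (suc (suc k)))) y ≈ (four * (y * y) - two) * U# (suc (suc k)) y - U# k y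
    four-step k = solve 3 (λ y a b → let two = con (+ 1) :+ con (+ 1) ; u₂ = two :* y :* a :+ :- b in
      two :* y :* (two :* y :* u₂ :+ :- a) :+ :- u₂ := (con (+ 4) :* (y :* y) :- two) :* u₂ :- b) refl y (U# (suc k) y) (U# k y)
    go : ∀ n → U# (dbl n) y ≈ P n (y * y)
    go zero          = refl
    go (suc zero)    = solve 1 (λ y → let two = con (+ 1) :+ con (+ 1) in two :* y :* (two :* y) :+ :- con (+ 1) := con (+ 4) :* (y :* y) :- con (+ 1)) refl y
    go (suc (suc n)) = trans (four-step (dbl n)) (+-cong (*-congˡ (go (suc n))) (-‿cong (go n)))

  -- For c j = cos jθ this is sin θ Uⱼ(cos θ) = sin (j + 1)θ multiplied by 2 sin θ, which turns both
  -- sides into cosines; both satisfy the recursion of the Chebyshev polynomials.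
  U-cosine : ∀ (c : ℕ → Carrier) → c 0 ≈ 1# → (∀ j → c (suc (suc j)) ≈ two * c 1 * c (suc j) - c j) →
    ∀ j → two * (1# - c 1 * c 1) * U# j (c 1) ≈ c j - c (suc (suc j))
  U-cosine c c₀ rec zero = trans
    (solve 1 (λ x → let two = con (+ 1) :+ con (+ 1) in two :* (con (+ 1) :- x :* x) :* con (+ 1) := con (+ 1) :- (two :* x :* x :- con (+ 1))) refl (c 1))
    (+-cong (sym c₀) (-‿cong (trans (+-congˡ (-‿cong (sym c₀))) (sym (rec 0)))))
  U-cosine c c₀ rec (suc zero) = trans
    (solve 1 (λ x → let two = con (+ 1) :+ con (+ 1) in two :* (con (+ 1) :- x :* x) :* (two :* x) := x :- (two :* x :* (two :* x :* x :- con (+ 1)) :- x)) refl (c 1))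
    (+-congˡ (-‿cong (trans (+-congʳ (*-congˡ (trans (+-congˡ (-‿cong (sym c₀))) (sym (rec 0))))) (sym (rec 1)))))
  U-cosine c c₀ rec (suc (suc j)) = begin
    two * s * (two * x * U# (suc j) x + - U# j x)
      ≈⟨ solve 5 (λ t s x u v → t :* s :* (t :* x :* u :+ :- v) := t :* x :* (t :* s :* u) :- t :* s :* v) refl two s x (U# (suc j) x) (U# j x) ⟩
    two * x * (two * s * U# (suc j) x) - two * s * U# j x
      ≈⟨ +-cong (*-congˡ (U-cosine c c₀ rec (suc j))) (-‿cong (U-cosine c c₀ rec j)) ⟩
    two * x * (c (suc j) - c (suc (suc (suc j)))) - (c j - c (suc (suc j)))
      ≈⟨ solve 5 (λ t a b d e → t :* (a :- b) :- (d :- e) := (t :* a :- d) :- (t :* b :- e)) refl (two * x) (c (suc j)) (c (suc (suc (suc j)))) (c j) (c (suc (suc j))) ⟩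
    (two * x * c (suc j) - c j) - (two * x * c (suc (suc (suc j))) - c (suc (suc j)))
      ≈⟨ +-cong (sym (rec j)) (-‿cong (sym (rec (suc (suc j))))) ⟩
    c (suc (suc j)) - c (suc (suc (suc (suc j)))) ∎
    where
    x = c 1
    s = 1# - x * x

-- Rational angles in units of π, and the nodes k/(2n + 1).

module RationalIdentities where
  open import Data.Rational
  open import Data.Rational.Solver using (module +-*-Solver)
  open import Relation.Binary.PropositionalEquality using (_≡_; refl)
  open +-*-Solver

  r+1 : ∀ r → r + 1ℚ ≡ (r + ½) + ½
  r+1 = solve 1 (λ r → r :+ con 1ℚ := (r :+ con ½) :+ con ½) refl

  r+½-½ : ∀ r → r ≡ (r + ½) - ½
  r+½-½ = solve 1 (λ r → r := (r :+ con ½) :- con ½) refl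

  sum-of-± : ∀ r s → (r + s) + (r - s) ≡ r + r
  sum-of-± = solve 2 (λ r s → (r :+ s) :+ (r :- s) := r :+ r) refl

  difference-of-± : ∀ r s → (r + s) - (r - s) ≡ s + s
  difference-of-± = solve 2 (λ r s → (r :+ s) :- (r :- s) := s :+ s) refl

  [1+t]r : ∀ t r → (1ℚ + t) * r ≡ t * r + r
  [1+t]r = solve 2 (λ t r → (con 1ℚ :+ t) :* r := t :* r :+ r) refl

  [1+t]r′ : ∀ t r → (1ℚ + t) * r ≡ r + t * r
  [1+t]r′ = solve 2 (λ t r → (con 1ℚ :+ t) :* r := r :+ t :* r) refl

  [1+t]r-r : ∀ t r → t * r ≡ (1ℚ + t) * r - r
  [1+t]r-r = solve 2 (λ t r → t :* r := (con 1ℚ :+ t) :* r :- r) refl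

  -r+[1+t]r : ∀ t r → t * r ≡ - r + (1ℚ + t) * r
  -r+[1+t]r = solve 2 (λ t r → t :* r := :- r :+ (con 1ℚ :+ t) :* r) refl

  s+[1+t] : ∀ s t → s + (1ℚ + t) ≡ s + t + 1ℚ
  s+[1+t] = solve 2 (λ s t → s :+ (con 1ℚ :+ t) := s :+ t :+ con 1ℚ) refl

  swap-factors : ∀ a b q → a * (b * q) ≡ b * (a * q)
  swap-factors = solve 3 (λ a b q → a :* (b :* q) := b :* (a :* q)) refl

module Nodes (n : ℕ) where
  open import Data.Nat as ℕ using (zero; suc)
  open import Data.Rational as ℚ using (ℚ; 0ℚ; 1ℚ)
  import Data.Rational.Properties as ℚ
  open import Relation.Binary.PropositionalEquality as ≡ using (_≡_)

  q : ℚ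
  q = recip (suc (2 ℕ.* n))

  node : ℕ → ℚ
  node k = fromℕℚ k ℚ.* q

  0<q : 0ℚ ℚ.< q
  0<q = ℚ.positive⁻¹ q {{ℚ.normalize-pos 1 (suc (2 ℕ.* n))}}

  fromℕℚ-+ : ∀ i j → fromℕℚ (i ℕ.+ j) ≡ fromℕℚ i ℚ.+ fromℕℚ j
  fromℕℚ-+ zero    j = ≡.sym (ℚ.+-identityˡ (fromℕℚ j))
  fromℕℚ-+ (suc i) j = ≡.trans (fromℕℚ-suc (i ℕ.+ j)) (≡.trans (≡.cong (1ℚ ℚ.+_) (fromℕℚ-+ i j))
    (≡.trans (≡.sym (ℚ.+-assoc 1ℚ (fromℕℚ i) (fromℕℚ j))) (≡.cong (ℚ._+ fromℕℚ j) (≡.sym (fromℕℚ-suc i)))))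

  node-+ : ∀ i j → node (i ℕ.+ j) ≡ node i ℚ.+ node j
  node-+ i j = ≡.trans (≡.cong (ℚ._* q) (fromℕℚ-+ i j)) (ℚ.*-distribʳ-+ q (fromℕℚ i) (fromℕℚ j))

  node-< : ∀ {i j} → i ℕ.< j → node i ℚ.< node j
  node-< {i} {j} i<j = ℚ.*-monoˡ-<-pos q {{ℚ.positive 0<q}}
    (ℚ.<-≤-trans (≡.subst (fromℕℚ i ℚ.<_) (≡.sym (fromℕℚ-suc i)) (p<1+p (fromℕℚ i))) (fromℕℚ-mono i<j))

  node-end : node (suc (2 ℕ.* n)) ≡ 1ℚ
  node-end = fromℕℚ*recip (2 ℕ.* n)

-- Zeros of U₂ₙ from the functional equation of the cosine.

-- C r stands for cos (r π).
module Cosine (R : CommutativeRing 0ℓ 0ℓ) (C : Rat.ℚ → CommutativeRing.Carrier R) where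
  open import Data.Integer using (+_)
  open import Data.Nat as ℕ using (ℕ; zero; suc)
  import Data.Nat.Properties as ℕ
  open import Data.Rational as ℚ using (ℚ; 0ℚ; 1ℚ; ½)
  import Data.Rational.Properties as ℚ
  open import Data.Sum using (inj₁; inj₂)
  open import Relation.Binary.PropositionalEquality as ≡ using (_≡_)
  open CommutativeRing R hiding (zero)
  open import Relation.Binary.Reasoning.Setoid setoid
  open IntegerCoefficients R using (module Solver; fromInt)
  open Solver
  open ChebyshevU R
  open RationalIdentities

  module _
    (C-± : ∀ r s → C (r ℚ.+ s) + C (r ℚ.- s) ≈ two * C r * C s)
    (C-0 : C 0ℚ ≈ 1#) (C-½ : C ½ ≈ 0#) (two-regular : Regular two)
    (1-C-regular : ∀ r → 0ℚ ℚ.< r → r ℚ.≤ ½ → Regular (1# - C r))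
    (C-half-regular : ∀ r → 0ℚ ℚ.< r → r ℚ.≤ ½ → Regular (C (½ ℚ.* r))) where

    C-cong : ∀ {r s} → r ≡ s → C r ≈ C s
    C-cong e = reflexive (≡.cong C e)

    C-neg : ∀ r → C (ℚ.- r) ≈ C r
    C-neg r = begin
      C (ℚ.- r)                             ≈⟨ solve 2 (λ a b → b := a :+ b :- a) refl (C r) (C (ℚ.- r)) ⟩
      C r + C (ℚ.- r) - C r                 ≈⟨ +-congʳ (+-cong (C-cong (ℚ.+-identityˡ r)) (C-cong (ℚ.+-identityˡ (ℚ.- r)))) ⟨
      C (0ℚ ℚ.+ r) + C (0ℚ ℚ.- r) - C r     ≈⟨ +-congʳ (C-± 0ℚ r) ⟩
      two * C 0ℚ * C r - C r                ≈⟨ +-congʳ (*-congʳ (*-congˡ C-0)) ⟩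
      two * 1# * C r - C r                  ≈⟨ solve 1 (λ a → (con (+ 1) :+ con (+ 1)) :* con (+ 1) :* a :- a := a) refl (C r) ⟩
      C r                                   ∎

    C-+1 : ∀ r → C (r ℚ.+ 1ℚ) ≈ - C r
    C-+1 r = begin
      C (r ℚ.+ 1ℚ)                                        ≈⟨ solve 2 (λ a b → a := a :+ b :- b) refl (C (r ℚ.+ 1ℚ)) (C r) ⟩
      C (r ℚ.+ 1ℚ) + C r - C r                            ≈⟨ +-congʳ (+-cong (C-cong (r+1 r)) (C-cong (r+½-½ r))) ⟩
      C ((r ℚ.+ ½) ℚ.+ ½) + C ((r ℚ.+ ½) ℚ.- ½) - C r     ≈⟨ +-congʳ (C-± (r ℚ.+ ½) ½) ⟩
      two * C (r ℚ.+ ½) * C ½ - C r                       ≈⟨ +-congʳ (trans (*-congˡ C-½) (zeroʳ _)) ⟩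
      0# - C r                                            ≈⟨ +-identityˡ _ ⟩
      - C r                                               ∎

    sin² : ℚ → Carrier
    sin² r = 1# - C r * C r

    sin²-neg : ∀ r → sin² (ℚ.- r) ≈ sin² r
    sin²-neg r = +-congˡ (-‿cong (*-cong (C-neg r) (C-neg r)))

    sin²-supplement : ∀ r → sin² (ℚ.- r ℚ.+ 1ℚ) ≈ sin² r
    sin²-supplement r = trans (+-congˡ (-‿cong (*-cong (C-+1 (ℚ.- r)) (C-+1 (ℚ.- r)))))
      (trans (solve 1 (λ a → con (+ 1) :- (:- a) :* (:- a) := con (+ 1) :- a :* a) refl (C (ℚ.- r))) (sin²-neg r))

    -- The factors of sin² r = (1 - cos r)(1 + cos r) are regular for angles up to π/2, the second
    -- because 1 + cos r = 2 cos² (r/2).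
    sin²-regular-½ : ∀ r → 0ℚ ℚ.< r → r ℚ.≤ ½ → Regular (sin² r)
    sin²-regular-½ r 0<r r≤½ = regular-cong factor
      (regular-* (1-C-regular r 0<r r≤½) (regular-* two-regular (regular-* half half)))
      where
      half = C-half-regular r 0<r r≤½
      h = ½ ℚ.* r
      1+C : 1# + C r ≈ two * (C h * C h)
      1+C = begin
        1# + C r                         ≈⟨ +-comm _ _ ⟩
        C r + 1#                         ≈⟨ +-cong (C-cong (½+½ r)) (trans (C-cong (ℚ.+-inverseʳ h)) C-0) ⟨
        C (h ℚ.+ h) + C (h ℚ.- h)        ≈⟨ C-± h h ⟩
        two * C h * C h                  ≈⟨ *-assoc _ _ _ ⟩
        two * (C h * C h)                ∎
      factor : (1# - C r) * (two * (C h * C h)) ≈ sin² r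
      factor = trans (*-congˡ (sym 1+C)) (solve 1 (λ c → (con (+ 1) :- c) :* (con (+ 1) :+ c) := con (+ 1) :- c :* c) refl (C r))

    sin²-regular : ∀ r → 0ℚ ℚ.< r → r ℚ.< 1ℚ → Regular (sin² r)
    sin²-regular r 0<r r<1 with ℚ.≤-total r ½
    ... | inj₁ r≤½ = sin²-regular-½ r 0<r r≤½
    ... | inj₂ ½≤r = regular-cong (sin²-supplement r) (sin²-regular-½ (ℚ.- r ℚ.+ 1ℚ)
      (≡.subst (ℚ._< ℚ.- r ℚ.+ 1ℚ) (ℚ.+-inverseˡ r) (ℚ.+-monoʳ-< (ℚ.- r) r<1))
      (≡.subst (ℚ.- r ℚ.+ 1ℚ ℚ.≤_) ≡.refl (ℚ.+-monoˡ-≤ 1ℚ (ℚ.neg-antimono-≤ ½≤r))))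

    -- The squared form of cos (r + s) - cos (r - s) = -2 sin r sin s, computed from the sum and the
    -- product of the two cosines.
    cosine-gap : ∀ r s → (C (r ℚ.+ s) - C (r ℚ.- s)) * (C (r ℚ.+ s) - C (r ℚ.- s)) ≈ two * two * (sin² r * sin² s)
    cosine-gap r s = begin
      (p - q) * (p - q)
        ≈⟨ solve 2 (λ p q → (p :- q) :* (p :- q) := (p :+ q) :* (p :+ q) :- (con (+ 1) :+ con (+ 1)) :* ((con (+ 1) :+ con (+ 1)) :* p :* q)) refl p q ⟩
      (p + q) * (p + q) - two * (two * p * q)
        ≈⟨ +-cong (*-cong (C-± r s) (C-± r s)) (-‿cong (*-congˡ product)) ⟩
      (two * C r * C s) * (two * C r * C s) - two * ((two * C r * C r - 1#) + (two * C s * C s - 1#))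
        ≈⟨ solve 2 (λ a b → let t = con (+ 1) :+ con (+ 1) in
             (t :* a :* b) :* (t :* a :* b) :- t :* ((t :* a :* a :- con (+ 1)) :+ (t :* b :* b :- con (+ 1)))
             := t :* t :* ((con (+ 1) :- a :* a) :* (con (+ 1) :- b :* b))) refl (C r) (C s) ⟩
      two * two * (sin² r * sin² s) ∎
      where
      p = C (r ℚ.+ s)
      q = C (r ℚ.- s)
      double : ∀ r → C (r ℚ.+ r) ≈ two * C r * C r - 1#
      double r = begin
        C (r ℚ.+ r)                               ≈⟨ solve 2 (λ a b → a := a :+ b :- b) refl (C (r ℚ.+ r)) (C (r ℚ.- r)) ⟩
        C (r ℚ.+ r) + C (r ℚ.- r) - C (r ℚ.- r)   ≈⟨ +-cong (C-± r r) (-‿cong (trans (C-cong (ℚ.+-inverseʳ r)) C-0)) ⟩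
        two * C r * C r - 1#                      ∎
      product : two * p * q ≈ (two * C r * C r - 1#) + (two * C s * C s - 1#)
      product = trans (sym (C-± (r ℚ.+ s) (r ℚ.- s))) (+-cong (trans (C-cong (sum-of-± r s)) (double r)) (trans (C-cong (difference-of-± r s)) (double s)))

    module Roots (n : ℕ) where
      open Nodes n

      sin²-node : ∀ k → 0 ℕ.< k → k ℕ.< suc (2 ℕ.* n) → Regular (sin² (node k))
      sin²-node k 0<k k<N = sin²-regular (node k) (≡.subst (ℚ._< node k) (ℚ.*-zeroˡ q) (node-< 0<k))
        (≡.subst (node k ℚ.<_) node-end (node-< k<N))

      c : ℕ → ℕ → Carrier
      c k j = C (fromℕℚ j ℚ.* node k)

      -- By `U-cosine`, 2 sin² θ times the value is cos 2nθ - cos (2n + 2)θ with (2n + 1)θ = kπ. The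
      -- two angles are kπ - θ and kπ + θ, whose cosines agree.
      root : ∀ k → 0 ℕ.< k → k ℕ.< suc (2 ℕ.* n) → P n (C (node k) * C (node k)) ≈ 0#
      root k 0<k k<N = trans (sym (U-even n (C r)))
        (sin²-node k 0<k k<N (U# (2 ℕ.* n) (C r)) (two-regular _ vanish))
        where
        r = node k
        c₁ : c k 1 ≈ C r
        c₁ = C-cong (ℚ.*-identityˡ r)
        rec : ∀ j → c k (suc (suc j)) ≈ two * c k 1 * c k (suc j) - c k j
        rec j = begin
          c k (suc (suc j))                             ≈⟨ solve 2 (λ a b → a := a :+ b :- b) refl (c k (suc (suc j))) (c k j) ⟩
          c k (suc (suc j)) + c k j - c k j             ≈⟨ +-congʳ (+-cong (C-cong up) (C-cong down)) ⟩
          C (s ℚ.+ r) + C (s ℚ.- r) - c k j             ≈⟨ +-congʳ (C-± s r) ⟩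
          two * c k (suc j) * C r - c k j               ≈⟨ +-congʳ (solve 3 (λ t a b → t :* a :* b := t :* b :* a) refl two (c k (suc j)) (C r)) ⟩
          two * C r * c k (suc j) - c k j               ≈⟨ +-congʳ (*-congʳ (*-congˡ c₁)) ⟨
          two * c k 1 * c k (suc j) - c k j             ∎
          where
          s = fromℕℚ (suc j) ℚ.* r
          up : fromℕℚ (suc (suc j)) ℚ.* r ≡ s ℚ.+ r
          up = ≡.trans (≡.cong (ℚ._* r) (fromℕℚ-suc (suc j))) ([1+t]r (fromℕℚ (suc j)) r)
          down : fromℕℚ j ℚ.* r ≡ s ℚ.- r
          down = ≡.trans ([1+t]r-r (fromℕℚ j) r) (≡.cong (λ t → t ℚ.* r ℚ.- r) (≡.sym (fromℕℚ-suc j)))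
        c-0 : c k 0 ≈ 1#
        c-0 = trans (C-cong (ℚ.*-zeroˡ r)) C-0
        C-+k : ∀ k s t → C s ≈ C t → C (s ℚ.+ fromℕℚ k) ≈ C (t ℚ.+ fromℕℚ k)
        C-+k zero    s t e = trans (C-cong (ℚ.+-identityʳ s)) (trans e (sym (C-cong (ℚ.+-identityʳ t))))
        C-+k (suc k) s t e = trans (C-cong (suc-shift s)) (trans (C-+1 (s ℚ.+ fromℕℚ k))
          (trans (-‿cong (C-+k k s t e)) (trans (sym (C-+1 (t ℚ.+ fromℕℚ k))) (sym (C-cong (suc-shift t))))))
          where
          suc-shift : ∀ s → s ℚ.+ fromℕℚ (suc k) ≡ s ℚ.+ fromℕℚ k ℚ.+ 1ℚ
          suc-shift s = ≡.trans (≡.cong (s ℚ.+_) (fromℕℚ-suc k)) (s+[1+t] s (fromℕℚ k))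
        full-turn : fromℕℚ (suc (2 ℕ.* n)) ℚ.* r ≡ fromℕℚ k
        full-turn = ≡.trans (swap-factors (fromℕℚ (suc (2 ℕ.* n))) (fromℕℚ k) q) (≡.trans (≡.cong (fromℕℚ k ℚ.*_) node-end) (ℚ.*-identityʳ (fromℕℚ k)))
        before : fromℕℚ (2 ℕ.* n) ℚ.* r ≡ ℚ.- r ℚ.+ fromℕℚ k
        before = ≡.trans (-r+[1+t]r (fromℕℚ (2 ℕ.* n)) r) (≡.cong (ℚ.- r ℚ.+_) (≡.trans (≡.cong (ℚ._* r) (≡.sym (fromℕℚ-suc (2 ℕ.* n)))) full-turn))
        after : fromℕℚ (suc (suc (2 ℕ.* n))) ℚ.* r ≡ r ℚ.+ fromℕℚ k
        after = ≡.trans (≡.cong (ℚ._* r) (fromℕℚ-suc (suc (2 ℕ.* n)))) (≡.trans ([1+t]r′ (fromℕℚ (suc (2 ℕ.* n))) r) (≡.cong (r ℚ.+_) full-turn))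
        vanish : two * (sin² r * U# (2 ℕ.* n) (C r)) ≈ 0#
        vanish = trans (sym (*-assoc _ _ _)) (≡.subst (λ s → two * (1# - C s * C s) * U# (2 ℕ.* n) (C s) ≈ 0#) (ℚ.*-identityˡ r) (begin
          two * (1# - c k 1 * c k 1) * U# (2 ℕ.* n) (c k 1)   ≈⟨ U-cosine (c k) c-0 rec (2 ℕ.* n) ⟩
          c k (2 ℕ.* n) - c k (suc (suc (2 ℕ.* n)))           ≈⟨ +-cong (C-cong before) (-‿cong (C-cong after)) ⟩
          C (ℚ.- r ℚ.+ fromℕℚ k) - C (r ℚ.+ fromℕℚ k)         ≈⟨ +-congʳ (C-+k k (ℚ.- r) r (C-neg r)) ⟩
          C (r ℚ.+ fromℕℚ k) - C (r ℚ.+ fromℕℚ k)             ≈⟨ -‿inverseʳ _ ⟩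
          0#                                                  ∎))

      -- Twice the difference is cos 2θ - cos 2φ, whose square is 4 sin² (θ + φ) sin² (θ - φ). As 0
      -- < l < k ≤ n, both angles lie strictly between 0 and π, and a factor of a regular element is
      -- regular.
      distinct : ∀ {k l} → l ℕ.< k → k ℕ.≤ n → 0 ℕ.< l → Regular (C (node k) * C (node k) - C (node l) * C (node l))
      distinct {k} {l} l<k k≤n 0<l = regular-*ˡ (regular-cong
        (trans gap (*-comm two _))
        (regular-*ˡ (regular-cong (sym (cosine-gap u v)) (regular-* (regular-* two-regular two-regular)
          (regular-* (sin²-node (k ℕ.+ l) (ℕ.<-≤-trans 0<l (ℕ.m≤n+m l k)) (ℕ.s≤s (≡.subst (k ℕ.+ l ℕ.≤_) (≡.cong (n ℕ.+_) (≡.sym (ℕ.+-identityʳ n))) (ℕ.+-mono-≤ k≤n (ℕ.≤-trans (ℕ.<⇒≤ l<k) k≤n)))))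
            (sin²-node (k ℕ.∸ l) (ℕ.m<n⇒0<n∸m l<k) (ℕ.s≤s (ℕ.≤-trans (ℕ.m∸n≤m k l) (ℕ.≤-trans k≤n (ℕ.m≤m+n n (n ℕ.+ 0)))))))))))
        where
        u = node (k ℕ.+ l)
        v = node (k ℕ.∸ l)
        back : l ℕ.+ (k ℕ.∸ l) ≡ k
        back = ℕ.m+[n∸m]≡n (ℕ.<⇒≤ l<k)
        u+v : u ℚ.+ v ≡ node k ℚ.+ node k
        u+v = ≡.trans (≡.sym (node-+ (k ℕ.+ l) (k ℕ.∸ l))) (≡.trans (≡.cong node (≡.trans (ℕ.+-assoc k l _) (≡.cong (k ℕ.+_) back))) (node-+ k k))
        u-v : u ℚ.- v ≡ node l ℚ.+ node l
        u-v = ≡.trans (≡.cong (ℚ._- v) (≡.trans (≡.cong node (≡.trans (ℕ.+-comm k l) (≡.trans (≡.cong (l ℕ.+_) (≡.sym back)) (≡.sym (ℕ.+-assoc l l _))))) (node-+ (l ℕ.+ l) (k ℕ.∸ l))))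
          (≡.trans (minus (node (l ℕ.+ l)) v) (node-+ l l))
          where
          minus : ∀ a b → a ℚ.+ b ℚ.- b ≡ a
          minus a b = ≡.trans (ℚ.+-assoc a b (ℚ.- b)) (≡.trans (≡.cong (a ℚ.+_) (ℚ.+-inverseʳ b)) (ℚ.+-identityʳ a))
        square : ∀ r → C (r ℚ.+ r) + 1# ≈ two * (C r * C r)
        square r = trans (+-congˡ (sym (trans (C-cong (ℚ.+-inverseʳ r)) C-0))) (trans (C-± r r) (*-assoc _ _ _))
        gap : C (u ℚ.+ v) - C (u ℚ.- v) ≈ two * (C (node k) * C (node k) - C (node l) * C (node l))
        gap = begin
          C (u ℚ.+ v) - C (u ℚ.- v)
            ≈⟨ +-cong (C-cong u+v) (-‿cong (C-cong u-v)) ⟩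
          C (node k ℚ.+ node k) - C (node l ℚ.+ node l)
            ≈⟨ solve 2 (λ a b → a :- b := (a :+ con (+ 1)) :- (b :+ con (+ 1))) refl _ _ ⟩
          (C (node k ℚ.+ node k) + 1#) - (C (node l ℚ.+ node l) + 1#)
            ≈⟨ +-cong (square (node k)) (-‿cong (square (node l))) ⟩
          two * (C (node k) * C (node k)) - two * (C (node l) * C (node l))
            ≈⟨ solve 3 (λ t a b → t :* a :- t :* b := t :* (a :- b)) refl two _ _ ⟩
          two * (C (node k) * C (node k) - C (node l) * C (node l)) ∎

-- The real cosine at rational multiples of π.

module RealCosine where
  open import Data.Integer as ℤ using (+_)
  import Data.Integer.Properties as ℤ
  open import Data.Nat as ℕ using (ℕ; zero; suc)
  import Data.Nat.Properties as ℕ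
  open import Data.Product using (_×_; _,_; ∃-syntax)
  open import Data.Rational as ℚ using (ℚ; 0ℚ; 1ℚ; ½; _+_; _*_; -_; _-_; _<_; _≤_; ∣_∣)
  import Data.Rational.Properties as ℚ
  import Data.Rational.Unnormalised as ℚᵘ
  import Data.Rational.Unnormalised.Properties as ℚᵘ
  open import Data.Rational.Solver using (module +-*-Solver)
  open import Relation.Binary.PropositionalEquality as ≡
  open import Relation.Nullary.Decidable using (toWitness)
  open +-*-Solver
  open RealRing hiding (Regular)
  open CosineZero
  open HalfPi
  open CosineAddition using (cos-±)
  open ℝ
  open ChebyshevU ℝ-commutativeRing using (Regular; regular-cong; two)

  angle : ℚ → ℝ
  angle r = ℚ→ℝ r *ℝ π

  C : ℚ → ℝ
  C r = cos (angle r)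

  abstract
    ⊞≈ : ∀ x y → x ⊞ y ≈ℝ x +ℝ y
    ⊞≈ x y = subst (x ⊞ y ≈ℝ_) (⊞-def x y) ≈-refl

    ⊠≈ : ∀ x y → x ⊠ y ≈ℝ x *ℝ y
    ⊠≈ x y = subst (x ⊠ y ≈ℝ_) (⊠-def x y) ≈-refl

    ⊟≈ : ∀ x → ⊟ x ≈ℝ -ℝ x
    ⊟≈ x = subst (⊟ x ≈ℝ_) (⊟-def x) ≈-refl

    1≈ : 1ℝ ≈ℝ ℕ→ℝ 1
    1≈ = subst (1ℝ ≈ℝ_) 1ℝ-def ≈-refl

    ⊞-raw : ∀ x y u v → x ≈ℝ y → u ≈ℝ v → x ⊞ u ≈ℝ y +ℝ v
    ⊞-raw x y u v h k = ≈-trans (+-cong h k) (⊞≈ y v)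

    ⊠-raw : ∀ x y u v → x ≈ℝ y → u ≈ℝ v → x ⊠ u ≈ℝ y *ℝ v
    ⊠-raw x y u v h k = ≈-trans (*-cong h k) (⊠≈ y v)

    two≈ : two ≈ℝ ℕ→ℝ 2
    two≈ = ≈-trans (⊞-raw 1ℝ (ℕ→ℝ 1) 1ℝ (ℕ→ℝ 1) 1≈ 1≈) (pointwise {ℕ→ℝ 1 +ℝ ℕ→ℝ 1} {ℕ→ℝ 2} (λ n → sym (fromℕℚ-suc 1)))

    angle-+ : ∀ r s → angle (r + s) ≈ℝ angle r +ℝ angle s
    angle-+ r s = pointwise (λ n → ℚ.*-distribʳ-+ (seq π n) r s)

    angle-- : ∀ r s → angle (r - s) ≈ℝ angle r +ℝ (-ℝ angle s)
    angle-- r s = pointwise (λ n → lem r s (seq π n))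
      where
      lem : ∀ r s p → (r - s) * p ≡ r * p + - (s * p)
      lem = solve 3 (λ r s p → (r :- s) :* p := r :* p :+ :- (s :* p)) refl

    ⊞⊠-cos-± : ∀ p q a b x y → p ≈ℝ cos (x +ℝ y) → q ≈ℝ cos (x +ℝ (-ℝ y)) → a ≈ℝ cos x → b ≈ℝ cos y → p ⊞ q ≈ℝ two ⊠ a ⊠ b
    ⊞⊠-cos-± p q a b x y hp hq ha hb = ≈-trans (⊞-raw p (cos (x +ℝ y)) q (cos (x +ℝ (-ℝ y))) hp hq)
      (≈-trans (cos-± x y) (≈-sym (⊠-raw (two ⊠ a) (ℕ→ℝ 2 *ℝ cos x) b (cos y) (⊠-raw two (ℕ→ℝ 2) a (cos x) two≈ ha) hb)))

    C-± : ∀ r s → C (r + s) ⊞ C (r - s) ≈ℝ two ⊠ C r ⊠ C s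
    C-± r s = ⊞⊠-cos-± (C (r + s)) (C (r - s)) (C r) (C s) (angle r) (angle s)
      (cos-cong {angle (r + s)} {angle r +ℝ angle s} (angle-+ r s)) (cos-cong {angle (r - s)} {angle r +ℝ (-ℝ angle s)} (angle-- r s)) ≈-refl ≈-refl

    cosTerm-0≡0 : ∀ k → cosTerm (suc k) 0ℚ ≡ 0ℚ
    cosTerm-0≡0 k = ≡.trans (cosTerm-suc k 0ℚ) (lem (cosTerm k 0ℚ) (ratio k))
      where
      lem : ∀ c r → - (c * (0ℚ * 0ℚ) * r) ≡ 0ℚ
      lem = solve 2 (λ c r → :- (c :* (con 0ℚ :* con 0ℚ) :* r) := con 0ℚ) refl

    cosSum-0≡1 : ∀ n → cosSum (suc n) 0ℚ ≡ 1ℚ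
    cosSum-0≡1 zero    = refl
    cosSum-0≡1 (suc n) = ≡.trans (cong₂ _+_ (cosSum-0≡1 n) (cosTerm-0≡0 n)) (ℚ.+-identityʳ 1ℚ)

    C-0 : C 0ℚ ≈ℝ 1ℝ
    C-0 = subst (C 0ℚ ≈ℝ_) (sym 1ℝ-def) (mk≈ (null-shift 1 {λ n → cosSum n (0ℚ * seq π n) - fromℕℚ 1}
      (null-cong {λ _ → 0ℚ} (λ n → sym (≡.trans (cong (_- fromℕℚ 1) (≡.trans (cong (cosSum (suc n)) (ℚ.*-zeroˡ (seq π (suc n)))) (cosSum-0≡1 n))) (ℚ.+-inverseʳ 1ℚ))) null-0)))

    C-½ : C ½ ≈ℝ 0ℝ
    C-½ = subst (C ½ ≈ℝ_) (sym 0ℝ-def) (≈-trans (cos-cong {angle ½} {halfπ} (pointwise (λ n → lem (lower n)))) cos-halfπ)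
      where
      lem : ∀ l → ½ * (fromℕℚ 2 * l) ≡ l
      lem = solve 1 (λ l → con ½ :* (con (fromℕℚ 2) :* l) := l) refl

    bounded-below⇒regular : ∀ x c N → 0ℚ < c → (∀ n → c ≤ seq x (n ℕ.+ N)) → Regular x
    bounded-below⇒regular x c N 0<c h = bounded-away⇒regular x c N 0<c (λ n le →
      ℚ.≤-trans (beyond le (λ n → c ≤ seq x n) h) (p≤∣p∣ (seq x n)))
      where
      open import Data.Sum using ([_,_]′)
      p≤∣p∣ : ∀ p → p ≤ ∣ p ∣
      p≤∣p∣ p = [ (λ h → ℚ.≤-reflexive (sym (ℚ.0≤p⇒∣p∣≡p h))) , (λ h → ℚ.≤-trans h (ℚ.0≤∣p∣ p)) ]′ (ℚ.≤-total 0ℚ p)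

    two-regular : Regular two
    two-regular = regular-cong (≈-sym two≈) (bounded-below⇒regular (ℕ→ℝ 2) (fromℕℚ 2) 0 (ℚ.positive⁻¹ (fromℕℚ 2)) (λ n → ℚ.≤-refl))

    ⅔≤lower : ∀ n → ⅔ ≤ lower (n ℕ.+ 2)
    ⅔≤lower n = subst (λ k → ⅔ ≤ lower k) (ℕ.+-comm 2 n) (Brackets.⅔≤a (brackets (suc n)))

    lower≤2 : ∀ n → lower (n ℕ.+ 2) ≤ fromℕℚ 2
    lower≤2 n = subst (λ k → lower k ≤ fromℕℚ 2) (ℕ.+-comm 2 n) (ℚ.≤-trans (Brackets.a≤b (brackets (suc n))) (Brackets.b≤2 (brackets (suc n))))

    -- The approximations of rπ lie between 4r/3 and 2, as those of π/2 lie between 2/3 and 2 from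
    -- index 2 on. There cos x ≤ 1 - x²/3 keeps 1 - cos away from 0, and at half the angle 1 - x²/2
    -- ≤ cos x keeps the cosine above 1/2.
    module Acute (r : ℚ) (0<r : 0ℚ < r) (r≤½ : r ≤ ½) where

      0≤r : 0ℚ ≤ r
      0≤r = ℚ.<⇒≤ 0<r

      0≤2⅔ : 0ℚ ≤ fromℕℚ 2 * ⅔
      0≤2⅔ = *-nonneg (0≤fromℕℚ 2) 0≤⅔

      c : ℚ
      c = r * (fromℕℚ 2 * ⅔)

      0<c : 0ℚ < c
      0<c = *-pos 0<r (ℚ.positive⁻¹ (fromℕℚ 2 * ⅔))

      z : ℕ → ℚ
      z n = r * (fromℕℚ 2 * lower (n ℕ.+ 2))

      c≤z : ∀ n → c ≤ z n
      c≤z n = *-mono-≤ 0≤r ℚ.≤-refl 0≤2⅔ (ℚ.*-monoˡ-≤-nonNeg (fromℕℚ 2) (⅔≤lower n))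

      0≤z : ∀ n → 0ℚ ≤ z n
      0≤z n = ℚ.≤-trans (ℚ.<⇒≤ 0<c) (c≤z n)

      z≤2 : ∀ n → z n ≤ fromℕℚ 2
      z≤2 n = ≤-by (*-mono-≤ 0≤r r≤½ (*-nonneg (0≤fromℕℚ 2) (ℚ.≤-trans 0≤⅔ (⅔≤lower n))) (ℚ.*-monoˡ-≤-nonNeg (fromℕℚ 2) (lower≤2 n)))
        refl refl

      1-C-bound : ∀ n → ⅓ * (c * c) ≤ fromℕℚ 1 + - cosSum (n ℕ.+ 2) (z n)
      1-C-bound n = ℚ.≤-trans
        (ℚ.*-monoˡ-≤-nonNeg ⅓ (square-≤ (ℚ.<⇒≤ 0<c) (c≤z n)))
        (≤-by (p-≤p- 1ℚ (cosSum-≤ n (z n) (square-≤4 (0≤z n) (z≤2 n)))) (lem (⅓ * (z n * z n))) refl)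
        where
        lem : ∀ x → 1ℚ - (1ℚ - x) ≡ x
        lem = solve 1 (λ x → con 1ℚ :- (con 1ℚ :- x) := x) refl

      1-C-regular : Regular (1ℝ ⊞ ⊟ C r)
      1-C-regular = regular-cong (≈-sym (⊞-raw 1ℝ (ℕ→ℝ 1) (⊟ C r) (-ℝ C r) 1≈ (⊟≈ (C r))))
        (bounded-below⇒regular (ℕ→ℝ 1 +ℝ (-ℝ C r)) (⅓ * (c * c)) 2 (*-pos (ℚ.positive⁻¹ ⅓) (*-pos 0<c 0<c)) 1-C-bound)

      y : ℕ → ℚ
      y n = ½ * r * (fromℕℚ 2 * lower (n ℕ.+ 2))

      y≡ : ∀ n → y n ≡ ½ * z n
      y≡ n = ℚ.*-assoc ½ r (fromℕℚ 2 * lower (n ℕ.+ 2))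

      0≤y : ∀ n → 0ℚ ≤ y n
      0≤y n = subst (0ℚ ≤_) (sym (y≡ n)) (*-nonneg 0≤½ (0≤z n))

      y≤1 : ∀ n → y n ≤ 1ℚ
      y≤1 n = ≤-by (ℚ.*-monoˡ-≤-nonNeg ½ (z≤2 n)) (sym (y≡ n)) refl

      C-half-bound : ∀ n → ½ ≤ cosSum (n ℕ.+ 2) (y n)
      C-half-bound n = ℚ.≤-trans
        (p-≤p- 1ℚ (ℚ.*-monoˡ-≤-nonNeg ½ (square-≤ (0≤y n) (y≤1 n))))
        (cosSum-≥ n (y n) (ℚ.≤-trans (square-≤ (0≤y n) (y≤1 n)) (toWitness {a? = 1ℚ * 1ℚ ℚ.≤? fromℕℚ 4} _)))

      C-half-regular : Regular (C (½ * r))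
      C-half-regular = bounded-below⇒regular (C (½ * r)) ½ 2 0<½ C-half-bound

  module Real = Cosine ℝ-commutativeRing C

  module Rootsℝ (n : ℕ) = Real.Roots C-± C-0 C-½ two-regular
    (λ r → Acute.1-C-regular r) (λ r → Acute.C-half-regular r) n

  abstract
    fraction≡ : ∀ h m → + h ℚ./ suc m ≡ fromℕℚ h * recip (suc m)
    fraction≡ h m = ℚ.toℚᵘ-injective (ℚᵘ.≃-trans (ℚ.toℚᵘ-fromℚᵘ (ℚᵘ.mkℚᵘ (+ h) m))
      (ℚᵘ.≃-sym (ℚᵘ.≃-trans (ℚ.toℚᵘ-homo-* (fromℕℚ h) (recip (suc m)))
        (ℚᵘ.≃-trans (ℚᵘ.*-congˡ {ℚ.toℚᵘ (fromℕℚ h)} (recip-toℚᵘ m))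
          (ℚᵘ.*≡* (cong₂ ℤ._*_ (ℤ.*-identityʳ (+ h)) (cong +_ (sym (ℕ.+-identityʳ (suc m))))))))))

    node≡ : ∀ h d → + h ℚ./ suc (2 ℕ.* d) ≡ Nodes.node d h
    node≡ h d = fraction≡ h (2 ℕ.* d)

    ξ-seq : ∀ h d n → seq (ξ h d) n ≡ cosSum n (+ h ℚ./ suc (2 ℕ.* d) * seq π n)
    ξ-seq h d n = refl

    C-seq : ∀ r n → seq (C r) n ≡ cosSum n (r * seq π n)
    C-seq r n = refl

    ξ≈C : ∀ h d r → + h ℚ./ suc (2 ℕ.* d) ≡ r → ξ h d ≈ℝ C r
    ξ≈C h d r e = pointwise {ξ h d} {C r} (λ n → ≡.trans (ξ-seq h d n) (≡.trans (cong (λ s → cosSum n (s * seq π n)) e) (sym (C-seq r n))))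

    ξ≈ : ∀ h d → ξ h d ≈ℝ C (Nodes.node d h)
    ξ≈ h d = ξ≈C h d (Nodes.node d h) (node≡ h d)

  -- The bound is asked of all terms of some equal sequence, so that bounds add up exactly under
  -- sums.
  AtLeast : ℚ → ℝ → Set
  AtLeast c x = ∃[ y ] x ≈ℝ y × (∀ n → c ≤ seq y n)

  abstract
    atLeast-square : ∀ x → AtLeast 0ℚ (x ⊠ x)
    atLeast-square x = x *ℝ x , ⊠≈ x x , λ n → 0≤x*x (seq x n)

    atLeast-1 : AtLeast 1ℚ 1ℝ
    atLeast-1 = ℕ→ℝ 1 , 1≈ , λ n → ℚ.≤-refl

    atLeast-+ : ∀ {c d x y} → AtLeast c x → AtLeast d y → AtLeast (c + d) (x ⊞ y)
    atLeast-+ {x = x} {y} (x′ , ex , hx) (y′ , ey , hy) = x′ +ℝ y′ ,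
      ⊞-raw x x′ y y′ ex ey , λ n → ℚ.+-mono-≤ (hx n) (hy n)

    atLeast-cong : ∀ {c x y} → x ≈ℝ y → AtLeast c x → AtLeast c y
    atLeast-cong e (x′ , ex , hx) = x′ , ≈-trans (≈-sym e) ex , hx

    atLeast⇒regular : ∀ {x} → AtLeast 1ℚ x → Regular x
    atLeast⇒regular {x} (y , e , h) = regular-cong (≈-sym e)
      (bounded-below⇒regular y 1ℚ 0 (ℚ.positive⁻¹ 1ℚ) (λ n → h (n ℕ.+ 0)))

-- The reduced Laplacian of the quotient.

module HalfGrid where
  open import Data.Bool using (Bool; false; not)
  open import Data.Integer as ℤ using (ℤ; +_)
  open import Data.List using (List; downFrom; cartesianProduct)
  open import Data.Nat as ℕ using (ℕ; zero; suc)
  import Data.Nat.Properties as ℕ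
  open import Data.Product using (_×_; _,_)
  open import Relation.Binary.PropositionalEquality as ≡ using (_≡_; _≢_)
  open import Relation.Nullary using (yes; no; contradiction)

  parity : ℕ → Bool
  parity zero    = false
  parity (suc k) = not (parity k)

  δ : ℕ → ℕ → ℕ
  δ zero    zero    = 1
  δ zero    (suc b) = 0
  δ (suc a) zero    = 0
  δ (suc a) (suc b) = δ a b

  δ-refl : ∀ a → δ a a ≡ 1
  δ-refl zero    = ≡.refl
  δ-refl (suc a) = δ-refl a

  δ-≢ : ∀ {a b} → a ≢ b → δ a b ≡ 0
  δ-≢ {zero}  {zero}  n = contradiction ≡.refl n
  δ-≢ {zero}  {suc b} n = ≡.refl
  δ-≢ {suc a} {zero}  n = ≡.refl
  δ-≢ {suc a} {suc b} n = δ-≢ (λ e → n (≡.cong suc e))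

  δ-sym : ∀ a b → δ a b ≡ δ b a
  δ-sym zero    zero    = ≡.refl
  δ-sym zero    (suc b) = ≡.refl
  δ-sym (suc a) zero    = ≡.refl
  δ-sym (suc a) (suc b) = δ-sym a b

  -- The two middle cells of a line are mirror images and neighbours of each other; in the quotient
  -- this edge becomes a loop, which lowers the degree at the middle from 2 to 1.
  diag : ℕ → ℕ
  diag zero    = 1
  diag (suc a) = 2

  path : ℕ → ℕ → ℕ
  path a b = δ (suc a) b ℕ.+ δ a (suc b)

  path-sym : ∀ a b → path a b ≡ path b a
  path-sym a b = ≡.trans (≡.cong₂ ℕ._+_ (δ-sym (suc a) b) (δ-sym a (suc b))) (ℕ.+-comm (δ b (suc a)) (δ (suc b) a))

  -- the Laplacian of a path with a free end at 0 and the sink beyond the other end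
  T : ℕ → ℕ → ℤ
  T a b = + (diag a ℕ.* δ a b) ℤ.- + path a b

  T-sym : ∀ a b → T a b ≡ T b a
  T-sym a b = ≡.cong₂ (λ x y → + x ℤ.- + y) lem (path-sym a b)
    where
    lem : diag a ℕ.* δ a b ≡ diag b ℕ.* δ b a
    lem with a ℕ.≟ b
    ... | yes ≡.refl = ≡.refl
    ... | no n = ≡.trans (≡.cong (diag a ℕ.*_) (δ-≢ n)) (≡.trans (ℕ.*-zeroʳ (diag a))
      (≡.sym (≡.trans (≡.cong (diag b ℕ.*_) (δ-≢ (λ e → n (≡.sym e)))) (ℕ.*-zeroʳ (diag b)))))

  vertices : ℕ → ℕ → List (ℕ × ℕ)
  vertices m n = cartesianProduct (downFrom m) (downFrom n)

  -- the reduced Laplacian of the quotient of the 2m × 2n grid by its two reflections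
  Δ : ℕ × ℕ → ℕ × ℕ → ℤ
  Δ (a , b) (a′ , b′) = T a a′ ℤ.* + δ b b′ ℤ.+ + δ a a′ ℤ.* T b b′

-- Factorisation by roots, and the eigenvectors of T and Δ.

module Spectrum (R : CommutativeRing 0ℓ 0ℓ) where
  open import Data.Bool using (false)
  open import Data.Integer as ℤ using (ℤ; +_)
  open import Data.List using (List; []; _∷_; map; length; downFrom; cartesianProduct)
  open import Data.List.Properties using (length-map)
  open import Data.List.Membership.Propositional using (_∈_)
  open import Data.List.Membership.Propositional.Properties using (∈-downFrom⁻; ∈-cartesianProduct⁻)
  open import Data.List.Relation.Unary.All as All using ()
  open import Data.List.Relation.Unary.AllPairs using ([]; _∷_)
  open import Data.List.Relation.Unary.Any using (here; there)
  open import Data.List.Relation.Unary.Unique.Propositional using (Unique)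
  open import Data.Nat as ℕ using (ℕ; zero; suc; _<_; _≤_; s≤s)
  import Data.Nat.Properties as ℕ
  open import Data.Product using (_×_; _,_; ∃-syntax; proj₁; proj₂)
  open import Data.Sum using (inj₁; inj₂)
  open import Relation.Binary.PropositionalEquality as ≡ using (_≡_; _≢_)
  open import Relation.Nullary using (yes; no; contradiction)
  open CommutativeRing R hiding (zero)
  open import Relation.Binary.Reasoning.Setoid setoid
  open IntegerCoefficients R using (module Solver; fromInt; fromNat)
  open Solver
  open ChebyshevU R
  open ListSums R
  open Exterior R
  open HalfGrid

  private variable I J : Set

  -- polynomial functions of degree n with leading coefficient l
  IsPolynomial : ℕ → Carrier → (Carrier → Carrier) → Set
  IsPolynomial zero    l f = ∀ z → f z ≈ l
  IsPolynomial (suc n) l f = ∃[ c ] ∃[ g ] IsPolynomial n l g × (∀ z → f z ≈ c + z * g z)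

  polynomial-cong : ∀ n {l l′ f g} → l ≈ l′ → (∀ z → f z ≈ g z) → IsPolynomial n l f → IsPolynomial n l′ g
  polynomial-cong zero    e h p = λ z → trans (sym (h z)) (trans (p z) e)
  polynomial-cong (suc n) e h (c , g , p , q) = c , g , polynomial-cong n e (λ _ → refl) p , λ z → trans (sym (h z)) (q z)

  polynomial-+ : ∀ n {k l f g} → IsPolynomial n k f → IsPolynomial n l g → IsPolynomial n (k + l) (λ z → f z + g z)
  polynomial-+ zero    p q = λ z → +-cong (p z) (q z)
  polynomial-+ (suc n) (c , f , p , h) (d , g , q , k) = c + d , (λ z → f z + g z) , polynomial-+ n p q ,
    λ z → trans (+-cong (h z) (k z)) (solve 5 (λ c d z f g → c :+ z :* f :+ (d :+ z :* g) := c :+ d :+ z :* (f :+ g)) refl c d z (f z) (g z))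

  polynomial-* : ∀ n a {l f} → IsPolynomial n l f → IsPolynomial n (a * l) (λ z → a * f z)
  polynomial-* zero    a p = λ z → *-congˡ (p z)
  polynomial-* (suc n) a (c , f , p , h) = a * c , (λ z → a * f z) , polynomial-* n a p ,
    λ z → trans (*-congˡ (h z)) (solve 4 (λ a c z f → a :* (c :+ z :* f) := a :* c :+ z :* (a :* f)) refl a c z (f z))

  polynomial-shift : ∀ n {l f} → IsPolynomial n l f → IsPolynomial (suc n) l (λ z → z * f z)
  polynomial-shift n p = 0# , _ , p , λ z → sym (+-identityˡ _)

  polynomial-raise : ∀ n {l f} → IsPolynomial n l f → IsPolynomial (suc n) 0# f
  polynomial-raise zero    {l} p = l , (λ _ → 0#) , (λ _ → refl) , λ z → trans (p z) (solve 2 (λ l z → l := l :+ z :* con (+ 0)) refl l z)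
  polynomial-raise (suc n) (c , f , p , h) = c , f , polynomial-raise n p , h

  -- Synthetic division: with f = c + z g and g = g(r) + (z - r) q, the quotient of f is g + r q.
  polynomial-divide : ∀ n {l f} → IsPolynomial (suc n) l f → ∀ r →
    ∃[ g ] IsPolynomial n l g × (∀ z → f z ≈ f r + (z - r) * g z)
  polynomial-divide zero {l} {f} (c , g , p , h) r = g , p , λ z → begin
    f z                           ≈⟨ trans (h z) (+-congˡ (*-congˡ (p z))) ⟩
    c + z * l                     ≈⟨ solve 4 (λ c z r l → c :+ z :* l := c :+ r :* l :+ (z :- r) :* l) refl c z r l ⟩
    c + r * l + (z - r) * l       ≈⟨ +-cong (+-congˡ (*-congˡ (sym (p r)))) (*-congˡ (sym (p z))) ⟩
    c + r * g r + (z - r) * g z   ≈⟨ +-congʳ (h r) ⟨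
    f r + (z - r) * g z           ∎
  polynomial-divide (suc n) {l} {f} (c , g , p , h) r with polynomial-divide n p r
  ... | q , s , k = (λ z → g z + r * q z) ,
    polynomial-cong (suc n) (solve 2 (λ l r → l :+ r :* con (+ 0) := l) refl l r) (λ _ → refl) (polynomial-+ (suc n) p (polynomial-* (suc n) r (polynomial-raise n s))) ,
    λ z → begin
      f z                                               ≈⟨ h z ⟩
      c + z * g z                                       ≈⟨ solve 4 (λ c z r g → c :+ z :* g := c :+ r :* g :+ (z :- r) :* g) refl c z r (g z) ⟩
      c + r * g z + (z - r) * g z                       ≈⟨ +-congʳ (+-congˡ (*-congˡ (k z))) ⟩
      c + r * (g r + (z - r) * q z) + (z - r) * g z     ≈⟨ solve 6 (λ c r a z q g → c :+ r :* (a :+ (z :- r) :* q) :+ (z :- r) :* g := c :+ r :* a :+ (z :- r) :* (g :+ r :* q)) refl c r (g r) z (q z) (g z) ⟩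
      c + r * g r + (z - r) * (g z + r * q z)           ≈⟨ +-congʳ (h r) ⟨
      f r + (z - r) * (g z + r * q z)                   ∎

  -- In a ring with zero divisors, distinctness of roots means that their differences are regular:
  -- then every other root of f is a root of the quotient by a linear factor.
  polynomial-factor : ∀ n {l f} → IsPolynomial n l f → ∀ (root : ℕ → Carrier) →
    (∀ k → k < n → f (root k) ≈ 0#) → (∀ j k → j < k → k < n → Regular (root k - root j)) →
    ∀ z → f z ≈ l * ∏ (downFrom n) (λ k → z - root k)
  polynomial-factor zero    p root vanish apart z = trans (p z) (sym (*-identityʳ _))
  polynomial-factor (suc n) {l} {f} p root vanish apart z with polynomial-divide n p (root n)
  ... | g , q , h = begin
    f z                                                        ≈⟨ trans (h z) (+-congʳ (vanish n ℕ.≤-refl)) ⟩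
    0# + (z - root n) * g z                                    ≈⟨ trans (+-identityˡ _) (*-congˡ (polynomial-factor n q root g-vanish (λ j k j<k k<n → apart j k j<k (ℕ.m<n⇒m<1+n k<n)) z)) ⟩
    (z - root n) * (l * ∏ (downFrom n) (λ k → z - root k))     ≈⟨ solve 3 (λ a b c → a :* (b :* c) := b :* (a :* c)) refl (z - root n) l _ ⟩
    l * ((z - root n) * ∏ (downFrom n) (λ k → z - root k))     ∎
    where
    g-vanish : ∀ k → k < n → g (root k) ≈ 0#
    g-vanish k k<n = apart k n k<n ℕ.≤-refl (g (root k)) (begin
      (root n - root k) * g (root k)                       ≈⟨ solve 3 (λ a b c → (a :- b) :* c := :- ((b :- a) :* c)) refl (root n) (root k) (g (root k)) ⟩
      - ((root k - root n) * g (root k))                   ≈⟨ -‿cong (+-identityˡ _) ⟨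
      - (0# + (root k - root n) * g (root k))              ≈⟨ -‿cong (+-congʳ (vanish n ℕ.≤-refl)) ⟨
      - (f (root n) + (root k - root n) * g (root k))      ≈⟨ -‿cong (h (root k)) ⟨
      - f (root k)                                         ≈⟨ -‿cong (vanish k (ℕ.m<n⇒m<1+n k<n)) ⟩
      - 0#                                                 ≈⟨ solve 0 (:- con (+ 0) := con (+ 0)) refl ⟩
      0#                                                   ∎)

  -- The leading coefficient 4ⁿ is kept as a product over the roots, ready to be distributed over
  -- the linear factors in `P-factor`.
  P-polynomial : ∀ n → IsPolynomial n (∏ (downFrom n) (λ _ → four)) (P n)
  P-polynomial zero          = λ z → refl
  P-polynomial (suc zero)    = - 1# , (λ _ → four) , (λ _ → sym (*-identityʳ _)) ,
    λ z → solve 1 (λ z → con (+ 4) :* z :- con (+ 1) := :- con (+ 1) :+ z :* con (+ 4)) refl z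
  P-polynomial (suc (suc n)) = polynomial-cong (suc (suc n))
    (solve 2 (λ a b → a :* b :+ con (+ 0) := a :* b) refl four (∏ (downFrom (suc n)) (λ _ → four)))
    (λ z → solve 4 (λ z a b t → con (+ 4) :* (z :* a) :+ (:- t :* a :+ :- con (+ 1) :* b) := (con (+ 4) :* z :- t) :* a :- b) refl z (P (suc n) z) (P n z) two)
    (polynomial-+ (suc (suc n)) (polynomial-* (suc (suc n)) four (polynomial-shift (suc n) (P-polynomial (suc n))))
      (polynomial-cong (suc (suc n)) refl (λ _ → refl) (polynomial-raise (suc n) (polynomial-+ (suc n)
        (polynomial-* (suc n) (- two) (P-polynomial (suc n))) (polynomial-* (suc n) (- 1#) (polynomial-raise n (P-polynomial n)))))))

  ∏-* : ∀ (is : List I) f g → ∏ is f * ∏ is g ≈ ∏ is (λ i → f i * g i)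
  ∏-* []       f g = *-identityˡ _
  ∏-* (i ∷ is) f g = trans (solve 4 (λ a b c d → a :* b :* (c :* d) := a :* c :* (b :* d)) refl (f i) (∏ is f) (g i) (∏ is g)) (*-congˡ (∏-* is f g))

  P-factor : ∀ n (root : ℕ → Carrier) → (∀ k → k < n → P n (root k) ≈ 0#) → (∀ j k → j < k → k < n → Regular (root k - root j)) →
    ∀ z → P n z ≈ ∏ (downFrom n) (λ k → four * (z - root k))
  P-factor n root vanish apart z = trans (polynomial-factor n (P-polynomial n) root vanish apart z) (∏-* (downFrom n) _ _)

  fromInt-T : ∀ a b → fromInt (T a b) ≈ fromNat (diag a) * fromNat (δ a b) - (fromNat (δ (suc a) b) + fromNat (δ a (suc b)))
  fromInt-T a b = trans (IntegerCoefficients.fromInt-+ R (+ (diag a ℕ.* δ a b)) (ℤ.- (+ path a b)))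
    (+-cong (IntegerCoefficients.fromNat-* R (diag a) (δ a b)) (trans (IntegerCoefficients.fromInt-neg R (+ path a b))
      (-‿cong (IntegerCoefficients.fromNat-+ R (δ (suc a) b) (δ a (suc b))))))

  ∑-δ-out : ∀ m (f : ℕ → Carrier) b → m ≤ b → ∑ (downFrom m) (λ a → f a * fromNat (δ a b)) ≈ 0#
  ∑-δ-out m f b m≤b = ∑-zero (downFrom m) (λ {a} a∈ → trans
    (*-congˡ (reflexive (≡.cong fromNat (δ-≢ {a} {b} (λ { ≡.refl → ℕ.<⇒≱ (∈-downFrom⁻ a∈) m≤b }))))) (zeroʳ (f a)))

  ∑-δ : ∀ m (f : ℕ → Carrier) b → b < m → ∑ (downFrom m) (λ a → f a * fromNat (δ a b)) ≈ f b
  ∑-δ (suc m) f b (s≤s b≤m) with ℕ.m≤n⇒m<n∨m≡n b≤m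
  ... | inj₁ b<m = trans (+-cong (trans (*-congˡ (reflexive (≡.cong fromNat (δ-≢ {m} {b} (λ { ≡.refl → ℕ.<-irrefl ≡.refl b<m }))))) (zeroʳ (f m))) (∑-δ m f b b<m)) (+-identityˡ _)
  ... | inj₂ ≡.refl = trans (+-cong (trans (*-congˡ (reflexive (≡.cong fromNat (δ-refl b)))) (*-identityʳ (f b))) (∑-δ-out b f b ℕ.≤-refl)) (+-identityʳ _)

  -- E j z = (-1)ʲ Pⱼ(z) are the entries of an eigenvector with eigenvalue 4z if Pₘ(z) = 0.
  E : Carrier → ℕ → Carrier
  E z zero          = 1#
  E z (suc zero)    = 1# - four * z
  E z (suc (suc j)) = (two - four * z) * E z (suc j) - E z j

  sgn : ℕ → Carrier
  sgn zero    = 1#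
  sgn (suc j) = - sgn j

  E-P : ∀ z j → E z j ≈ sgn j * P j z
  E-P z zero          = sym (*-identityˡ _)
  E-P z (suc zero)    = solve 1 (λ z → con (+ 1) :- con (+ 4) :* z := (:- con (+ 1)) :* (con (+ 4) :* z :- con (+ 1))) refl z
  E-P z (suc (suc j)) = trans (+-cong (*-congˡ (E-P z (suc j))) (-‿cong (E-P z j)))
    (solve 5 (λ t z s a b → (t :- con (+ 4) :* z) :* (:- s :* a) :- s :* b := :- :- s :* ((con (+ 4) :* z :- t) :* a :- b)) refl two z (sgn j) (P (suc j) z) (P j z))

  E-root : ∀ z m → P m z ≈ 0# → E z m ≈ 0#
  E-root z m h = trans (E-P z m) (trans (*-congˡ h) (zeroʳ _))

  -- In the interior this is the three-term recursion of E; at the free end it is the initial value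
  -- 1 - 4z, and at the other end E m = 0 stands in for the missing neighbour.
  T-eigen : ∀ z m → E z m ≈ 0# → ∀ b → b < m →
    ∑ (downFrom m) (λ a → E z a * fromInt (T a b)) ≈ four * z * E z b
  T-eigen z m end b b<m = begin
    ∑ (downFrom m) (λ a → E z a * fromInt (T a b))
      ≈⟨ ∑-cong (downFrom m) (λ {a} _ → trans (*-congˡ (fromInt-T a b))
           (solve 5 (λ e d x y w → e :* (d :* x :- (y :+ w)) := (e :* d) :* x :+ :- (e :* y :+ e :* w)) refl
             (E z a) (fromNat (diag a)) (fromNat (δ a b)) (fromNat (δ (suc a) b)) (fromNat (δ a (suc b))))) ⟩
    ∑ (downFrom m) (λ a → (E z a * fromNat (diag a)) * fromNat (δ a b) + - (E z a * fromNat (δ (suc a) b) + E z a * fromNat (δ a (suc b))))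
      ≈⟨ trans (∑-+ (downFrom m) _ _) (+-congˡ (trans (∑-neg (downFrom m) _) (-‿cong (∑-+ (downFrom m) _ _)))) ⟩
    ∑ (downFrom m) (λ a → (E z a * fromNat (diag a)) * fromNat (δ a b))
      + - (∑ (downFrom m) (λ a → E z a * fromNat (δ (suc a) b)) + ∑ (downFrom m) (λ a → E z a * fromNat (δ a (suc b))))
      ≈⟨ +-cong (∑-δ m (λ a → E z a * fromNat (diag a)) b b<m) (-‿cong (+-congˡ next)) ⟩
    E z b * fromNat (diag b) + - (∑ (downFrom m) (λ a → E z a * fromNat (δ (suc a) b)) + E z (suc b))
      ≈⟨ previous b b<m ⟩
    four * z * E z b ∎
    where
    next : ∑ (downFrom m) (λ a → E z a * fromNat (δ a (suc b))) ≈ E z (suc b)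
    next with ℕ.m≤n⇒m<n∨m≡n b<m
    ... | inj₁ 1+b<m    = ∑-δ m (E z) (suc b) 1+b<m
    ... | inj₂ ≡.refl   = trans (∑-δ-out m (E z) (suc b) ℕ.≤-refl) (sym end)
    previous : ∀ b → b < m → E z b * fromNat (diag b) + - (∑ (downFrom m) (λ a → E z a * fromNat (δ (suc a) b)) + E z (suc b)) ≈ four * z * E z b
    previous zero    _   = trans (+-congˡ (-‿cong (+-congʳ (∑-zero (downFrom m) (λ {a} _ → zeroʳ (E z a))))))
      (solve 1 (λ z → con (+ 1) :* con (+ 1) :+ :- (con (+ 0) :+ (con (+ 1) :- con (+ 4) :* z)) := con (+ 4) :* z :* con (+ 1)) refl z)
    previous (suc b) b<m = trans (+-congˡ (-‿cong (+-congʳ (∑-δ m (E z) b (ℕ.<-trans ℕ.≤-refl b<m)))))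
      (solve 3 (λ z x y → x :* (con (+ 1) :+ con (+ 1)) :+ :- (y :+ ((con (+ 1) :+ con (+ 1) :- con (+ 4) :* z) :* x :- y)) := con (+ 4) :* z :* x) refl z (E z (suc b)) (E z b))

  inner : ℕ → Carrier → Carrier → Carrier
  inner m z w = ∑ (downFrom m) (λ a → E z a * E w a)

  -- T is symmetric, so its bilinear form on the two eigenvectors is their inner product times
  -- either eigenvalue.
  orthogonal : ∀ m z w → E z m ≈ 0# → E w m ≈ 0# → Regular (four * z - four * w) → inner m z w ≈ 0#
  orthogonal m z w zm wm apart = apart (inner m z w) (begin
    (four * z - four * w) * inner m z w
      ≈⟨ solve 3 (λ a b c → (a :- b) :* c := a :* c :- b :* c) refl (four * z) (four * w) (inner m z w) ⟩
    four * z * inner m z w - four * w * inner m z w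
      ≈⟨ +-cong left (-‿cong right) ⟩
    ∑ (downFrom m) (λ b → ∑ (downFrom m) (λ a → E z a * fromInt (T a b) * E w b))
      - ∑ (downFrom m) (λ b → ∑ (downFrom m) (λ a → E z a * fromInt (T a b) * E w b))
      ≈⟨ -‿inverseʳ _ ⟩
    0# ∎)
    where
    left : four * z * inner m z w ≈ ∑ (downFrom m) (λ b → ∑ (downFrom m) (λ a → E z a * fromInt (T a b) * E w b))
    left = trans (sym (∑-* (downFrom m) _ _)) (∑-cong (downFrom m) (λ {b} b∈ → trans (sym (*-assoc _ _ _))
      (trans (*-congʳ (sym (T-eigen z m zm b (∈-downFrom⁻ b∈)))) (sym (∑-*ʳ (downFrom m) (E w b) _)))))
    right : four * w * inner m z w ≈ ∑ (downFrom m) (λ b → ∑ (downFrom m) (λ a → E z a * fromInt (T a b) * E w b))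
    right = trans (sym (∑-* (downFrom m) _ _)) (trans (∑-cong (downFrom m) (λ {a} a∈ → begin
      four * w * (E z a * E w a)
        ≈⟨ solve 3 (λ l x y → l :* (x :* y) := (l :* y) :* x) refl (four * w) (E z a) (E w a) ⟩
      four * w * E w a * E z a
        ≈⟨ *-congʳ (sym (T-eigen w m wm a (∈-downFrom⁻ a∈))) ⟩
      ∑ (downFrom m) (λ b → E w b * fromInt (T b a)) * E z a
        ≈⟨ sym (∑-*ʳ (downFrom m) (E z a) _) ⟩
      ∑ (downFrom m) (λ b → E w b * fromInt (T b a) * E z a)
        ≈⟨ ∑-cong (downFrom m) (λ {b} _ → trans (*-congʳ (*-congˡ (reflexive (≡.cong fromInt (T-sym b a)))))
             (solve 3 (λ x t y → x :* t :* y := y :* t :* x) refl (E w b) (fromInt (T a b)) (E z a))) ⟩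
      ∑ (downFrom m) (λ b → E z a * fromInt (T a b) * E w b) ∎)) (∑-swap (downFrom m) (downFrom m) _))

  det-diagonal : ∀ (is : List I) → Unique is → ∀ A → (∀ {i j} → i ∈ is → j ∈ is → i ≢ j → A i j ≈ 0#) →
    det is A ≈ ∏ is (λ i → A i i)
  det-diagonal []       _        A h = refl
  det-diagonal (i ∷ is) (n ∷ un) A h = trans
    (volume-unit i is (A i) (map A is) (λ m → h (here ≡.refl) (there m) (All.lookup n m)))
    (*-congˡ (det-diagonal is un A (λ m m′ → h (there m) (there m′))))

  regular-∏ : ∀ (is : List I) {f} → (∀ {i} → i ∈ is → Regular (f i)) → Regular (∏ is f)
  regular-∏ []       h = λ y e → trans (sym (*-identityˡ y)) e
  regular-∏ (i ∷ is) h = regular-* (h (here ≡.refl)) (regular-∏ is (λ m → h (there m)))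

  -- S is a basis of left eigenvectors; orthogonality makes its volume regular.
  det-eigen : ∀ (is : List I) (ks : List J) → Unique ks → length ks ≡ length is → ∀ A (S : J → I → Carrier) ev →
    (∀ {k} → k ∈ ks → ∀ {j} → j ∈ is → ∑ is (λ i → S k i * A i j) ≈ ev k * S k j) →
    (∀ {k k′} → k ∈ ks → k′ ∈ ks → k ≢ k′ → ∑ is (λ i → S k i * S k′ i) ≈ 0#) →
    (∀ {k} → k ∈ ks → Regular (∑ is (λ i → S k i * S k i))) →
    det is A ≈ ∏ ks ev
  det-eigen is ks un len A S ev eig orth norm = regular-cancel regular (begin
    volume (map S ks) is * det is A
      ≈⟨ volume-pushforward is is A (map S ks) (≡.trans (length-map S ks) len) ⟨
    volume (map (pushforward is A) (map S ks)) is
      ≡⟨ ≡.cong (λ rows → volume rows is) (≡.sym (map-∘ ks)) ⟩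
    volume (map (λ k → pushforward is A (S k)) ks) is
      ≈⟨ volume-cong is _ (λ k j → ev k * S k j) ks (λ k∈ j∈ → eig k∈ j∈) ⟩
    volume (map (λ k j → ev k * S k j) ks) is
      ≈⟨ volume-scale is ev S ks ⟩
    ∏ ks ev * volume (map S ks) is
      ≈⟨ *-comm _ _ ⟩
    volume (map S ks) is * ∏ ks ev ∎)
    where
    open import Data.List.Properties using (map-∘)
    regular : Regular (volume (map S ks) is)
    regular = regular-*ˡ (regular-cong (begin
      ∏ ks (λ k → ∑ is (λ i → S k i * S k i))
        ≈⟨ det-diagonal ks un (λ k k′ → ∑ is (λ i → S k i * S k′ i)) orth ⟨
      volume (map (λ k → pushforward is (λ i k′ → S k′ i) (S k)) ks) ks
        ≡⟨ ≡.cong (λ rows → volume rows ks) (map-∘ ks) ⟩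
      volume (map (pushforward is (λ i k′ → S k′ i)) (map S ks)) ks
        ≈⟨ volume-pushforward is ks (λ i k′ → S k′ i) (map S ks) (≡.trans (length-map S ks) len) ⟩
      volume (map S ks) is * volume (map (λ i k′ → S k′ i) is) ks ∎)
      (regular-∏ ks norm))

  -- Products of eigenvectors of the two paths are eigenvectors of the Kronecker sum Δ, with the
  -- sums of the eigenvalues; their Gram matrix is the product of the two Gram matrices.
  det-Δ : ∀ m n (z w : ℕ → Carrier) →
    (∀ h → h < m → P m (z h) ≈ 0#) → (∀ k → k < n → P n (w k) ≈ 0#) →
    (∀ {h h′} → h < m → h′ < m → h ≢ h′ → Regular (four * z h - four * z h′)) →
    (∀ {k k′} → k < n → k′ < n → k ≢ k′ → Regular (four * w k - four * w k′)) →
    (∀ h → h < m → Regular (inner m (z h) (z h))) → (∀ k → k < n → Regular (inner n (w k) (w k))) →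
    det (vertices m n) (λ u v → fromInt (Δ u v)) ≈ ∏ (vertices m n) (λ (h , k) → four * z h + four * w k)
  det-Δ m n z w zm wn zz ww nz nw = det-eigen (vertices m n) (vertices m n) unique ≡.refl
    (λ u v → fromInt (Δ u v)) S (λ (h , k) → four * z h + four * w k) eigen orth norm
    where
    open import Data.List.Relation.Unary.Unique.Propositional.Properties using (cartesianProduct⁺; downFrom⁺)
    unique : Unique (vertices m n)
    unique = cartesianProduct⁺ (downFrom⁺ m) (downFrom⁺ n)
    S : ℕ × ℕ → ℕ × ℕ → Carrier
    S (h , k) (a , b) = E (z h) a * E (w k) b
    zE : ∀ {h} → h ∈ downFrom m → E (z h) m ≈ 0#
    zE {h} h∈ = E-root (z h) m (zm h (∈-downFrom⁻ h∈))
    wE : ∀ {k} → k ∈ downFrom n → E (w k) n ≈ 0#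
    wE {k} k∈ = E-root (w k) n (wn k (∈-downFrom⁻ k∈))
    ∑-product : ∀ f g → ∑ (vertices m n) (λ (a , b) → f a * g b) ≈ ∑ (downFrom m) f * ∑ (downFrom n) g
    ∑-product f g = trans (∑-× (downFrom m) (downFrom n) _) (trans (∑-cong (downFrom m) (λ {a} _ → ∑-* (downFrom n) (f a) g))
      (∑-*ʳ (downFrom m) (∑ (downFrom n) g) f))
    fromInt-Δ : ∀ a b a′ b′ → fromInt (Δ (a , b) (a′ , b′)) ≈ fromInt (T a a′) * fromNat (δ b b′) + fromNat (δ a a′) * fromInt (T b b′)
    fromInt-Δ a b a′ b′ = trans (IntegerCoefficients.fromInt-+ R (T a a′ ℤ.* + δ b b′) (+ δ a a′ ℤ.* T b b′))
      (+-cong (IntegerCoefficients.fromInt-* R (T a a′) (+ δ b b′)) (IntegerCoefficients.fromInt-* R (+ δ a a′) (T b b′)))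
    eigen : ∀ {k} → k ∈ vertices m n → ∀ {j} → j ∈ vertices m n →
      ∑ (vertices m n) (λ i → S k i * fromInt (Δ i j)) ≈ (four * z (proj₁ k) + four * w (proj₂ k)) * S k j
    eigen {h , k} hk∈ {a′ , b′} ab∈ = begin
      ∑ (vertices m n) (λ i → S (h , k) i * fromInt (Δ i (a′ , b′)))
        ≈⟨ ∑-cong (vertices m n) (λ { {a , b} _ → trans (*-congˡ (fromInt-Δ a b a′ b′))
             (solve 6 (λ e f t x y u → e :* f :* (t :* x :+ y :* u) := (e :* t) :* (f :* x) :+ (e :* y) :* (f :* u)) refl
               (E (z h) a) (E (w k) b) (fromInt (T a a′)) (fromNat (δ b b′)) (fromNat (δ a a′)) (fromInt (T b b′))) }) ⟩
      ∑ (vertices m n) (λ (a , b) → (E (z h) a * fromInt (T a a′)) * (E (w k) b * fromNat (δ b b′)) + (E (z h) a * fromNat (δ a a′)) * (E (w k) b * fromInt (T b b′)))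
        ≈⟨ ∑-+ (vertices m n) _ _ ⟩
      ∑ (vertices m n) (λ (a , b) → (E (z h) a * fromInt (T a a′)) * (E (w k) b * fromNat (δ b b′))) + ∑ (vertices m n) (λ (a , b) → (E (z h) a * fromNat (δ a a′)) * (E (w k) b * fromInt (T b b′)))
        ≈⟨ +-cong (∑-product _ _) (∑-product _ _) ⟩
      ∑ (downFrom m) (λ a → E (z h) a * fromInt (T a a′)) * ∑ (downFrom n) (λ b → E (w k) b * fromNat (δ b b′))
        + ∑ (downFrom m) (λ a → E (z h) a * fromNat (δ a a′)) * ∑ (downFrom n) (λ b → E (w k) b * fromInt (T b b′))
        ≈⟨ +-cong (*-cong (T-eigen (z h) m (zE h∈) a′ a′<m) (∑-δ n (E (w k)) b′ b′<n)) (*-cong (∑-δ m (E (z h)) a′ a′<m) (T-eigen (w k) n (wE k∈) b′ b′<n)) ⟩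
      four * z h * E (z h) a′ * E (w k) b′ + E (z h) a′ * (four * w k * E (w k) b′)
        ≈⟨ solve 4 (λ l e f u → l :* e :* f :+ e :* (u :* f) := (l :+ u) :* (e :* f)) refl (four * z h) (E (z h) a′) (E (w k) b′) (four * w k) ⟩
      (four * z h + four * w k) * (E (z h) a′ * E (w k) b′) ∎
      where
      h∈ = proj₁ (∈-cartesianProduct⁻ (downFrom m) (downFrom n) hk∈)
      k∈ = proj₂ (∈-cartesianProduct⁻ (downFrom m) (downFrom n) hk∈)
      a′<m = ∈-downFrom⁻ (proj₁ (∈-cartesianProduct⁻ (downFrom m) (downFrom n) ab∈))
      b′<n = ∈-downFrom⁻ (proj₂ (∈-cartesianProduct⁻ (downFrom m) (downFrom n) ab∈))
    gram : ∀ h k h′ k′ → ∑ (vertices m n) (λ i → S (h , k) i * S (h′ , k′) i) ≈ inner m (z h) (z h′) * inner n (w k) (w k′)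
    gram h k h′ k′ = trans (∑-cong (vertices m n) (λ { {a , b} _ → solve 4 (λ p q r s → p :* q :* (r :* s) := (p :* r) :* (q :* s)) refl (E (z h) a) (E (w k) b) (E (z h′) a) (E (w k′) b) }))
      (∑-product (λ a → E (z h) a * E (z h′) a) (λ b → E (w k) b * E (w k′) b))
    orth : ∀ {i i′} → i ∈ vertices m n → i′ ∈ vertices m n → i ≢ i′ → ∑ (vertices m n) (λ j → S i j * S i′ j) ≈ 0#
    orth {h , k} {h′ , k′} i∈ i′∈ n≢ with ∈-cartesianProduct⁻ (downFrom m) (downFrom n) i∈ | ∈-cartesianProduct⁻ (downFrom m) (downFrom n) i′∈ | h ℕ.≟ h′
    ... | h∈ , k∈ | h′∈ , k′∈ | no h≢ = trans (gram h k h′ k′) (trans (*-congʳ (orthogonal m (z h) (z h′) (zE h∈) (zE h′∈) (zz (∈-downFrom⁻ h∈) (∈-downFrom⁻ h′∈) h≢))) (zeroˡ _))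
    ... | h∈ , k∈ | h′∈ , k′∈ | yes ≡.refl = trans (gram h k h′ k′) (trans (*-congˡ (orthogonal n (w k) (w k′) (wE k∈) (wE k′∈) (ww (∈-downFrom⁻ k∈) (∈-downFrom⁻ k′∈) (λ { ≡.refl → n≢ ≡.refl })))) (zeroʳ _))
    norm : ∀ {i} → i ∈ vertices m n → Regular (∑ (vertices m n) (λ j → S i j * S i j))
    norm {h , k} i∈ = regular-cong (sym (gram h k h k)) (regular-* (nz h (∈-downFrom⁻ (proj₁ p))) (nw k (∈-downFrom⁻ (proj₂ p))))
      where p = ∈-cartesianProduct⁻ (downFrom m) (downFrom n) i∈

-- Determinants under the homomorphism from ℤ.

module RingHomDet (R : CommutativeRing 0ℓ 0ℓ) where
  open import Data.Bool using (true; false)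
  open import Data.Integer as ℤ using (ℤ; +_)
  import Data.Integer.Properties as ℤ
  open import Data.List using (List; []; _∷_; map)
  open import Data.Vec using ([]; _∷_)
  open CommutativeRing R
  open IntegerCoefficients R
  private
    module Z = Exterior ℤ.+-*-commutativeRing
    module X = Exterior R

  fromInt-wedge : ∀ {I : Set} (is : List I) v z z′ → (∀ L → fromInt (z L) ≈ z′ L) → ∀ L →
    fromInt (Z.wedge is v z L) ≈ X.wedge is (λ i → fromInt (v i)) z′ L
  fromInt-wedge []       v z z′ h L           = refl
  fromInt-wedge (i ∷ is) v z z′ h (false ∷ L) = fromInt-wedge is v _ _ (λ K → h _) L
  fromInt-wedge (i ∷ is) v z z′ h (true ∷ L)  = trans (fromInt-+ (v i ℤ.* z (false ∷ L)) (ℤ.- Z.wedge is v (λ K → z (true ∷ K)) L))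
    (+-cong (trans (fromInt-* (v i) (z (false ∷ L))) (*-congˡ (h _)))
      (trans (fromInt-neg (Z.wedge is v (λ K → z (true ∷ K)) L)) (-‿cong (fromInt-wedge is v _ _ (λ K → h _) L))))

  fromInt-one : ∀ {I : Set} (is : List I) L → fromInt (Z.one is L) ≈ X.one is L
  fromInt-one []       L           = refl
  fromInt-one (i ∷ is) (false ∷ L) = fromInt-one is L
  fromInt-one (i ∷ is) (true ∷ L)  = refl

  fromInt-wedges : ∀ {I : Set} (is ks : List I) A L →
    fromInt (Z.wedges is (map A ks) (Z.one is) L) ≈ X.wedges is (map (λ i j → fromInt (A i j)) ks) (X.one is) L
  fromInt-wedges is []       A L = fromInt-one is L
  fromInt-wedges is (k ∷ ks) A L = fromInt-wedge is (A k) _ _ (fromInt-wedges is ks A) L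

  fromInt-det : ∀ {I : Set} (is : List I) A → fromInt (Z.det is A) ≈ X.det is (λ i j → fromInt (A i j))
  fromInt-det is A = fromInt-wedges is is A _

-- Chebyshev polynomials at imaginary arguments.

module CosineTwist (R : CommutativeRing 0ℓ 0ℓ) where
  open import Data.Integer using (+_)
  open import Data.Nat using (ℕ; zero; suc)
  open CommutativeRing R hiding (zero)
  open IntegerCoefficients R using (module Solver)
  open Solver
  open ChebyshevU R

  -- U₂ₖ(ix) = evenPart x k and U₂ₖ₊₁(ix) = i oddPart x k
  evenPart oddPart : Carrier → ℕ → Carrier
  evenPart x zero    = 1#
  evenPart x (suc k) = - (two * x * oddPart x k) - evenPart x k
  oddPart  x zero    = two * x
  oddPart  x (suc k) = two * x * evenPart x (suc k) - oddPart x k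

  evenPart≈P : ∀ x k → evenPart x k ≈ P k (- (x * x))
  evenPart≈P x zero          = refl
  evenPart≈P x (suc zero)    = solve 1 (λ x → let t = con (+ 1) :+ con (+ 1) in :- (t :* x :* (t :* x)) :- con (+ 1) := con (+ 4) :* (:- (x :* x)) :- con (+ 1)) refl x
  evenPart≈P x (suc (suc k)) = trans
    (solve 3 (λ x a b → let t = con (+ 1) :+ con (+ 1) ; a′ = :- (t :* x :* b) :- a in
      :- (t :* x :* (t :* x :* a′ :- b)) :- a′ := (con (+ 4) :* (:- (x :* x)) :- t) :* a′ :- a) refl x (evenPart x k) (oddPart x k))
    (+-cong (*-congˡ (evenPart≈P x (suc k))) (-‿cong (evenPart≈P x k)))

-- The determinant of Δ as a product over the zeros.

module CosineSpectrum (R : CommutativeRing 0ℓ 0ℓ) (C : Rat.ℚ → CommutativeRing.Carrier R) where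
  open import Data.Integer as ℤ using (+_)
  import Data.Integer.Properties as ℤ
  open import Data.List using (List; []; _∷_; downFrom; map)
  open import Data.Nat as ℕ using (ℕ; zero; suc; _<_; s≤s; z≤n)
  import Data.Nat.Properties as ℕ
  open import Data.Rational as ℚ using (0ℚ; ½)
  open import Relation.Binary.PropositionalEquality as ≡ using (_≢_)
  open import Relation.Binary.Definitions using (tri<; tri≈; tri>)
  open import Relation.Nullary using (contradiction)
  open CommutativeRing R hiding (zero)
  open import Relation.Binary.Reasoning.Setoid setoid
  open IntegerCoefficients R using (module Solver; fromInt)
  open Solver
  open ChebyshevU R
  open Spectrum R
  open ListSums R using (∏; ∏-cong; ∏-×)
  open HalfGrid

  sgn-+ : ∀ i j → sgn (i ℕ.+ j) ≈ sgn i * sgn j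
  sgn-+ zero    j = sym (*-identityˡ _)
  sgn-+ (suc i) j = trans (-‿cong (sgn-+ i j)) (solve 2 (λ a b → :- (a :* b) := :- a :* b) refl (sgn i) (sgn j))

  sgn² : ∀ i → sgn i * sgn i ≈ 1#
  sgn² zero    = *-identityˡ _
  sgn² (suc i) = trans (solve 1 (λ a → :- a :* :- a := a :* a) refl (sgn i)) (sgn² i)

  ∏-neg : ∀ n f → ∏ (downFrom n) (λ k → - f k) ≈ sgn n * ∏ (downFrom n) f
  ∏-neg zero    f = sym (*-identityˡ _)
  ∏-neg (suc n) f = trans (*-congˡ (∏-neg n f)) (solve 3 (λ a s p → :- a :* (s :* p) := :- s :* (a :* p)) refl (f n) (sgn n) (∏ (downFrom n) f))

  -- Each of the m factors carries (-1)ⁿ, in total (-1)ᵐⁿ, and this sign squares to 1.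
  ∏-sgn : ∀ m n f → sgn (m ℕ.* n) * ∏ (downFrom m) (λ h → sgn n * f h) ≈ ∏ (downFrom m) f
  ∏-sgn zero    n f = *-identityˡ _
  ∏-sgn (suc m) n f = begin
    sgn (n ℕ.+ m ℕ.* n) * (sgn n * f m * p)      ≈⟨ *-congʳ (sgn-+ n (m ℕ.* n)) ⟩
    sgn n * s * (sgn n * f m * p)                ≈⟨ solve 4 (λ a s f p → a :* s :* (a :* f :* p) := (a :* a) :* (f :* (s :* p))) refl (sgn n) s (f m) p ⟩
    sgn n * sgn n * (f m * (s * p))              ≈⟨ *-cong (sgn² n) (*-congˡ (∏-sgn m n f)) ⟩
    1# * (f m * ∏ (downFrom m) f)                ≈⟨ *-identityˡ _ ⟩
    f m * ∏ (downFrom m) f                       ∎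
    where
    s = sgn (m ℕ.* n)
    p = ∏ (downFrom m) (λ h → sgn n * f h)

  module _
    (C-± : ∀ r s → C (r ℚ.+ s) + C (r ℚ.- s) ≈ two * C r * C s)
    (C-0 : C 0ℚ ≈ 1#) (C-½ : C ½ ≈ 0#) (two-regular : Regular two)
    (1-C-regular : ∀ r → 0ℚ ℚ.< r → r ℚ.≤ ½ → Regular (1# - C r))
    (C-half-regular : ∀ r → 0ℚ ℚ.< r → r ℚ.≤ ½ → Regular (C (½ ℚ.* r)))
    (inner-regular : ∀ m z → Regular (inner (suc m) z z)) where

    private
      module Roots = Cosine.Roots R C C-± C-0 C-½ two-regular 1-C-regular C-half-regular

    -- The lists count from 0 and the angles from 1, so index h belongs to the zero with number h +
    -- 1.
    ζ : ℕ → ℕ → Carrier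
    ζ m h = C (Nodes.node m (suc h)) * C (Nodes.node m (suc h))

    four-regular : Regular four
    four-regular = regular-cong (solve 0 ((con (+ 1) :+ con (+ 1)) :* (con (+ 1) :+ con (+ 1)) := con (+ 4)) refl) (regular-* two-regular two-regular)

    ζ-root : ∀ m h → h < m → P m (ζ m h) ≈ 0#
    ζ-root m h h<m = Roots.root m (suc h) (s≤s z≤n) (s≤s (ℕ.≤-trans h<m (ℕ.m≤m+n m (m ℕ.+ 0))))

    ζ-apart : ∀ m j k → j < k → k < m → Regular (ζ m k - ζ m j)
    ζ-apart m j k j<k k<m = Roots.distinct m (s≤s j<k) k<m (s≤s z≤n)

    ζ-apart′ : ∀ m {h h′} → h < m → h′ < m → h ≢ h′ → Regular (four * ζ m h - four * ζ m h′)
    ζ-apart′ m {h} {h′} h<m h′<m n with ℕ.<-cmp h h′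
    ... | tri≈ _ e _ = contradiction e n
    ... | tri> _ _ h′<h = regular-cong (solve 3 (λ f a b → f :* (a :- b) := f :* a :- f :* b) refl four (ζ m h) (ζ m h′))
      (regular-* four-regular (ζ-apart m h′ h h′<h h<m))
    ... | tri< h<h′ _ _ = λ y e → regular-* four-regular (ζ-apart m h h′ h<h′ h′<m) y (begin
      four * (ζ m h′ - ζ m h) * y          ≈⟨ solve 4 (λ f a b y → f :* (b :- a) :* y := :- ((f :* a :- f :* b) :* y)) refl four (ζ m h) (ζ m h′) y ⟩
      - ((four * ζ m h - four * ζ m h′) * y) ≈⟨ -‿cong e ⟩
      - 0#                                 ≈⟨ solve 0 (:- con (+ 0) := con (+ 0)) refl ⟩
      0#                                   ∎)

    norm : ∀ {h m} → h < m → ∀ z → Regular (inner m z z)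
    norm {m = suc m} _ z = inner-regular m z

    eigenvalue : ℕ → ℕ → ℕ → ℕ → Carrier
    eigenvalue m n h k = four * ζ m h + four * ζ n k

    det-Δ≈ : ∀ m n → fromInt (Exterior.det ℤ.+-*-commutativeRing (vertices m n) Δ) ≈ ∏ (downFrom m) (λ h → ∏ (downFrom n) (eigenvalue m n h))
    det-Δ≈ m n = trans (RingHomDet.fromInt-det R (vertices m n) Δ)
      (trans (det-Δ m n (ζ m) (ζ n) (ζ-root m) (ζ-root n) (ζ-apart′ m) (ζ-apart′ n)
        (λ h h<m → norm h<m (ζ m h)) (λ k k<n → norm k<n (ζ n k)))
        (∏-× (downFrom m) (downFrom n) _))

    -- With the roots wₖ of Pₙ, Pₙ(-z) = ∏ 4 (-z - wₖ) = (-1)ⁿ ∏ (4z + 4wₖ). For z = ξ² the argument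
    -- -z is the square of iξ, which is how the imaginary unit enters.
    det-Δ≈∏P : ∀ m n → fromInt (Exterior.det ℤ.+-*-commutativeRing (vertices m n) Δ) ≈ sgn (m ℕ.* n) * ∏ (downFrom m) (λ h → P n (- ζ m h))
    det-Δ≈∏P m n = trans (det-Δ≈ m n) (sym (trans (*-congˡ (∏-cong (downFrom m) (λ {h} _ → factored h)))
      (∏-sgn m n (λ h → ∏ (downFrom n) (eigenvalue m n h)))))
      where
      factored : ∀ h → P n (- ζ m h) ≈ sgn n * ∏ (downFrom n) (eigenvalue m n h)
      factored h = trans (P-factor n (ζ n) (ζ-root n) (ζ-apart n) (- ζ m h))
        (trans (∏-cong (downFrom n) (λ {k} _ → solve 3 (λ f a b → f :* (:- a :- b) := :- (f :* a :+ f :* b)) refl four (ζ m h) (ζ n k)))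
          (∏-neg n (eigenvalue m n h)))

-- Complex arithmetic through real and imaginary parts.

-- A relation z ↦ x + i y between a ring and formal complex numbers over R that respects the
-- ring operations respects everything built from them.
module Representation (R : CommutativeRing 0ℓ 0ℓ) (Q : RawRing 0ℓ 0ℓ)
  (Rep : RawRing.Carrier Q → CommutativeRing.Carrier R → CommutativeRing.Carrier R → Set) where
  open import Data.Integer as ℤ using (+_)
  open import Data.Nat as ℕ using (ℕ; zero; suc)
  import Data.Nat.Properties as ℕ
  open import Data.Product using (_×_; _,_; proj₁; proj₂)
  open import Relation.Binary.PropositionalEquality as ≡ using (_≡_)
  open CommutativeRing R hiding (zero)
  open IntegerCoefficients R using (module Solver)
  open Solver
  open ChebyshevU R
  open CosineTwist R
  private
    module Q = RawRing Q

  module _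
    (rep-cong : ∀ z {a b c d} → a ≈ c → b ≈ d → Rep z a b → Rep z c d)
    (rep-+ : ∀ z w {a b c d} → Rep z a b → Rep w c d → Rep (z Q.+ w) (a + c) (b + d))
    (rep-neg : ∀ z {a b} → Rep z a b → Rep (Q.- z) (- a) (- b))
    (rep-* : ∀ z w {a b c d} → Rep z a b → Rep w c d → Rep (z Q.* w) (a * c - b * d) (a * d + b * c))
    (rep-1 : Rep Q.1# 1# 0#) where

    module ImaginaryArgument (y : Q.Carrier) (x : Carrier) (rep-y : Rep y 0# x) where

      2y : Q.Carrier
      2y = (Q.1# Q.+ Q.1#) Q.* y

      rep-2y : Rep 2y 0# (two * x)
      rep-2y = rep-cong _ (solve 1 (λ x → (con (+ 1) :+ con (+ 1)) :* con (+ 0) :- (con (+ 0) :+ con (+ 0)) :* x := con (+ 0)) refl x)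
        (solve 1 (λ x → (con (+ 1) :+ con (+ 1)) :* x :+ (con (+ 0) :+ con (+ 0)) :* con (+ 0) := (con (+ 1) :+ con (+ 1)) :* x) refl x)
        (rep-* _ _ (rep-+ _ _ rep-1 rep-1) rep-y)

      a b : ℕ → Carrier
      a = evenPart x
      b = oddPart x

      dbl : ℕ → ℕ
      dbl zero    = zero
      dbl (suc k) = suc (suc (dbl k))

      rep-U : ∀ k → Rep (chebyshevU Q (dbl k) y) (a k) 0# × Rep (chebyshevU Q (suc (dbl k)) y) 0# (b k)
      rep-U zero    = rep-1 , rep-2y
      rep-U (suc k) = even ,
          rep-cong _ (solve 2 (λ t a → con (+ 0) :* a :- t :* con (+ 0) :+ :- con (+ 0) := con (+ 0)) refl (two * x) (a (suc k)))
            (solve 3 (λ t a b → con (+ 0) :* con (+ 0) :+ t :* a :+ :- b := t :* a :- b) refl (two * x) (a (suc k)) (b k))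
            (rep-+ _ _ (rep-* _ _ rep-2y even) (rep-neg _ (proj₂ (rep-U k))))
        where
        even : Rep (chebyshevU Q (suc (suc (dbl k))) y) (a (suc k)) 0#
        even = rep-cong _ (solve 3 (λ t a b → con (+ 0) :* con (+ 0) :- t :* b :+ :- a := :- (t :* b) :- a) refl (two * x) (a k) (b k))
          (solve 2 (λ t b → con (+ 0) :* b :+ t :* con (+ 0) :+ :- con (+ 0) := con (+ 0)) refl (two * x) (b k))
          (rep-+ _ _ (rep-* _ _ rep-2y (proj₂ (rep-U k))) (rep-neg _ (proj₁ (rep-U k))))

      rep-U2n : ∀ n → Rep (chebyshevU Q (2 ℕ.* n) y) (P n (- (x * x))) 0#
      rep-U2n n = ≡.subst (λ j → Rep (chebyshevU Q j y) (P n (- (x * x))) 0#) (≡.sym (2*≡ n)) (rep-cong _ (evenPart≈P x n) refl (proj₁ (rep-U n)))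
        where
        2*≡ : ∀ n → 2 ℕ.* n ≡ dbl n
        2*≡ zero    = ≡.refl
        2*≡ (suc n) = ≡.trans (ℕ.*-suc 2 n) (≡.cong (λ k → suc (suc k)) (2*≡ n))

-- The two product formulas over ℝ and ℂ.

module Evaluation where
  open import Data.Integer as ℤ using (+_)
  import Data.Integer.Properties as ℤ
  open import Data.List using (downFrom)
  open import Data.Nat as ℕ using (ℕ; zero; suc)
  import Data.Nat.Properties as ℕ
  open import Data.Product using (_×_; _,_; proj₁; proj₂)
  open import Data.Rational as ℚ using (1ℚ)
  open import Relation.Binary.PropositionalEquality as ≡ using (_≡_)
  open RealRing using (ℝ-commutativeRing; ≈⇒≃; pointwise; 0ℝ-def)
  open RealCosine
  open CommutativeRing ℝ-commutativeRing hiding (zero)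
  open import Relation.Binary.Reasoning.Setoid setoid
  open IntegerCoefficients ℝ-commutativeRing using (module Solver; fromInt; fromNat; fromNat-suc)
  open Solver
  open ChebyshevU ℝ-commutativeRing
  open Spectrum ℝ-commutativeRing using (inner; E; sgn)
  open ListSums ℝ-commutativeRing using (∏)
  open HalfGrid
  open ℂ
  open ℝ

  fromNat≈ : ∀ n → fromNat n ≈ ℕ→ℝ n
  fromNat≈ zero    = reflexive 0ℝ-def
  fromNat≈ (suc n) = trans (fromNat-suc n) (trans (⊞-raw 1# (ℕ→ℝ 1) (fromNat n) (ℕ→ℝ n) 1≈ (fromNat≈ n))
    (pointwise {ℕ→ℝ 1 +ℝ ℕ→ℝ n} {ℕ→ℝ (suc n)} (λ k → ≡.sym (fromℕℚ-suc n))))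

  abstract
    -- The entry of index 0 is 1, and the squares of the others are nonnegative.
    inner≥1 : ∀ m z → AtLeast 1ℚ (inner (suc m) z z)
    inner≥1 zero    z = atLeast-cong (solve 0 (con (+ 1) := con (+ 1) :* con (+ 1) :+ con (+ 0)) refl) atLeast-1
    inner≥1 (suc m) z = atLeast-+ (atLeast-square (E z (suc m))) (inner≥1 m z)

    inner-regular : ∀ m z → Regular (inner (suc m) z z)
    inner-regular m z = atLeast⇒regular (inner≥1 m z)

  module Spec = CosineSpectrum ℝ-commutativeRing C

  determinant : ℕ → ℕ → ℤ.ℤ
  determinant m n = Exterior.det ℤ.+-*-commutativeRing (vertices m n) Δ

  node² : ℕ → ℕ → ℝ
  node² m h = C (Nodes.node m (suc h)) * C (Nodes.node m (suc h))

  abstract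
    determinant≈ : ∀ m n → fromInt (determinant m n) ≈ ∏ (downFrom m) (λ h → ∏ (downFrom n) (λ k → four * node² m h + four * node² n k))
    determinant≈ m n = Spec.det-Δ≈ C-± C-0 C-½ two-regular (λ r → Acute.1-C-regular r) (λ r → Acute.C-half-regular r) inner-regular m n

    determinant≈∏P : ∀ m n → fromInt (determinant m n) ≈ sgn (m ℕ.* n) * ∏ (downFrom m) (λ h → P n (- node² m h))
    determinant≈∏P m n = Spec.det-Δ≈∏P C-± C-0 C-½ two-regular (λ r → Acute.1-C-regular r) (λ r → Acute.C-half-regular r) inner-regular m n

  ∏ℝ-suc : ∀ m (f : ℕ → ℝ) → ∏ℝ (suc m) f ≈ ∏ℝ m f *ℝ f (suc m)
  ∏ℝ-suc m f = pointwise {∏ℝ (suc m) f} {∏ℝ m f *ℝ f (suc m)} (λ n → ≡.refl)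

  ∏ℝ-zero : ∀ (f : ℕ → ℝ) → ∏ℝ 0 f ≈ ℕ→ℝ 1
  ∏ℝ-zero f = pointwise {∏ℝ 0 f} {ℕ→ℝ 1} (λ n → ≡.refl)

  ∏ℝ≈ : ∀ m (f g : ℕ → ℝ) → (∀ h → f (suc h) ≈ g h) → ∏ℝ m f ≈ ∏ (downFrom m) g
  ∏ℝ≈ zero    f g e = trans (∏ℝ-zero f) (sym 1≈)
  ∏ℝ≈ (suc m) f g e = trans (∏ℝ-suc m f) (trans (sym (⊠-raw (∏ (downFrom m) g) (∏ℝ m f) (g m) (f (suc m)) (sym (∏ℝ≈ m f g e)) (sym (e m)))) (*-comm _ _))

  four≈ : four ≈ ℕ→ℝ 4
  four≈ = fromNat≈ 4

  cube≈ : ∀ c x → c ≈ x → c * (c * 1#) ≈ x *ℝ (x *ℝ ℕ→ℝ 1)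
  cube≈ c x c≈x = ⊠-raw c x (c * 1#) (x *ℝ ℕ→ℝ 1) c≈x (⊠-raw c x 1# (ℕ→ℝ 1) c≈x 1≈)

  square≈ : ∀ c x → c ≈ x → c * c ≈ x *ℝ (x *ℝ ℕ→ℝ 1)
  square≈ c x c≈x = trans (*-congˡ {c} {c} {c * 1#} (sym (*-identityʳ c))) (cube≈ c x c≈x)

  four-square≈ : ∀ c x → c ≈ x → four * (c * c) ≈ ℕ→ℝ 4 *ℝ (x *ℝ (x *ℝ ℕ→ℝ 1))
  four-square≈ c x c≈x = ⊠-raw four (ℕ→ℝ 4) (c * c) (x *ℝ (x *ℝ ℕ→ℝ 1)) four≈ (square≈ c x c≈x)

  square-seq : ∀ x n → seq (x ^ℝ 2) n ≡ seq x n ℚ.* (seq x n ℚ.* fromℕℚ 1)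
  square-seq x n = ≡.refl

  powers-raw : ∀ x y → ℕ→ℝ 4 *ℝ x ^ℝ 2 +ℝ ℕ→ℝ 4 *ℝ y ^ℝ 2 ≈ ℕ→ℝ 4 *ℝ (x *ℝ (x *ℝ ℕ→ℝ 1)) +ℝ ℕ→ℝ 4 *ℝ (y *ℝ (y *ℝ ℕ→ℝ 1))
  powers-raw x y = pointwise (λ n → ≡.cong₂ ℚ._+_ (≡.cong (fromℕℚ 4 ℚ.*_) (square-seq x n)) (≡.cong (fromℕℚ 4 ℚ.*_) (square-seq y n)))

  four-squares≈ : ∀ c x d y → x ≈ c → y ≈ d → ℕ→ℝ 4 *ℝ x ^ℝ 2 +ℝ ℕ→ℝ 4 *ℝ y ^ℝ 2 ≈ four * (c * c) + four * (d * d)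
  four-squares≈ c x d y p q = trans (powers-raw x y)
    (sym (⊞-raw (four * (c * c)) (ℕ→ℝ 4 *ℝ (x *ℝ (x *ℝ ℕ→ℝ 1))) (four * (d * d)) (ℕ→ℝ 4 *ℝ (y *ℝ (y *ℝ ℕ→ℝ 1))) (four-square≈ c x (sym p)) (four-square≈ d y (sym q))))

  ∏∏ℝ≈ : ∀ m n (X Y c d : ℕ → ℝ) → (∀ h → X (suc h) ≈ c h) → (∀ k → Y (suc k) ≈ d k) →
    ∏ℝ m (λ h → ∏ℝ n (λ k → ℕ→ℝ 4 *ℝ X h ^ℝ 2 +ℝ ℕ→ℝ 4 *ℝ Y k ^ℝ 2))
      ≈ ∏ (downFrom m) (λ h → ∏ (downFrom n) (λ k → four * (c h * c h) + four * (d k * d k)))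
  ∏∏ℝ≈ m n X Y c d e f = ∏ℝ≈ m _ _ (λ h → ∏ℝ≈ n _ _ (λ k → four-squares≈ (c h) (X (suc h)) (d k) (Y (suc k)) (e h) (f k)))

  double-product≈ : ∀ m n → fromInt (determinant m n) ≈ ∏ℝ m (λ h → ∏ℝ n (λ k → ℕ→ℝ 4 *ℝ ξ h m ^ℝ 2 +ℝ ℕ→ℝ 4 *ℝ ξ k n ^ℝ 2))
  double-product≈ m n = trans (determinant≈ m n) (sym (∏∏ℝ≈ m n (λ h → ξ h m) (λ k → ξ k n) (λ h → C (Nodes.node m (suc h))) (λ k → C (Nodes.node n (suc k)))
    (λ h → ξ≈ (suc h) m) (λ k → ξ≈ (suc k) n)))

  double-product : ∀ m n N → + N ≡ determinant m n →
    ℕ→ℝ N ≃ℝ ∏ℝ m (λ h → ∏ℝ n (λ k → ℕ→ℝ 4 *ℝ ξ h m ^ℝ 2 +ℝ ℕ→ℝ 4 *ℝ ξ k n ^ℝ 2))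
  double-product m n N e = ≈⇒≃ (trans (trans (sym (fromNat≈ N)) (reflexive (≡.cong fromInt e))) (double-product≈ m n))

  -- Links a complex number built by the concrete operations to its real and imaginary parts in the
  -- opaque ring, where identities are solved.
  record Represents (z : ℂ) (x y : ℝ) : Set where
    constructor _,_
    field
      re≈ : re z ≈ x
      im≈ : im z ≈ y
  open Represents

  represents-cong : ∀ {z x y x′ y′} → x ≈ x′ → y ≈ y′ → Represents z x y → Represents z x′ y′
  represents-cong e f (p , q) = trans p e , trans q f

  represents-pointwise : ∀ z w {a b} → (∀ n → seq (re z) n ≡ seq (re w) n) → (∀ n → seq (im z) n ≡ seq (im w) n) →
    Represents w a b → Represents z a b
  represents-pointwise z w h k (p , q) = trans (pointwise {re z} {re w} h) p , trans (pointwise {im z} {im w} k) q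

  represents-intro : ∀ x y {a b} → x ≈ a → y ≈ b → Represents (x +i y) a b
  represents-intro x y p q = p , q

  represents-+ : ∀ z w {a b c d} → Represents z a b → Represents w c d → Represents (z +ℂ w) (a + c) (b + d)
  represents-+ z w {a} {b} {c} {d} (p , q) (r , s) =
    represents-pointwise (z +ℂ w) ((re z +ℝ re w) +i (im z +ℝ im w)) (λ n → ≡.refl) (λ n → ≡.refl)
      (represents-intro (re z +ℝ re w) (im z +ℝ im w)
        (sym (⊞-raw a (re z) c (re w) (sym p) (sym r))) (sym (⊞-raw b (im z) d (im w) (sym q) (sym s))))

  neg-raw : ∀ x y → x ≈ y → - x ≈ -ℝ y
  neg-raw x y h = trans (-‿cong h) (⊟≈ y)

  represents-neg : ∀ z {a b} → Represents z a b → Represents (-ℂ z) (- a) (- b)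
  represents-neg z {a} {b} (p , q) = represents-pointwise (-ℂ z) ((-ℝ re z) +i (-ℝ im z)) (λ n → ≡.refl) (λ n → ≡.refl)
    (represents-intro (-ℝ re z) (-ℝ im z) (sym (neg-raw a (re z) (sym p))) (sym (neg-raw b (im z) (sym q))))

  represents-* : ∀ z w {a b c d} → Represents z a b → Represents w c d → Represents (z *ℂ w) (a * c - b * d) (a * d + b * c)
  represents-* z w {a} {b} {c} {d} (p , q) (r , s) = represents-pointwise (z *ℂ w)
    ((re z *ℝ re w +ℝ (-ℝ (im z *ℝ im w))) +i (re z *ℝ im w +ℝ im z *ℝ re w)) (λ n → ≡.refl) (λ n → ≡.refl)
    (represents-intro (re z *ℝ re w +ℝ (-ℝ (im z *ℝ im w))) (re z *ℝ im w +ℝ im z *ℝ re w)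
      (sym (⊞-raw (a * c) (re z *ℝ re w) (- (b * d)) (-ℝ (im z *ℝ im w)) (⊠-raw a (re z) c (re w) (sym p) (sym r))
        (neg-raw (b * d) (im z *ℝ im w) (⊠-raw b (im z) d (im w) (sym q) (sym s)))))
      (sym (⊞-raw (a * d) (re z *ℝ im w) (b * c) (im z *ℝ re w) (⊠-raw a (re z) d (im w) (sym p) (sym s)) (⊠-raw b (im z) c (re w) (sym q) (sym r)))))

  represents-ℕ : ∀ n → Represents (ℕ→ℂ n) (fromNat n) 0#
  represents-ℕ n = represents-pointwise (ℕ→ℂ n) (ℕ→ℝ n +i ℕ→ℝ 0) (λ k → ≡.refl) (λ k → ≡.refl)
    (represents-intro (ℕ→ℝ n) (ℕ→ℝ 0) (sym (fromNat≈ n)) (sym (fromNat≈ 0)))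

  represents-𝕚* : ∀ x c → x ≈ c → Represents (𝕚 *ℂ ℝ→ℂ x) 0# c
  represents-𝕚* x c e = represents-cong (solve 1 (λ c → con (+ 0) :* c :- con (+ 1) :* con (+ 0) := con (+ 0)) refl c)
    (solve 1 (λ c → con (+ 0) :* con (+ 0) :+ con (+ 1) :* c := c) refl c)
    (represents-* 𝕚 (ℝ→ℂ x) (represents-pointwise 𝕚 (ℕ→ℝ 0 +i ℕ→ℝ 1) (λ n → ≡.refl) (λ n → ≡.refl) (represents-intro (ℕ→ℝ 0) (ℕ→ℝ 1) (sym (fromNat≈ 0)) (sym (fromNat≈ 1))))
      (represents-pointwise (ℝ→ℂ x) (x +i ℕ→ℝ 0) (λ n → ≡.refl) (λ n → ≡.refl) (represents-intro x (ℕ→ℝ 0) e (sym (fromNat≈ 0)))))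

  represents-real-* : ∀ z w {a c} → Represents z a 0# → Represents w c 0# → Represents (z *ℂ w) (a * c) 0#
  represents-real-* z w {a} {c} p q = represents-cong (solve 2 (λ a c → a :* c :- con (+ 0) :* con (+ 0) := a :* c) refl a c)
    (solve 2 (λ a c → a :* con (+ 0) :+ con (+ 0) :* c := con (+ 0)) refl a c) (represents-* z w p q)

  represents-∏ : ∀ m (f : ℕ → ℂ) (g : ℕ → ℝ) → (∀ h → Represents (f (suc h)) (g h) 0#) → Represents (∏ℂ m f) (∏ (downFrom m) g) 0#
  represents-∏ zero    f g e = represents-pointwise (∏ℂ 0 f) (ℕ→ℂ 1) (λ n → ≡.refl) (λ n → ≡.refl) (represents-ℕ 1)
  represents-∏ (suc m) f g e = represents-pointwise (∏ℂ (suc m) f) (∏ℂ m f *ℂ f (suc m)) (λ n → ≡.refl) (λ n → ≡.refl)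
    (represents-cong (*-comm _ _) refl (represents-real-* (∏ℂ m f) (f (suc m)) (represents-∏ m f g e) (e m)))

  represents-sgn : ∀ z k → Represents z (- 1#) 0# → Represents (z ^ℂ k) (sgn k) 0#
  represents-sgn z zero    r = represents-pointwise (z ^ℂ 0) (ℕ→ℂ 1) (λ n → ≡.refl) (λ n → ≡.refl) (represents-ℕ 1)
  represents-sgn z (suc k) r = represents-pointwise (z ^ℂ suc k) (z *ℂ z ^ℂ k) (λ n → ≡.refl) (λ n → ≡.refl)
    (represents-cong (solve 1 (λ s → (:- con (+ 1)) :* s := :- s) refl (sgn k)) refl (represents-real-* z (z ^ℂ k) r (represents-sgn z k r)))

  represents--1 : Represents (-ℂ ℕ→ℂ 1) (- 1#) 0#
  represents--1 = represents-cong refl (solve 0 (:- con (+ 0) := con (+ 0)) refl) (represents-neg (ℕ→ℂ 1) (represents-ℕ 1))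

  represents-U : ∀ n y x → Represents y 0# x → Represents (U (2 ℕ.* n) y) (P n (- (x * x))) 0#
  represents-U n y x r = Representation.ImaginaryArgument.rep-U2n ℝ-commutativeRing ℂ-rawRing Represents
    (λ z → represents-cong {z}) represents-+ represents-neg represents-* (represents-ℕ 1) y x r n

  represents-factor : ∀ n (X c : ℕ → ℝ) → (∀ h → X (suc h) ≈ c h) → ∀ h →
    Represents (U (2 ℕ.* n) (𝕚 *ℂ ℝ→ℂ (X (suc h)))) (P n (- (c h * c h))) 0#
  represents-factor n X c e h = represents-U n _ (c h) (represents-𝕚* (X (suc h)) (c h) (e h))

  represents-power : ∀ k → Represents ((-ℂ ℕ→ℂ 1) ^ℂ k) (sgn k) 0#
  represents-power k = represents-sgn _ k represents--1

  represents-factors : ∀ m n (X c : ℕ → ℝ) → (∀ h → X (suc h) ≈ c h) →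
    Represents (∏ℂ m (λ h → U (2 ℕ.* n) (𝕚 *ℂ ℝ→ℂ (X h)))) (∏ (downFrom m) (λ h → P n (- (c h * c h)))) 0#
  represents-factors m n X c e = represents-∏ m _ (λ h → P n (- (c h * c h))) (represents-factor n X c e)

  represents-product : ∀ m n (X c : ℕ → ℝ) → (∀ h → X (suc h) ≈ c h) →
    Represents ((-ℂ ℕ→ℂ 1) ^ℂ (m ℕ.* n) *ℂ ∏ℂ m (λ h → U (2 ℕ.* n) (𝕚 *ℂ ℝ→ℂ (X h))))
      (sgn (m ℕ.* n) * ∏ (downFrom m) (λ h → P n (- (c h * c h)))) 0#
  represents-product m n X c e = let r = represents-real-* _ _ (represents-power (m ℕ.* n)) (represents-factors m n X c e) in r

  represents⇒≃ : ∀ {z w a b} → Represents z a 0# → Represents w b 0# → a ≈ b → z ≃ℂ w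
  represents⇒≃ (p , q) (r , s) e = ≈⇒≃ (trans p (trans e (sym r))) , ≈⇒≃ (trans q (sym s))

  chebyshev-product : ∀ m n N → + N ≡ determinant m n →
    ℕ→ℂ N ≃ℂ (-ℂ ℕ→ℂ 1) ^ℂ (m ℕ.* n) *ℂ ∏ℂ m (λ h → U (2 ℕ.* n) (𝕚 *ℂ ℝ→ℂ (ξ h m)))
  chebyshev-product m n N e =
    let r = represents⇒≃ (represents-ℕ N) (represents-product m n (λ h → ξ h m) (λ h → C (Nodes.node m (suc h))) (λ h → ξ≈ (suc h) m))
              (trans (reflexive (≡.cong fromInt e)) (determinant≈∏P m n))
    in r

-- The Pfaffian as a recursive count of matchings.

-- Matchings of the cells 0, …, k - 1 of a board with rows of length q, numbered row by row:
-- cell k can be matched with k - 1 (if in the same row) and k - q.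
module MatchingCount (q : ℕ) .{{_ : NonZero q}} where
  open import Data.Bool using (Bool; true; false; not; _xor_; if_then_else_; _∧_)
  open import Data.Bool.Properties using (not-involutive)
  open import Data.Integer as ℤ using (ℤ; +_)
  import Data.Integer.Properties as ℤ
  open import Data.Integer.Solver using (module +-*-Solver)
  open import Data.List using ([]; _∷_; downFrom; length)
  open import Data.List.Membership.Propositional using (_∈_)
  open import Data.List.Membership.Propositional.Properties using (∈-downFrom⁻)
  open import Data.Nat as ℕ using (ℕ; zero; suc; _∸_; _≤_; _<_; z≤n; s≤s; _≡ᵇ_; _≤ᵇ_)
  open import Data.Nat.DivMod using (_%_; [m+kn]%n≡m%n; m<n⇒m%n≡m)
  open import Data.Product using (_×_; _,_)
  import Data.Nat.Properties as ℕ
  open import Data.Sum using (inj₁; inj₂)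
  open import Data.Vec using (Vec; []; _∷_; replicate)
  open import Function using (_∘_)
  open import Relation.Binary.PropositionalEquality
  open import Relation.Nullary using (contradiction)
  open Exterior ℤ.+-*-commutativeRing
  open Pfaffian ℤ.+-*-commutativeRing
  open HalfGrid using (δ; δ-refl; δ-≢; parity)

  position-% : ∀ x {y} → y < q → (y ℕ.+ x ℕ.* q) % q ≡ y
  position-% x {y} y<q = trans ([m+kn]%n≡m%n y x q) (m<n⇒m%n≡m y<q)

  position-injective : ∀ {x y x′ y′} → y < q → y′ < q → y ℕ.+ x ℕ.* q ≡ y′ ℕ.+ x′ ℕ.* q → x ≡ x′ × y ≡ y′
  position-injective {x} {y} {x′} {y′} y<q y′<q e = ℕ.*-cancelʳ-≡ x x′ q (ℕ.+-cancelˡ-≡ y _ _ (trans e (cong (ℕ._+ x′ ℕ.* q) (sym y≡)))) , y≡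
    where
    y≡ : y ≡ y′
    y≡ = trans (sym (position-% x y<q)) (trans (cong (_% q) e) (position-% x′ y′<q))

  Region : Set
  Region = ℕ → Bool

  remove : ℕ → Region → Region
  remove d L j = if j ≡ᵇ d then false else L j

  sameRow : ℕ → Bool
  sameRow k = not (k % q ≡ᵇ 0)

  -- The largest cell of a region can only be matched with its left or its upper neighbour; the
  -- Pfaffian is expanded along the same choice.
  matchings : ℕ → Region → ℕ
  matchings zero    L = 1
  matchings (suc k) L = if L k
    then (if sameRow k ∧ L (k ∸ 1) then matchings k (remove (k ∸ 1) L) else 0) ℕ.+
         (if (q ≤ᵇ k) ∧ L (k ∸ q) then matchings k (remove (k ∸ q) L) else 0)
    else matchings k L

  mask : ∀ k → Region → Vec Bool (length (downFrom k))
  mask zero    L = []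
  mask (suc k) L = L k ∷ mask k L

  -- The number of cells of L below k modulo 2, which governs the signs of the wedge product.
  size : ℕ → Region → Bool
  size zero    L = false
  size (suc k) L = L k xor size k L

  private
    ≡ᵇ-refl : ∀ d → (d ≡ᵇ d) ≡ true
    ≡ᵇ-refl zero    = refl
    ≡ᵇ-refl (suc d) = ≡ᵇ-refl d

  remove-at : ∀ d L → remove d L d ≡ false
  remove-at d L rewrite ≡ᵇ-refl d = refl

  remove-off : ∀ {d j} L → j ≢ d → remove d L j ≡ L j
  remove-off {d} {j} L n with j ≡ᵇ d in eq
  ... | true  = contradiction (ℕ.≡ᵇ⇒≡ j d (subst Data.Bool.T (sym eq) _)) n
  ... | false = refl

  private
    mask-cong : ∀ k {L L′ : Region} → (∀ j → j < k → L j ≡ L′ j) → mask k L ≡ mask k L′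
    mask-cong zero    h = refl
    mask-cong (suc k) h = cong₂ _∷_ (h k ℕ.≤-refl) (mask-cong k (λ j lt → h j (ℕ.m<n⇒m<1+n lt)))

    size-cong : ∀ k {L L′ : Region} → (∀ j → j < k → L j ≡ L′ j) → size k L ≡ size k L′
    size-cong zero    h = refl
    size-cong (suc k) h = cong₂ _xor_ (h k ℕ.≤-refl) (size-cong k (λ j lt → h j (ℕ.m<n⇒m<1+n lt)))

    mask-remove : ∀ k L → mask k (remove k L) ≡ mask k L
    mask-remove k L = mask-cong k (λ j lt → remove-off L (λ { refl → ℕ.<-irrefl refl lt }))

    size-full : ∀ k {L : Region} → (∀ j → j < k → L j ≡ true) → size k L ≡ parity k
    size-full zero    h = refl
    size-full (suc k) h = trans (cong₂ _xor_ (h k ℕ.≤-refl) (size-full k (λ j lt → h j (ℕ.m<n⇒m<1+n lt)))) refl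

    not-xor : ∀ a b → not a xor b ≡ not (a xor b)
    not-xor true  b = sym (not-involutive b)
    not-xor false b = refl

    -- the parity of the number of cells of L strictly between d and k is that of
    -- size k L minus size (d + 1) L
    size-remove : ∀ d k L → d < k → L d ≡ true → size k (remove d L) ≡ not (size k L)
    size-remove d (suc k) L (s≤s d≤k) h with ℕ.m≤n⇒m<n∨m≡n d≤k
    ... | inj₂ refl = trans (cong₂ _xor_ (remove-at k L) (size-cong k (λ j lt → remove-off L (λ { refl → ℕ.<-irrefl refl lt }))))
      (sym (trans (cong (λ b → not (b xor size k L)) h) (not-involutive (size k L))))
    ... | inj₁ d<k = trans (cong₂ _xor_ (remove-off L (λ { refl → ℕ.<-irrefl refl d<k })) (size-remove d k L d<k h)) (xor-not (L k) (size k L))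
      where
      xor-not : ∀ a b → a xor not b ≡ not (a xor b)
      xor-not true  b = refl
      xor-not false b = refl

  unit : ℕ → ℕ → ℤ
  unit d j = + δ d j

  -- The unit vector at d has to move past the cells of L between d and k, and the two sizes differ
  -- by their number.
  wedge-unit : ∀ k d L (z : Λ (downFrom k)) → d < k →
    wedge (downFrom k) (unit d) z (mask k L)
      ≡ (if L d then signed (size k L xor size (suc d) L) (z (mask k (remove d L))) else + 0)
  wedge-unit (suc k) d L z (s≤s d≤k) with ℕ.m≤n⇒m<n∨m≡n d≤k
  ... | inj₂ refl = at-head (L k) refl
    where
    zero-below : ∀ {i} → i ∈ downFrom k → unit k i ≡ + 0
    zero-below {i} m = cong +_ (δ-≢ {k} {i} (λ { refl → ℕ.<-irrefl refl (∈-downFrom⁻ m) }))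
    self : ∀ b → b xor b ≡ false
    self true  = refl
    self false = refl
    at-head : ∀ b → L k ≡ b → wedge (k ∷ downFrom k) (unit k) z (b ∷ mask k L)
      ≡ (if b then signed ((b xor size k L) xor (b xor size k L)) (z (remove k L k ∷ mask k (remove k L))) else + 0)
    at-head false e = wedge-zeroˡ (downFrom k) _ zero-below _
    at-head true  e = begin
      + δ k k ℤ.* z (false ∷ mask k L) ℤ.- wedge (downFrom k) (unit k) _ (mask k L)
        ≡⟨ cong₂ ℤ._-_ (trans (cong (λ x → + x ℤ.* z (false ∷ mask k L)) (δ-refl k)) (ℤ.*-identityˡ _)) (wedge-zeroˡ (downFrom k) _ zero-below _) ⟩
      z (false ∷ mask k L) ℤ.- + 0
        ≡⟨ ℤ.+-identityʳ _ ⟩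
      z (false ∷ mask k L)
        ≡⟨ cong₂ (λ b K → z (b ∷ K)) (sym (remove-at k L)) (sym (mask-remove k L)) ⟩
      z (remove k L k ∷ mask k (remove k L))
        ≡⟨ cong (λ b → signed b (z (remove k L k ∷ mask k (remove k L)))) (sym (self (not (size k L)))) ⟩
      signed (not (size k L) xor not (size k L)) (z (remove k L k ∷ mask k (remove k L))) ∎
      where open ≡-Reasoning
  ... | inj₁ d<k = at-tail (L k) refl
    where
    k≢d : k ≢ d
    k≢d refl = ℕ.<-irrefl refl d<k
    at-tail : ∀ b → L k ≡ b → wedge (k ∷ downFrom k) (unit d) z (b ∷ mask k L)
      ≡ (if L d then signed ((b xor size k L) xor size (suc d) L) (z (remove d L k ∷ mask k (remove d L))) else + 0)
    at-tail false e = trans (wedge-unit k d L _ d<k)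
      (cong (λ b → if L d then signed (size k L xor size (suc d) L) (z (b ∷ mask k (remove d L))) else + 0) (sym (trans (remove-off L k≢d) e)))
    at-tail true e = begin
      + δ d k ℤ.* z (false ∷ mask k L) ℤ.- wedge (downFrom k) (unit d) (z ∘ (true ∷_)) (mask k L)
        ≡⟨ cong₂ (λ x y → + x ℤ.* z (false ∷ mask k L) ℤ.- y) (δ-≢ (k≢d ∘ sym)) (wedge-unit k d L (z ∘ (true ∷_)) d<k) ⟩
      + 0 ℤ.* z (false ∷ mask k L) ℤ.- (if L d then signed (size k L xor size (suc d) L) (z (true ∷ mask k (remove d L))) else + 0)
        ≡⟨ trans (cong (ℤ._- (if L d then signed (size k L xor size (suc d) L) (z (true ∷ mask k (remove d L))) else + 0)) (ℤ.*-zeroˡ (z (false ∷ mask k L)))) (ℤ.+-identityˡ _) ⟩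
      ℤ.- (if L d then signed (size k L xor size (suc d) L) (z (true ∷ mask k (remove d L))) else + 0)
        ≡⟨ negate (L d) ⟩
      (if L d then signed ((not (size k L)) xor size (suc d) L) (z (true ∷ mask k (remove d L))) else + 0)
        ≡⟨ cong (λ b → if L d then signed (not (size k L) xor size (suc d) L) (z (b ∷ mask k (remove d L))) else + 0) (sym (trans (remove-off L k≢d) e)) ⟩
      (if L d then signed ((not (size k L)) xor size (suc d) L) (z (remove d L k ∷ mask k (remove d L))) else + 0) ∎
      where
      open ≡-Reasoning
      flip : ∀ b {x} → ℤ.- signed b x ≡ signed (not b) x
      flip false = refl
      flip true  = ℤ.neg-involutive _
      negate : ∀ b {x} → ℤ.- (if b then signed (size k L xor size (suc d) L) x else + 0) ≡ (if b then signed (not (size k L) xor size (suc d) L) x else + 0)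
      negate false = refl
      negate true {x} = trans (flip (size k L xor size (suc d) L)) (cong (λ b → signed b x) (sym (not-xor (size k L) (size (suc d) L))))

  -- The frontier of the region processed by `matchings` contains all cells below k - q; the
  -- parity of the number of remaining cells then determines the sign with which the domino on
  -- k and k - q enters the Pfaffian.
  module _ (A : ℕ → ℕ → ℤ) (even : parity q ≡ false)
    (A-row : ∀ k {j} → j < k →
      A k j ≡ (if sameRow k then unit (k ∸ 1) j else + 0) ℤ.+ (if q ≤ᵇ k then signed (parity k) (unit (k ∸ q) j) else + 0)) where

    private
      parity-∸ : ∀ k → q ≤ k → parity (k ∸ q) ≡ parity k
      parity-∸ k q≤k = trans (sym (trans (cong (_xor parity (k ∸ q)) even) refl)) (trans (sym (parity-+ q (k ∸ q))) (cong parity (ℕ.m+[n∸m]≡n q≤k)))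
        where
        parity-+ : ∀ a b → parity (a ℕ.+ b) ≡ parity a xor parity b
        parity-+ zero    b = refl
        parity-+ (suc a) b = trans (cong not (parity-+ a b)) (sym (not-xor (parity a) (parity b)))

      sameRow-pos : ∀ k → sameRow k ≡ true → 0 < k
      sameRow-pos zero    e with () ← trans (sym e) (cong (λ x → not (x ≡ᵇ 0)) (Data.Nat.DivMod.m*n%n≡0 0 q))
      sameRow-pos (suc k) e = s≤s z≤n

    -- Dominoes placed so far have their larger cell at k or beyond, hence touch no cell below k -
    -- q; and each of them removes two cells, so the number of cells stays even.
    pf-matchings : ∀ k L → (∀ j → j < k ∸ q → L j ≡ true) → size k L ≡ false → pf A (downFrom k) (mask k L) ≡ + matchings k L
    pf-matchings zero    L full ev = refl
    pf-matchings (suc k) L full ev = by-case (L k) refl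
      where
      q>0 : 0 < q
      q>0 = ℕ.>-nonZero⁻¹ q
      full′ : ∀ j → j < k ∸ q → L j ≡ true
      full′ j lt = full j (ℕ.<-≤-trans lt (ℕ.∸-monoˡ-≤ q (ℕ.n≤1+n k)))
      h v : ℕ → Region → ℕ
      h k L = if sameRow k ∧ L (k ∸ 1) then matchings k (remove (k ∸ 1) L) else 0
      v k L = if (q ≤ᵇ k) ∧ L (k ∸ q) then matchings k (remove (k ∸ q) L) else 0
      by-case : ∀ b → L k ≡ b → pf A (downFrom (suc k)) (b ∷ mask k L) ≡ + (if b then h k L ℕ.+ v k L else matchings k L)
      by-case false e = pf-matchings k L full′ (trans (sym (cong (_xor size k L) e)) ev)
      by-case true  e = begin
        wedge (downFrom k) (A k) z (mask k L)
          ≡⟨ wedge-cong (downFrom k) {z = z} (λ m → A-row k (∈-downFrom⁻ m)) (λ _ → refl) (mask k L) ⟩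
        wedge (downFrom k) (λ j → hor j ℤ.+ ver j) z (mask k L)
          ≡⟨ wedge-+ˡ (downFrom k) hor ver z (mask k L) ⟩
        wedge (downFrom k) hor z (mask k L) ℤ.+ wedge (downFrom k) ver z (mask k L)
          ≡⟨ cong₂ ℤ._+_ (along-row (sameRow k) refl) (along-column (q ≤ᵇ k) refl) ⟩
        + h k L ℤ.+ + v k L
          ≡⟨ refl ⟩
        + (h k L ℕ.+ v k L) ∎
        where
        open ≡-Reasoning
        z = pf A (downFrom k)
        hor ver : ℕ → ℤ
        hor j = if sameRow k then unit (k ∸ 1) j else + 0
        ver j = if q ≤ᵇ k then signed (parity k) (unit (k ∸ q) j) else + 0
        odd-rest : size k L ≡ true
        odd-rest = trans (sym (not-involutive (size k L))) (cong not (trans (sym (cong (_xor size k L) e)) ev))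
        ih : ∀ d → k ∸ q ≤ d → d < k → L d ≡ true → pf A (downFrom k) (mask k (remove d L)) ≡ + matchings k (remove d L)
        ih d low d<k Ld = pf-matchings k (remove d L)
          (λ j lt → trans (remove-off L (λ { refl → ℕ.<⇒≱ lt low })) (full′ j lt))
          (trans (size-remove d k L d<k Ld) (cong not odd-rest))
        along-row : ∀ b → sameRow k ≡ b → wedge (downFrom k) (λ j → if b then unit (k ∸ 1) j else + 0) z (mask k L)
          ≡ + (if b ∧ L (k ∸ 1) then matchings k (remove (k ∸ 1) L) else 0)
        along-row false e = wedge-zeroˡ (downFrom k) z (λ _ → refl) (mask k L)
        along-row true  e = trans (wedge-unit k (k ∸ 1) L z k-1<k) (choose (L (k ∸ 1)) refl)
          where
          suc[k-1] : suc (k ∸ 1) ≡ k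
          suc[k-1] = ℕ.m+[n∸m]≡n (sameRow-pos k e)
          k-1<k : k ∸ 1 < k
          k-1<k = ℕ.≤-reflexive suc[k-1]
          self : ∀ b → b xor b ≡ false
          self true  = refl
          self false = refl
          choose : ∀ c → L (k ∸ 1) ≡ c → (if c then signed (size k L xor size (suc (k ∸ 1)) L) (z (mask k (remove (k ∸ 1) L))) else + 0)
            ≡ + (if c then matchings k (remove (k ∸ 1) L) else 0)
          choose false f = refl
          -- In the numbering nothing lies between horizontally adjacent cells, so no sign arises.
          choose true  f = trans (cong (λ b → signed b (z (mask k (remove (k ∸ 1) L)))) (trans (cong (λ i → size k L xor size i L) suc[k-1]) (self (size k L))))
            (ih (k ∸ 1) (ℕ.∸-monoʳ-≤ k q>0) k-1<k f)
        along-column : ∀ b → (q ≤ᵇ k) ≡ b → wedge (downFrom k) (λ j → if b then signed (parity k) (unit (k ∸ q) j) else + 0) z (mask k L)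
          ≡ + (if b ∧ L (k ∸ q) then matchings k (remove (k ∸ q) L) else 0)
        along-column false e = wedge-zeroˡ (downFrom k) z (λ _ → refl) (mask k L)
        along-column true  e = trans (wedge-signed (parity k)) (trans (cong (signed (parity k)) (wedge-unit k d L z d<k)) (trans (cong (λ c → signed (parity k) (if c then signed (size k L xor size (suc d) L) (z (mask k (remove d L))) else + 0)) Ld)
            (trans (trans (signed-xor (parity k) (size k L xor size (suc d) L) _) (cong (λ b → signed b (z (mask k (remove d L)))) sign))
              (trans (ih d ℕ.≤-refl d<k Ld) (cong (λ c → + (if c then matchings k (remove d L) else 0)) (sym Ld))))))
          where
          d = k ∸ q
          q≤k : q ≤ k
          q≤k = ℕ.≤ᵇ⇒≤ q k (subst Data.Bool.T (sym e) _)
          d<k : d < k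
          d<k = ℕ.∸-monoʳ-< q>0 q≤k
          wedge-signed : ∀ s → wedge (downFrom k) (λ j → signed s (unit d j)) z (mask k L) ≡ signed s (wedge (downFrom k) (unit d) z (mask k L))
          wedge-signed false = refl
          wedge-signed true  = trans (wedge-cong (downFrom k) {z = z} (λ {i} _ → sym (ℤ.-1*i≡-i (unit d i))) (λ _ → refl) (mask k L))
            (trans (wedge-*ˡ (downFrom k) (unit d) (ℤ.- (+ 1)) z (mask k L)) (ℤ.-1*i≡-i _))
          full-d : ∀ j → j < suc d → L j ≡ true
          full-d j lt = full j (subst (j <_) (sym (ℕ.+-∸-assoc 1 q≤k)) lt)
          Ld : L d ≡ true
          Ld = full-d d ℕ.≤-refl
          -- An odd number of cells is left below k, of which k - q + 1 lie up to d, and q is even: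
          -- the number passed has the parity of k, and the weight (-1)ᵏ of the vertical edge
          -- compensates it.
          sign : parity k xor (size k L xor size (suc d) L) ≡ false
          sign = trans (cong₂ (λ a b → parity k xor (a xor b)) odd-rest (trans (size-full (suc d) full-d) (cong not (parity-∸ k q≤k)))) (cancel (parity k))
            where
            cancel : ∀ b → b xor (true xor not b) ≡ false
            cancel true  = refl
            cancel false = refl

    pfaffian-matchings : ∀ k → parity k ≡ false → pfaffian A (downFrom k) ≡ + matchings k (λ _ → true)
    pfaffian-matchings k e = trans (cong (pf A (downFrom k)) (sym (full-mask k)))
      (pf-matchings k (λ _ → true) (λ _ _ → refl) (trans (size-full k (λ _ _ → refl)) e))
      where
      full-mask : ∀ k → mask k (λ _ → true) ≡ replicate (length (downFrom k)) true
      full-mask zero    = refl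
      full-mask (suc k) = cong (true ∷_) (full-mask k)

-- Kasteleyn's matrix and its square.

module Kasteleyn where
  open import Data.Bool using (Bool; true; false; not; _xor_; if_then_else_)
  open import Data.Integer as ℤ using (ℤ; +_)
  import Data.Integer.Properties as ℤ
  open import Data.Integer.Solver using (module +-*-Solver)
  open import Data.List using (List; []; _∷_; _++_; map; downFrom; length)
  open import Data.List.Properties using (length-map; length-++; length-downFrom)
  open import Data.List.Membership.Propositional using (_∈_)
  open import Data.List.Membership.Propositional.Properties using (∈-∃++; ∈-++⁺ˡ; ∈-++⁺ʳ; ∈-++⁻; ∈-map⁺; ∈-map⁻; ∈-downFrom⁺; ∈-downFrom⁻; ∈-cartesianProduct⁺; ∈-cartesianProduct⁻)
  open import Data.List.Relation.Binary.Permutation.Propositional as Perm using (_↭_; prep; swap; ↭-trans; ↭-sym; ↭-refl)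
  open import Data.List.Relation.Binary.Permutation.Propositional.Properties using (shift; ↭-length; ∈-resp-↭)
  open import Data.List.Relation.Unary.All as All using ()
  open import Data.List.Relation.Unary.AllPairs using ([]; _∷_)
  open import Data.List.Relation.Unary.Any using (here; there)
  open import Data.List.Relation.Unary.Unique.Propositional using (Unique)
  import Data.List.Relation.Unary.Unique.Propositional.Properties as Unique
  open import Data.Nat as ℕ using (zero; suc; _∸_; _≤_; _<_; z≤n; s≤s)
  open import Data.Nat.DivMod using (_/_; _%_; m≡m%n+[m/n]*n; m%n<n; m<n*o⇒m/o<n)
  import Data.Nat.Properties as ℕ
  open import Data.Product using (_×_; _,_; ∃-syntax; proj₁; proj₂)
  open import Data.Sum using (_⊎_; inj₁; inj₂)
  open import Data.Vec using ([]; _∷_)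
  open import Relation.Binary.PropositionalEquality
  open import Relation.Binary.Definitions using (tri<; tri≈; tri>)
  open import Relation.Nullary using (yes; no; contradiction)
  open import Relation.Nullary.Decidable using (dec-true; dec-false)
  open +-*-Solver
  open ListSums ℤ.+-*-commutativeRing
  open Exterior ℤ.+-*-commutativeRing
  open Pfaffian ℤ.+-*-commutativeRing
  open HalfGrid

  -- Allows two enumerations of the cells to be compared by inclusion and length alone.
  ⊆-length⇒↭ : ∀ {A : Set} (xs ys : List A) → Unique xs → (∀ {x} → x ∈ xs → x ∈ ys) → length ys ≡ length xs → xs ↭ ys
  ⊆-length⇒↭ []       []       _       _ _ = ↭-refl
  ⊆-length⇒↭ (x ∷ xs) ys (n ∷ u) s e with ∈-∃++ (s (here refl))
  ... | as , bs , refl = ↭-trans (prep x (⊆-length⇒↭ xs (as ++ bs) u sub (ℕ.suc-injective (trans (sym (↭-length (shift x as bs))) e)))) (↭-sym (shift x as bs))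
    where
    sub : ∀ {y} → y ∈ xs → y ∈ as ++ bs
    sub m with ∈-resp-↭ (shift x as bs) (s (there m))
    ... | here refl = contradiction refl (All.lookup n m)
    ... | there k   = k

  ∑-↭ : ∀ {I : Set} {is js : List I} → is ↭ js → ∀ f → ∑ is f ≡ ∑ js f
  ∑-↭ Perm.refl        f = refl
  ∑-↭ (prep i p)       f = cong (ℤ._+_ (f i)) (∑-↭ p f)
  ∑-↭ (swap {is} {js} i j p) f = trans (cong (λ s → f i ℤ.+ (f j ℤ.+ s)) (∑-↭ p f))
    (solve 3 (λ a b c → a :+ (b :+ c) := b :+ (a :+ c)) refl (f i) (f j) (∑ js f))
  ∑-↭ (Perm.trans p q) f = trans (∑-↭ p f) (∑-↭ q f)

  pfaffian-map : ∀ {I J : Set} (A : J → J → ℤ) (g : I → J) is → pfaffian A (map g is) ≡ pfaffian (λ i j → A (g i) (g j)) is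
  pfaffian-map A g is = trans (cong (pf A (map g is)) (sym (relabel-full g is))) (go is _)
    where
    go : ∀ is L → pf A (map g is) (relabel g is L) ≡ pf (λ i j → A (g i) (g j)) is L
    go []       L           = refl
    go (i ∷ is) (false ∷ L) = go is L
    go (i ∷ is) (true ∷ L)  = trans (relabel-wedge g is (A (g i)) _ L) (wedge-congʳ is (go is) L)

  δ-cong : ∀ {a b c d} → (a ≡ b → c ≡ d) → (c ≡ d → a ≡ b) → δ a b ≡ δ c d
  δ-cong {a} {b} {c} {d} f g with a ℕ.≟ b
  ... | yes refl = trans (δ-refl a) (trans (sym (δ-refl d)) (cong (λ x → δ x d) (sym (f refl))))
  ... | no n     = trans (δ-≢ n) (sym (δ-≢ (λ e → n (g e))))

  -- The skew adjacency matrix of a path, positive from the larger to the smaller index.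
  D : ℕ → ℕ → ℤ
  D y y′ = + δ y (suc y′) ℤ.- + δ (suc y) y′

  D-skew : ∀ y y′ → D y y′ ≡ ℤ.- D y′ y
  D-skew y y′ = trans (cong₂ (λ a b → + a ℤ.- + b) (δ-sym y (suc y′)) (δ-sym (suc y) y′))
    (solve 2 (λ a b → a :- b := :- (b :- a)) refl (+ δ (suc y′) y) (+ δ y′ (suc y)))

  not≢ : ∀ b → not b ≢ b
  not≢ true  ()
  not≢ false ()

  D-parity : ∀ y y′ → parity y ≡ parity y′ → D y y′ ≡ + 0
  D-parity y y′ e = cong₂ (λ a b → + a ℤ.- + b)
    (δ-≢ {y} {suc y′} (λ { refl → not≢ (parity y′) e })) (δ-≢ {suc y} {y′} (λ { refl → not≢ (parity y) (sym e) }))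

  -- horizontal edges have weight 1, vertical edges (-1)^y, with the sign of the orientation
  K : ℕ × ℕ → ℕ × ℕ → ℤ
  K (x , y) (x′ , y′) = + δ x x′ ℤ.* D y y′ ℤ.+ signed (parity y) (+ δ y y′) ℤ.* D x x′

  σδ-sym : ∀ y y′ → signed (parity y) (+ δ y y′) ≡ signed (parity y′) (+ δ y′ y)
  σδ-sym y y′ with y ℕ.≟ y′
  ... | yes refl = refl
  ... | no n     = trans (cong (λ a → signed (parity y) (+ a)) (δ-≢ n)) (trans (zeros (parity y) (parity y′)) (cong (λ a → signed (parity y′) (+ a)) (sym (δ-≢ (λ e → n (sym e))))))
    where
    zeros : ∀ a b → signed a (+ 0) ≡ signed b (+ 0)
    zeros true  true  = refl
    zeros true  false = refl
    zeros false true  = refl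
    zeros false false = refl

  K-skew : ∀ u v → K u v ≡ ℤ.- K v u
  K-skew (x , y) (x′ , y′) = trans
    (cong₂ ℤ._+_ (cong₂ ℤ._*_ (cong +_ (δ-sym x x′)) (D-skew y y′)) (cong₂ ℤ._*_ (σδ-sym y y′) (D-skew x x′)))
    (solve 4 (λ a b c d → a :* :- b :+ c :* :- d := :- (a :* b :+ c :* d)) refl (+ δ x′ x) (D y′ y) (signed (parity y′) (+ δ y′ y)) (D x′ x))

  colour : ℕ × ℕ → Bool
  colour (x , y) = parity x xor parity y

  xor-cancelˡ : ∀ a {b c} → a xor b ≡ a xor c → b ≡ c
  xor-cancelˡ false e = e
  xor-cancelˡ true {true}  {true}  e = refl
  xor-cancelˡ true {false} {false} e = refl

  xor-cancelʳ : ∀ a {b c} → b xor a ≡ c xor a → b ≡ c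
  xor-cancelʳ a {true}  {true}  e = refl
  xor-cancelʳ a {false} {false} e = refl
  xor-cancelʳ true  {true}  {false} ()
  xor-cancelʳ true  {false} {true}  ()
  xor-cancelʳ false {true}  {false} ()
  xor-cancelʳ false {false} {true}  ()

  δ*-zero : ∀ x x′ {d} → (x ≡ x′ → d ≡ + 0) → + δ x x′ ℤ.* d ≡ + 0
  δ*-zero x x′ {d} h with x ℕ.≟ x′
  ... | yes e = trans (cong (+ δ x x′ ℤ.*_) (h e)) (ℤ.*-zeroʳ (+ δ x x′))
  ... | no n  = trans (cong (λ a → + a ℤ.* d) (δ-≢ n)) (ℤ.*-zeroˡ d)

  *δ-zero : ∀ d {x x′} → x ≢ x′ → d ℤ.* + δ x x′ ≡ + 0
  *δ-zero d n = trans (cong (λ a → d ℤ.* + a) (δ-≢ n)) (ℤ.*-zeroʳ d)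

  σδ*-zero : ∀ y y′ {d} → (y ≡ y′ → d ≡ + 0) → signed (parity y) (+ δ y y′) ℤ.* d ≡ + 0
  σδ*-zero y y′ {d} h = trans (lem (parity y)) (trans (cong (signed (parity y)) (δ*-zero y y′ h)) (zero′ (parity y)))
    where
    lem : ∀ s → signed s (+ δ y y′) ℤ.* d ≡ signed s (+ δ y y′ ℤ.* d)
    lem false = refl
    lem true  = sym (ℤ.neg-distribˡ-* (+ δ y y′) d)
    zero′ : ∀ s → signed s (+ 0) ≡ + 0
    zero′ false = refl
    zero′ true  = refl

  K-colour : ∀ u v → colour u ≡ colour v → K u v ≡ + 0
  K-colour (x , y) (x′ , y′) e = cong₂ ℤ._+_
    (δ*-zero x x′ (λ { refl → D-parity y y′ (xor-cancelˡ (parity x) e) }))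
    (σδ*-zero y y′ (λ { refl → D-parity x x′ (xor-cancelʳ (parity y) e) }))

  D² : ℕ → ℕ → ℕ → ℤ
  D² q y y′ = ∑ (downFrom q) (λ t → D y t ℤ.* D t y′)

  ∑-δ : ∀ m (f : ℕ → ℤ) b → b < m → ∑ (downFrom m) (λ a → + δ b a ℤ.* f a) ≡ f b
  ∑-δ m f b b<m = trans (∑-cong (downFrom m) (λ {a} _ → trans (ℤ.*-comm (+ δ b a) (f a)) (cong (λ d → f a ℤ.* d) (trans (cong +_ (δ-sym b a)) (fromNat≡ (δ a b))))))
    (Spectrum.∑-δ ℤ.+-*-commutativeRing m f b b<m)
    where
    open IntegerCoefficients ℤ.+-*-commutativeRing using (fromNat; fromNat-suc)
    fromNat≡ : ∀ n → + n ≡ fromNat n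
    fromNat≡ zero    = refl
    fromNat≡ (suc n) = trans (cong (ℤ._+_ (+ 1)) (fromNat≡ n)) (sym (fromNat-suc n))

  ∑-δ-out : ∀ m (f : ℕ → ℤ) b → m ≤ b → ∑ (downFrom m) (λ a → + δ b a ℤ.* f a) ≡ + 0
  ∑-δ-out m f b m≤b = ∑-zero (downFrom m) (λ {a} a∈ → trans (cong (λ d → + d ℤ.* f a) (δ-≢ {b} {a} (λ { refl → ℕ.<⇒≱ (∈-downFrom⁻ a∈) m≤b }))) (ℤ.*-zeroˡ (f a)))

  ∑-product : ∀ p q f g → ∑ (vertices p q) (λ c → f (proj₁ c) ℤ.* g (proj₂ c)) ≡ ∑ (downFrom p) f ℤ.* ∑ (downFrom q) g
  ∑-product p q f g = trans (∑-× (downFrom p) (downFrom q) _) (trans (∑-cong (downFrom p) (λ {a} _ → ∑-* (downFrom q) (f a) g))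
    (∑-*ʳ (downFrom p) (∑ (downFrom q) g) f))

  -- The square splits into the squares along the two directions provided the mixed terms cancel.
  -- They do, because neighbouring columns carry opposite signs in the weights of the vertical
  -- edges: the two ways around a unit square cancel.
  K² : ∀ p q x y x′ y′ → x < p → y < q → x′ < p → y′ < q →
    ∑ (vertices p q) (λ c → K (x , y) c ℤ.* K c (x′ , y′)) ≡ + δ x x′ ℤ.* D² q y y′ ℤ.+ D² p x x′ ℤ.* + δ y y′
  K² p q x y x′ y′ x<p y<q x′<p y′<q = begin
    ∑ C (λ c → K (x , y) c ℤ.* K c (x′ , y′))
      ≡⟨ ∑-cong C (λ { {s , t} _ → expand s t }) ⟩
    ∑ C (λ { (s , t) → (+ δ x s ℤ.* + δ s x′) ℤ.* (D y t ℤ.* D t y′) ℤ.+ (+ δ x s ℤ.* D s x′) ℤ.* (σ t y′ ℤ.* D y t)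
      ℤ.+ ((D x s ℤ.* + δ s x′) ℤ.* (σ y t ℤ.* D t y′) ℤ.+ (D x s ℤ.* D s x′) ℤ.* (σ y t ℤ.* σ t y′)) })
      ≡⟨ trans (∑-+ C _ _) (cong₂ ℤ._+_ (∑-+ C _ _) (∑-+ C _ _)) ⟩
    ∑ C (λ { (s , t) → (+ δ x s ℤ.* + δ s x′) ℤ.* (D y t ℤ.* D t y′) }) ℤ.+ ∑ C (λ { (s , t) → (+ δ x s ℤ.* D s x′) ℤ.* (σ t y′ ℤ.* D y t) })
      ℤ.+ (∑ C (λ { (s , t) → (D x s ℤ.* + δ s x′) ℤ.* (σ y t ℤ.* D t y′) }) ℤ.+ ∑ C (λ { (s , t) → (D x s ℤ.* D s x′) ℤ.* (σ y t ℤ.* σ t y′) }))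
      ≡⟨ cong₂ ℤ._+_ (cong₂ ℤ._+_ (∑-product p q (λ s → + δ x s ℤ.* + δ s x′) (λ t → D y t ℤ.* D t y′)) (∑-product p q (λ s → + δ x s ℤ.* D s x′) (λ t → σ t y′ ℤ.* D y t)))
           (cong₂ ℤ._+_ (∑-product p q (λ s → D x s ℤ.* + δ s x′) (λ t → σ y t ℤ.* D t y′)) (∑-product p q (λ s → D x s ℤ.* D s x′) (λ t → σ y t ℤ.* σ t y′))) ⟩
    ∑ (downFrom p) (λ s → + δ x s ℤ.* + δ s x′) ℤ.* D² q y y′ ℤ.+ ∑ (downFrom p) (λ s → + δ x s ℤ.* D s x′) ℤ.* ∑ (downFrom q) (λ t → σ t y′ ℤ.* D y t)
      ℤ.+ (∑ (downFrom p) (λ s → D x s ℤ.* + δ s x′) ℤ.* ∑ (downFrom q) (λ t → σ y t ℤ.* D t y′) ℤ.+ D² p x x′ ℤ.* ∑ (downFrom q) (λ t → σ y t ℤ.* σ t y′))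
      ≡⟨ cong₂ ℤ._+_ (cong₂ ℤ._+_ (cong (ℤ._* D² q y y′) (∑-δ p (λ s → + δ s x′) x x<p)) (cong₂ ℤ._*_ (∑-δ p (λ s → D s x′) x x<p) (trans (∑-cong (downFrom q) (λ {t} _ → cong (ℤ._* D y t) (σδ-sym t y′))) (∑-σδ y′ (D y) y′<q))))
           (cong₂ ℤ._+_ (cong₂ ℤ._*_ (trans (∑-cong (downFrom p) (λ {s} _ → trans (ℤ.*-comm (D x s) (+ δ s x′)) (cong (λ d → + d ℤ.* D x s) (δ-sym s x′)))) (∑-δ p (D x) x′ x′<p)) (∑-σδ y (λ t → D t y′) y<q))
             (cong (D² p x x′ ℤ.*_) (trans (∑-σδ y (λ t → σ t y′) y<q) (signed-twice (parity y))))) ⟩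
    + δ x x′ ℤ.* D² q y y′ ℤ.+ D x x′ ℤ.* signed (parity y′) (D y y′) ℤ.+ (D x x′ ℤ.* signed (parity y) (D y y′) ℤ.+ D² p x x′ ℤ.* + δ y y′)
      ≡⟨ solve 4 (λ a b c d → a :+ b :+ (c :+ d) := (a :+ d) :+ (b :+ c)) refl (+ δ x x′ ℤ.* D² q y y′) (D x x′ ℤ.* signed (parity y′) (D y y′)) (D x x′ ℤ.* signed (parity y) (D y y′)) (D² p x x′ ℤ.* + δ y y′) ⟩
    (+ δ x x′ ℤ.* D² q y y′ ℤ.+ D² p x x′ ℤ.* + δ y y′) ℤ.+ (D x x′ ℤ.* signed (parity y′) (D y y′) ℤ.+ D x x′ ℤ.* signed (parity y) (D y y′))
      ≡⟨ trans (cong (ℤ._+_ (+ δ x x′ ℤ.* D² q y y′ ℤ.+ D² p x x′ ℤ.* + δ y y′)) (trans (sym (ℤ.*-distribˡ-+ (D x x′) _ _)) (trans (cong (D x x′ ℤ.*_) (opposite (parity y) (parity y′) refl refl)) (ℤ.*-zeroʳ (D x x′))))) (ℤ.+-identityʳ _) ⟩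
    + δ x x′ ℤ.* D² q y y′ ℤ.+ D² p x x′ ℤ.* + δ y y′ ∎
    where
    open ≡-Reasoning
    C = vertices p q
    σ : ℕ → ℕ → ℤ
    σ t t′ = signed (parity t) (+ δ t t′)
    expand : ∀ s t → K (x , y) (s , t) ℤ.* K (s , t) (x′ , y′) ≡ (+ δ x s ℤ.* + δ s x′) ℤ.* (D y t ℤ.* D t y′) ℤ.+ (+ δ x s ℤ.* D s x′) ℤ.* (σ t y′ ℤ.* D y t)
      ℤ.+ ((D x s ℤ.* + δ s x′) ℤ.* (σ y t ℤ.* D t y′) ℤ.+ (D x s ℤ.* D s x′) ℤ.* (σ y t ℤ.* σ t y′))
    expand s t = solve 8 (λ a b c d e f g h → (a :* b :+ c :* d) :* (e :* f :+ g :* h) := (a :* e) :* (b :* f) :+ (a :* h) :* (g :* b) :+ ((d :* e) :* (c :* f) :+ (d :* h) :* (c :* g))) refl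
      (+ δ x s) (D y t) (σ y t) (D x s) (+ δ s x′) (D t y′) (σ t y′) (D s x′)
    signed-*ˡ : ∀ s a b → signed s a ℤ.* b ≡ signed s (a ℤ.* b)
    signed-*ˡ false a b = refl
    signed-*ˡ true  a b = sym (ℤ.neg-distribˡ-* a b)
    ∑-signed : ∀ s (is : List ℕ) f → ∑ is (λ i → signed s (f i)) ≡ signed s (∑ is f)
    ∑-signed false is f = refl
    ∑-signed true  is f = ∑-neg is f
    ∑-σδ : ∀ b (f : ℕ → ℤ) → b < q → ∑ (downFrom q) (λ t → σ b t ℤ.* f t) ≡ signed (parity b) (f b)
    ∑-σδ b f b<q = trans (∑-cong (downFrom q) (λ {t} _ → signed-*ˡ (parity b) (+ δ b t) (f t)))
      (trans (∑-signed (parity b) (downFrom q) (λ t → + δ b t ℤ.* f t)) (cong (signed (parity b)) (∑-δ q f b b<q)))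
    signed-twice : ∀ s {a} → signed s (signed s a) ≡ a
    signed-twice false = refl
    signed-twice true  = ℤ.neg-involutive _
    -- D vanishes unless the two parities differ, and then the two signs are opposite.
    opposite : ∀ s s′ → parity y ≡ s → parity y′ ≡ s′ → signed s′ (D y y′) ℤ.+ signed s (D y y′) ≡ + 0
    opposite true  true  e f = trans (cong (λ d → ℤ.- d ℤ.+ ℤ.- d) (D-parity y y′ (trans e (sym f)))) refl
    opposite false false e f = trans (cong (λ d → d ℤ.+ d) (D-parity y y′ (trans e (sym f)))) refl
    opposite true  false e f = ℤ.+-inverseʳ (D y y′)
    opposite false true  e f = ℤ.+-inverseˡ (D y y′)

  dbl : ℕ → ℕ
  dbl zero    = zero
  dbl (suc k) = suc (suc (dbl k))

  δ-dbl : ∀ a b → δ (dbl a) (dbl b) ≡ δ a b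
  δ-dbl zero    zero    = refl
  δ-dbl zero    (suc b) = refl
  δ-dbl (suc a) zero    = refl
  δ-dbl (suc a) (suc b) = δ-dbl a b

  dbl≢suc-dbl : ∀ a b → dbl a ≢ suc (dbl b)
  dbl≢suc-dbl (suc a) (suc b) e = dbl≢suc-dbl a b (ℕ.suc-injective (ℕ.suc-injective e))

  dbl-mono : ∀ {a b} → a < b → suc (dbl a) < dbl b
  dbl-mono {zero}  {suc b} (s≤s _)   = s≤s (s≤s z≤n)
  dbl-mono {suc a} {suc b} (s≤s a<b) = s≤s (s≤s (dbl-mono a<b))

  halve : ∀ x m → x < dbl m → ∃[ a ] a < m × (x ≡ dbl a ⊎ x ≡ suc (dbl a))
  halve zero          (suc m) _ = 0 , s≤s z≤n , inj₁ refl
  halve (suc zero)    (suc m) _ = 0 , s≤s z≤n , inj₂ refl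
  halve (suc (suc x)) (suc m) (s≤s (s≤s x<)) with halve x m x<
  ... | a , a<m , inj₁ refl = suc a , s≤s a<m , inj₁ refl
  ... | a , a<m , inj₂ refl = suc a , s≤s a<m , inj₂ refl

  D²-split : ∀ q y y′ → D² q y y′ ≡ ∑ (downFrom q) (λ t → + δ y (suc t) ℤ.* D t y′) ℤ.- ∑ (downFrom q) (λ t → + δ (suc y) t ℤ.* D t y′)
  D²-split q y y′ = trans (∑-cong (downFrom q) (λ {t} _ → solve 3 (λ a b d → (a :- b) :* d := a :* d :+ :- (b :* d)) refl (+ δ y (suc t)) (+ δ (suc y) t) (D t y′)))
    (trans (∑-+ (downFrom q) _ _) (cong (ℤ._+_ (∑ (downFrom q) (λ t → + δ y (suc t) ℤ.* D t y′))) (∑-neg (downFrom q) _)))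

  D²-zero : ∀ q y′ → 1 < q → D² q 0 y′ ≡ ℤ.- D 1 y′
  D²-zero q y′ 1<q = trans (D²-split q 0 y′) (trans (cong₂ ℤ._-_ (∑-zero (downFrom q) (λ {t} _ → ℤ.*-zeroˡ (D t y′))) (∑-δ q (λ t → D t y′) 1 1<q)) (ℤ.+-identityˡ _))

  D²-suc : ∀ q y y′ → suc (suc y) < q → D² q (suc y) y′ ≡ D y y′ ℤ.- D (suc (suc y)) y′
  D²-suc q y y′ lt = trans (D²-split q (suc y) y′) (cong₂ ℤ._-_
    (∑-δ q (λ t → D t y′) y (ℕ.<-trans (ℕ.n<1+n y) (ℕ.<-trans (ℕ.n<1+n (suc y)) lt))) (∑-δ q (λ t → D t y′) (suc (suc y)) lt))

  D²-last : ∀ y y′ → D² (suc (suc y)) (suc y) y′ ≡ D y y′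
  D²-last y y′ = trans (D²-split (suc (suc y)) (suc y) y′) (trans (cong₂ ℤ._-_
    (∑-δ (suc (suc y)) (λ t → D t y′) y (ℕ.<-trans (ℕ.n<1+n y) (ℕ.n<1+n (suc y)))) (∑-δ-out (suc (suc y)) (λ t → D t y′) (suc (suc y)) ℕ.≤-refl)) (ℤ.+-identityʳ _))

  D²-even : ∀ n b b′ → b < n → D² (dbl n) (dbl b) (dbl b′) ≡ ℤ.- T b b′
  D²-even (suc n) zero b′ _ = trans (D²-zero (dbl (suc n)) (dbl b′) (s≤s (s≤s z≤n)))
    (cong ℤ.-_ (trans (cong₂ (λ a c → + a ℤ.- + c) (δ-dbl 0 b′) (δ-dbl 1 b′))
      (cong₂ (λ a c → + a ℤ.- + c) (sym (ℕ.+-identityʳ (δ 0 b′))) (sym (ℕ.+-identityʳ (δ 1 b′))))))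
  D²-even (suc n) (suc b) b′ b<n = trans (D²-suc (dbl (suc n)) (suc (dbl b)) (dbl b′) (dbl-mono b<n))
    (trans (cong₂ (λ x y → (+ x ℤ.- + δ (dbl (suc b)) (dbl b′)) ℤ.- (+ δ (dbl (suc b)) (dbl b′) ℤ.- + y)) (δ-dbl b b′) (δ-dbl (suc (suc b)) b′))
      (trans (cong (λ x → (+ δ b b′ ℤ.- + x) ℤ.- (+ x ℤ.- + δ (suc (suc b)) b′)) (δ-dbl (suc b) b′)) (assemble (δ b b′) (δ (suc b) b′) (δ (suc (suc b)) b′))))
    where
    assemble : ∀ p d s → (+ p ℤ.- + d) ℤ.- (+ d ℤ.- + s) ≡ ℤ.- (+ (2 ℕ.* d) ℤ.- + (s ℕ.+ p))
    assemble p d s = trans (solve 3 (λ p d s → (p :- d) :- (d :- s) := :- ((d :+ (d :+ con (+ 0))) :- (s :+ p))) refl (+ p) (+ d) (+ s)) refl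

  rev : ℕ → ℕ → ℕ
  rev n b = n ∸ suc b

  rev-+ : ∀ {n b} → b < n → rev n b ℕ.+ suc b ≡ n
  rev-+ b<n = ℕ.m∸n+n≡m b<n

  rev-rev : ∀ {n b} → b < n → rev n (rev n b) ≡ b
  rev-rev {suc n} {b} (s≤s b≤n) = ℕ.m∸[m∸n]≡n b≤n

  rev-< : ∀ {n b} → b < n → rev n b < n
  rev-< {suc n} {b} _ = s≤s (ℕ.m∸n≤m n b)

  δ-rev : ∀ {n b b′} → b < n → b′ < n → δ (rev n b) (rev n b′) ≡ δ b b′
  δ-rev {n} {b} {b′} h h′ = δ-cong (λ e → trans (sym (rev-rev h)) (trans (cong (rev n) e) (rev-rev h′))) (cong (rev n))

  δ-rev-suc : ∀ {n b b′} → b < n → b′ < n → δ (rev n b) (suc (rev n b′)) ≡ δ (suc b) b′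
  δ-rev-suc {n} {b} {b′} h h′ = δ-cong to from
    where
    to : rev n b ≡ suc (rev n b′) → suc b ≡ b′
    to e = ℕ.suc-injective (ℕ.+-cancelˡ-≡ (rev n b′) (suc (suc b)) (suc b′)
      (trans (ℕ.+-suc (rev n b′) (suc b)) (trans (cong (ℕ._+ suc b) (sym e)) (trans (rev-+ h) (sym (rev-+ h′))))))
    from : suc b ≡ b′ → rev n b ≡ suc (rev n b′)
    from refl = ℕ.+-cancelʳ-≡ (suc b) (rev n b) (suc (rev n b′)) (trans (rev-+ h) (trans (sym (rev-+ h′)) (ℕ.+-suc (rev n b′) (suc b))))

  D-odd : ∀ n b b′ → b < n → b′ < n → D (dbl (rev n b)) (suc (dbl (rev n b′))) ≡ + δ (suc b) b′ ℤ.- + δ b b′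
  D-odd n b b′ h h′ = cong₂ (λ x y → + x ℤ.- + y) (trans (δ-dbl (rev n b) (suc (rev n b′))) (δ-rev-suc h h′)) (trans (δ-dbl (rev n b) (rev n b′)) (δ-rev h h′))

  -- Among the odd indices it is the last one, 2n - 1, that has a single neighbour; reversing the
  -- numbering brings the free end to 0.
  D²-odd : ∀ n b b′ → b < n → b′ < n → D² (dbl n) (suc (dbl (rev n b))) (suc (dbl (rev n b′))) ≡ ℤ.- T b b′
  D²-odd (suc n) zero b′ h h′ = trans (D²-last (dbl n) (suc (dbl (rev (suc n) b′)))) (trans (D-odd (suc n) 0 b′ h h′) (assemble (δ 1 b′) (δ 0 b′)))
    where
    assemble : ∀ s d → + s ℤ.- + d ≡ ℤ.- (+ (1 ℕ.* d) ℤ.- + (s ℕ.+ 0))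
    assemble s d = solve 2 (λ s d → s :- d := :- ((d :+ con (+ 0)) :- (s :+ con (+ 0)))) refl (+ s) (+ d)
  D²-odd n (suc b) b′ h h′ = trans (D²-suc (dbl n) (dbl r) (suc (dbl r′)) (subst (ℕ._< dbl n) refl (ℕ.<-trans (ℕ.n<1+n (dbl (suc r))) (dbl-mono 1+r<n))))
    (trans (cong₂ ℤ._-_ (D-odd n (suc b) b′ h h′) second) (assemble (δ (suc (suc b)) b′) (δ (suc b) b′) (δ b b′)))
    where
    r = rev n (suc b)
    r′ = rev n b′
    1+r : suc r ≡ rev n b
    1+r = ℕ.+-cancelʳ-≡ (suc b) (suc r) (rev n b) (trans (sym (ℕ.+-suc r (suc b))) (trans (rev-+ h) (sym (rev-+ (ℕ.<-trans (ℕ.n<1+n b) h)))))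
    1+r<n : suc r < n
    1+r<n = subst (_< n) (sym 1+r) (rev-< (ℕ.<-trans (ℕ.n<1+n b) h))
    second : D (suc (suc (dbl r))) (suc (dbl r′)) ≡ + δ (suc b) b′ ℤ.- + δ b b′
    second = trans (cong (λ i → D (dbl i) (suc (dbl r′))) 1+r) (D-odd n b b′ (ℕ.<-trans (ℕ.n<1+n b) h) h′)
    assemble : ∀ s d p → (+ s ℤ.- + d) ℤ.- (+ d ℤ.- + p) ≡ ℤ.- (+ (2 ℕ.* d) ℤ.- + (s ℕ.+ p))
    assemble s d p = solve 3 (λ s d p → (s :- d) :- (d :- p) := :- ((d :+ (d :+ con (+ 0))) :- (s :+ p))) refl (+ s) (+ d) (+ p)

  dbl≡2* : ∀ n → dbl n ≡ 2 ℕ.* n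
  dbl≡2* zero    = refl
  dbl≡2* (suc n) = cong suc (trans (cong suc (dbl≡2* n)) (sym (ℕ.+-suc n (n ℕ.+ 0))))

  module Board (m n : ℕ) where

    p q : ℕ
    p = dbl m
    q = dbl n

    -- The four classes of cells modulo 2. Cells with equal parities are black, and `oddCell`
    -- reverses both coordinates so that K² looks the same on both black classes.
    evenCell oddCell evenOdd oddEven : ℕ × ℕ → ℕ × ℕ
    evenCell (a , b) = dbl a , dbl b
    oddCell  (a , b) = suc (dbl (rev m a)) , suc (dbl (rev n b))
    evenOdd  (a , b) = dbl a , suc (dbl b)
    oddEven  (a , b) = suc (dbl a) , dbl b

    vs bs ws : List (ℕ × ℕ)
    vs = vertices m n
    bs = map evenCell vs ++ map oddCell vs
    ws = map evenOdd vs ++ map oddEven vs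

    vertices-∈ : ∀ {m n a b} → a < m → b < n → (a , b) ∈ vertices m n
    vertices-∈ a<m b<n = ∈-cartesianProduct⁺ (∈-downFrom⁺ a<m) (∈-downFrom⁺ b<n)

    vertices-∈⁻ : ∀ m n {u : ℕ × ℕ} → u ∈ vertices m n → proj₁ u < m × proj₂ u < n
    vertices-∈⁻ m n u∈ = let a∈ , b∈ = ∈-cartesianProduct⁻ (downFrom m) (downFrom n) u∈ in ∈-downFrom⁻ a∈ , ∈-downFrom⁻ b∈

    length-vertices : ∀ m n → length (vertices m n) ≡ m ℕ.* n
    length-vertices zero    n = refl
    length-vertices (suc m) n = trans (length-++ (map (m ,_) (downFrom n))) (cong₂ ℕ._+_ (trans (length-map (m ,_) (downFrom n)) (length-downFrom n)) (length-vertices m n))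

    parity-dbl : ∀ a → parity (dbl a) ≡ false
    parity-dbl zero    = refl
    parity-dbl (suc a) = trans (not-not (parity (dbl a))) (parity-dbl a)
      where
      not-not : ∀ b → not (not b) ≡ b
      not-not true  = refl
      not-not false = refl

    black : ∀ {u} → u ∈ bs → colour u ≡ false
    black u∈ with ∈-++⁻ (map evenCell vs) u∈
    ... | inj₁ m∈ with ∈-map⁻ evenCell m∈
    ... | (a , b) , _ , refl = cong₂ _xor_ (parity-dbl a) (parity-dbl b)
    black u∈ | inj₂ m∈ with ∈-map⁻ oddCell m∈
    ... | (a , b) , _ , refl = cong₂ (λ s t → not s xor not t) (parity-dbl (rev m a)) (parity-dbl (rev n b))

    white : ∀ {u} → u ∈ ws → colour u ≡ true
    white u∈ with ∈-++⁻ (map evenOdd vs) u∈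
    ... | inj₁ m∈ with ∈-map⁻ evenOdd m∈
    ... | (a , b) , _ , refl = cong₂ (λ s t → s xor not t) (parity-dbl a) (parity-dbl b)
    white u∈ | inj₂ m∈ with ∈-map⁻ oddEven m∈
    ... | (a , b) , _ , refl = cong₂ (λ s t → not s xor t) (parity-dbl a) (parity-dbl b)

    covers : ∀ {x y} → x < p → y < q → (x , y) ∈ bs ++ ws
    covers {x} {y} x<p y<q with halve x m x<p | halve y n y<q
    ... | a , a<m , inj₁ refl | b , b<n , inj₁ refl = ∈-++⁺ˡ (∈-++⁺ˡ (∈-map⁺ evenCell (vertices-∈ a<m b<n)))
    ... | a , a<m , inj₁ refl | b , b<n , inj₂ refl = ∈-++⁺ʳ bs (∈-++⁺ˡ (∈-map⁺ evenOdd (vertices-∈ a<m b<n)))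
    ... | a , a<m , inj₂ refl | b , b<n , inj₁ refl = ∈-++⁺ʳ bs (∈-++⁺ʳ (map evenOdd vs) (∈-map⁺ oddEven (vertices-∈ a<m b<n)))
    ... | a , a<m , inj₂ refl | b , b<n , inj₂ refl = ∈-++⁺ˡ (∈-++⁺ʳ (map evenCell vs)
      (subst (_∈ map oddCell vs) (cong₂ (λ i j → suc (dbl i) , suc (dbl j)) (rev-rev a<m) (rev-rev b<n)) (∈-map⁺ oddCell (vertices-∈ (rev-< a<m) (rev-< b<n)))))

    length-half : ∀ (f g : ℕ × ℕ → ℕ × ℕ) → length (map f vs ++ map g vs) ≡ m ℕ.* n ℕ.+ m ℕ.* n
    length-half f g = trans (length-++ (map f vs)) (cong₂ ℕ._+_ (trans (length-map f vs) (length-vertices m n)) (trans (length-map g vs) (length-vertices m n)))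

    length-cells : length (bs ++ ws) ≡ p ℕ.* q
    length-cells = trans (length-++ bs) (trans (cong₂ ℕ._+_ (length-half evenCell oddCell) (length-half evenOdd oddEven)) (sym (area m n)))
      where
      area : ∀ m n → dbl m ℕ.* dbl n ≡ (m ℕ.* n ℕ.+ m ℕ.* n) ℕ.+ (m ℕ.* n ℕ.+ m ℕ.* n)
      area m n = trans (cong₂ ℕ._*_ (dbl≡2* m) (dbl≡2* n)) (lem m n)
        where
        open import Data.Nat.Tactic.RingSolver using (solve-∀)
        lem : ∀ m n → 2 ℕ.* m ℕ.* (2 ℕ.* n) ≡ (m ℕ.* n ℕ.+ m ℕ.* n) ℕ.+ (m ℕ.* n ℕ.+ m ℕ.* n)
        lem = solve-∀

    vertices-unique : ∀ m n → Unique (vertices m n)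
    vertices-unique m n = Unique.cartesianProduct⁺ (Unique.downFrom⁺ m) (Unique.downFrom⁺ n)

    vertices↭ : vertices p q ↭ bs ++ ws
    vertices↭ = ⊆-length⇒↭ (vertices p q) (bs ++ ws) (vertices-unique p q) (λ u∈ → covers (proj₁ (vertices-∈⁻ p q u∈)) (proj₂ (vertices-∈⁻ p q u∈)))
      (trans length-cells (sym (length-vertices p q)))

    gram : ∀ {u v} → u ∈ bs → ∑ ws (λ w → K u w ℤ.* K w v) ≡ ∑ (vertices p q) (λ w → K u w ℤ.* K w v)
    gram {u} {v} u∈ = sym (trans (∑-↭ vertices↭ _) (trans (∑-++ bs ws _)
      (trans (cong (ℤ._+ ∑ ws (λ w → K u w ℤ.* K w v)) (∑-zero bs (λ {w} w∈ → trans (cong (ℤ._* K w v) (K-colour u w (trans (black u∈) (sym (black w∈))))) (ℤ.*-zeroˡ (K w v)))))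
        (ℤ.+-identityˡ _))))

    G : ℕ × ℕ → ℕ × ℕ → ℤ
    G u v = ∑ ws (λ w → K u w ℤ.* K w v)

    even-range : ∀ {a b} → (a , b) ∈ vs → dbl a < p × dbl b < q
    even-range u∈ = let a< , b< = vertices-∈⁻ m n u∈ in ℕ.<-trans (ℕ.n<1+n _) (dbl-mono a<) , ℕ.<-trans (ℕ.n<1+n _) (dbl-mono b<)

    odd-range : ∀ {a b} → (a , b) ∈ vs → suc (dbl (rev m a)) < p × suc (dbl (rev n b)) < q
    odd-range u∈ = let a< , b< = vertices-∈⁻ m n u∈ in dbl-mono (rev-< a<) , dbl-mono (rev-< b<)

    combine : ∀ a a′ b b′ {d e s t} → d ≡ δ a a′ → e ≡ δ b b′ → s ≡ ℤ.- T a a′ → t ≡ ℤ.- T b b′ → + d ℤ.* t ℤ.+ s ℤ.* + e ≡ ℤ.- (+ 1) ℤ.* Δ (a , b) (a′ , b′)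
    combine a a′ b b′ refl refl refl refl = solve 4 (λ d t s e → d :* :- t :+ :- s :* e := :- con (+ 1) :* (s :* e :+ d :* t)) refl (+ δ a a′) (T b b′) (T a a′) (+ δ b b′)

    G-even : ∀ {u v} → u ∈ vs → v ∈ vs → G (evenCell u) (evenCell v) ≡ ℤ.- (+ 1) ℤ.* Δ u v
    G-even {a , b} {a′ , b′} u∈ v∈ = trans (gram (∈-++⁺ˡ (∈-map⁺ evenCell u∈)))
      (trans (K² p q _ _ _ _ (proj₁ (even-range u∈)) (proj₂ (even-range u∈)) (proj₁ (even-range v∈)) (proj₂ (even-range v∈)))
        (combine a a′ b b′ (δ-dbl a a′) (δ-dbl b b′) (D²-even m a a′ (proj₁ (vertices-∈⁻ m n u∈))) (D²-even n b b′ (proj₂ (vertices-∈⁻ m n u∈)))))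

    G-odd : ∀ {u v} → u ∈ vs → v ∈ vs → G (oddCell u) (oddCell v) ≡ ℤ.- (+ 1) ℤ.* Δ u v
    G-odd {a , b} {a′ , b′} u∈ v∈ = trans (gram (∈-++⁺ʳ (map evenCell vs) (∈-map⁺ oddCell u∈)))
      (trans (K² p q _ _ _ _ (proj₁ (odd-range u∈)) (proj₂ (odd-range u∈)) (proj₁ (odd-range v∈)) (proj₂ (odd-range v∈)))
        (combine a a′ b b′ (trans (δ-dbl (rev m a) (rev m a′)) (δ-rev (proj₁ u<) (proj₁ v<))) (trans (δ-dbl (rev n b) (rev n b′)) (δ-rev (proj₂ u<) (proj₂ v<)))
          (D²-odd m a a′ (proj₁ u<) (proj₁ v<)) (D²-odd n b b′ (proj₂ u<) (proj₂ v<))))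
      where
      u< = vertices-∈⁻ m n u∈
      v< = vertices-∈⁻ m n v∈

    -- K² moves a cell by two in one direction or not at all, and so preserves the parity of each
    -- coordinate.
    G-cross : ∀ {u v} → u ∈ map evenCell vs → v ∈ map oddCell vs → G u v ≡ + 0
    G-cross u∈ v∈ with ∈-map⁻ evenCell u∈ | ∈-map⁻ oddCell v∈
    ... | (a , b) , i∈ , refl | (a′ , b′) , j∈ , refl = trans (gram (∈-++⁺ˡ u∈))
      (trans (K² p q _ _ _ _ (proj₁ (even-range i∈)) (proj₂ (even-range i∈)) (proj₁ (odd-range j∈)) (proj₂ (odd-range j∈)))
        (cong₂ ℤ._+_ (δ*-zero (dbl a) (suc (dbl (rev m a′))) (λ e → contradiction e (dbl≢suc-dbl a (rev m a′))))
          (*δ-zero (D² p (dbl a) (suc (dbl (rev m a′)))) (dbl≢suc-dbl b (rev n b′)))))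

    G-cross′ : ∀ {u v} → u ∈ map evenCell vs → v ∈ map oddCell vs → G v u ≡ + 0
    G-cross′ u∈ v∈ with ∈-map⁻ evenCell u∈ | ∈-map⁻ oddCell v∈
    ... | (a , b) , i∈ , refl | (a′ , b′) , j∈ , refl = trans (gram (∈-++⁺ʳ (map evenCell vs) v∈))
      (trans (K² p q _ _ _ _ (proj₁ (odd-range j∈)) (proj₂ (odd-range j∈)) (proj₁ (even-range i∈)) (proj₂ (even-range i∈)))
        (cong₂ ℤ._+_ (δ*-zero (suc (dbl (rev m a′))) (dbl a) (λ e → contradiction (sym e) (dbl≢suc-dbl a (rev m a′))))
          (*δ-zero (D² p (suc (dbl (rev m a′))) (dbl a)) (λ e → dbl≢suc-dbl b (rev n b′) (sym e)))))

    -- Both diagonal blocks are -Δ of the same size, so their signs cancel in the product.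
    det-G : det bs G ≡ det vs Δ ℤ.* det vs Δ
    det-G = begin
      det bs G
        ≡⟨ det-block (map evenCell vs) (map oddCell vs) G G-cross G-cross′ ⟩
      det (map evenCell vs) G ℤ.* det (map oddCell vs) G
        ≡⟨ cong₂ ℤ._*_ (half evenCell G-even) (half oddCell G-odd) ⟩
      (s ℤ.* det vs Δ) ℤ.* (s ℤ.* det vs Δ)
        ≡⟨ solve 2 (λ s d → (s :* d) :* (s :* d) := (s :* s) :* (d :* d)) refl s (det vs Δ) ⟩
      (s ℤ.* s) ℤ.* (det vs Δ ℤ.* det vs Δ)
        ≡⟨ trans (cong (ℤ._* (det vs Δ ℤ.* det vs Δ)) (sign² vs)) (ℤ.*-identityˡ _) ⟩
      det vs Δ ℤ.* det vs Δ ∎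
      where
      open ≡-Reasoning
      s = ∏ vs (λ _ → ℤ.- (+ 1))
      half : ∀ f → (∀ {u v} → u ∈ vs → v ∈ vs → G (f u) (f v) ≡ ℤ.- (+ 1) ℤ.* Δ u v) → det (map f vs) G ≡ s ℤ.* det vs Δ
      half f h = trans (det-map f vs G) (trans (det-cong vs h) (volume-scale vs (λ _ → ℤ.- (+ 1)) Δ vs))
      sign² : ∀ (is : List (ℕ × ℕ)) → ∏ is (λ _ → ℤ.- (+ 1)) ℤ.* ∏ is (λ _ → ℤ.- (+ 1)) ≡ + 1
      sign² []       = refl
      sign² (i ∷ is) = trans (solve 1 (λ t → (:- con (+ 1) :* t) :* (:- con (+ 1) :* t) := t :* t) refl (∏ is (λ _ → ℤ.- (+ 1)))) (sign² is)

    module _ .{{_ : NonZero q}} where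

      cell : ℕ → ℕ × ℕ
      cell k = k / q , k % q

      cell-injective : ∀ {j k} → cell j ≡ cell k → j ≡ k
      cell-injective {j} {k} e = trans (m≡m%n+[m/n]*n j q) (trans (cong₂ (λ x y → y ℕ.+ x ℕ.* q) (cong proj₁ e) (cong proj₂ e)) (sym (m≡m%n+[m/n]*n k q)))

      cells : List (ℕ × ℕ)
      cells = map cell (downFrom (p ℕ.* q))

      cells↭ : cells ↭ bs ++ ws
      cells↭ = ⊆-length⇒↭ cells (bs ++ ws) (Unique.map⁺ cell-injective (Unique.downFrom⁺ (p ℕ.* q))) sub
        (trans length-cells (sym (trans (length-map cell (downFrom (p ℕ.* q))) (length-downFrom (p ℕ.* q)))))
        where
        sub : ∀ {u} → u ∈ cells → u ∈ bs ++ ws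
        sub u∈ with ∈-map⁻ cell u∈
        ... | k , k∈ , refl = covers (m<n*o⇒m/o<n (∈-downFrom⁻ k∈)) (m%n<n k q)

      open MatchingCount q using (matchings; sameRow; unit; pfaffian-matchings; position-%; position-injective)

      δ-label : ∀ x y x′ y′ → y < q → y′ < q → + δ (y ℕ.+ x ℕ.* q) (y′ ℕ.+ x′ ℕ.* q) ≡ + δ x x′ ℤ.* + δ y y′
      δ-label x y x′ y′ y<q y′<q with x ℕ.≟ x′
      ... | no n = trans (cong +_ (δ-≢ (λ e → n (proj₁ (position-injective y<q y′<q e))))) (sym (trans (cong (λ d → + d ℤ.* + δ y y′) (δ-≢ n)) (ℤ.*-zeroˡ (+ δ y y′))))
      ... | yes refl = trans (cong +_ (δ-cong (λ e → proj₂ (position-injective {x} {y} {x} y<q y′<q e)) (cong (ℕ._+ x ℕ.* q)))) (sym (trans (cong (λ d → + d ℤ.* + δ y y′) (δ-refl x)) (ℤ.*-identityˡ _)))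

      parity-+ : ∀ a b → parity (a ℕ.+ b) ≡ parity a xor parity b
      parity-+ zero    b = refl
      parity-+ (suc a) b = trans (cong not (parity-+ a b)) (not-xor (parity a) (parity b))
        where
        not-xor : ∀ a b → not (a xor b) ≡ not a xor b
        not-xor true  true  = refl
        not-xor true  false = refl
        not-xor false b     = refl

      parity-label : ∀ x y → parity (y ℕ.+ x ℕ.* q) ≡ parity y
      parity-label x y = trans (parity-+ y (x ℕ.* q)) (trans (cong (parity y xor_) (multiple x)) (xor-false (parity y)))
        where
        xor-false : ∀ b → b xor false ≡ b
        xor-false true  = refl
        xor-false false = refl
        multiple : ∀ x → parity (x ℕ.* q) ≡ false
        multiple zero    = refl
        multiple (suc x) = trans (parity-+ q (x ℕ.* q)) (cong₂ _xor_ (parity-dbl n) (multiple x))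

      A : ℕ → ℕ → ℤ
      A k j = K (cell k) (cell j)

      *-distribˡ-minus : ∀ a b c → a ℤ.* (b ℤ.- c) ≡ a ℤ.* b ℤ.- a ℤ.* c
      *-distribˡ-minus = solve 3 (λ a b c → a :* (b :- c) := a :* b :- a :* c) refl

      private
        module Row {x y x′ y′ : ℕ} (y<q : y < q) (y′<q : y′ < q) (lt : y′ ℕ.+ x′ ℕ.* q < y ℕ.+ x ℕ.* q) where

          k j : ℕ
          k = y ℕ.+ x ℕ.* q
          j = y′ ℕ.+ x′ ℕ.* q

          along-row : + δ x x′ ℤ.* D y y′ ≡ (if sameRow k then unit (k ∸ 1) j else + 0)
          along-row = trans (trans (*-distribˡ-minus (+ δ x x′) (+ δ y (suc y′)) (+ δ (suc y) y′))
            (trans (cong (λ d → + δ x x′ ℤ.* + δ y (suc y′) ℤ.- d) (δ*-zero x x′ (λ e → cong +_ (δ-≢ (later e))))) (ℤ.+-identityʳ _)))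
            (trans (byColumn y refl) (cong (λ r → if not (r ℕ.≡ᵇ 0) then unit (k ∸ 1) j else + 0) (sym (position-% x y<q))))
            where
            later : x ≡ x′ → suc y ≢ y′
            later refl refl = ℕ.<-asym lt (ℕ.n<1+n k)
            byColumn : ∀ z → y ≡ z → + δ x x′ ℤ.* + δ z (suc y′) ≡ (if not (z ℕ.≡ᵇ 0) then unit (k ∸ 1) j else + 0)
            byColumn zero    e    = ℤ.*-zeroʳ (+ δ x x′)
            byColumn (suc z) refl = sym (δ-label x z x′ y′ (ℕ.<-trans (ℕ.n<1+n z) y<q) y′<q)

          along-column : signed (parity y) (+ δ y y′) ℤ.* D x x′ ≡ (if q ℕ.≤ᵇ k then signed (parity k) (unit (k ∸ q) j) else + 0)
          along-column = trans (signed-*ˡ (parity y)) (trans (cong (signed (parity y))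
            (trans (*-distribˡ-minus (+ δ y y′) (+ δ x (suc x′)) (+ δ (suc x) x′))
              (trans (cong (λ d → + δ y y′ ℤ.* + δ x (suc x′) ℤ.- d) (δ*-zero y y′ (λ e → cong +_ (δ-≢ (later e))))) (ℤ.+-identityʳ _))))
            (byRow x refl))
            where
            signed-*ˡ : ∀ s {a b} → signed s a ℤ.* b ≡ signed s (a ℤ.* b)
            signed-*ˡ false     = refl
            signed-*ˡ true {a} {b} = sym (ℤ.neg-distribˡ-* a b)
            signed-zero : ∀ s → signed s (+ 0) ≡ + 0
            signed-zero false = refl
            signed-zero true  = refl
            later : y ≡ y′ → suc x ≢ x′
            later refl refl = ℕ.<-asym lt (ℕ.+-monoʳ-< y (ℕ.m<n+m (x ℕ.* q) (ℕ.>-nonZero⁻¹ q)))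
            byRow : ∀ z → x ≡ z → signed (parity y) (+ δ y y′ ℤ.* + δ z (suc x′)) ≡ (if q ℕ.≤ᵇ k then signed (parity k) (unit (k ∸ q) j) else + 0)
            byRow zero    refl = trans (trans (cong (signed (parity y)) (ℤ.*-zeroʳ (+ δ y y′))) (signed-zero (parity y)))
              (cong (λ b → if b then signed (parity k) (unit (k ∸ q) j) else + 0) (sym (dec-false (q ℕ.≤? k) (ℕ.<⇒≱ (subst (_< q) (sym (ℕ.+-identityʳ y)) y<q)))))
            byRow (suc z) refl = trans (cong₂ signed (sym (parity-label x y)) (trans (ℤ.*-comm (+ δ y y′) (+ δ z x′))
                (trans (sym (δ-label z y x′ y′ y<q y′<q)) (cong (λ i → + δ i j) (sym k∸q)))))
              (cong (λ b → if b then signed (parity k) (unit (k ∸ q) j) else + 0) (sym (dec-true (q ℕ.≤? k) (subst (q ≤_) (sym k≡) (ℕ.m≤m+n q _)))))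
              where
              k≡ : k ≡ q ℕ.+ (y ℕ.+ z ℕ.* q)
              k≡ = trans (sym (ℕ.+-assoc y q (z ℕ.* q))) (trans (cong (ℕ._+ z ℕ.* q) (ℕ.+-comm y q)) (ℕ.+-assoc q y (z ℕ.* q)))
              k∸q : k ∸ q ≡ y ℕ.+ z ℕ.* q
              k∸q = trans (cong (_∸ q) k≡) (ℕ.m+n∸m≡n q _)

      A-row : ∀ k {j} → j < k → A k j ≡ (if sameRow k then unit (k ∸ 1) j else + 0) ℤ.+ (if q ℕ.≤ᵇ k then signed (parity k) (unit (k ∸ q) j) else + 0)
      A-row k {j} j<k = subst₂ (λ k′ j′ → A k j ≡ (if sameRow k′ then unit (k′ ∸ 1) j′ else + 0) ℤ.+ (if q ℕ.≤ᵇ k′ then signed (parity k′) (unit (k′ ∸ q) j′) else + 0))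
        (sym (m≡m%n+[m/n]*n k q)) (sym (m≡m%n+[m/n]*n j q)) (cong₂ ℤ._+_ along-row along-column)
        where open Row {k / q} {k % q} {j / q} {j % q} (m%n<n k q) (m%n<n j q) (subst₂ _<_ (m≡m%n+[m/n]*n j q) (m≡m%n+[m/n]*n k q) j<k) using (along-row; along-column)

      pfaffian-cells : pfaffian K cells ≡ + matchings (p ℕ.* q) (λ _ → true)
      pfaffian-cells = trans (pfaffian-map K cell (downFrom (p ℕ.* q))) (pfaffian-matchings A (parity-dbl n) A-row (p ℕ.* q) (parity-label p 0 ))

      -- Both numbers are natural, and their squares agree up to a sign that the absolute value
      -- removes.
      matchings-det : ∀ N → + N ≡ det vs Δ → matchings (p ℕ.* q) (λ _ → true) ≡ N
      matchings-det N e = square-injective M N (begin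
        M ℕ.* M
          ≡⟨ sym (trans (cong (λ a → ℤ.∣ a ℤ.* a ∣) pfaffian-cells) (ℤ.abs-* (+ M) (+ M))) ⟩
        ℤ.∣ pfaffian K cells ℤ.* pfaffian K cells ∣
          ≡⟨ trans (cong ℤ.∣_∣ (proj₂ square)) (abs-signed (proj₁ square)) ⟩
        ℤ.∣ det bs G ∣
          ≡⟨ trans (cong ℤ.∣_∣ (trans det-G (sym (cong₂ ℤ._*_ e e)))) (ℤ.abs-* (+ N) (+ N)) ⟩
        N ℕ.* N ∎)
        where
        open ≡-Reasoning
        M = matchings (p ℕ.* q) (λ _ → true)
        square : ∃[ s ] pfaffian K cells ℤ.* pfaffian K cells ≡ signed s (det bs G)
        square = pfaffian² K K-skew bs ws cells↭ (trans (length-half evenCell oddCell) (sym (length-half evenOdd oddEven)))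
          (λ {u} {v} u∈ v∈ → K-colour u v (trans (white u∈) (sym (white v∈))))
          (λ {u} {v} u∈ v∈ → K-colour u v (trans (black u∈) (sym (black v∈))))
        abs-signed : ∀ s {a} → ℤ.∣ signed s a ∣ ≡ ℤ.∣ a ∣
        abs-signed false     = refl
        abs-signed true {a}  = ℤ.∣-i∣≡∣i∣ a
        square-injective : ∀ a b → a ℕ.* a ≡ b ℕ.* b → a ≡ b
        square-injective a b h with ℕ.<-cmp a b
        ... | tri< a<b _ _ = contradiction h (ℕ.<⇒≢ (ℕ.*-mono-< a<b a<b))
        ... | tri≈ _ a≡b _ = a≡b
        ... | tri> _ _ b<a = contradiction (sym h) (ℕ.<⇒≢ (ℕ.*-mono-< b<a b<a))

  matchings-determinant : ∀ m n .{{_ : NonZero (2 ℕ.* n)}} N → + N ≡ det (vertices m n) Δ →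
    MatchingCount.matchings (2 ℕ.* n) (2 ℕ.* m ℕ.* (2 ℕ.* n)) (λ _ → true) ≡ N
  matchings-determinant m n N e = resize (dbl≡2* m) (dbl≡2* n)
    where
    resize : ∀ {p q} .{{_ : NonZero q}} → dbl m ≡ p → dbl n ≡ q → MatchingCount.matchings q (p ℕ.* q) (λ _ → true) ≡ N
    resize refl refl = Board.matchings-det m n N e

-- Domino tilings as matchings of numbered cells.

module DominoTilings (q : ℕ) .{{_ : NonZero q}} where
  open import Data.Bool using (Bool; true; false; not; if_then_else_; _∧_)
  import Data.Bool.Properties as Bool
  open import Data.Empty using (⊥)
  open import Data.Fin as Fin using (Fin; toℕ; fromℕ<)
  import Data.Fin.Properties as Fin
  open import Data.Nat as ℕ using (zero; suc; _+_; _*_; _∸_; _≤_; _<_; s≤s; _≡ᵇ_; _≤ᵇ_)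
  open import Data.Nat.DivMod using (_/_; m≡m%n+[m/n]*n; m%n<n; m<n*o⇒m/o<n; m<n⇒m%n≡m)
  import Data.Nat.Properties as ℕ
  open import Data.Product using (_×_; _,_; ∃-syntax; proj₁; proj₂)
  open import Data.Product.Properties using (≡-dec)
  open import Data.Sum using (_⊎_; inj₁; inj₂)
  open import Data.Unit using (tt)
  open import Function.Bundles using (mk⇔)
  open import Relation.Binary.Definitions using (DecidableEquality)
  open import Relation.Binary.PropositionalEquality
  open import Relation.Nullary using (Dec; yes; no; ¬_; contradiction)
  open import Relation.Nullary.Decidable using (map′; dec-true)
  open Counting
  open MatchingCount q

  -- an edge is given by its larger cell and whether it is vertical
  Edge : Set
  Edge = ℕ × Bool

  _≟ₑ_ : DecidableEquality Edge
  _≟ₑ_ = ≡-dec ℕ._≟_ Bool._≟_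

  big small : Edge → ℕ
  big   (k , _)     = k
  small (k , false) = k ∸ 1
  small (k , true)  = k ∸ q

  valid : Edge → Bool
  valid (k , false) = sameRow k
  valid (k , true)  = q ≤ᵇ k

  Touches : Edge → ℕ → Set
  Touches e j = j ≡ big e ⊎ j ≡ small e

  -- Tilings of the cells of L below k. The field `edges` forces T to be false elsewhere, so that a
  -- tiling is a unique function on all of `Edge`.
  record Tiling (k : ℕ) (L : Region) (T : Edge → Bool) : Set where
    field
      edges    : ∀ e → T e ≡ true → valid e ≡ true × big e < k × L (big e) ≡ true × L (small e) ≡ true
      covered  : ∀ j → j < k → L j ≡ true → ∃[ e ] T e ≡ true × Touches e j
      disjoint : ∀ {e e′ j} → T e ≡ true → T e′ ≡ true → Touches e j → Touches e′ j → e ≡ e′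

  open Tiling

  Tilings = Edge →-setoid Bool

  q>0 : 0 < q
  q>0 = ℕ.>-nonZero⁻¹ q

  q≤ : ∀ k → (q ≤ᵇ k) ≡ true → q ≤ k
  q≤ k h = ℕ.≤ᵇ⇒≤ q k (subst Data.Bool.T (sym h) tt)

  -- Validity excludes the cases in which the subtraction would leave the row or be truncated at 0.
  small<big : ∀ e → valid e ≡ true → small e < big e
  small<big (zero , false) h with trans (sym (cong (λ r → not (r ≡ᵇ 0)) (m<n⇒m%n≡m q>0))) h
  ... | ()
  small<big (suc k , false) h = ℕ.≤-refl
  small<big (k , true)      h = ℕ.∸-monoʳ-< q>0 (q≤ k h)

  remove⁻ : ∀ d j L → remove d L j ≡ true → j ≢ d × L j ≡ true
  remove⁻ d j L h = j≢d , trans (sym (remove-off L j≢d)) h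
    where
    j≢d : j ≢ d
    j≢d refl with trans (sym (remove-at d L)) h
    ... | ()

  put : Edge → Bool → (Edge → Bool) → Edge → Bool
  put e b T e′ with e ≟ₑ e′
  ... | yes _ = b
  ... | no _  = T e′

  put-at : ∀ e b T → put e b T e ≡ b
  put-at e b T with e ≟ₑ e
  ... | yes _ = refl
  ... | no n  = contradiction refl n

  put-off : ∀ e e′ b T → e ≢ e′ → put e b T e′ ≡ T e′
  put-off e e′ b T n with e ≟ₑ e′
  ... | yes p = contradiction p n
  ... | no _  = refl

  ≡-bool : ∀ {a b} → (a ≡ true → b ≡ true) → (b ≡ true → a ≡ true) → a ≡ b
  ≡-bool {true}  {b}     f g = sym (f refl)
  ≡-bool {false} {true}  f g = g refl
  ≡-bool {false} {false} f g = refl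

  true≢false : ∀ {b} → b ≡ true → b ≢ false
  true≢false refl ()

  tiling-cong : ∀ {k L T T′} → (∀ e → T e ≡ T′ e) → Tiling k L T → Tiling k L T′
  tiling-cong h t = record
    { edges    = λ e p → edges t e (trans (h e) p)
    ; covered  = λ j j<k Lj → let e , p , m = covered t j j<k Lj in e , trans (sym (h e)) p , m
    ; disjoint = λ {e} {e′} p p′ → disjoint t (trans (h e) p) (trans (h e′) p′)
    }

  module _ {k : ℕ} {L : Region} (e : Edge) (ek : big e ≡ k) (valid-e : valid e ≡ true) (Lk : L k ≡ true) (Ls : L (small e) ≡ true) where

    below : ∀ {L T} → Tiling k L T → T e ≡ false
    below {L} {T} t with T e in eq
    ... | false = refl
    ... | true  = contradiction ek (ℕ.<⇒≢ (proj₁ (proj₂ (edges t e eq))))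

    insert : ∀ {T} → Tiling k (remove (small e) L) T → Tiling (suc k) L (put e true T)
    insert {T} t = record { edges = edges′ ; covered = covered′ ; disjoint = disjoint′ }
      where
      old : ∀ {e′ j} → T e′ ≡ true → Touches e′ j → ¬ Touches e j
      old {e′} p (inj₁ refl) (inj₁ refl) = ℕ.<⇒≢ (proj₁ (proj₂ (edges t e′ p))) ek
      old {e′} p (inj₁ refl) (inj₂ f)    = proj₁ (remove⁻ (small e) (big e′) L (proj₁ (proj₂ (proj₂ (edges t e′ p))))) f
      old {e′} p (inj₂ refl) (inj₁ f)    = ℕ.<⇒≢ (ℕ.<-trans (small<big e′ (proj₁ (edges t e′ p))) (proj₁ (proj₂ (edges t e′ p)))) (trans f ek)
      old {e′} p (inj₂ refl) (inj₂ f)    = proj₁ (remove⁻ (small e) (small e′) L (proj₂ (proj₂ (proj₂ (edges t e′ p))))) f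
      edges′ : ∀ e′ → put e true T e′ ≡ true → valid e′ ≡ true × big e′ < suc k × L (big e′) ≡ true × L (small e′) ≡ true
      edges′ e′ p with e ≟ₑ e′
      ... | yes refl = valid-e , s≤s (ℕ.≤-reflexive ek) , trans (cong L ek) Lk , Ls
      ... | no n     = let v , lt , lb , ls = edges t e′ p in v , ℕ.m<n⇒m<1+n lt , proj₂ (remove⁻ (small e) (big e′) L lb) , proj₂ (remove⁻ (small e) (small e′) L ls)
      covered′ : ∀ j → j < suc k → L j ≡ true → ∃[ e′ ] put e true T e′ ≡ true × Touches e′ j
      covered′ j (s≤s j≤k) Lj with ℕ.m≤n⇒m<n∨m≡n j≤k
      ... | inj₂ refl = e , put-at e true T , inj₁ (sym ek)
      ... | inj₁ j<k with j ℕ.≟ small e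
      ... | yes j≡s = e , put-at e true T , inj₂ j≡s
      ... | no n with covered t j j<k (trans (remove-off L n) Lj)
      ... | e′ , p , m = e′ , trans (put-off e e′ true T (λ { refl → old p m m })) p , m
      disjoint′ : ∀ {e₁ e₂ j} → put e true T e₁ ≡ true → put e true T e₂ ≡ true → Touches e₁ j → Touches e₂ j → e₁ ≡ e₂
      disjoint′ {e₁} {e₂} p₁ p₂ m₁ m₂ with e ≟ₑ e₁ | e ≟ₑ e₂
      ... | yes refl | yes refl = refl
      ... | yes refl | no _     = contradiction m₁ (old p₂ m₂)
      ... | no _     | yes refl = contradiction m₂ (old p₁ m₁)
      ... | no _     | no _     = disjoint t p₁ p₂ m₁ m₂

    delete : ∀ {T} → Tiling (suc k) L T → T e ≡ true → Tiling k (remove (small e) L) (put e false T)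
    delete {T} t Te = record { edges = edges′ ; covered = covered′ ; disjoint = λ {e₁} {e₂} p₁ p₂ → disjoint t (kept e₁ p₁) (kept e₂ p₂) }
      where
      kept : ∀ e′ → put e false T e′ ≡ true → T e′ ≡ true
      kept e′ p with e ≟ₑ e′
      kept e′ p  | no _ = p
      kept e′ () | yes _
      edges′ : ∀ e′ → put e false T e′ ≡ true → valid e′ ≡ true × big e′ < k × remove (small e) L (big e′) ≡ true × remove (small e) L (small e′) ≡ true
      edges′ e′ p with e ≟ₑ e′
      edges′ e′ () | yes _
      edges′ e′ p  | no n with edges t e′ p
      ... | v , s≤s lt , lb , ls = v , ℕ.≤∧≢⇒< lt (λ f → n (disjoint t Te p (inj₁ (trans f (sym ek))) (inj₁ refl))) ,
        trans (remove-off L (λ f → n (disjoint t Te p (inj₂ f) (inj₁ refl)))) lb ,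
        trans (remove-off L (λ f → n (disjoint t Te p (inj₂ f) (inj₂ refl)))) ls
      covered′ : ∀ j → j < k → remove (small e) L j ≡ true → ∃[ e′ ] put e false T e′ ≡ true × Touches e′ j
      covered′ j j<k h with remove⁻ (small e) j L h
      ... | j≢s , Lj with covered t j (ℕ.m<n⇒m<1+n j<k) Lj
      ... | e′ , p , m = e′ , trans (put-off e e′ false T (λ { refl → away m })) p , m
        where
        away : ¬ Touches e j
        away (inj₁ f) = ℕ.<⇒≢ j<k (trans f ek)
        away (inj₂ f) = j≢s f

    -- Inserting and deleting the edge at the largest cell are inverse to each other; insertion is
    -- injective because no tiling of the smaller region contains e.
    count-edge : ∀ {N} → Counts Tilings (Tiling k (remove (small e) L)) N → Counts Tilings (λ T → Tiling (suc k) L T × T e ≡ true) N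
    count-edge = counts-map {S = Tilings} {T = Tilings} (put e true) put-cong inj′
      (λ {T} t h → tiling-cong (λ e′ → sym (h e′)) (insert t) , trans (h e) (put-at e true T))
      (λ T (t , p) → put e false T , delete t p , back p)
      where
      put-cong : ∀ {T T′ : Edge → Bool} → (∀ e′ → T e′ ≡ T′ e′) → ∀ e′ → put e true T e′ ≡ put e true T′ e′
      put-cong h e′ with e ≟ₑ e′
      ... | yes _ = refl
      ... | no _  = h e′
      inj′ : ∀ {T T′} → Tiling k (remove (small e) L) T → Tiling k (remove (small e) L) T′ → (∀ e′ → put e true T e′ ≡ put e true T′ e′) → ∀ e′ → T e′ ≡ T′ e′
      inj′ {T} {T′} t t′ h e′ with e ≟ₑ e′
      ... | yes refl = trans (below t) (sym (below t′))
      ... | no n     = trans (sym (put-off e e′ true T n)) (trans (h e′) (put-off e e′ true T′ n))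
      back : ∀ {T : Edge → Bool} → T e ≡ true → ∀ e′ → T e′ ≡ put e true (put e false T) e′
      back {T} p e′ with e ≟ₑ e′
      ... | yes refl = p
      ... | no n     = sym (put-off e e′ false T n)

  -- If the largest cell k belongs to the region, it lies in exactly one edge and is the larger end
  -- of it, which leaves two candidates, as in the recursion of `matchings`.
  tilings : ∀ k L → Counts Tilings (Tiling k L) (matchings k L)
  tilings zero L = counts-singleton {S = Tilings} (λ _ → false) (λ T → mk⇔ to′ from′)
    where
    to′ : ∀ {T} → (∀ e → T e ≡ false) → Tiling 0 L T
    to′ h = record { edges = λ e p → contradiction (h e) (true≢false p) ; covered = λ _ () ; disjoint = λ {e} p → contradiction (h e) (true≢false p) }
    from′ : ∀ {T} → Tiling 0 L T → ∀ e → T e ≡ false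
    from′ {T} t e with T e in eq
    ... | false = refl
    ... | true with edges t e eq
    ... | _ , () , _
  tilings (suc k) L with L k in Lk
  ... | false = counts-⇔ {S = Tilings} (λ T → mk⇔ up down) (tilings k L)
    where
    up : ∀ {T} → Tiling k L T → Tiling (suc k) L T
    up t = record { edges = λ e p → let v , lt , l = edges t e p in v , ℕ.m<n⇒m<1+n lt , l ; covered = covered′ ; disjoint = disjoint t }
      where
      covered′ : ∀ j → j < suc k → L j ≡ true → _
      covered′ j (s≤s j≤k) Lj with ℕ.m≤n⇒m<n∨m≡n j≤k
      ... | inj₁ j<k  = covered t j j<k Lj
      ... | inj₂ refl = contradiction Lk (true≢false Lj)
    down : ∀ {T} → Tiling (suc k) L T → Tiling k L T
    down t = record { edges = edges′ ; covered = λ j j<k → covered t j (ℕ.m<n⇒m<1+n j<k) ; disjoint = disjoint t }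
      where
      edges′ : ∀ e → _ ≡ true → _
      edges′ e p with edges t e p
      ... | v , s≤s lt , lb , ls = v , ℕ.≤∧≢⇒< lt (λ { refl → true≢false lb Lk }) , lb , ls
  ... | true = counts-⊎ {S = Tilings} apart (λ T → mk⇔ (λ { (inj₁ (t , _)) → t ; (inj₂ (t , _)) → t }) split) (with-edge false) (with-edge true)
    where
    with-edge : ∀ d → Counts Tilings (λ T → Tiling (suc k) L T × T (k , d) ≡ true)
      (if valid (k , d) ∧ L (small (k , d)) then matchings k (remove (small (k , d)) L) else 0)
    with-edge d with valid (k , d) in v | L (small (k , d)) in l
    ... | true  | true  = count-edge (k , d) refl v Lk l (tilings k (remove (small (k , d)) L))
    ... | true  | false = counts-∅ {S = Tilings} (λ T (t , p) → true≢false (proj₂ (proj₂ (proj₂ (edges t (k , d) p)))) l)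
    ... | false | _     = counts-∅ {S = Tilings} (λ T (t , p) → true≢false (proj₁ (edges t (k , d) p)) v)
    apart : ∀ T T′ → (∀ e → T e ≡ T′ e) → Tiling (suc k) L T × T (k , false) ≡ true → Tiling (suc k) L T′ × T′ (k , true) ≡ true → ⊥
    apart T T′ h (t , p) (_ , p′) with disjoint t p (trans (h (k , true)) p′) (inj₁ refl) (inj₁ refl)
    ... | ()
    split : ∀ {T} → Tiling (suc k) L T → (Tiling (suc k) L T × T (k , false) ≡ true) ⊎ (Tiling (suc k) L T × T (k , true) ≡ true)
    split t with covered t k ℕ.≤-refl Lk
    ... | (_ , false) , p , inj₁ refl = inj₁ (t , p)
    ... | (_ , true)  , p , inj₁ refl = inj₂ (t , p)
    ... | e , p , inj₂ k≡s with edges t e p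
    ... | v , s≤s lt , _ = contradiction k≡s (ℕ.>⇒≢ (ℕ.<-≤-trans (small<big e v) lt))

  module _ (p : ℕ) where

    label : Vertex p q → ℕ
    label (x , y) = toℕ y + toℕ x * q

    -- An edge is named by its larger cell, a domino by its upper left one; hence the successors.
    edge : Domino p q → Edge
    edge (horizontal a b) = suc (toℕ b) + toℕ a * q , false
    edge (vertical a b)   = toℕ b + suc (toℕ a) * q , true

    suc< : ∀ q {b} → b < q ∸ 1 → suc b < q
    suc< (suc q) b<q = s≤s b<q

    b<q-1 : ∀ {b : Fin (q ∸ 1)} → suc (toℕ b) < q
    b<q-1 {b} = suc< q (Fin.toℕ<n b)

    small-vertical : ∀ a b → b + suc a * q ∸ q ≡ b + a * q
    small-vertical a b = trans (ℕ.+-∸-assoc b (ℕ.m≤m+n q (a * q))) (cong (b +_) (ℕ.m+n∸m≡n q (a * q)))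

    touches⇒covers : ∀ d s → Touches (edge d) (label s) → Covers d s
    touches⇒covers (horizontal a b) (x , y) (inj₁ e) = let x≡ , y≡ = position-injective (Fin.toℕ<n y) (b<q-1 {b}) e in x≡ , inj₂ y≡
    touches⇒covers (horizontal a b) (x , y) (inj₂ e) = let x≡ , y≡ = position-injective (Fin.toℕ<n y) (ℕ.<-trans (ℕ.n<1+n _) (b<q-1 {b})) e in x≡ , inj₁ y≡
    touches⇒covers (vertical a b) (x , y) (inj₁ e) = let x≡ , y≡ = position-injective (Fin.toℕ<n y) (Fin.toℕ<n b) e in inj₂ x≡ , y≡
    touches⇒covers (vertical a b) (x , y) (inj₂ e) =
      let x≡ , y≡ = position-injective (Fin.toℕ<n y) (Fin.toℕ<n b) (trans e (small-vertical (toℕ a) (toℕ b))) in inj₁ x≡ , y≡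

    covers⇒touches : ∀ d s → Covers d s → Touches (edge d) (label s)
    covers⇒touches (horizontal a b) (x , y) (x≡ , inj₁ y≡) = inj₂ (cong₂ (λ i j → j + i * q) x≡ y≡)
    covers⇒touches (horizontal a b) (x , y) (x≡ , inj₂ y≡) = inj₁ (cong₂ (λ i j → j + i * q) x≡ y≡)
    covers⇒touches (vertical a b) (x , y) (inj₁ x≡ , y≡) = inj₂ (trans (cong₂ (λ i j → j + i * q) x≡ y≡) (sym (small-vertical (toℕ a) (toℕ b))))
    covers⇒touches (vertical a b) (x , y) (inj₂ x≡ , y≡) = inj₁ (cong₂ (λ i j → j + i * q) x≡ y≡)

    position< : ∀ {x y} → x < p → y < q → y + x * q < p * q
    position< {x} {y} x<p y<q = ℕ.<-≤-trans (ℕ.+-monoˡ-< (x * q) y<q) (ℕ.*-monoˡ-≤ q x<p)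

    label-surjective : ∀ {j} → j < p * q → ∃[ s ] label s ≡ j
    label-surjective {j} j<pq = (fromℕ< x<p , fromℕ< (m%n<n j q)) ,
      trans (cong₂ (λ i j → j + i * q) (Fin.toℕ-fromℕ< x<p) (Fin.toℕ-fromℕ< (m%n<n j q))) (sym (m≡m%n+[m/n]*n j q))
      where
      x<p : j / q < p
      x<p = m<n*o⇒m/o<n j<pq

    edge-injective : ∀ d d′ → edge d ≡ edge d′ → d ≡ d′
    edge-injective (horizontal a b) (horizontal a′ b′) e =
      let a≡ , b≡ = position-injective (b<q-1 {b}) (b<q-1 {b′}) (cong proj₁ e) in
      cong₂ horizontal (Fin.toℕ-injective a≡) (Fin.toℕ-injective (ℕ.suc-injective b≡))
    edge-injective (vertical a b) (vertical a′ b′) e =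
      let a≡ , b≡ = position-injective {suc (toℕ a)} {x′ = suc (toℕ a′)} (Fin.toℕ<n b) (Fin.toℕ<n b′) (cong proj₁ e) in
      cong₂ vertical (Fin.toℕ-injective (ℕ.suc-injective a≡)) (Fin.toℕ-injective b≡)
    edge-injective (horizontal a b) (vertical a′ b′) e with cong proj₂ e
    ... | ()
    edge-injective (vertical a b) (horizontal a′ b′) e with cong proj₂ e
    ... | ()

    edge-valid : ∀ d → valid (edge d) ≡ true
    edge-valid (horizontal a b) = cong (λ r → not (r ≡ᵇ 0)) (position-% (toℕ a) (b<q-1 {b}))
    edge-valid (vertical a b) = dec-true (q ℕ.≤? _) (ℕ.≤-trans (ℕ.m≤m+n q (toℕ a * q)) (ℕ.m≤n+m _ (toℕ b)))

    edge-big : ∀ d → big (edge d) < p * q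
    edge-big (horizontal a b) = position< (Fin.toℕ<n a) (b<q-1 {b})
    edge-big (vertical a b)   = position< (suc< p (Fin.toℕ<n a)) (Fin.toℕ<n b)

    edge-surjective : ∀ e → valid e ≡ true → big e < p * q → ∃[ d ] edge d ≡ e
    edge-surjective (k , false) v lt with label-surjective lt
    ... | (x , y) , refl with toℕ y in ey
    ... | zero  = contradiction (cong (λ r → not (r ≡ᵇ 0)) (position-% (toℕ x) q>0)) (true≢false v)
    ... | suc z = horizontal x (fromℕ< z<) , cong (λ i → suc i + toℕ x * q , false) (Fin.toℕ-fromℕ< z<)
      where
      z< : z < q ∸ 1
      z< = ℕ.<-≤-trans ℕ.≤-refl (ℕ.∸-monoˡ-≤ 1 (subst (_< q) ey (Fin.toℕ<n y)))
    edge-surjective (k , true) v lt with label-surjective lt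
    ... | (x , y) , refl with toℕ x in ex
    ... | zero  = contradiction (q≤ _ v) (ℕ.<⇒≱ (subst (_< q) (sym (ℕ.+-identityʳ (toℕ y))) (Fin.toℕ<n y)))
    ... | suc z = vertical (fromℕ< z<) y , cong (λ i → toℕ y + suc i * q , true) (Fin.toℕ-fromℕ< z<)
      where
      z< : z < p ∸ 1
      z< = ℕ.∸-monoˡ-≤ 1 (subst (_< p) ex (Fin.toℕ<n x))

    -- A set of dominoes is extended by `false` to the edges that are no dominoes, which requires
    -- deciding which those are.
    edge? : ∀ e → Dec (∃[ d ] edge d ≡ e)
    edge? (k , false) = map′ (λ { (a , b , e) → horizontal a b , cong (_, false) e }) (λ { (horizontal a b , refl) → a , b , refl })
      (Fin.any? (λ a → Fin.any? (λ b → suc (toℕ b) + toℕ a * q ℕ.≟ k)))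
    edge? (k , true) = map′ (λ { (a , b , e) → vertical a b , cong (_, true) e }) (λ { (vertical a b , refl) → a , b , refl })
      (Fin.any? (λ a → Fin.any? (λ b → toℕ b + suc (toℕ a) * q ℕ.≟ k)))

    count-tilings : Counts (DominoSetSetoid p q) IsTiling (matchings (p * q) (λ _ → true))
    count-tilings = counts-map {S = Tilings} {T = DominoSetSetoid p q} (λ T d → T (edge d)) (λ h d → h (edge d)) inj′ to′ from′ (tilings (p * q) (λ _ → true))
      where
      domino : ∀ {T} → Tiling (p * q) (λ _ → true) T → ∀ e → T e ≡ true → ∃[ d ] edge d ≡ e
      domino t e Te = let v , lt , _ = edges t e Te in edge-surjective e v lt
      inj′ : ∀ {T T′} → Tiling (p * q) (λ _ → true) T → Tiling (p * q) (λ _ → true) T′ → (∀ d → T (edge d) ≡ T′ (edge d)) → ∀ e → T e ≡ T′ e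
      inj′ {T} {T′} t t′ h e = ≡-bool one two
        where
        one : T e ≡ true → T′ e ≡ true
        one p with domino t e p
        ... | d , refl = trans (sym (h d)) p
        two : T′ e ≡ true → T e ≡ true
        two p with domino t′ e p
        ... | d , refl = trans (h d) p
      to′ : ∀ {T T′} → Tiling (p * q) (λ _ → true) T → (∀ d → T′ d ≡ T (edge d)) → IsTiling T′
      to′ {T} {T′} t h s@(x , y) with covered t (label s) (position< (Fin.toℕ<n x) (Fin.toℕ<n y)) refl
      ... | e , Te , m with domino t e Te
      ... | d , refl = d , (trans (h d) Te , touches⇒covers d s m) ,
        λ {d′} (T′d′ , c) → edge-injective d d′ (disjoint t Te (trans (sym (h d′)) T′d′) m (covers⇒touches d′ s c))
      from′ : ∀ T′ → IsTiling T′ → ∃[ T ] Tiling (p * q) (λ _ → true) T × (∀ d → T′ d ≡ T (edge d))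
      from′ T′ t′ = T , record { edges = edges′ ; covered = covered′ ; disjoint = disjoint′ } , T-edge
        where
        T : Edge → Bool
        T e with edge? e
        ... | yes (d , _) = T′ d
        ... | no _        = false
        T-edge : ∀ d → T′ d ≡ T (edge d)
        T-edge d with edge? (edge d)
        ... | yes (d′ , e) = cong T′ (edge-injective d d′ (sym e))
        ... | no n         = contradiction (d , refl) n
        T⁻ : ∀ e → T e ≡ true → ∃[ d ] edge d ≡ e × T′ d ≡ true
        T⁻ e h with edge? e
        T⁻ e h  | yes (d , f) = d , f , h
        T⁻ e () | no _
        edges′ : ∀ e → T e ≡ true → valid e ≡ true × big e < p * q × true ≡ true × true ≡ true
        edges′ e h with T⁻ e h
        ... | d , refl , _ = edge-valid d , edge-big d , refl , refl
        covered′ : ∀ j → j < p * q → true ≡ true → ∃[ e ] T e ≡ true × Touches e j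
        covered′ j lt _ with label-surjective lt
        ... | s , refl with t′ s
        ... | d , (T′d , c) , _ = edge d , trans (sym (T-edge d)) T′d , covers⇒touches d s c
        disjoint′ : ∀ {e e′ j} → T e ≡ true → T e′ ≡ true → Touches e j → Touches e′ j → e ≡ e′
        disjoint′ {e} {e′} {j} h h′ m m′ with T⁻ e h | T⁻ e′ h′
        ... | d , refl , T′d | d′ , refl , T′d′ with label-surjective {j} (small-bound m)
          where
          small-bound : Touches (edge d) j → j < p * q
          small-bound (inj₁ refl) = edge-big d
          small-bound (inj₂ refl) = ℕ.<-trans (small<big (edge d) (edge-valid d)) (edge-big d)
        ... | s , refl with t′ s
        ... | _ , _ , unique = cong edge (trans (sym (unique (T′d , touches⇒covers d s m))) (unique (T′d′ , touches⇒covers d′ s m′)))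

-- Dhar's burning criterion.

module Recurrence where
  open import Data.Bool using (Bool; true; false; if_then_else_)
  open import Data.Empty using (⊥-elim)
  open import Data.Fin as Fin using (toℕ; fromℕ<)
  import Data.Fin.Properties as Fin
  open import Data.List using (List; []; _∷_; map; allFin; cartesianProduct)
  open import Data.List.Extrema.Nat using (argmax; f[xs]≤f[argmax])
  open import Data.List.Membership.Propositional using (_∈_)
  open import Data.List.Membership.Propositional.Properties using (∈-allFin; ∈-cartesianProduct⁺)
  import Data.List.Relation.Unary.All as All
  open import Data.List.Relation.Unary.Any using (here; there)
  open import Data.Nat as ℕ using (zero; suc; _+_; _*_; _∸_; _≤_; _<_; z≤n; s≤s; _≡ᵇ_; ∣_-_∣)
  open import Data.Nat.ListAction using (sum)
  import Data.Nat.Properties as ℕ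
  open import Data.Nat.Solver using (module +-*-Solver)
  open import Data.Product using (_×_; _,_; ∃-syntax; proj₁; proj₂)
  open import Data.Product.Properties using (≡-dec)
  open import Data.Sum using (inj₁; inj₂)
  open import Relation.Binary.PropositionalEquality
  open import Relation.Nullary using (yes; no; contradiction)
  open HalfGrid using (δ; δ-refl; δ-≢; path)
  open +-*-Solver

  back : (ℕ → ℕ) → ℕ → ℕ
  back f zero    = 0
  back f (suc x) = f x

  -- Functions on the grid are extended by 0 to all of ℕ × ℕ.
  N : (ℕ × ℕ → ℕ) → ℕ × ℕ → ℕ
  N f (x , y) = (back (λ x → f (x , y)) x + f (suc x , y)) + (back (λ y → f (x , y)) y + f (x , suc y))

  back-+ : ∀ f g x → back (λ x → f x + g x) x ≡ back f x + back g x
  back-+ f g zero    = refl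
  back-+ f g (suc x) = refl

  back-* : ∀ k f x → back (λ x → k * f x) x ≡ k * back f x
  back-* k f zero    = sym (ℕ.*-zeroʳ k)
  back-* k f (suc x) = refl

  back-mono : ∀ {f g} x → (∀ z → z ≢ x → f z ≤ g z) → back f x ≤ back g x
  back-mono zero    h = z≤n
  back-mono (suc x) h = h x (ℕ.<⇒≢ (ℕ.n<1+n x))

  N-+ : ∀ f g u → N (λ u → f u + g u) u ≡ N f u + N g u
  N-+ f g (x , y) = trans (cong₂ (λ s t → (s + (f (suc x , y) + g (suc x , y))) + (t + (f (x , suc y) + g (x , suc y)))) (back-+ (λ x → f (x , y)) (λ x → g (x , y)) x) (back-+ (λ y → f (x , y)) (λ y → g (x , y)) y))
    (solve 8 (λ a b c d e f g h → ((a :+ b) :+ (c :+ d)) :+ ((e :+ f) :+ (g :+ h)) := ((a :+ c) :+ (e :+ g)) :+ ((b :+ d) :+ (f :+ h))) refl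
      (back (λ x → f (x , y)) x) (back (λ x → g (x , y)) x) (f (suc x , y)) (g (suc x , y)) (back (λ y → f (x , y)) y) (back (λ y → g (x , y)) y) (f (x , suc y)) (g (x , suc y)))

  N-* : ∀ k f u → N (λ u → k * f u) u ≡ k * N f u
  N-* k f (x , y) = trans (cong₂ (λ s t → (s + k * f (suc x , y)) + (t + k * f (x , suc y))) (back-* k (λ x → f (x , y)) x) (back-* k (λ y → f (x , y)) y))
    (solve 5 (λ k a b c d → (k :* a :+ k :* b) :+ (k :* c :+ k :* d) := k :* ((a :+ b) :+ (c :+ d))) refl
      k (back (λ x → f (x , y)) x) (f (suc x , y)) (back (λ y → f (x , y)) y) (f (x , suc y)))

  -- The neighbours of u do not include u, so a comparison away from u suffices.
  N-mono : ∀ {f g} u → (∀ v → v ≢ u → f v ≤ g v) → N f u ≤ N g u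
  N-mono (x , y) h = ℕ.+-mono-≤
    (ℕ.+-mono-≤ (back-mono x (λ z n → h (z , y) (λ e → n (cong proj₁ e)))) (h (suc x , y) (λ e → ℕ.<⇒≢ (ℕ.n<1+n x) (sym (cong proj₁ e)))))
    (ℕ.+-mono-≤ (back-mono y (λ z n → h (x , z) (λ e → n (cong proj₂ e)))) (h (x , suc y) (λ e → ℕ.<⇒≢ (ℕ.n<1+n y) (sym (cong proj₂ e)))))

  N-cong : ∀ {f g} u → (∀ v → f v ≡ g v) → N f u ≡ N g u
  N-cong u h = ℕ.≤-antisym (N-mono u (λ v _ → ℕ.≤-reflexive (h v))) (N-mono u (λ v _ → ℕ.≤-reflexive (sym (h v))))

  N-const : ∀ k u → N (λ _ → k) u ≤ 4 * k
  N-const k (x , y) = ℕ.≤-trans (ℕ.+-mono-≤ (ℕ.+-monoˡ-≤ k (back-const x)) (ℕ.+-monoˡ-≤ k (back-const y)))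
    (ℕ.≤-reflexive (solve 1 (λ k → (k :+ k) :+ (k :+ k) := con 4 :* k) refl k))
    where
    back-const : ∀ x → back (λ _ → k) x ≤ k
    back-const zero    = z≤n
    back-const (suc x) = ℕ.≤-refl

  indicator : (ℕ × ℕ → Bool) → ℕ × ℕ → ℕ
  indicator A u = if A u then 1 else 0

  module _ {p q : ℕ} where

    position : Vertex p q → ℕ × ℕ
    position (x , y) = toℕ x , toℕ y

    position-injective : ∀ {v w} → position v ≡ position w → v ≡ w
    position-injective e = cong₂ _,_ (Fin.toℕ-injective (cong proj₁ e)) (Fin.toℕ-injective (cong proj₂ e))

    inside : ∀ {x y} → x < p → y < q → ∃[ v ] position v ≡ (x , y)
    inside x<p y<q = (fromℕ< x<p , fromℕ< y<q) , cong₂ _,_ (Fin.toℕ-fromℕ< x<p) (Fin.toℕ-fromℕ< y<q)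

    unit : Vertex p q → ℕ × ℕ → ℕ
    unit (a , b) (x , y) = δ (toℕ a) x * δ (toℕ b) y

    unit-at : ∀ v → unit v (position v) ≡ 1
    unit-at (a , b) = cong₂ _*_ (δ-refl (toℕ a)) (δ-refl (toℕ b))

    unit-off : ∀ v u → u ≢ position v → unit v u ≡ 0
    unit-off (a , b) (x , y) n with toℕ a ℕ.≟ x
    ... | no a≢x = cong (_* δ (toℕ b) y) (δ-≢ a≢x)
    ... | yes refl = trans (cong (δ (toℕ a) (toℕ a) *_) (δ-≢ (λ e → n (cong (toℕ a ,_) (sym e))))) (ℕ.*-zeroʳ (δ (toℕ a) (toℕ a)))

    N-unit : ∀ v w → N (unit v) (position w) ≡ δ (∣ toℕ (proj₁ v) - toℕ (proj₁ w) ∣ + ∣ toℕ (proj₂ v) - toℕ (proj₂ w) ∣) 1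
    N-unit (a , b) (x , y) = trans (cong₂ _+_
        (trans (cong (_+ δ i (suc j) * δ k l) (row j)) (sym (ℕ.*-distribʳ-+ (δ k l) (δ (suc i) j) (δ i (suc j)))))
        (trans (cong (_+ δ i j * δ k (suc l)) (column l)) (sym (ℕ.*-distribˡ-+ (δ i j) (δ (suc k) l) (δ k (suc l))))))
      (trans (cong₂ _+_ (cong₂ _*_ (path-distance i j) (δ-distance k l)) (cong₂ _*_ (δ-distance i j) (path-distance k l)))
        (one (∣ i - j ∣) (∣ k - l ∣)))
      where
      i = toℕ a
      j = toℕ x
      k = toℕ b
      l = toℕ y
      row : ∀ j → back (λ j → δ i j * δ k l) j ≡ δ (suc i) j * δ k l
      row zero    = refl
      row (suc j) = refl
      column : ∀ l → back (λ l → δ i j * δ k l) l ≡ δ i j * δ (suc k) l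
      column zero    = sym (ℕ.*-zeroʳ (δ i j))
      column (suc l) = refl
      δ-distance : ∀ i j → δ i j ≡ δ ∣ i - j ∣ 0
      δ-distance zero    zero    = refl
      δ-distance zero    (suc j) = refl
      δ-distance (suc i) zero    = refl
      δ-distance (suc i) (suc j) = δ-distance i j
      path-distance : ∀ i j → path i j ≡ δ ∣ i - j ∣ 1
      path-distance zero          zero          = refl
      path-distance zero          (suc zero)    = refl
      path-distance zero          (suc (suc j)) = refl
      path-distance (suc zero)    zero          = refl
      path-distance (suc (suc i)) zero          = refl
      path-distance (suc i)       (suc j)       = path-distance i j
      one : ∀ s t → δ s 1 * δ t 0 + δ s 0 * δ t 1 ≡ δ (s + t) 1
      one zero          t       = ℕ.*-identityˡ (δ t 1)
      one (suc zero)    zero    = refl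
      one (suc zero)    (suc t) = refl
      one (suc (suc s)) t       = refl

    -- Conservation of grains without subtraction: the loss of the fired vertex and the gain of its
    -- neighbours stand on opposite sides.
    fire-balance : ∀ v (c : Config p q) w → 4 ≤ c v → fire v c w + 4 * unit v (position w) ≡ c w + N (unit v) (position w)
    fire-balance v c w u with w ≟ᵥ v | adjacent? v w
    ... | yes refl | _ = trans (cong (λ t → c w ∸ 4 + 4 * t) (unit-at w)) (trans (ℕ.m∸n+n≡m u) (sym (trans (cong (c w +_) (trans (N-unit w w) (cong₂ (λ s t → δ (s + t) 1) (ℕ.∣n-n∣≡0 (toℕ (proj₁ w))) (ℕ.∣n-n∣≡0 (toℕ (proj₂ w)))))) (ℕ.+-identityʳ (c w)))))
    ... | no n | yes adj = trans (cong (λ t → c w + 1 + 4 * t) (unit-off v (position w) (λ e → n (position-injective e)))) (trans (ℕ.+-identityʳ _) (cong (c w +_) (sym (trans (N-unit v w) (cong (λ s → δ s 1) adj)))))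
    ... | no n | no apart = cong₂ _+_ {x = c w} refl (trans (cong (4 *_) (unit-off v (position w) (λ e → n (position-injective e)))) (sym (trans (N-unit v w) (δ-≢ apart))))

    fired : ∀ {c d : Config p q} → c ⟶* d → ℕ × ℕ → ℕ
    fired (done _)     u = 0
    fired (step v _ r) u = fired r u + unit v u

    -- The odometer `fired` determines the outcome: d is c minus the grid Laplacian of the odometer.
    balance : ∀ {c d : Config p q} (r : c ⟶* d) v → d v + 4 * fired r (position v) ≡ c v + N (fired r) (position v)
    balance (done h) v = cong₂ _+_ (sym (h v)) (sym (ℕ.n≤0⇒n≡0 (N-const 0 (position v))))
    balance {c} {d} (step w u r) v = ℕ.+-cancelʳ-≡ (fire w c v) _ _ (begin
      d v + 4 * (f + e) + fire w c v
        ≡⟨ solve 4 (λ d f e c → d :+ con 4 :* (f :+ e) :+ c := (d :+ con 4 :* f) :+ (c :+ con 4 :* e)) refl (d v) f e (fire w c v) ⟩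
      (d v + 4 * f) + (fire w c v + 4 * e)
        ≡⟨ cong₂ _+_ (balance r v) (fire-balance w c v u) ⟩
      (fire w c v + N (fired r) (position v)) + (c v + N (unit w) (position v))
        ≡⟨ solve 4 (λ x a y b → (x :+ a) :+ (y :+ b) := y :+ (a :+ b) :+ x) refl (fire w c v) (N (fired r) (position v)) (c v) (N (unit w) (position v)) ⟩
      c v + (N (fired r) (position v) + N (unit w) (position v)) + fire w c v
        ≡⟨ cong (λ s → c v + s + fire w c v) (sym (N-+ (fired r) (unit w) (position v))) ⟩
      c v + N (λ u → fired r u + unit w u) (position v) + fire w c v ∎)
      where
      open ≡-Reasoning
      f = fired r (position v)
      e = unit w (position v)

    -- no forbidden subconfiguration, as in Dhar's burning criterion
    Ample : Config p q → Set
    Ample c = ∀ (A : ℕ × ℕ → Bool) → (∀ u → A u ≡ true → ∃[ v ] position v ≡ u) → ∀ v → A (position v) ≡ true →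
      ∃[ u ] A (position u) ≡ true × N (indicator A) (position u) ≤ c u

    -- The vertex of A that stops firing first still receives a grain from each neighbour in A.
    fired⇒ample : ∀ {c d : Config p q} (r : c ⟶* d) (A : ℕ × ℕ → Bool) → (∀ u → A u ≡ true → 0 < fired r u) → ∀ v → A (position v) ≡ true →
      ∃[ u ] A (position u) ≡ true × N (indicator A) (position u) ≤ d u
    fired⇒ample (done _) A h v Av with h (position v) Av
    ... | ()
    fired⇒ample {c} {d} (step w u r) A h v Av with A (position w) in Aw | fired r (position w) in fw
    ... | true | zero = w , Aw , (begin
      N (indicator A) (position w)  ≤⟨ N-mono (position w) below ⟩
      N (fired r) (position w)      ≤⟨ ℕ.m≤n+m _ (fire w c w) ⟩
      fire w c w + N (fired r) (position w)  ≡⟨ sym (balance r w) ⟩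
      d w + 4 * fired r (position w)  ≡⟨ cong (λ f → d w + 4 * f) fw ⟩
      d w + 0                       ≡⟨ ℕ.+-identityʳ (d w) ⟩
      d w                           ∎)
      where
      open ℕ.≤-Reasoning
      below : ∀ x → x ≢ position w → indicator A x ≤ fired r x
      below x n with A x in Ax
      ... | false = z≤n
      ... | true  = subst (1 ≤_) (trans (cong (fired r x +_) (unit-off w x n)) (ℕ.+-identityʳ _)) (h x Ax)
    ... | true | suc k = fired⇒ample r A h′ v Av
      where
      h′ : ∀ x → A x ≡ true → 0 < fired r x
      h′ x Ax with ≡-dec ℕ._≟_ ℕ._≟_ x (position w)
      ... | yes refl = subst (0 <_) (sym fw) (s≤s z≤n)
      ... | no n     = subst (0 <_) (trans (cong (fired r x +_) (unit-off w x n)) (ℕ.+-identityʳ _)) (h x Ax)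
    ... | false | _ = fired⇒ample r A h′ v Av
      where
      h′ : ∀ x → A x ≡ true → 0 < fired r x
      h′ x Ax with ≡-dec ℕ._≟_ ℕ._≟_ x (position w)
      ... | yes refl = contradiction (trans (sym Ax) Aw) (λ ())
      ... | no n     = subst (0 <_) (trans (cong (fired r x +_) (unit-off w x n)) (ℕ.+-identityʳ _)) (h x Ax)

    -- Starting from at least 4 grains everywhere, every vertex has to fire before a stable
    -- configuration is reached; so `fired⇒ample` applies to every set.
    recurrent⇒ample : ∀ {c : Config p q} → Recurrent c → Ample c
    recurrent⇒ample {c} (stable , reach) A A⊆ v Av with reach (λ _ → 4)
    ... | b , r , _ = fired⇒ample r A fires v Av
      where
      fires : ∀ u → A u ≡ true → 0 < fired r u
      fires u Au with A⊆ u Au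
      ... | w , refl with fired r (position w) in f
      ... | suc _ = s≤s z≤n
      ... | zero  = ⊥-elim (stable w (begin
        4                                 ≤⟨ ℕ.m≤m+n 4 (b w) ⟩
        4 + b w                           ≤⟨ ℕ.m≤m+n (4 + b w) _ ⟩
        4 + b w + N (fired r) (position w)  ≡⟨ sym (balance r w) ⟩
        c w + 4 * fired r (position w)    ≡⟨ cong (λ t → c w + 4 * t) f ⟩
        c w + 0                           ≡⟨ ℕ.+-identityʳ (c w) ⟩
        c w                               ∎))
        where open ℕ.≤-Reasoning

    vertexList : List (Vertex p q)
    vertexList = cartesianProduct (allFin p) (allFin q)

    ∈-vertexList : ∀ v → v ∈ vertexList
    ∈-vertexList (x , y) = ∈-cartesianProduct⁺ (∈-allFin x) (∈-allFin y)

    maximal : Vertex p q → (f : Vertex p q → ℕ) → ∃[ v ] (∀ w → f w ≤ f v)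
    maximal v₀ f = argmax f v₀ vertexList , λ w → All.lookup (f[xs]≤f[argmax] {f = f} v₀ vertexList) (∈-vertexList w)

    sum-mono : ∀ {f g : Vertex p q → ℕ} → (∀ v → f v ≤ g v) → ∀ vs → sum (map f vs) ≤ sum (map g vs)
    sum-mono h []       = z≤n
    sum-mono h (v ∷ vs) = ℕ.+-mono-≤ (h v) (sum-mono h vs)

    sum-mono-< : ∀ {f g : Vertex p q → ℕ} {u vs} → (∀ v → f v ≤ g v) → u ∈ vs → f u < g u → sum (map f vs) < sum (map g vs)
    sum-mono-< {vs = _ ∷ vs} h (here refl) lt = ℕ.+-mono-<-≤ lt (sum-mono h vs)
    sum-mono-< {vs = v ∷ _}  h (there m)   lt = ℕ.+-mono-≤-< (h v) (sum-mono-< h m lt)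

    -- Firing a vertex where τ is maximal is legal.
    unfire : Vertex p q → ∀ {c : Config p q} → Ample c → ∀ fuel (τ : ℕ × ℕ → ℕ) → (∀ u → 0 < τ u → ∃[ v ] position v ≡ u) →
      sum (map (λ v → τ (position v)) vertexList) < fuel → ∀ d → (∀ v → d v + N τ (position v) ≡ c v + 4 * τ (position v)) → d ⟶* c
    unfire v₀ {c} ample (suc fuel) τ τ⊆ (s≤s le) d bal with maximal v₀ (λ v → τ (position v))
    ... | v , max with τ (position v) in τv
    ... | zero = done (λ w → begin
        d w                       ≡⟨ ℕ.+-identityʳ (d w) ⟨
        d w + 0                   ≡⟨ cong (d w +_) (sym (trans (N-cong (position w) zeros) (ℕ.n≤0⇒n≡0 (N-const 0 (position w))))) ⟩
        d w + N τ (position w)    ≡⟨ bal w ⟩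
        c w + 4 * τ (position w)  ≡⟨ cong (λ t → c w + 4 * t) (zeros (position w)) ⟩
        c w + 0                   ≡⟨ ℕ.+-identityʳ (c w) ⟩
        c w                       ∎)
      where
      open ≡-Reasoning
      zeros : ∀ u → τ u ≡ 0
      zeros u with τ u in e
      ... | zero  = refl
      ... | suc k with τ⊆ u (subst (0 <_) (sym e) (s≤s z≤n))
      ... | w , refl = trans (sym e) (ℕ.n≤0⇒n≡0 (max w))
    ... | suc M = go (ample A (λ u Au → τ⊆ u (subst (0 <_) (sym (A⁻ Au)) (s≤s z≤n))) v (A⁺ τv))
      where
      A : ℕ × ℕ → Bool
      A u = τ u ≡ᵇ suc M
      A⁻ : ∀ {u} → A u ≡ true → τ u ≡ suc M
      A⁻ {u} h = ℕ.≡ᵇ⇒≡ (τ u) (suc M) (subst Data.Bool.T (sym h) _)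
      A⁺ : ∀ {u} → τ u ≡ suc M → A u ≡ true
      A⁺ {u} h = trans (cong (_≡ᵇ suc M) h) (≡ᵇ-refl M)
        where
        ≡ᵇ-refl : ∀ d → (d ≡ᵇ d) ≡ true
        ≡ᵇ-refl zero    = refl
        ≡ᵇ-refl (suc d) = ≡ᵇ-refl d
      τ≤ : ∀ u → τ u ≤ M + indicator A u
      τ≤ u with A u in Au
      ... | true  = ℕ.≤-reflexive (trans (A⁻ Au) (ℕ.+-comm 1 M))
      ... | false with ℕ.m≤n⇒m<n∨m≡n (bounded u)
        where
        bounded : ∀ u → τ u ≤ suc M
        bounded u with τ u in e
        ... | zero  = z≤n
        ... | suc k with τ⊆ u (subst (0 <_) (sym e) (s≤s z≤n))
        ... | w , refl = subst (_≤ suc M) e (max w)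
      ... | inj₁ (s≤s lt) = ℕ.≤-trans lt (ℕ.m≤m+n M 0)
      ... | inj₂ e = contradiction (trans (sym (A⁺ e)) Au) (λ ())
      go : ∃[ u ] A (position u) ≡ true × N (indicator A) (position u) ≤ c u → d ⟶* c
      go (u , Au , enough) = step u unstable (unfire v₀ ample fuel τ′ (λ x lt → τ⊆ x (ℕ.<-≤-trans lt (ℕ.m∸n≤m (τ x) (unit u x))))
          (ℕ.<-≤-trans (sum-mono-< (λ w → ℕ.m∸n≤m (τ (position w)) (unit u (position w))) (∈-vertexList u) smaller) le) (fire u d) bal′)
        where
        open ℕ.≤-Reasoning
        τu = A⁻ Au
        τ′ : ℕ × ℕ → ℕ
        τ′ x = τ x ∸ unit u x
        unit≤τ : ∀ x → unit u x ≤ τ x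
        unit≤τ x with ≡-dec ℕ._≟_ ℕ._≟_ x (position u)
        ... | yes refl = subst₂ _≤_ (sym (unit-at u)) (sym τu) (s≤s z≤n)
        ... | no n     = subst (_≤ τ x) (sym (unit-off u x n)) z≤n
        τ-split : ∀ x → τ x ≡ τ′ x + unit u x
        τ-split x = sym (ℕ.m∸n+n≡m (unit≤τ x))
        smaller : τ′ (position u) < τ (position u)
        smaller = subst₂ _<_ (sym (trans (cong (_∸ unit u (position u)) τu) (cong (suc M ∸_) (unit-at u)))) (sym τu) ℕ.≤-refl
        -- Neighbours of u have τ at most M, or M + 1 if in A, and at most c u of them are in A. So
        -- the neighbour sum of τ is at most 4M + c u, and the balance leaves 4 grains on u.
        unstable : 4 ≤ d u
        unstable = ℕ.+-cancelʳ-≤ (N τ (position u)) 4 (d u) (begin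
          4 + N τ (position u)
            ≤⟨ ℕ.+-monoʳ-≤ 4 (ℕ.≤-trans (N-mono (position u) (λ x _ → τ≤ x)) (ℕ.≤-reflexive (N-+ (λ _ → M) (indicator A) (position u)))) ⟩
          4 + (N (λ _ → M) (position u) + N (indicator A) (position u))
            ≤⟨ ℕ.+-monoʳ-≤ 4 (ℕ.+-mono-≤ (N-const M (position u)) enough) ⟩
          4 + (4 * M + c u)
            ≡⟨ solve 2 (λ m c → con 4 :+ (con 4 :* m :+ c) := c :+ con 4 :* (con 1 :+ m)) refl M (c u) ⟩
          c u + 4 * suc M
            ≡⟨ sym (trans (bal u) (cong (λ t → c u + 4 * t) τu)) ⟩
          d u + N τ (position u) ∎)
        bal′ : ∀ w → fire u d w + N τ′ (position w) ≡ c w + 4 * τ′ (position w)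
        bal′ w = ℕ.+-cancelʳ-≡ (4 * e) _ _ (begin-equality
          fire u d w + N τ′ (position w) + 4 * e
            ≡⟨ solve 3 (λ a b c → a :+ b :+ c := (a :+ c) :+ b) refl (fire u d w) (N τ′ (position w)) (4 * e) ⟩
          (fire u d w + 4 * e) + N τ′ (position w)
            ≡⟨ cong (_+ N τ′ (position w)) (fire-balance u d w unstable) ⟩
          (d w + N (unit u) (position w)) + N τ′ (position w)
            ≡⟨ solve 3 (λ a b c → (a :+ b) :+ c := a :+ (c :+ b)) refl (d w) (N (unit u) (position w)) (N τ′ (position w)) ⟩
          d w + (N τ′ (position w) + N (unit u) (position w))
            ≡⟨ cong (d w +_) (sym (trans (N-cong (position w) τ-split) (N-+ τ′ (unit u) (position w)))) ⟩
          d w + N τ (position w)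
            ≡⟨ trans (bal w) (cong (λ t → c w + 4 * t) (τ-split (position w))) ⟩
          c w + 4 * (τ′ (position w) + e)
            ≡⟨ solve 3 (λ c t e → c :+ con 4 :* (t :+ e) := c :+ con 4 :* t :+ con 4 :* e) refl (c w) (τ′ (position w)) e ⟩
          c w + 4 * τ′ (position w) + 4 * e ∎)
          where
          e = unit u (position w)

    -- Zero at -1 and at r, with second difference -2 in between; truncated subtraction continues it
    -- by 0 to the right.
    parabola : ℕ → ℕ → ℕ
    parabola r x = suc x * (r ∸ x)

    parabola-concave : ∀ {r x} → x < r → 2 * parabola r x ≡ (back (parabola r) x + parabola r (suc x)) + 2
    parabola-concave {r} {x} x<r = subst (λ r → 2 * parabola r x ≡ (back (parabola r) x + parabola r (suc x)) + 2) (trans (ℕ.+-suc x _) (ℕ.m+[n∸m]≡n x<r)) (go x (r ∸ suc x))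
      where
      go : ∀ x k → 2 * parabola (x + suc k) x ≡ (back (parabola (x + suc k)) x + parabola (x + suc k) (suc x)) + 2
      go zero k = solve 1 (λ k → con 2 :* (con 1 :* (con 1 :+ k)) := con 2 :* k :+ con 2) refl k
      go (suc x) k = trans (cong (λ t → 2 * (suc (suc x) * t)) (ℕ.m+n∸m≡n x (suc k))) (trans
        (solve 2 (λ x k → con 2 :* ((con 2 :+ x) :* (con 1 :+ k)) := ((con 1 :+ x) :* (con 2 :+ k) :+ (con 3 :+ x) :* k) :+ con 2) refl x k)
        (sym (cong₂ (λ s t → (suc x * s + suc (suc (suc x)) * t) + 2)
          (trans (cong (_∸ x) (trans (cong suc (ℕ.+-suc x k)) (sym (trans (ℕ.+-suc x (suc k)) (cong suc (ℕ.+-suc x k)))))) (ℕ.m+n∸m≡n x (suc (suc k))))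
          (trans (cong (_∸ suc x) (ℕ.+-suc x k)) (ℕ.m+n∸m≡n x k)))))

    -- Positive on the grid, zero outside and strictly superharmonic: firing every vertex K * `hill`
    -- times lowers each vertex by at least K grains.
    hill : ℕ × ℕ → ℕ
    hill (x , y) = parabola p x * parabola q y

    hill-inside : ∀ u → 0 < hill u → ∃[ v ] position v ≡ u
    hill-inside (x , y) h with x ℕ.<? p | y ℕ.<? q
    ... | yes x<p | yes y<q = inside x<p y<q
    ... | no x≮p  | _       = contradiction (subst (0 <_) (trans (cong (λ t → suc x * t * parabola q y) (ℕ.m≤n⇒m∸n≡0 (ℕ.≮⇒≥ x≮p))) (cong (_* parabola q y) (ℕ.*-zeroʳ (suc x)))) h) (λ ())
    ... | yes _   | no y≮q  = contradiction (subst (0 <_) (trans (cong (λ t → parabola p x * (suc y * t)) (ℕ.m≤n⇒m∸n≡0 (ℕ.≮⇒≥ y≮q))) (trans (cong (parabola p x *_) (ℕ.*-zeroʳ (suc y))) (ℕ.*-zeroʳ (parabola p x)))) h) (λ ())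

    hill-superharmonic : ∀ v → N hill (position v) < 4 * hill (position v)
    hill-superharmonic (a , b) = begin-strict
      N hill (x , y)
        ≡⟨ cong₂ _+_ (cong (_+ s₊ * t) (trans (back-cong x (λ x → ℕ.*-comm (parabola p x) t)) (trans (back-* t (parabola p) x) (ℕ.*-comm t s₋)))) (cong (_+ s * t₊) (back-* s (parabola q) y)) ⟩
      (s₋ * t + s₊ * t) + (s * t₋ + s * t₊)
        <⟨ ℕ.m<m+n _ (ℕ.*-mono-< {0} {2} {0} {s + t} (s≤s z≤n) (ℕ.<-≤-trans (s≥1) (ℕ.m≤m+n s t))) ⟩
      (s₋ * t + s₊ * t) + (s * t₋ + s * t₊) + 2 * (s + t)
        ≡⟨ solve 6 (λ a b c d s t → (a :* t :+ b :* t) :+ (s :* c :+ s :* d) :+ con 2 :* (s :+ t) := ((a :+ b) :+ con 2) :* t :+ s :* ((c :+ d) :+ con 2)) refl s₋ s₊ t₋ t₊ s t ⟩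
      ((s₋ + s₊) + 2) * t + s * ((t₋ + t₊) + 2)
        ≡⟨ sym (cong₂ (λ i j → i * t + s * j) (parabola-concave (Fin.toℕ<n a)) (parabola-concave (Fin.toℕ<n b))) ⟩
      2 * s * t + s * (2 * t)
        ≡⟨ solve 2 (λ s t → con 2 :* s :* t :+ s :* (con 2 :* t) := con 4 :* (s :* t)) refl s t ⟩
      4 * hill (x , y) ∎
      where
      open ℕ.≤-Reasoning
      x = toℕ a
      y = toℕ b
      s = parabola p x
      s₋ = back (parabola p) x
      s₊ = parabola p (suc x)
      t = parabola q y
      t₋ = back (parabola q) y
      t₊ = parabola q (suc y)
      s≥1 : 0 < s
      s≥1 = ℕ.*-mono-< {0} {suc x} {0} (s≤s z≤n) (ℕ.m<n⇒0<n∸m (Fin.toℕ<n a))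
      back-cong : ∀ {f g : ℕ → ℕ} x → (∀ z → f z ≡ g z) → back f x ≡ back g x
      back-cong zero    h = refl
      back-cong (suc x) h = h x

    -- With K the maximum of a, the addition b is chosen so that a ⊕ b is c plus what firing K *
    -- `hill` takes away; `unfire` performs these firings in a legal order. The subtraction of a in
    -- b is exact because every gain is at least 1.
    ample⇒recurrent : Vertex p q → ∀ {c : Config p q} → Stable c → Ample c → Recurrent c
    ample⇒recurrent v₀ {c} stable ample = stable , λ a → let v , a≤ = maximal v₀ a in b a (a v) , reach a (a v) a≤ , stable
      where
      gain : Vertex p q → ℕ
      gain v = 4 * hill (position v) ∸ N hill (position v)
      b : Config p q → ℕ → Config p q
      b a K v = c v + K * gain v ∸ a v
      reach : ∀ a K → (∀ v → a v ≤ K) → (a ⊕ b a K) ⟶* c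
      reach a K a≤ = unfire v₀ ample (suc (sum (map (λ v → K * hill (position v)) vertexList))) (λ u → K * hill u)
        (λ u h → hill-inside u (ℕ.n≢0⇒n>0 (λ e → ℕ.<⇒≢ h (sym (trans (cong (K *_) e) (ℕ.*-zeroʳ K)))))) ℕ.≤-refl (a ⊕ b a K) (λ v → begin
          a v + b a K v + N (λ u → K * hill u) (position v)
            ≡⟨ cong₂ _+_ (ℕ.m+[n∸m]≡n (ℕ.≤-trans (a≤ v) (ℕ.≤-trans (ℕ.≤-trans (ℕ.≤-reflexive (sym (ℕ.*-identityʳ K))) (ℕ.*-monoʳ-≤ K (ℕ.m<n⇒0<n∸m (hill-superharmonic v)))) (ℕ.m≤n+m _ (c v))))) (N-* K hill (position v)) ⟩
          c v + K * gain v + K * N hill (position v)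
            ≡⟨ trans (ℕ.+-assoc (c v) _ _) (cong (c v +_) (sym (ℕ.*-distribˡ-+ K (gain v) (N hill (position v))))) ⟩
          c v + K * (gain v + N hill (position v))
            ≡⟨ cong (λ t → c v + K * t) (ℕ.m∸n+n≡m (ℕ.<⇒≤ (hill-superharmonic v))) ⟩
          c v + K * (4 * hill (position v))
            ≡⟨ solve 3 (λ c k h → c :+ k :* (con 4 :* h) := c :+ con 4 :* (k :* h)) refl (c v) K (hill (position v)) ⟩
          c v + 4 * (K * hill (position v)) ∎)
        where open ≡-Reasoning

-- Symmetric configurations and the quotient of the grid.

module SymmetricConfigurations (m n : ℕ) where
  open import Data.Bool as Bool using (Bool; true; false; if_then_else_; _∧_)
  import Data.Integer as ℤ
  open import Data.Integer using (ℤ) renaming (+_ to pos)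
  import Data.Integer.Properties as ℤ
  open import Data.Fin as Fin using (Fin; toℕ; opposite)
  import Data.Fin.Properties as Fin
  open import Data.List using (List; []; _∷_; map; downFrom; cartesianProduct)
  open import Data.List.Membership.Propositional using (_∈_; _∉_)
  open import Data.List.Membership.Propositional.Properties using (∈-cartesianProduct⁺; ∈-cartesianProduct⁻; ∈-downFrom⁺; ∈-downFrom⁻)
  open import Data.List.Properties using (map-cong; map-++; map-∘)
  open import Data.List.Relation.Unary.Unique.Propositional using (Unique)
  import Data.List.Relation.Unary.Unique.Propositional.Properties as Unique
  open import Data.Nat as ℕ using (zero; suc; _+_; _*_; _∸_; _≤_; _<_; z≤n; s≤s)
  open import Data.Nat.ListAction using (sum)
  open import Data.Nat.ListAction.Properties using (sum-++)
  import Data.Nat.Properties as ℕ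
  open import Data.Nat.Solver using (module +-*-Solver)
  open import Data.Product using (_×_; _,_; ∃-syntax; proj₁; proj₂)
  open import Data.Product.Properties using (≡-dec)
  open import Data.Sum using (_⊎_; inj₁; inj₂)
  open import Function using (const)
  open import Relation.Binary.Definitions using (tri<; tri≈; tri>)
  open import Relation.Binary.PropositionalEquality
  open import Relation.Nullary using (Dec; yes; no; does; contradiction)
  open import Relation.Nullary.Decidable using (dec-true; dec-false; map′; _×-dec_)
  open +-*-Solver
  open Counting
  open Exterior ℤ.+-*-commutativeRing using (det; det-cong)
  open HalfGrid
  open Recurrence

  Σ : {I : Set} → List I → (I → ℕ) → ℕ
  Σ is f = sum (map f is)

  Σ-cong : ∀ {I : Set} (is : List I) {f g : I → ℕ} → (∀ i → f i ≡ g i) → Σ is f ≡ Σ is g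
  Σ-cong is h = cong sum (map-cong h is)

  Σ-+ : ∀ {I : Set} (is : List I) f g → Σ is (λ i → f i + g i) ≡ Σ is f + Σ is g
  Σ-+ []       f g = refl
  Σ-+ (i ∷ is) f g = trans (cong (f i + g i +_) (Σ-+ is f g))
    (solve 4 (λ a b c d → (a :+ b) :+ (c :+ d) := (a :+ c) :+ (b :+ d)) refl (f i) (g i) (Σ is f) (Σ is g))

  Σ-* : ∀ {I : Set} (is : List I) k f → Σ is (λ i → k * f i) ≡ k * Σ is f
  Σ-* []       k f = sym (ℕ.*-zeroʳ k)
  Σ-* (i ∷ is) k f = trans (cong (k * f i +_) (Σ-* is k f)) (sym (ℕ.*-distribˡ-+ k (f i) (Σ is f)))

  Σ-× : ∀ {I J : Set} (is : List I) (js : List J) f → Σ (cartesianProduct is js) f ≡ Σ is (λ i → Σ js (λ j → f (i , j)))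
  Σ-× []       js f = refl
  Σ-× (i ∷ is) js f = trans (cong sum (map-++ f (map (i ,_) js) (cartesianProduct is js)))
    (trans (sum-++ (map f (map (i ,_) js)) _) (cong₂ _+_ (cong sum (sym (map-∘ js))) (Σ-× is js f)))

  restrict : ℕ → (ℕ → ℕ) → ℕ → ℕ
  restrict r h b = if does (b ℕ.<? r) then h b else 0

  restrict-in : ∀ {r b} h → b < r → restrict r h b ≡ h b
  restrict-in {r} {b} h b<r = cong (if_then h b else 0) (dec-true (b ℕ.<? r) b<r)

  restrict-out : ∀ {r b} h → r ≤ b → restrict r h b ≡ 0
  restrict-out {r} {b} h r≤b = cong (if_then h b else 0) (dec-false (b ℕ.<? r) (ℕ.≤⇒≯ r≤b))

  Σ-δ : ∀ r h b → Σ (downFrom r) (λ a → δ b a * h a) ≡ restrict r h b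
  Σ-δ zero    h b = refl
  Σ-δ (suc r) h b with ℕ.<-cmp b r
  ... | tri< b<r b≢r _ = trans (cong₂ (λ d s → d * h r + s) (δ-≢ b≢r) (Σ-δ r h b)) (trans (restrict-in h b<r) (sym (restrict-in h (ℕ.m<n⇒m<1+n b<r))))
  ... | tri≈ _ refl _ = trans (cong₂ (λ d s → d * h b + s) (δ-refl b) (trans (Σ-δ b h b) (restrict-out h ℕ.≤-refl)))
    (trans (trans (ℕ.+-identityʳ (1 * h b)) (ℕ.*-identityˡ (h b))) (sym (restrict-in {suc b} h ℕ.≤-refl)))
  ... | tri> _ b≢r r<b = trans (cong₂ (λ d s → d * h r + s) (δ-≢ b≢r) (trans (Σ-δ r h b) (restrict-out h (ℕ.<⇒≤ r<b)))) (sym (restrict-out h r<b))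

  along : ℕ → (ℕ → ℕ) → ℕ → ℕ
  along r h a = Σ (downFrom r) (λ a′ → path a a′ * h a′)

  along-value : ∀ {r} h a → a < r → along r h a ≡ back h a + restrict r h (suc a)
  along-value {r} h a a<r = trans (Σ-cong (downFrom r) (λ a′ → ℕ.*-distribʳ-+ (h a′) (δ (suc a) a′) (δ a (suc a′))))
    (trans (Σ-+ (downFrom r) (λ a′ → δ (suc a) a′ * h a′) (λ a′ → δ a (suc a′) * h a′))
      (trans (ℕ.+-comm (Σ (downFrom r) (λ a′ → δ (suc a) a′ * h a′)) _) (cong₂ _+_ (previous a a<r) (Σ-δ r h (suc a)))))
    where
    previous : ∀ a → a < r → Σ (downFrom r) (λ a′ → δ a (suc a′) * h a′) ≡ back h a
    previous zero    _   = Σ-* (downFrom r) 0 h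
    previous (suc a) a<r = trans (Σ-δ r h a) (restrict-in h (ℕ.<-trans (ℕ.n<1+n a) a<r))

  free : ℕ → ℕ
  free zero    = 1
  free (suc a) = 0

  diag+free : ∀ a → diag a + free a ≡ 2
  diag+free zero    = refl
  diag+free (suc a) = refl

  -- Distance from the middle of a line of length 2r, equal for mirror images; both middle cells
  -- have distance 0.
  fold : ℕ → ℕ → ℕ
  fold r x = if does (x ℕ.<? r) then r ∸ suc x else x ∸ r

  fold-upper : ∀ r a → fold r (r + a) ≡ a
  fold-upper r a = trans (cong (if_then r ∸ suc (r + a) else r + a ∸ r) (dec-false (r + a ℕ.<? r) (ℕ.≤⇒≯ (ℕ.m≤m+n r a)))) (ℕ.m+n∸m≡n r a)

  fold-lower : ∀ {r x a} → x + suc a ≡ r → fold r x ≡ a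
  fold-lower {r} {x} {a} e = trans (cong (if_then r ∸ suc x else x ∸ r) (dec-true (x ℕ.<? r) x<r))
    (trans (cong (_∸ suc x) (sym (trans (sym (ℕ.+-suc x a)) e))) (ℕ.m+n∸m≡n (suc x) a))
    where
    x<r : x < r
    x<r = subst (x <_) e (ℕ.m<m+n x (s≤s z≤n))

  Half : ℕ → ℕ → ℕ → Set
  Half r x a = a < r × (x ≡ r + a ⊎ x + suc a ≡ r)

  half : ∀ r x → x < 2 * r → ∃[ a ] Half r x a
  half r x x<2r with x ℕ.<? r
  ... | yes x<r = r ∸ suc x , subst (_≤ r) (ℕ.+-∸-assoc 1 x<r) (ℕ.m∸n≤m r x) , inj₂ (trans (ℕ.+-suc x _) (ℕ.m+[n∸m]≡n x<r))
  ... | no x≮r  = x ∸ r , ℕ.+-cancelˡ-< r _ _ (subst₂ _<_ (sym (ℕ.m+[n∸m]≡n (ℕ.≮⇒≥ x≮r))) (cong (λ s → r + s) (ℕ.+-identityʳ r)) x<2r) , inj₁ (sym (ℕ.m+[n∸m]≡n (ℕ.≮⇒≥ x≮r)))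

  fold-half : ∀ {r x a} → Half r x a → fold r x ≡ a
  fold-half {r} {x} {a} (_ , inj₁ refl) = fold-upper r a
  fold-half {r} {x} {a} (_ , inj₂ e)    = fold-lower e

  fold-< : ∀ {r x} → x < 2 * r → fold r x < r
  fold-< {r} {x} x<2r = let a , h = half r x x<2r in subst (_< r) (sym (fold-half h)) (proj₁ h)

  half-< : ∀ {r x a} → Half r x a → x < 2 * r
  half-< {r} {x} {a} (a<r , inj₁ refl) = ℕ.+-monoʳ-< r (subst (a <_) (sym (ℕ.+-identityʳ r)) a<r)
  half-< {r} {x} {a} (a<r , inj₂ e)    = ℕ.<-≤-trans (subst (x <_) e (ℕ.m<m+n x (s≤s z≤n))) (ℕ.m≤m+n r (r + 0))

  reflected : ℕ → (ℕ → ℕ) → ℕ → ℕ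
  reflected r h = restrict (2 * r) (λ x → h (fold r x))

  reflected-half : ∀ {r x a} h → Half r x a → reflected r h x ≡ h a
  reflected-half {r} h H = trans (restrict-in (λ x → h (fold r x)) (half-< H)) (cong h (fold-half H))

  -- The two central cells of a line, folded together, are neighbours of each other.
  reflected-sum : ∀ {r x} h → x < 2 * r → back (reflected r h) x + reflected r h (suc x) ≡ along r h (fold r x) + free (fold r x) * h (fold r x)
  reflected-sum {r} {x} h x<2r with half r x x<2r
  ... | a , H = trans (go a H) (trans (cong (_+ free a * h a) (sym (along-value h a (proj₁ H)))) (cong (λ a → along r h a + free a * h a) (sym (fold-half H))))
    where
    next : ∀ a y → (suc a < r → Half r y (suc a)) → (r ≤ suc a → 2 * r ≤ y) → reflected r h y ≡ restrict r h (suc a)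
    next a y i o with suc a ℕ.<? r
    ... | yes lt = trans (reflected-half h (i lt)) (sym (restrict-in h lt))
    ... | no nlt = trans (restrict-out (λ x → h (fold r x)) (o (ℕ.≮⇒≥ nlt))) (sym (restrict-out h (ℕ.≮⇒≥ nlt)))
    outer : ∀ a → reflected r h (suc (r + a)) ≡ restrict r h (suc a)
    outer a = next a (suc (r + a)) (λ lt → lt , inj₁ (sym (ℕ.+-suc r a)))
      (λ le → ℕ.≤-trans (ℕ.+-monoʳ-≤ r (ℕ.≤-trans (ℕ.≤-reflexive (ℕ.+-identityʳ r)) le)) (ℕ.≤-reflexive (ℕ.+-suc r a)))
    inner : ∀ x a → x + suc a ≡ r → back (reflected r h) x ≡ restrict r h (suc a)
    inner zero    a e = sym (restrict-out h (ℕ.≤-reflexive (sym e)))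
    inner (suc x) a e = trans (reflected-half h (lt , inj₂ (trans (ℕ.+-suc x (suc a)) e))) (sym (restrict-in h lt))
      where
      lt : suc a < r
      lt = subst (suc a <_) e (ℕ.m<n+m (suc a) (s≤s z≤n))
    go : ∀ {x} a → Half r x a → back (reflected r h) x + reflected r h (suc x) ≡ (back h a + restrict r h (suc a)) + free a * h a
    go {x} zero (0<r , inj₁ refl) = trans (cong₂ _+_ (trans (cong (back (reflected r h)) (ℕ.+-identityʳ r)) (centre r refl)) (outer 0))
      (trans (ℕ.+-comm (h 0) _) (cong (restrict r h 1 +_) (sym (ℕ.*-identityˡ (h 0)))))
      where
      centre : ∀ s → s ≡ r → back (reflected r h) s ≡ h 0
      centre zero    refl = contradiction 0<r (λ ())
      centre (suc s) e    = reflected-half h (0<r , inj₂ (trans (ℕ.+-comm s 1) e))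
    go {x} (suc a) (a<r , inj₁ refl) = trans (cong₂ _+_ (trans (cong (back (reflected r h)) (ℕ.+-suc r a)) (reflected-half h (ℕ.<-trans (ℕ.n<1+n a) a<r , inj₁ refl))) (outer (suc a))) (sym (ℕ.+-identityʳ _))
    go {x} zero (0<r , inj₂ e) = trans (cong₂ _+_ (inner x 0 e) (reflected-half h (0<r , inj₁ (trans (ℕ.+-comm 1 x) (trans e (sym (ℕ.+-identityʳ r)))))))
      (cong (restrict r h 1 +_) (sym (ℕ.*-identityˡ (h 0))))
    go {x} (suc a) (a<r , inj₂ e) = trans (cong₂ _+_ (inner x (suc a) e) (reflected-half h (ℕ.<-trans (ℕ.n<1+n a) a<r , inj₂ (trans (sym (ℕ.+-suc x (suc a))) e))))
      (trans (ℕ.+-comm _ (h a)) (sym (ℕ.+-identityʳ _)))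

  weight : ℕ × ℕ → ℕ × ℕ → ℕ
  weight (a , b) (a′ , b′) = δ b b′ * path a a′ + δ a a′ * path b b′

  path-irreflexive : ∀ a → path a a ≡ 0
  path-irreflexive a = cong₂ _+_ (δ-≢ {suc a} {a} (λ e → ℕ.<⇒≢ (ℕ.n<1+n a) (sym e))) (δ-≢ {a} {suc a} (ℕ.<⇒≢ (ℕ.n<1+n a)))

  loopless : ∀ u → weight u u ≡ 0
  loopless (a , b) = cong₂ _+_ (trans (cong (δ b b *_) (path-irreflexive a)) (ℕ.*-zeroʳ (δ b b))) (trans (cong (δ a a *_) (path-irreflexive b)) (ℕ.*-zeroʳ (δ a a)))

  _≟_ : (u v : ℕ × ℕ) → Dec (u ≡ v)
  _≟_ = ≡-dec ℕ._≟_ ℕ._≟_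

  open ParkingFunctions _≟_ weight loopless

  degree : ℕ × ℕ → ℕ
  degree (a , b) = diag a + diag b

  -- The number of neighbours of a cell that are its own mirror images; with the degree in the
  -- quotient they make 4.
  slack : ℕ × ℕ → ℕ
  slack (a , b) = free a + free b

  degree+slack : ∀ u → degree u + slack u ≡ 4
  degree+slack (a , b) = trans (solve 4 (λ x y z w → (x :+ y) :+ (z :+ w) := (x :+ z) :+ (y :+ w)) refl (diag a) (diag b) (free a) (free b)) (cong₂ _+_ (diag+free a) (diag+free b))

  vs : List (ℕ × ℕ)
  vs = vertices m n

  demand-along : ∀ B {a b} → a < m → b < n →
    demand vs B (a , b) ≡ along m (λ a′ → indicator B (a′ , b)) a + along n (λ b′ → indicator B (a , b′)) b
  demand-along B {a} {b} a<m b<n = begin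
    demand vs B (a , b)
      ≡⟨ Σ-× (downFrom m) (downFrom n) _ ⟩
    Σ (downFrom m) (λ a′ → Σ (downFrom n) (λ b′ → if B (a′ , b′) then weight (a , b) (a′ , b′) else 0))
      ≡⟨ Σ-cong (downFrom m) (λ a′ → trans (Σ-cong (downFrom n) (λ b′ → term a′ b′ (B (a′ , b′)))) (trans (Σ-+ (downFrom n) _ _) (cong₂ _+_
           (trans (Σ-δ n (λ b′ → path a a′ * indicator B (a′ , b′)) b) (restrict-in (λ b′ → path a a′ * indicator B (a′ , b′)) b<n)) (Σ-* (downFrom n) (δ a a′) (λ b′ → path b b′ * indicator B (a′ , b′)))))) ⟩
    Σ (downFrom m) (λ a′ → path a a′ * indicator B (a′ , b) + δ a a′ * along n (λ b′ → indicator B (a′ , b′)) b)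
      ≡⟨ Σ-+ (downFrom m) _ _ ⟩
    along m (λ a′ → indicator B (a′ , b)) a + Σ (downFrom m) (λ a′ → δ a a′ * along n (λ b′ → indicator B (a′ , b′)) b)
      ≡⟨ cong (along m (λ a′ → indicator B (a′ , b)) a +_) (trans (Σ-δ m (λ a′ → along n (λ b′ → indicator B (a′ , b′)) b) a) (restrict-in (λ a′ → along n (λ b′ → indicator B (a′ , b′)) b) a<m)) ⟩
    along m (λ a′ → indicator B (a′ , b)) a + along n (λ b′ → indicator B (a , b′)) b ∎
    where
    open ≡-Reasoning
    term : ∀ a′ b′ t → (if t then weight (a , b) (a′ , b′) else 0) ≡ δ b b′ * (path a a′ * (if t then 1 else 0)) + δ a a′ * (path b b′ * (if t then 1 else 0))
    term a′ b′ true  = sym (cong₂ (λ i j → δ b b′ * i + δ a a′ * j) (ℕ.*-identityʳ (path a a′)) (ℕ.*-identityʳ (path b b′)))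
    term a′ b′ false = solve 4 (λ x y z w → con 0 := x :* (y :* con 0) :+ z :* (w :* con 0)) refl (δ b b′) (path a a′) (δ a a′) (path b b′)

  foldᵥ : ℕ × ℕ → ℕ × ℕ
  foldᵥ (x , y) = fold m x , fold n y

  preimage : (ℕ × ℕ → Bool) → ℕ × ℕ → Bool
  preimage B (x , y) = does (x ℕ.<? 2 * m) ∧ (does (y ℕ.<? 2 * n) ∧ B (foldᵥ (x , y)))

  -- Neighbours of a cell map to neighbours of its image in the quotient, except for its own mirror
  -- images, which map to the image of the cell itself.
  N-preimage : ∀ B {x y} → x < 2 * m → y < 2 * n → let u = foldᵥ (x , y) in
    N (indicator (preimage B)) (x , y) ≡ demand vs B u + slack u * indicator B u
  N-preimage B {x} {y} x< y< = begin
    N (indicator (preimage B)) (x , y)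
      ≡⟨ cong₂ _+_ (cong₂ _+_ (back-cong x row) (row (suc x))) (cong₂ _+_ (back-cong y column) (column (suc y))) ⟩
    (back (reflected m f) x + reflected m f (suc x)) + (back (reflected n g) y + reflected n g (suc y))
      ≡⟨ cong₂ _+_ (reflected-sum {m} f x<) (reflected-sum {n} g y<) ⟩
    (along m f a + free a * k) + (along n g b + free b * k)
      ≡⟨ solve 5 (λ s t p q k → (s :+ p :* k) :+ (t :+ q :* k) := (s :+ t) :+ (p :+ q) :* k) refl (along m f a) (along n g b) (free a) (free b) k ⟩
    (along m f a + along n g b) + (free a + free b) * k
      ≡⟨ cong (_+ (free a + free b) * k) (sym (demand-along B (fold-< {m} x<) (fold-< {n} y<))) ⟩
    demand vs B (a , b) + (free a + free b) * k ∎
    where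
    open ≡-Reasoning
    a = fold m x
    b = fold n y
    f g : ℕ → ℕ
    f a′ = indicator B (a′ , b)
    g b′ = indicator B (a , b′)
    k = indicator B (a , b)
    back-cong : ∀ {f g : ℕ → ℕ} x → (∀ z → f z ≡ g z) → back f x ≡ back g x
    back-cong zero    h = refl
    back-cong (suc x) h = h x
    row : ∀ z → indicator (preimage B) (z , y) ≡ reflected m f z
    row z with does (z ℕ.<? 2 * m)
    ... | false = refl
    ... | true  = cong (λ s → if s ∧ B (foldᵥ (z , y)) then 1 else 0) (dec-true (y ℕ.<? 2 * n) y<)
    column : ∀ z → indicator (preimage B) (x , z) ≡ reflected n g z
    column z = trans (cong (λ s → if s ∧ (does (z ℕ.<? 2 * n) ∧ B (foldᵥ (x , z))) then 1 else 0) (dec-true (x ℕ.<? 2 * m) x<)) (rest z)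
      where
      rest : ∀ z → (if does (z ℕ.<? 2 * n) ∧ B (foldᵥ (x , z)) then 1 else 0) ≡ reflected n g z
      rest z with does (z ℕ.<? 2 * n)
      ... | false = refl
      ... | true  = refl

  V : Set
  V = Vertex (2 * m) (2 * n)

  quotient : V → ℕ × ℕ
  quotient v = foldᵥ (position v)

  quotient-∈ : ∀ v → quotient v ∈ vs
  quotient-∈ (x , y) = ∈-cartesianProduct⁺ (∈-downFrom⁺ (fold-< {m} (Fin.toℕ<n x))) (∈-downFrom⁺ (fold-< {n} (Fin.toℕ<n y)))

  quotient-surjective : ∀ {u} → u ∈ vs → ∃[ v ] quotient v ≡ u
  quotient-surjective {a , b} u∈ with ∈-cartesianProduct⁻ (downFrom m) (downFrom n) u∈
  ... | a∈ , b∈ = let v , e = inside {2 * m} {2 * n} (half-< {m} {m + a} A) (half-< {n} {n + b} B) in v , trans (cong foldᵥ e) (cong₂ _,_ (fold-half A) (fold-half B))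
    where
    A : Half m (m + a) a
    A = ∈-downFrom⁻ a∈ , inj₁ refl
    B : Half n (n + b) b
    B = ∈-downFrom⁻ b∈ , inj₁ refl

  find? : {P : V → Set} → (∀ v → Dec (P v)) → Dec (∃[ v ] P v)
  find? P? = map′ (λ (x , y , p) → (x , y) , p) (λ ((x , y) , p) → x , y , p) (Fin.any? (λ x → Fin.any? (λ y → P? (x , y))))

  does⁻ : {P : Set} (d : Dec P) → does d ≡ true → P
  does⁻ (yes p) _ = p

  ∧⁻ : ∀ {s t} → s ∧ t ≡ true → s ≡ true × t ≡ true
  ∧⁻ {true} {true} _ = refl , refl

  preimage⁻ : ∀ B u → preimage B u ≡ true → (∃[ v ] position v ≡ u) × B (foldᵥ u) ≡ true
  preimage⁻ B (x , y) h with ∧⁻ h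
  ... | hx , h′ with ∧⁻ h′
  ... | hy , Bu = inside (does⁻ (x ℕ.<? 2 * m) hx) (does⁻ (y ℕ.<? 2 * n) hy) , Bu

  preimage⁺ : ∀ B v → B (quotient v) ≡ true → preimage B (position v) ≡ true
  preimage⁺ B (x , y) h = cong₂ _∧_ (dec-true (toℕ x ℕ.<? 2 * m) (Fin.toℕ<n x)) (cong₂ _∧_ (dec-true (toℕ y ℕ.<? 2 * n) (Fin.toℕ<n y)) h)

  opposite-sum : ∀ {r} (i : Fin (2 * r)) → toℕ (opposite i) + suc (toℕ i) ≡ r + r
  opposite-sum {r} i = trans (cong (_+ suc (toℕ i)) (Fin.opposite-prop i)) (trans (ℕ.m∸n+n≡m (Fin.toℕ<n i)) (cong (λ s → r + s) (ℕ.+-identityʳ r)))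

  fold-opposite : ∀ {r} (i : Fin (2 * r)) → fold r (toℕ (opposite i)) ≡ fold r (toℕ i)
  fold-opposite {r} i with half r (toℕ i) (Fin.toℕ<n i)
  ... | a , a<r , inj₁ e = trans (fold-half {r} {_} {a} (a<r , inj₂ (ℕ.+-cancelˡ-≡ r _ _ (trans
      (solve 3 (λ r t a → r :+ (t :+ (con 1 :+ a)) := t :+ (con 1 :+ (r :+ a))) refl r (toℕ (opposite i)) a)
      (trans (cong (λ t → toℕ (opposite i) + suc t) (sym e)) (opposite-sum {r} i))))))
    (sym (fold-half (a<r , inj₁ e)))
  ... | a , a<r , inj₂ e = trans (fold-half {r} {_} {a} (a<r , inj₁ (ℕ.+-cancelʳ-≡ (suc (toℕ i)) _ _ (trans (opposite-sum {r} i) (trans (cong (λ s → r + s) (sym e))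
      (solve 3 (λ r t a → r :+ (t :+ (con 1 :+ a)) := (r :+ a) :+ (con 1 :+ t)) refl r (toℕ i) a))))))
    (sym (fold-half (a<r , inj₂ e)))

  fold-fibre : ∀ {r} (i j : Fin (2 * r)) → fold r (toℕ i) ≡ fold r (toℕ j) → i ≡ j ⊎ i ≡ opposite j
  fold-fibre {r} i j e with half r (toℕ i) (Fin.toℕ<n i) | half r (toℕ j) (Fin.toℕ<n j)
  ... | a , A | b , B with trans (sym (fold-half A)) (trans e (fold-half B))
  ... | refl = sides (proj₂ A) (proj₂ B)
    where
    mirrored : toℕ i + suc (toℕ j) ≡ r + r → i ≡ opposite j
    mirrored h = Fin.toℕ-injective (ℕ.+-cancelʳ-≡ (suc (toℕ j)) _ _ (trans h (sym (opposite-sum {r} j))))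
    sides : toℕ i ≡ r + a ⊎ toℕ i + suc a ≡ r → toℕ j ≡ r + a ⊎ toℕ j + suc a ≡ r → i ≡ j ⊎ i ≡ opposite j
    sides (inj₁ x) (inj₁ y) = inj₁ (Fin.toℕ-injective (trans x (sym y)))
    sides (inj₂ x) (inj₂ y) = inj₁ (Fin.toℕ-injective (ℕ.+-cancelʳ-≡ (suc a) _ _ (trans x (sym y))))
    sides (inj₁ x) (inj₂ y) = inj₂ (mirrored (trans (cong (_+ suc (toℕ j)) x) (trans
      (solve 3 (λ r a t → (r :+ a) :+ (con 1 :+ t) := r :+ (t :+ (con 1 :+ a))) refl r a (toℕ j)) (cong (λ s → r + s) y))))
    sides (inj₂ x) (inj₁ y) = inj₂ (mirrored (trans (cong (λ t → toℕ i + suc t) y) (trans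
      (solve 3 (λ r a t → t :+ (con 1 :+ (r :+ a)) := r :+ (t :+ (con 1 :+ a))) refl r a (toℕ i)) (cong (λ s → r + s) x))))

  quotient-fibre : ∀ {c : Config (2 * m) (2 * n)} → Symmetric c → ∀ v w → quotient v ≡ quotient w → c v ≡ c w
  quotient-fibre {c} symmetric (x , y) (x′ , y′) e = trans (row (fold-fibre {m} x x′ (cong proj₁ e))) (column (fold-fibre {n} y y′ (cong proj₂ e)))
    where
    row : x ≡ x′ ⊎ x ≡ opposite x′ → c (x , y) ≡ c (x′ , y)
    row (inj₁ refl) = refl
    row (inj₂ refl) = sym (proj₂ (symmetric x′ y))
    column : y ≡ y′ ⊎ y ≡ opposite y′ → c (x′ , y) ≡ c (x′ , y′)
    column (inj₁ refl) = refl
    column (inj₂ refl) = sym (proj₁ (symmetric x′ y′))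

  unfold : (ℕ × ℕ → ℕ) → Config (2 * m) (2 * n)
  unfold f v = 3 ∸ f (quotient v)

  -- The set consisting of u alone gives f u < degree u ≤ 4.
  parking-≤3 : ∀ {f} → Parking vs degree f → ∀ {u} → u ∈ vs → f u ≤ 3
  parking-≤3 {f} (_ , parking) {u} u∈ with parking (λ x → does (x ≟ u)) u u∈ (dec-true (u ≟ u) refl)
  ... | x , _ , x≡u , lt with does⁻ (x ≟ u) x≡u
  ... | refl = ℕ.s≤s⁻¹ (ℕ.≤-trans (ℕ.≤-<-trans (ℕ.m≤m+n (f u) _) lt) (subst (degree u ≤_) (degree+slack u) (ℕ.m≤m+n (degree u) (slack u))))

  indicator-true : ∀ {A : ℕ × ℕ → Bool} {u} → A u ≡ true → indicator A u ≡ 1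
  indicator-true h = cong (if_then 1 else 0) h

  image? : ∀ (A : ℕ × ℕ → Bool) u → Dec (∃[ v ] A (position v) ≡ true × quotient v ≡ u)
  image? A u = find? (λ v → (A (position v) Bool.≟ true) ×-dec (quotient v ≟ u))

  image : (ℕ × ℕ → Bool) → ℕ × ℕ → Bool
  image A u = does (image? A u)

  -- A may be asymmetric; it is enlarged to the preimage of its image in the quotient. This only
  -- adds neighbours, and the witness found in the quotient is lifted to a vertex of A itself.
  parking⇒ample : ∀ {f} → Parking vs degree f → Ample (unfold f)
  parking⇒ample {f} (_ , parking) A A⊆ v Av with parking (image A) (quotient v) (quotient-∈ v) (dec-true (image? A (quotient v)) (v , Av , refl))
  ... | u , _ , Bu , lt with does⁻ (image? A u) Bu
  ... | w , Aw , refl = w , Aw , ℕ.m+n≤o⇒m≤o∸n _ (ℕ.s≤s⁻¹ (begin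
      suc (N (indicator A) (position w) + f (quotient w))
        ≤⟨ s≤s (ℕ.+-monoˡ-≤ (f (quotient w)) (N-mono (position w) (λ x _ → A≤ x))) ⟩
      suc (N (indicator (preimage B)) (position w) + f (quotient w))
        ≡⟨ cong (λ s → suc (s + f (quotient w))) (trans (N-preimage B (Fin.toℕ<n (proj₁ w)) (Fin.toℕ<n (proj₂ w))) (cong (demand vs B (quotient w) +_) (trans (cong (slack (quotient w) *_) (indicator-true {B} Bu)) (ℕ.*-identityʳ _)))) ⟩
      suc (demand vs B (quotient w) + slack (quotient w) + f (quotient w))
        ≡⟨ solve 3 (λ d s f → con 1 :+ (d :+ s :+ f) := (con 1 :+ (f :+ d)) :+ s) refl (demand vs B (quotient w)) (slack (quotient w)) (f (quotient w)) ⟩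
      suc (f (quotient w) + demand vs B (quotient w)) + slack (quotient w)
        ≤⟨ ℕ.+-monoˡ-≤ (slack (quotient w)) lt ⟩
      degree (quotient w) + slack (quotient w)
        ≡⟨ degree+slack (quotient w) ⟩
      4 ∎))
    where
    open ℕ.≤-Reasoning
    B = image A
    A≤ : ∀ x → indicator A x ≤ indicator (preimage B) x
    A≤ x with A x in Ax
    ... | false = z≤n
    ... | true with A⊆ x Ax
    ... | v , refl = ℕ.≤-reflexive (sym (indicator-true {preimage B} {position v} (preimage⁺ B v (dec-true (image? A (quotient v)) (v , Ax , refl)))))

  -- The criterion is applied to the preimage of B. The witness has its mirror images in that set as
  -- well, and these `slack` neighbours account for the difference between 4 and its degree.
  ample⇒parking : ∀ {c : Config (2 * m) (2 * n)} {f} → Ample c → (∀ v → c v ≤ 3) → (∀ v → f (quotient v) ≡ 3 ∸ c v) → (∀ u → u ∉ vs → f u ≡ 0) → Parking vs degree f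
  ample⇒parking {c} {f} ample c≤3 f≡ f-out = f-out , find
    where
    open ℕ.≤-Reasoning
    find : ∀ B u → u ∈ vs → B u ≡ true → ∃[ x ] x ∈ vs × B x ≡ true × f x + demand vs B x < degree x
    find B u u∈ Bu with quotient-surjective u∈
    ... | v , refl with ample (preimage B) (λ u h → proj₁ (preimage⁻ B u h)) v (preimage⁺ B v Bu)
    ... | w , Pw , le = x , quotient-∈ w , Bx , ℕ.+-cancelʳ-< (slack x) _ _ (begin-strict
      f x + demand vs B x + slack x
        ≡⟨ ℕ.+-assoc (f x) (demand vs B x) (slack x) ⟩
      f x + (demand vs B x + slack x)
        ≡⟨ cong (f x +_) (sym (trans (N-preimage B (Fin.toℕ<n (proj₁ w)) (Fin.toℕ<n (proj₂ w))) (cong (demand vs B x +_) (trans (cong (slack x *_) (indicator-true {B} Bx)) (ℕ.*-identityʳ _))))) ⟩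
      f x + N (indicator (preimage B)) (position w)
        ≤⟨ ℕ.+-mono-≤ (ℕ.≤-reflexive (f≡ w)) le ⟩
      3 ∸ c w + c w
        ≡⟨ ℕ.m∸n+n≡m (c≤3 w) ⟩
      3
        <⟨ ℕ.≤-refl ⟩
      4
        ≡⟨ degree+slack x ⟨
      degree x + slack x ∎)
      where
      x = quotient w
      Bx = proj₂ (preimage⁻ B (position w) Pw)

  open import Data.List.Membership.DecPropositional _≟_ using (_∈?_)

  symmetric-recurrents : V → ∀ {M} → Counts ((ℕ × ℕ) →-setoid ℕ) (Parking vs degree) M → Counts (ConfigSetoid (2 * m) (2 * n)) SymmetricRecurrent M
  symmetric-recurrents v₀ = counts-map {S = (ℕ × ℕ) →-setoid ℕ} {T = ConfigSetoid (2 * m) (2 * n)} unfold (λ h v → cong (3 ∸_) (h (quotient v))) injective to′ from′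
    where
    injective : ∀ {f g} → Parking vs degree f → Parking vs degree g → (∀ v → unfold f v ≡ unfold g v) → ∀ u → f u ≡ g u
    injective {f} {g} F G h u with u ∈? vs
    ... | no u∉ = trans (proj₁ F u u∉) (sym (proj₁ G u u∉))
    ... | yes u∈ with quotient-surjective u∈
    ... | v , refl = trans (sym (ℕ.m∸[m∸n]≡n (parking-≤3 F u∈))) (trans (cong (3 ∸_) (h v)) (ℕ.m∸[m∸n]≡n (parking-≤3 G u∈)))
    ample-cong : ∀ {c d : Config (2 * m) (2 * n)} → (∀ v → c v ≡ d v) → Ample d → Ample c
    ample-cong h ample A A⊆ v Av = let u , Au , le = ample A A⊆ v Av in u , Au , subst (_ ≤_) (sym (h u)) le
    to′ : ∀ {f c} → Parking vs degree f → (∀ v → c v ≡ unfold f v) → SymmetricRecurrent c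
    to′ {f} {c} F h = ample⇒recurrent v₀ (λ v u → ℕ.<⇒≱ u (subst (_≤ 3) (sym (h v)) (ℕ.m∸n≤m 3 (f (quotient v))))) (ample-cong h (parking⇒ample F)) ,
      λ a b → same (a , b) (a , opposite b) (cong (fold m (toℕ a) ,_) (sym (fold-opposite {n} b))) , same (a , b) (opposite a , b) (cong (_, fold n (toℕ b)) (sym (fold-opposite {m} a)))
      where
      same : ∀ v w → quotient v ≡ quotient w → c v ≡ c w
      same v w e = trans (h v) (trans (cong (λ u → 3 ∸ f u) e) (sym (h w)))
    from′ : ∀ c → SymmetricRecurrent c → ∃[ f ] Parking vs degree f × (∀ v → c v ≡ unfold f v)
    from′ c (recurrent , symmetric) = f , ample⇒parking (recurrent⇒ample recurrent) c≤3 f≡ f-out ,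
      λ v → trans (sym (ℕ.m∸[m∸n]≡n (c≤3 v))) (cong (3 ∸_) (sym (f≡ v)))
      where
      c≤3 : ∀ v → c v ≤ 3
      c≤3 v = ℕ.≮⇒≥ (proj₁ recurrent v)
      -- A symmetric c is constant on each fibre, so any vertex of the fibre may be taken; off the
      -- quotient the value is 0, as `Parking` demands.
      f : ℕ × ℕ → ℕ
      f u with find? (λ v → quotient v ≟ u)
      ... | yes (v , _) = 3 ∸ c v
      ... | no _        = 0
      f≡ : ∀ v → f (quotient v) ≡ 3 ∸ c v
      f≡ v with find? (λ w → quotient w ≟ quotient v)
      ... | yes (w , e) = cong (3 ∸_) (quotient-fibre symmetric w v e)
      ... | no none     = contradiction (v , refl) none
      f-out : ∀ u → u ∉ vs → f u ≡ 0
      f-out u u∉ with find? (λ v → quotient v ≟ u)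
      ... | yes (v , refl) = contradiction (quotient-∈ v) u∉
      ... | no _           = refl

  laplacian≡Δ : ∀ u v → laplacian degree u v ≡ Δ u v
  laplacian≡Δ (a , b) (a′ , b′) with (a , b) ≟ (a′ , b′)
  ... | yes refl = sym (trans (cong₂ (λ s t → T a a ℤ.* pos s ℤ.+ pos t ℤ.* T b b) (δ-refl b) (δ-refl a))
    (trans (cong₂ ℤ._+_ (trans (ℤ.*-identityʳ (T a a)) (T-diag a)) (trans (ℤ.*-identityˡ (T b b)) (T-diag b))) refl))
    where
    T-diag : ∀ a → T a a ≡ pos (diag a)
    T-diag a = trans (cong₂ (λ s t → pos (diag a * s) ℤ.- pos t) (δ-refl a) (path-irreflexive a)) (trans (ℤ.+-identityʳ _) (cong pos (ℕ.*-identityʳ (diag a))))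
  ... | no u≢v = begin
    ℤ.- (pos (δ b b′ * path a a′ + δ a a′ * path b b′))
      ≡⟨ cong ℤ.-_ (cong₂ ℤ._+_ (ℤ.pos-* (δ b b′) (path a a′)) (ℤ.pos-* (δ a a′) (path b b′))) ⟩
    ℤ.- (pos (δ b b′) ℤ.* pos (path a a′) ℤ.+ pos (δ a a′) ℤ.* pos (path b b′))
      ≡⟨ negate (pos (δ b b′)) (pos (δ a a′)) (pos (path a a′)) (pos (path b b′)) ⟩
    ℤ.- (pos (path a a′)) ℤ.* pos (δ b b′) ℤ.+ pos (δ a a′) ℤ.* ℤ.- (pos (path b b′))
      ≡⟨ off-diagonal (a ℕ.≟ a′) (b ℕ.≟ b′) ⟩
    Δ (a , b) (a′ , b′) ∎
    where
    open ≡-Reasoning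
    negate : ∀ s t u v → ℤ.- (s ℤ.* u ℤ.+ t ℤ.* v) ≡ (ℤ.- u) ℤ.* s ℤ.+ t ℤ.* (ℤ.- v)
    negate s t u v = trans (ℤ.neg-distrib-+ (s ℤ.* u) (t ℤ.* v)) (cong₂ ℤ._+_ (trans (cong ℤ.-_ (ℤ.*-comm s u)) (ℤ.neg-distribˡ-* u s)) (ℤ.neg-distribʳ-* t v))
    T-off : ∀ {a a′} → a ≢ a′ → T a a′ ≡ ℤ.- (pos (path a a′))
    T-off {a} {a′} n = trans (cong (λ s → pos (diag a * s) ℤ.- pos (path a a′)) (δ-≢ n)) (trans (cong (λ s → pos s ℤ.- pos (path a a′)) (ℕ.*-zeroʳ (diag a))) (ℤ.+-identityˡ _))
    off-diagonal : Dec (a ≡ a′) → Dec (b ≡ b′) → ℤ.- (pos (path a a′)) ℤ.* pos (δ b b′) ℤ.+ pos (δ a a′) ℤ.* ℤ.- (pos (path b b′)) ≡ Δ (a , b) (a′ , b′)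
    off-diagonal (yes refl) (yes refl) = contradiction refl u≢v
    off-diagonal (yes refl) (no n) = cong₂ ℤ._+_ (trans (cong (λ s → ℤ.- (pos (path a a)) ℤ.* pos s) (δ-≢ n)) (trans (ℤ.*-zeroʳ (ℤ.- (pos (path a a)))) (sym (trans (cong (λ s → T a a ℤ.* pos s) (δ-≢ n)) (ℤ.*-zeroʳ (T a a))))))
      (cong (pos (δ a a) ℤ.*_) (sym (T-off n)))
    off-diagonal (no n) _ = cong₂ ℤ._+_ (cong (ℤ._* pos (δ b b′)) (sym (T-off n)))
      (trans (cong (λ s → pos s ℤ.* ℤ.- (pos (path b b′))) (δ-≢ n)) (trans (ℤ.*-zeroˡ (ℤ.- (pos (path b b′)))) (sym (trans (cong (λ s → pos s ℤ.* T b b′) (δ-≢ n)) (ℤ.*-zeroˡ (T b b′))))))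

  -- A cell has at most 4 neighbours in the grid, and removing its own mirror images leaves the two
  -- sides.
  demand≤degree : ∀ {u} → u ∈ vs → demand vs (const true) u ≤ degree u
  demand≤degree {u} u∈ with quotient-surjective u∈
  ... | v , refl = ℕ.+-cancelʳ-≤ (slack u) _ _ (begin
    demand vs (const true) u + slack u
      ≡⟨ cong (demand vs (const true) u +_) (sym (ℕ.*-identityʳ (slack u))) ⟩
    demand vs (const true) u + slack u * 1
      ≡⟨ sym (N-preimage (const true) (Fin.toℕ<n (proj₁ v)) (Fin.toℕ<n (proj₂ v))) ⟩
    N (indicator (preimage (const true))) (position v)
      ≤⟨ N-mono (position v) (λ x _ → indicator≤1 x) ⟩
    N (const 1) (position v)
      ≤⟨ N-const 1 (position v) ⟩
    4
      ≡⟨ degree+slack u ⟨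
    degree u + slack u ∎)
    where
    open ℕ.≤-Reasoning
    indicator≤1 : ∀ x → indicator (preimage (const true)) x ≤ 1
    indicator≤1 x with preimage (const true) x
    ... | true  = ℕ.≤-refl
    ... | false = z≤n

  count-symmetric-recurrents : V → ∃[ M ] Counts (ConfigSetoid (2 * m) (2 * n)) SymmetricRecurrent M × pos M ≡ det vs Δ
  count-symmetric-recurrents v₀ with counted vs degree (Unique.cartesianProduct⁺ (Unique.downFrom⁺ m) (Unique.downFrom⁺ n)) demand≤degree
  ... | M , counts , e = M , symmetric-recurrents v₀ counts , trans e (det-cong vs (λ {u} {v} _ _ → laplacian≡Δ u v))

-- Equality of the four numbers.

open import Data.Fin using (fromℕ<)
open import Data.Nat using (_*_; >-nonZero⁻¹)
import Data.Nat.Properties as ℕ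
open import Data.Product using (∃-syntax; _×_; _,_)
open import Relation.Binary.PropositionalEquality using (subst)

theorem4p2 : (m n : ℕ) .{{_ : NonZero m}} .{{_ : NonZero n}} →
    ∃[ N ]
    Counts (ConfigSetoid (2 * m) (2 * n)) SymmetricRecurrent N
    × Counts (DominoSetSetoid (2 * m) (2 * n)) IsTiling N
    × ℕ→ℂ N ≃ℂ (-ℂ ℕ→ℂ 1) ^ℂ (m * n) *ℂ ∏ℂ m (λ h → U (2 * n) (𝕚 *ℂ ℝ→ℂ (ξ h m)))
    × ℕ→ℝ N ≃ℝ ∏ℝ m (λ h → ∏ℝ n (λ k → ℕ→ℝ 4 *ℝ ξ h m ^ℝ 2 +ℝ ℕ→ℝ 4 *ℝ ξ k n ^ℝ 2))
theorem4p2 m n =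
  let instance
        2n≢0 : NonZero (2 * n)
        2n≢0 = ℕ.m*n≢0 2 n
        2m≢0 : NonZero (2 * m)
        2m≢0 = ℕ.m*n≢0 2 m
      N , recurrents , N≡det = SymmetricConfigurations.count-symmetric-recurrents m n
        (fromℕ< (>-nonZero⁻¹ (2 * m)) , fromℕ< (>-nonZero⁻¹ (2 * n)))
  in N , recurrents ,
     subst (Counts (DominoSetSetoid (2 * m) (2 * n)) IsTiling) (Kasteleyn.matchings-determinant m n N N≡det)
       (DominoTilings.count-tilings (2 * n) (2 * m)) ,
     Evaluation.chebyshev-product m n N N≡det ,
     Evaluation.double-product m n N N≡det
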